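{- Let $p\ge11$ be a prime and $X:=2p\mathcal{B}_{2(p-1)}-p^2\mathcal{B}_{p-1}^2$. Then, modulo $p^4$ in $\mathbb{Z}_p$, \begin{align*} A^\star_{p-1}\equiv-\frac{1}{p-1}\Bigg(&-\frac{p^3}{3}\mathcal{T}(p-1)+\frac{p^3}{4}\Big(w_p\mathcal{B}_{p-3}+(\mathcal{B}_{2p-4}-\mathcal{B}_{p-3})_1\Big)-\frac{p^3}{72}\mathcal{B}_{p-5}+\frac{7p^3}{12}\mathcal{B}_{p-3}\\ &+\frac{1}{2}p^3\big(\mathcal{C}(p-1)\big)_1+\frac{1-p}{2}(1+pw_p)p^2(X)_2\\ &-\frac{p^2}{6}(1+pw_p)\Big(\frac{1}{2}\mathcal{B}_{p-3}+\frac{1}{5}\mathcal{B}_{p-5}\Big)-\frac{p^3}{2}\sum_{a=1}^{p-1}\sum_{i=6}^{p-5}\frac{B_i}{a^i}q_a^2\\ &+\frac{13p^3+12p-12}{3}+\frac{19p^3-12}{2}pB_{p-1}+(4-7p^3)pB_{2(p-1)}+\frac{11p^3-6}{6}pB_{3(p-1)}\\ &+p(2\mathcal{B}_{p-3}-\mathcal{B}_{2p-4})\Big(\big(\tfrac{1}{2}-3B_{p+1}\big)p-\tfrac{4}{3}p^2\Big)\\ &+2p(\mathcal{B}_{2p-4}-2\mathcal{B}_{p-3})\Big(\frac{p}{12}-\frac{11p^2}{24}+\frac{p^2}{12}(pB_{p-1})_1\Big)\\ &+4p(\mathcal{B}_{2p-6}-2\mathcal{B}_{p-5})\Big(p(2\mathcal{B}_4-\mathcal{B}_{p+3})+\frac{1}{2}\Big(\frac{7}{720}p^2+2p\mathcal{B}_{p+3}+2p\mathcal{B}_4(pB_{p-1})\Big)\Big)\Bigg)\pmod{p^4}.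 \end{align*}
   Context: $A^\star_k:=\sum_{1\le i_1<\dots<i_k\le p-1}\frac{1}{i_1\cdots i_k}$ (so $A^\star_{p-1}=1/(p-1)!$). $w_p:=\frac{(p-1)!+1}{p}$, $q_a:=\frac{a^{p-1}-1}{p}$. $B_n$ is the $n$-th Bernoulli number, $\mathcal{B}_n:=B_n/n$; for even $m\ge4$, $\mathcal{C}(m):=\sum_{i=2}^{m-2}\mathcal{B}_i\mathcal{B}_{m-i}$ and $\mathcal{T}(m):=\sum_{i=2}^{m-4}\mathcal{B}_i\mathcal{C}(m-i)$. Hensel digits: for $x\in\mathbb{Q}_p$ with expansion $\sum_{i\ge-m}x_ip^i$, $x_i\in\{0,\dots,p-1\}$, $(x)_i:=x_i$; exception: $(pB_{p-1})_1:=(pB_{p-1}+1)/p$ (Agoh–Giuga quotient). $x\equiv y\pmod{p^4}$ means $x-y\in p^4\mathbb{Z}_p$. -}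

module Defs where

open import Data.Bool using (Bool; true; false; if_then_else_)
open import Data.Nat as ℕ using (ℕ; zero; suc; _∸_; _!)
open import Data.Nat.Combinatorics using (_C_)
open import Data.Nat.Divisibility using (_∣_)
open import Data.Integer as ℤ using (ℤ; +_)
open import Data.Rational as ℚ using (ℚ; _+_; _*_; _-_; -_; ↥_; ↧ₙ_; 0ℚ; 1ℚ)
open import Data.List using (List; []; _∷_; _++_; foldr; length)
open import Data.Product using (Σ; ∃; _×_)
open import Relation.Nullary using (¬_)
open import Relation.Binary.PropositionalEquality using (_≡_)

divℕ : ℕ → ℕ → ℕ
divℕ m zero    = 0
divℕ m (suc n) = m ℕ./ suc n

modℕ : ℕ → ℕ → ℕ
modℕ m zero    = 0
modℕ m (suc n) = m ℕ.% suc n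

modℤ : ℤ → ℕ → ℕ
modℤ z zero    = 0
modℤ z (suc n) = z ℤ.%ℕ suc n

ℤ→ℚ : ℤ → ℚ
ℤ→ℚ z = z ℚ./ 1

ℕ→ℚ : ℕ → ℚ
ℕ→ℚ n = ℤ→ℚ (+ n)

frac : ℤ → ℕ → ℚ
frac a zero    = 0ℚ
frac a (suc b) = a ℚ./ suc b

-- division of a rational by a rational (junk 0 when divisor is 0)
_÷q_ : ℚ → ℚ → ℚ
x ÷q y = x * frac (ℚ.↧ y) ℤ.∣ ↥ y ∣ * sgn (↥ y)
  where
  sgn : ℤ → ℚ
  sgn (+ _)      = 1ℚ
  sgn ℤ.-[1+ _ ] = - 1ℚ

infixl 7 _÷q_

_^q_ : ℚ → ℕ → ℚ
x ^q zero  = 1ℚ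
x ^q suc n = x * (x ^q n)

infixr 8 _^q_

-- Σ_{i = lo}^{hi} f i  (empty when hi < lo)
sumFrom : ℕ → ℕ → (ℕ → ℚ) → ℚ
sumFrom lo zero    f = 0ℚ
sumFrom lo (suc c) f = f lo + sumFrom (suc lo) c f

Σ[_≤i≤_] : ℕ → ℕ → (ℕ → ℚ) → ℚ
Σ[ lo ≤i≤ hi ] f = sumFrom lo (suc hi ∸ lo) f

-- Bernoulli numbers (B₀ = 1, B₁ = -1/2), via the standard recurrence
--   B_m = - 1/(m+1) Σ_{k=0}^{m-1} C(m+1,k) B_k

index : List ℚ → ℕ → ℚ
index []       _       = 0ℚ
index (x ∷ xs) zero    = x
index (x ∷ xs) (suc k) = index xs k

bernAll : ℕ → List ℚ
bernAll zero    = 1ℚ ∷ []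
bernAll (suc n) = prev ++ (next ∷ [])
  where
  m    = suc n
  prev = bernAll n
  next = - (frac (+ 1) (suc m) * sumFrom 0 m (λ k → ℕ→ℚ (suc m C k) * index prev k))

B : ℕ → ℚ
B n = index (bernAll n) n

𝓑 : ℕ → ℚ
𝓑 n = B n ÷q ℕ→ℚ n

𝓒 : ℕ → ℚ
𝓒 m = Σ[ 2 ≤i≤ m ∸ 2 ] (λ i → 𝓑 i * 𝓑 (m ∸ i))

𝓣 : ℕ → ℚ
𝓣 m = Σ[ 2 ≤i≤ m ∸ 4 ] (λ i → 𝓑 i * 𝓒 (m ∸ i))

-- A*_k = Σ_{1 ≤ i₁ < … < i_k ≤ n} 1/(i₁⋯i_k), the k-th elementary
-- symmetric sum of 1, 1/2, …, 1/n, by the standard recursion on n.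

elemSym : ℕ → ℕ → ℚ
elemSym n       zero    = 1ℚ
elemSym zero    (suc k) = 0ℚ
elemSym (suc n) (suc k) = elemSym n (suc k) + elemSym n k * frac (+ 1) (suc n)

Astar : ℕ → ℕ → ℚ
Astar p k = elemSym (p ∸ 1) k

w : ℕ → ℚ
w p = frac (+ ((p ∸ 1) ! ℕ.+ 1)) p

q : ℕ → ℕ → ℚ
q p a = frac (+ (a ℕ.^ (p ∸ 1)) ℤ.- + 1) p

IsPInt : ℕ → ℚ → Set
IsPInt p x = Σ ℤ λ a → Σ ℕ λ b → (¬ (p ∣ b)) × (x * ℕ→ℚ b ≡ ℤ→ℚ a)

CongP : ℕ → ℕ → ℚ → ℚ → Set
CongP p k x y = IsPInt p ((x - y) ÷q ℕ→ℚ (p ℕ.^ k))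

-- p-adic valuation of a positive natural (fuel = the number itself)
vpℕ : ℕ → ℕ → ℕ → ℕ
vpℕ p zero       d = 0
vpℕ p (suc fuel) d with modℕ d p | d
... | zero | suc _ = suc (vpℕ p fuel (divℕ d p))
... | _    | _     = 0

search : ℕ → ℕ → (ℕ → Bool) → ℕ
search zero    s P = 0
search (suc c) s P = if P s then s else search c (suc s) P

isZero : ℕ → Bool
isZero zero    = true
isZero (suc _) = false

-- j-th Hensel digit of the p-integral number n / d' (p ∤ d'):
-- r = (n/d' mod p^{j+1}) ∈ {0,…,p^{j+1}-1}, digit = ⌊r / p^j⌋ mod p.
digitInt : ℕ → ℕ → ℤ → ℕ → ℕ
digitInt p j n d' = modℕ (divℕ r (p ℕ.^ j)) p
  where
  M = p ℕ.^ suc j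
  r = search M 0 (λ t → isZero (modℤ ((+ (d' ℕ.* t)) ℤ.- n) M))

-- (x)_i : i-th Hensel digit (i ≥ 0) of x ∈ ℚ ⊂ ℚ_p, x = Σ_{i ≥ -m} x_i p^i.
-- Writing x = n / (p^e d') with p ∤ d', x_i = (n/d')_{i+e}.
digit : ℕ → ℕ → ℚ → ℕ
digit p i x = digitInt p (i ℕ.+ e) (↥ x) d'
  where
  d  = ↧ₙ x
  e  = vpℕ p d d
  d' = divℕ d (p ℕ.^ e)

module _ (p : ℕ) where
  private
    P  = ℕ→ℚ p
    n_ : ℕ → ℚ
    n_ = ℕ→ℚ
    r : ℤ → ℕ → ℚ
    r = frac
    wp = w p
    dg : ℕ → ℚ → ℚ
    dg i x = ℕ→ℚ (digit p i x)
    -- Agoh–Giuga quotient (pB_{p-1})_1 := (pB_{p-1}+1)/p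
    AG = (P * B (p ∸ 1) + 1ℚ) ÷q P

  Xp : ℚ
  Xp = n_ 2 * P * 𝓑 (2 ℕ.* (p ∸ 1)) - P ^q 2 * 𝓑 (p ∸ 1) ^q 2

  bigSum : ℚ
  bigSum = Σ[ 1 ≤i≤ p ∸ 1 ] (λ a → Σ[ 6 ≤i≤ p ∸ 5 ] (λ i →
             (B i ÷q (n_ a ^q i)) * q p a ^q 2))

  body : ℚ
  body =
      - (P ^q 3 * r (+ 1) 3 * 𝓣 (p ∸ 1))
    + P ^q 3 * r (+ 1) 4 * (wp * 𝓑 (p ∸ 3) + dg 1 (𝓑 (2 ℕ.* p ∸ 4) - 𝓑 (p ∸ 3)))
    - P ^q 3 * r (+ 1) 72 * 𝓑 (p ∸ 5)
    + r (+ 7) 12 * P ^q 3 * 𝓑 (p ∸ 3)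
    + r (+ 1) 2 * P ^q 3 * dg 1 (𝓒 (p ∸ 1))
    + ((1ℚ - P) * r (+ 1) 2) * (1ℚ + P * wp) * P ^q 2 * dg 2 Xp
    - P ^q 2 * r (+ 1) 6 * (1ℚ + P * wp) * (r (+ 1) 2 * 𝓑 (p ∸ 3) + r (+ 1) 5 * 𝓑 (p ∸ 5))
    - P ^q 3 * r (+ 1) 2 * bigSum
    + (n_ 13 * P ^q 3 + n_ 12 * P - n_ 12) * r (+ 1) 3
    + (n_ 19 * P ^q 3 - n_ 12) * r (+ 1) 2 * (P * B (p ∸ 1))
    + (n_ 4 - n_ 7 * P ^q 3) * (P * B (2 ℕ.* (p ∸ 1)))
    + (n_ 11 * P ^q 3 - n_ 6) * r (+ 1) 6 * (P * B (3 ℕ.* (p ∸ 1)))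
    + P * (n_ 2 * 𝓑 (p ∸ 3) - 𝓑 (2 ℕ.* p ∸ 4))
        * ((r (+ 1) 2 - n_ 3 * B (p ℕ.+ 1)) * P - r (+ 4) 3 * P ^q 2)
    + n_ 2 * P * (𝓑 (2 ℕ.* p ∸ 4) - n_ 2 * 𝓑 (p ∸ 3))
        * (P * r (+ 1) 12 - r (+ 11) 24 * P ^q 2 + P ^q 2 * r (+ 1) 12 * AG)
    + n_ 4 * P * (𝓑 (2 ℕ.* p ∸ 6) - n_ 2 * 𝓑 (p ∸ 5))
        * (P * (n_ 2 * 𝓑 4 - 𝓑 (p ℕ.+ 3))
           + r (+ 1) 2 * (r (+ 7) 720 * P ^q 2 + n_ 2 * P * 𝓑 (p ℕ.+ 3)
                          + n_ 2 * P * 𝓑 4 * (P * B (p ∸ 1))))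

  rhs5 : ℚ
  rhs5 = - (frac (+ 1) (p ∸ 1) * body)

-- Everything is computed modulo powers of p in the localisation of ℤ at p. Let q a be the Fermat
-- quotient of a, let ω a be the lift of a with ω a ^ (p - 1) ≡ 1 modulo p ^ 3, and put x = 1 / ω.
-- Faulhaber's formula for the power sums ∑ a ^ n, expanded around ω, expresses 𝓑 n by the moments
-- A n = ∑ ω ^ n q and M n = ∑ ω ^ n q ^ 2, modulo p ^ 2. Plancherel's formula for the powers of ω
-- then evaluates the convolution 𝓒 (p - 1) modulo p ^ 2 by the sums Q k = ∑ q ^ k and by moments;
-- M also governs the quotients (𝓑 (p - 1 + j) - 𝓑 j) / p. Modulo p, Fourier inversion gives
-- 2 q = 2 G - 2 Q 1 - x with G = ∑ 𝓑 n x ^ n. Expanding the moments of G and D = ∑ n 𝓑 n x ^ n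
-- yields 𝓣 (p - 1) in terms of the Q k and of moments. Substituting all this, the moments cancel,
-- and what remains is the product formula ∏ (1 + p q a) = (p - 1)! ^ (p - 1) with (p - 1)! = p w - 1.

module Submission where

open import Algebra using (CommutativeRing; RawRing)
open import Data.Bool using (Bool; true; false; _∧_; T)
open import Data.Nat as ℕ using (ℕ; zero; suc; _∸_; z≤n; s≤s; _!)
open import Data.Nat.Divisibility using (_∣_; divides; ∣⇒≤; _∣0; ∣-trans; m∣m*n; n∣m*n; *-cancelˡ-∣; *-monoʳ-∣; n∣m⇒m%n≡0; m%n≡0⇒n∣m; ∣-refl; ∣m+n∣m⇒∣n; _∣?_)
open import Data.Nat.Combinatorics using (_C_; nCn≡1; nC1≡n; nCk≡nC[n∸k]; nCk+nC[k+1]≡[n+1]C[k+1])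
open import Data.Nat.Combinatorics.Specification using (k>n⇒nCk≡0)
open import Data.Nat.Induction using (<-rec)
open import Data.Nat.Primality using (Prime; euclidsLemma; prime⇒irreducible)
open import Data.Integer as ℤ using (ℤ; +_; -[1+_]; _⊖_)
open import Data.Product using (Σ; ∃; ∃₂; _×_; _,_; proj₁; proj₂)
open import Data.Sum using (_⊎_; inj₁; inj₂; [_,_]′)
open import Data.Vec using (Vec; []; _∷_)
open import Function using (_∘_; _$_)
open import Level using (0ℓ)
open import Relation.Nullary using (¬_; yes; no; contradiction)
open import Relation.Binary using (tri<; tri≈; tri>)
open import Relation.Binary.PropositionalEquality as ≡ using (_≡_; _≢_)
import Data.Nat.Properties as ℕₚ
import Data.Rational.Properties as ℚₚ

-- Since A* is 1 / (p - 1)!, the claim is that the large bracket times (p - 1)! is - (p - 1) modulo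
-- p ^ 4. Its part 4 (p - 1) - 6 p B (p - 1) + 4 p B (2 (p - 1)) - p B (3 (p - 1)) is the sum of 1 /
-- u over u = a ^ (p - 1), because 4 - 6 u + 4 u ^ 2 - u ^ 3 = (1 - (1 - u) ^ 4) / u and 1 - u is a
-- multiple of p. All other terms are corrections of order p ^ 2 or higher. Digits are not
-- compatible with ring operations and enter only as residues: (X)_2 is the leading digit of X,
-- which is p ^ 2 𝓒 (p - 1) modulo p ^ 3, so it is also the lowest digit of 𝓒 (p - 1) and combines
-- with the digit of index 1 to the residue modulo p ^ 2; the digit of 𝓑 (2 p - 4) - 𝓑 (p - 3) is
-- again a leading digit. The other obstacle is denominators. The congruences are therefore proved
-- in an abstract ring in which p is cancellable and integers prime to p are units, with
-- denominators cleared or expressed by one inverse, so that each becomes a polynomial identity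
-- truncated at a power of p. Rational numbers enter only when this ring is instantiated.

-- Numerals and solvers for ring identities

module Numerals (R : CommutativeRing 0ℓ 0ℓ) where
  import Data.Integer.Properties as ℤₚ
  open import Data.Vec.N-ary using (N-ary; _$ⁿ_)
  import Data.Vec as Vec
  open import Data.Maybe using (Maybe; just; nothing)
  open import Data.Unit using (tt)
  import Algebra.Solver.Ring
  import Algebra.Solver.Ring.AlmostCommutativeRing as ACR
  import Algebra.Properties.Ring

  open CommutativeRing R hiding (zero)
  open Algebra.Properties.Ring ring using (-‿distribˡ-*; -‿distribʳ-*; -0#≈0#; -‿involutive; -‿+-comm)
  open import Algebra.Properties.Semiring.Exp semiring using (_^_; ^-congˡ; ^-homo-*)
  open import Algebra.Properties.CommutativeSemiring.Exp commutativeSemiring using (^-distrib-*)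
  open import Relation.Binary.Reasoning.Setoid setoid

  -- The separate clause for 1 makes `ι 1` reduce to `1#`, so that the numerals of the solver, which
  -- evaluate to `ι n`, agree with `0#` and `1#` by computation.
  ι : ℕ → Carrier
  ι zero          = 0#
  ι (suc zero)    = 1#
  ι (suc (suc n)) = 1# + ι (suc n)

  ι-suc : ∀ n → ι (suc n) ≈ 1# + ι n
  ι-suc zero    = sym (+-identityʳ 1#)
  ι-suc (suc n) = refl

  ι-+ : ∀ m n → ι (m ℕ.+ n) ≈ ι m + ι n
  ι-+ zero    n = sym (+-identityˡ _)
  ι-+ (suc m) n = begin
    ι (suc (m ℕ.+ n))  ≈⟨ ι-suc (m ℕ.+ n) ⟩
    1# + ι (m ℕ.+ n)   ≈⟨ +-congˡ (ι-+ m n) ⟩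
    1# + (ι m + ι n)   ≈⟨ +-assoc _ _ _ ⟨
    1# + ι m + ι n     ≈⟨ +-congʳ (ι-suc m) ⟨
    ι (suc m) + ι n    ∎

  ι-* : ∀ m n → ι (m ℕ.* n) ≈ ι m * ι n
  ι-* zero    n = sym (zeroˡ _)
  ι-* (suc m) n = begin
    ι (n ℕ.+ m ℕ.* n)      ≈⟨ ι-+ n (m ℕ.* n) ⟩
    ι n + ι (m ℕ.* n)      ≈⟨ +-cong (sym (*-identityˡ _)) (ι-* m n) ⟩
    1# * ι n + ι m * ι n   ≈⟨ distribʳ _ _ _ ⟨
    (1# + ι m) * ι n       ≈⟨ *-congʳ (ι-suc m) ⟨
    ι (suc m) * ι n        ∎

  ι-^ : ∀ m n → ι (m ℕ.^ n) ≈ ι m ^ n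
  ι-^ m zero    = refl
  ι-^ m (suc n) = trans (ι-* m (m ℕ.^ n)) (*-congˡ (ι-^ m n))

  ι-∸ : ∀ {m n} → n ℕ.≤ m → ι (m ∸ n) ≈ ι m - ι n
  ι-∸ {m} {n} n≤m = begin
    ι (m ∸ n)                ≈⟨ +-identityʳ _ ⟨
    ι (m ∸ n) + 0#           ≈⟨ +-congˡ (-‿inverseʳ (ι n)) ⟨
    ι (m ∸ n) + (ι n - ι n)  ≈⟨ +-assoc _ _ _ ⟨
    ι (m ∸ n) + ι n - ι n    ≈⟨ +-congʳ (ι-+ (m ∸ n) n) ⟨
    ι (m ∸ n ℕ.+ n) - ι n    ≡⟨ ≡.cong (λ z → ι z - ι n) (ℕₚ.m∸n+n≡m n≤m) ⟩
    ι m - ι n                ∎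

  ιℤ : ℤ → Carrier
  ιℤ (+ n)    = ι n
  ιℤ -[1+ n ] = - ι (suc n)

  ιℤ-⊖ : ∀ m n → ιℤ (m ⊖ n) ≈ ι m - ι n
  ιℤ-⊖ m n with ℕₚ.≤-total n m
  ... | inj₁ n≤m = trans (reflexive (≡.cong ιℤ (ℤₚ.⊖-≥ n≤m))) (ι-∸ n≤m)
  ... | inj₂ m≤n = begin
    ιℤ (m ⊖ n)              ≡⟨ ≡.cong ιℤ (ℤₚ.⊖-≤ m≤n) ⟩
    ιℤ (ℤ.- (+ (n ∸ m)))    ≈⟨ neg (n ∸ m) ⟩
    - ι (n ∸ m)             ≈⟨ -‿cong (ι-∸ m≤n) ⟩
    - (ι n - ι m)           ≈⟨ -‿+-comm _ _ ⟨
    - ι n + - - ι m         ≈⟨ +-congˡ (-‿involutive _) ⟩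
    - ι n + ι m             ≈⟨ +-comm _ _ ⟩
    ι m - ι n               ∎
    where
    neg : ∀ k → ιℤ (ℤ.- (+ k)) ≈ - ι k
    neg zero    = sym -0#≈0#
    neg (suc k) = refl

  ιℤ-neg : ∀ z → ιℤ (ℤ.- z) ≈ - ιℤ z
  ιℤ-neg (+ zero)  = sym -0#≈0#
  ιℤ-neg (+ suc n) = refl
  ιℤ-neg -[1+ n ]  = sym (-‿involutive _)

  ιℤ-+ : ∀ x y → ιℤ (x ℤ.+ y) ≈ ιℤ x + ιℤ y
  ιℤ-+ (+ m)    (+ n)    = ι-+ m n
  ιℤ-+ (+ m)    -[1+ n ] = ιℤ-⊖ m (suc n)
  ιℤ-+ -[1+ m ] (+ n)    = trans (ιℤ-⊖ n (suc m)) (+-comm _ _)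
  ιℤ-+ -[1+ m ] -[1+ n ] = begin
    - ι (suc (suc (m ℕ.+ n)))   ≡⟨ ≡.cong (λ z → - ι (suc z)) (≡.sym (ℕₚ.+-suc m n)) ⟩
    - ι (suc m ℕ.+ suc n)       ≈⟨ -‿cong (ι-+ (suc m) (suc n)) ⟩
    - (ι (suc m) + ι (suc n))   ≈⟨ -‿+-comm _ _ ⟨
    - ι (suc m) + - ι (suc n)   ∎

  ιℤ-*+ : ∀ m y → ιℤ (+ m ℤ.* y) ≈ ι m * ιℤ y
  ιℤ-*+ m (+ n)    = trans (reflexive (≡.cong ιℤ (≡.sym (ℤₚ.pos-* m n)))) (ι-* m n)
  ιℤ-*+ m -[1+ n ] = begin
    ιℤ (+ m ℤ.* -[1+ n ])             ≡⟨ ≡.cong ιℤ (ℤₚ.neg-distribʳ-* (+ m) (+ suc n)) ⟨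
    ιℤ (ℤ.- (+ m ℤ.* + suc n))        ≈⟨ ιℤ-neg (+ m ℤ.* + suc n) ⟩
    - ιℤ (+ m ℤ.* + suc n)            ≡⟨ ≡.cong (λ z → - ιℤ z) (≡.sym (ℤₚ.pos-* m (suc n))) ⟩
    - ι (m ℕ.* suc n)                 ≈⟨ -‿cong (ι-* m (suc n)) ⟩
    - (ι m * ι (suc n))               ≈⟨ -‿distribʳ-* _ _ ⟩
    ι m * - ι (suc n)                 ∎

  ιℤ-* : ∀ x y → ιℤ (x ℤ.* y) ≈ ιℤ x * ιℤ y
  ιℤ-* (+ m)    y = ιℤ-*+ m y
  ιℤ-* -[1+ m ] y = begin
    ιℤ (-[1+ m ] ℤ.* y)         ≡⟨ ≡.cong ιℤ (ℤₚ.neg-distribˡ-* (+ suc m) y) ⟨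
    ιℤ (ℤ.- (+ suc m ℤ.* y))    ≈⟨ ιℤ-neg (+ suc m ℤ.* y) ⟩
    - ιℤ (+ suc m ℤ.* y)        ≈⟨ -‿cong (ιℤ-*+ (suc m) y) ⟩
    - (ι (suc m) * ιℤ y)        ≈⟨ -‿distribˡ-* _ _ ⟩
    - ι (suc m) * ιℤ y          ∎

  private
    acr = ACR.fromCommutativeRing R

  module Mod (π : Carrier) where
    infix 4 _≈[_]_
    -- The quotient is data: Fermat quotients, the Wilson quotient and differences of Bernoulli
    -- numbers divided by p are later obtained as the `quot` of a congruence modulo p.
    record _≈[_]_ (x : Carrier) (k : ℕ) (y : Carrier) : Set where
      constructor mk
      field
        quot : Carrier
        eq   : x ≈ y + π ^ k * quot
    open _≈[_]_ public

  x≈y+[x-y] : ∀ x y → x ≈ y + (x - y)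
  x≈y+[x-y] x y = begin
    x              ≈⟨ +-identityʳ x ⟨
    x + 0#         ≈⟨ +-congˡ (-‿inverseˡ y) ⟨
    x + (- y + y)  ≈⟨ +-assoc _ _ _ ⟨
    x - y + y      ≈⟨ +-comm _ _ ⟩
    y + (x - y)    ∎

  -- Ring identities, exact and modulo powers of π, with coefficients from a ring in which zero is
  -- recognisable. Congruence modulo π ^ k is decided by expanding in the first variable, which
  -- stands for π, and checking that the lowest k coefficients vanish.
  module Solve (Coeff : RawRing 0ℓ 0ℓ) (morphism : Coeff ACR.-Raw-AlmostCommutative⟶ acr)
    (_coeff≟_ : ∀ x y → Maybe (ACR._-Raw-AlmostCommutative⟶_.⟦_⟧ morphism x ≈ ACR._-Raw-AlmostCommutative⟶_.⟦_⟧ morphism y))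
    (isZero : RawRing.Carrier Coeff → Bool)
    (isZero-sound : ∀ c → T (isZero c) → ACR._-Raw-AlmostCommutative⟶_.⟦_⟧ morphism c ≈ 0#)
    where

    module Solver = Algebra.Solver.Ring Coeff acr morphism _coeff≟_
    open Solver public using (Polynomial; con; var; _:^_; _:+_; _:*_; _:-_; :-_)
    open Solver using (HNF; Normal; ∅; _*x+_; poly; normalise; correct; ⟦_⟧H; ⟦_⟧N)

    infix 4 _:=_
    _:=_ : ∀ {n} → Polynomial n → Polynomial n → Polynomial n × Polynomial n
    _:=_ = _,_

    zeroH : ∀ {n} → HNF (suc n) → Bool
    zeroN : ∀ {n} → Normal n → Bool
    zeroH ∅         = true
    zeroH (p *x+ c) = zeroH p ∧ zeroN c
    zeroN (con c)   = isZero c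
    zeroN (poly p)  = zeroH p

    lowZeroH : ∀ {n} → ℕ → HNF (suc n) → Bool
    lowZeroH zero    p         = true
    lowZeroH (suc k) ∅         = true
    lowZeroH (suc k) (p *x+ c) = lowZeroH k p ∧ zeroN c

    lowZeroN : ∀ {n} → ℕ → Normal (suc n) → Bool
    lowZeroN k (poly p) = lowZeroH k p

    private
      ∧-split : ∀ {a b} → T (a ∧ b) → T a × T b
      ∧-split {true} {true} _ = tt , tt

      zeroH-sound : ∀ {n} (p : HNF (suc n)) → T (zeroH p) → ∀ ρ → ⟦ p ⟧H ρ ≈ 0#
      zeroN-sound : ∀ {n} (p : Normal n) → T (zeroN p) → ∀ ρ → ⟦ p ⟧N ρ ≈ 0#
      zeroH-sound ∅         _ ρ       = refl
      zeroH-sound (p *x+ c) h (x ∷ ρ) = begin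
        ⟦ p ⟧H (x ∷ ρ) * x + ⟦ c ⟧N ρ  ≈⟨ +-cong (*-congʳ (zeroH-sound p (proj₁ (∧-split h)) (x ∷ ρ))) (zeroN-sound c (proj₂ (∧-split {zeroH p} h)) ρ) ⟩
        0# * x + 0#                    ≈⟨ +-identityʳ _ ⟩
        0# * x                         ≈⟨ zeroˡ x ⟩
        0#                             ∎
      zeroN-sound (con c)  h ρ = isZero-sound c h
      zeroN-sound (poly p) h ρ = zeroH-sound p h ρ

      lowZeroH-sound : ∀ {n} π k (p : HNF (suc n)) → T (lowZeroH k p) → ∀ ρ → ∃ λ z → ⟦ p ⟧H (π ∷ ρ) ≈ π ^ k * z
      lowZeroH-sound π zero    p         _ ρ = _ , sym (*-identityˡ _)
      lowZeroH-sound π (suc k) ∅         _ ρ = 0# , sym (zeroʳ _)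
      lowZeroH-sound π (suc k) (p *x+ c) h ρ with lowZeroH-sound π k p (proj₁ (∧-split h)) ρ
      ... | z , eq = z , (begin
        ⟦ p ⟧H (π ∷ ρ) * π + ⟦ c ⟧N ρ  ≈⟨ +-cong (*-congʳ eq) (zeroN-sound c (proj₂ (∧-split {lowZeroH k p} h)) ρ) ⟩
        π ^ k * z * π + 0#             ≈⟨ +-identityʳ _ ⟩
        π ^ k * z * π                  ≈⟨ *-comm _ _ ⟩
        π * (π ^ k * z)                ≈⟨ *-assoc _ _ _ ⟨
        π * π ^ k * z                  ∎)

    -- The difference of the two sides is tested for zero, instead of comparing their normal forms,
    -- because a fractional coefficient has several representations, such as 1 and 720 / 720.
    difference lhs rhs : ∀ {n} → N-ary n (Polynomial n) (Polynomial n × Polynomial n) → Polynomial n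
    difference {n} f = let e = f $ⁿ Vec.map var (Vec.allFin n) in proj₁ e :- proj₂ e
    lhs {n} f = proj₁ (f $ⁿ Vec.map var (Vec.allFin n))
    rhs {n} f = proj₂ (f $ⁿ Vec.map var (Vec.allFin n))

    solve : ∀ {n} (f : N-ary n (Polynomial n) (Polynomial n × Polynomial n)) (ρ : Vec Carrier n) →
            {T (zeroN (normalise (difference {n} f)))} → Solver.⟦ lhs {n} f ⟧ ρ ≈ Solver.⟦ rhs {n} f ⟧ ρ
    solve {n} f ρ {h} = begin
      x            ≈⟨ x≈y+[x-y] x y ⟩
      y + (x - y)  ≈⟨ +-congˡ (trans (sym (correct (difference {n} f) ρ)) (zeroN-sound (normalise (difference {n} f)) h ρ)) ⟩
      y + 0#       ≈⟨ +-identityʳ y ⟩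
      y            ∎
      where
      x = Solver.⟦ lhs {n} f ⟧ ρ
      y = Solver.⟦ rhs {n} f ⟧ ρ

    module Congruences (π : Carrier) where
      open Mod π

      solveMod : ∀ k {n} (f : N-ary (suc n) (Polynomial (suc n)) (Polynomial (suc n) × Polynomial (suc n))) (ρ : Vec Carrier n) →
                 {T (lowZeroN k (normalise (difference {suc n} f)))} → Solver.⟦ lhs {suc n} f ⟧ (π ∷ ρ) ≈[ k ] Solver.⟦ rhs {suc n} f ⟧ (π ∷ ρ)
      solveMod k {n} f ρ {h} = lemma (normalise d) h (correct d (π ∷ ρ))
        where
        d = difference {suc n} f
        lemma : ∀ (N : Normal (suc n)) → T (lowZeroN k N) → ∀ {x y} → ⟦ N ⟧N (π ∷ ρ) ≈ x - y → x ≈[ k ] y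
        lemma (poly p) h {x} {y} e with lowZeroH-sound π k p h ρ
        ... | z , eq = mk z (trans (x≈y+[x-y] x y) (+-congˡ (trans (sym e) eq)))

  private
    ℤ-raw : RawRing 0ℓ 0ℓ
    ℤ-raw = record { Carrier = ℤ ; _≈_ = _≡_ ; _+_ = ℤ._+_ ; _*_ = ℤ._*_ ; -_ = ℤ.-_ ; 0# = + 0 ; 1# = + 1 }

    ℤ-morphism : ℤ-raw ACR.-Raw-AlmostCommutative⟶ acr
    ℤ-morphism = record
      { ⟦_⟧ = ιℤ ; +-homo = ιℤ-+ ; *-homo = ιℤ-* ; -‿homo = ιℤ-neg ; 0-homo = refl ; 1-homo = refl }

    _ℤ≟_ : ∀ x y → Maybe (ιℤ x ≈ ιℤ y)
    x ℤ≟ y with x ℤ.≟ y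
    ... | yes x≡y = just (reflexive (≡.cong ιℤ x≡y))
    ... | no  _   = nothing

    isZeroℤ : ℤ → Bool
    isZeroℤ (+ zero) = true
    isZeroℤ _        = false

    isZeroℤ-sound : ∀ z → T (isZeroℤ z) → ιℤ z ≈ 0#
    isZeroℤ-sound (+ zero) _ = refl

  open Solve ℤ-raw ℤ-morphism _ℤ≟_ isZeroℤ isZeroℤ-sound public

  # : ∀ {n} → ℕ → Polynomial n
  # n = con (+ n)

  -- A pair (z , e) stands for the coefficient z / N ^ e.
  module Fractions (N : ℕ) (κ : Carrier) (Nκ≈1 : ι N * κ ≈ 1#) where
    private
      Fraction : Set
      Fraction = ℤ × ℕ

      -- Exponent 0 is a case of its own in `value`, so that an integer constant evaluates to its
      -- numeral without a factor `κ ^ 0`; `value′` is the uniform expression used in the proofs.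
      value value′ : Fraction → Carrier
      value (z , zero)  = ιℤ z
      value (z , suc e) = ιℤ z * κ ^ suc e
      value′ (z , e)    = ιℤ z * κ ^ e

      value≈value′ : ∀ c → value c ≈ value′ c
      value≈value′ (z , zero)  = sym (*-identityʳ _)
      value≈value′ (z , suc e) = refl

      expand : ℤ → ℕ → ℤ
      expand z e = z ℤ.* + (N ℕ.^ e)

      _⊕_ _⊗_ : Fraction → Fraction → Fraction
      (z , e) ⊕ (z′ , e′) = expand z (e′ ∸ e) ℤ.+ expand z′ (e ∸ e′) , e ℕ.+ (e′ ∸ e)
      (z , e) ⊗ (z′ , e′) = z ℤ.* z′ , e ℕ.+ e′

      ⊖_ : Fraction → Fraction
      ⊖ (z , e) = ℤ.- z , e

      -- Both sides are the maximum of the exponents, that is, the exponent of the common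
      -- denominator.
      max-comm : ∀ e e′ → e ℕ.+ (e′ ∸ e) ≡ e′ ℕ.+ (e ∸ e′)
      max-comm zero    e′       = ≡.sym (≡.trans (≡.cong (e′ ℕ.+_) (ℕₚ.0∸n≡0 e′)) (ℕₚ.+-identityʳ e′))
      max-comm (suc e) zero     = ℕₚ.+-identityʳ (suc e)
      max-comm (suc e) (suc e′) = ≡.cong suc (max-comm e e′)

      expand-value : ∀ z e d → value′ (expand z d , e ℕ.+ d) ≈ value′ (z , e)
      expand-value z e d = begin
        ιℤ (z ℤ.* + (N ℕ.^ d)) * κ ^ (e ℕ.+ d)       ≈⟨ *-cong (ιℤ-* z (+ (N ℕ.^ d))) (^-homo-* κ e d) ⟩
        ιℤ z * ι (N ℕ.^ d) * (κ ^ e * κ ^ d)         ≈⟨ *-congʳ (*-congˡ (ι-^ N d)) ⟩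
        ιℤ z * ι N ^ d * (κ ^ e * κ ^ d)             ≈⟨ solve {4} (λ a b c f → a :* b :* (c :* f) := a :* c :* (b :* f)) (ιℤ z ∷ ι N ^ d ∷ κ ^ e ∷ κ ^ d ∷ []) ⟩
        ιℤ z * κ ^ e * (ι N ^ d * κ ^ d)             ≈⟨ *-congˡ (trans (sym (^-distrib-* (ι N) κ d)) (trans (^-congˡ d Nκ≈1) (one d))) ⟩
        ιℤ z * κ ^ e * 1#                            ≈⟨ *-identityʳ _ ⟩
        ιℤ z * κ ^ e                                 ∎
        where
        one : ∀ d → 1# ^ d ≈ 1#
        one zero    = refl
        one (suc d) = trans (*-identityˡ _) (one d)

      +-homo : ∀ c d → value (c ⊕ d) ≈ value c + value d
      +-homo c@(z , e) d@(z′ , e′) = begin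
        value (c ⊕ d)
          ≈⟨ value≈value′ (c ⊕ d) ⟩
        ιℤ (expand z (e′ ∸ e) ℤ.+ expand z′ (e ∸ e′)) * κ ^ (e ℕ.+ (e′ ∸ e))
          ≈⟨ trans (*-congʳ (ιℤ-+ (expand z (e′ ∸ e)) (expand z′ (e ∸ e′)))) (distribʳ _ _ _) ⟩
        value′ (expand z (e′ ∸ e) , e ℕ.+ (e′ ∸ e)) + value′ (expand z′ (e ∸ e′) , e ℕ.+ (e′ ∸ e))
          ≈⟨ +-congˡ (reflexive (≡.cong (λ k → value′ (expand z′ (e ∸ e′) , k)) (max-comm e e′))) ⟩
        value′ (expand z (e′ ∸ e) , e ℕ.+ (e′ ∸ e)) + value′ (expand z′ (e ∸ e′) , e′ ℕ.+ (e ∸ e′))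
          ≈⟨ +-cong (expand-value z e (e′ ∸ e)) (expand-value z′ e′ (e ∸ e′)) ⟩
        value′ c + value′ d
          ≈⟨ +-cong (value≈value′ c) (value≈value′ d) ⟨
        value c + value d ∎

      *-homo : ∀ c d → value (c ⊗ d) ≈ value c * value d
      *-homo c@(z , e) d@(z′ , e′) = begin
        value (c ⊗ d)                          ≈⟨ value≈value′ (c ⊗ d) ⟩
        ιℤ (z ℤ.* z′) * κ ^ (e ℕ.+ e′)         ≈⟨ *-cong (ιℤ-* z z′) (^-homo-* κ e e′) ⟩
        ιℤ z * ιℤ z′ * (κ ^ e * κ ^ e′)        ≈⟨ solve {4} (λ a b c f → a :* b :* (c :* f) := a :* c :* (b :* f)) (ιℤ z ∷ ιℤ z′ ∷ κ ^ e ∷ κ ^ e′ ∷ []) ⟩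
        value′ c * value′ d                    ≈⟨ *-cong (value≈value′ c) (value≈value′ d) ⟨
        value c * value d                      ∎

      neg-homo : ∀ c → value (⊖ c) ≈ - value c
      neg-homo (z , zero)  = ιℤ-neg z
      neg-homo (z , suc e) = trans (*-congʳ (ιℤ-neg z)) (sym (-‿distribˡ-* _ _))

      raw : RawRing 0ℓ 0ℓ
      raw = record { Carrier = Fraction ; _≈_ = _≡_ ; _+_ = _⊕_ ; _*_ = _⊗_ ; -_ = ⊖_ ; 0# = + 0 , 0 ; 1# = + 1 , 0 }

      morphism : raw ACR.-Raw-AlmostCommutative⟶ acr
      morphism = record
        { ⟦_⟧ = value ; +-homo = +-homo ; *-homo = *-homo ; -‿homo = neg-homo ; 0-homo = refl ; 1-homo = refl }

      sound : ∀ c → T (isZeroℤ (proj₁ c)) → value c ≈ 0#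
      sound (+ zero , zero)  _ = refl
      sound (+ zero , suc e) _ = zeroˡ _

      _≟_ : ∀ c d → Maybe (value c ≈ value d)
      c ≟ d with isZeroℤ (proj₁ c) in p | isZeroℤ (proj₁ d) in q
      ... | true | true = just (trans (sound c (≡.subst T (≡.sym p) tt)) (sym (sound d (≡.subst T (≡.sym q) tt))))
      ... | _    | _    = nothing

    module S = Solve raw morphism _≟_ (isZeroℤ ∘ proj₁) sound

-- Finite sums and exponential generating functions

module Sums (R : CommutativeRing 0ℓ 0ℓ) where
  open Numerals R

  open CommutativeRing R hiding (zero)
  open import Algebra.Properties.Semiring.Exp semiring using (_^_)
  open import Relation.Binary.Reasoning.Setoid setoid

  ∑ : ℕ → (ℕ → Carrier) → Carrier
  ∑ zero    f = 0#
  ∑ (suc n) f = ∑ n f + f n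

  ∑-cong : ∀ n {f g} → (∀ i → i ℕ.< n → f i ≈ g i) → ∑ n f ≈ ∑ n g
  ∑-cong zero    h = refl
  ∑-cong (suc n) h = +-cong (∑-cong n (λ i i<n → h i (ℕₚ.m<n⇒m<1+n i<n))) (h n ℕₚ.≤-refl)

  ∑-cong′ : ∀ n {f g} → (∀ i → f i ≈ g i) → ∑ n f ≈ ∑ n g
  ∑-cong′ n h = ∑-cong n (λ i _ → h i)

  ∑-0 : ∀ n → ∑ n (λ _ → 0#) ≈ 0#
  ∑-0 zero    = refl
  ∑-0 (suc n) = trans (+-identityʳ _) (∑-0 n)

  ∑-+ : ∀ n f g → ∑ n (λ i → f i + g i) ≈ ∑ n f + ∑ n g
  ∑-+ zero    f g = sym (+-identityʳ _)
  ∑-+ (suc n) f g = trans (+-congʳ (∑-+ n f g))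
    (solve {4} (λ a b c d → (a :+ b) :+ (c :+ d) := (a :+ c) :+ (b :+ d)) (_ ∷ _ ∷ _ ∷ _ ∷ []))

  ∑-*ˡ : ∀ n c f → ∑ n (λ i → c * f i) ≈ c * ∑ n f
  ∑-*ˡ zero    c f = sym (zeroʳ c)
  ∑-*ˡ (suc n) c f = trans (+-congʳ (∑-*ˡ n c f)) (sym (distribˡ _ _ _))

  ∑-*ʳ : ∀ n c f → ∑ n (λ i → f i * c) ≈ ∑ n f * c
  ∑-*ʳ zero    c f = sym (zeroˡ c)
  ∑-*ʳ (suc n) c f = trans (+-congʳ (∑-*ʳ n c f)) (sym (distribʳ _ _ _))

  ∑-const : ∀ n c → ∑ n (λ _ → c) ≈ ι n * c
  ∑-const zero    c = sym (zeroˡ c)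
  ∑-const (suc n) c = begin
    ∑ n (λ _ → c) + c  ≈⟨ +-congʳ (∑-const n c) ⟩
    ι n * c + c        ≈⟨ solve {2} (λ a b → a :* b :+ b := (# 1 :+ a) :* b) (_ ∷ _ ∷ []) ⟩
    (1# + ι n) * c     ≈⟨ *-congʳ (ι-suc n) ⟨
    ι (suc n) * c      ∎

  ∑-swap : ∀ m n (f : ℕ → ℕ → Carrier) → ∑ m (λ i → ∑ n (f i)) ≈ ∑ n (λ j → ∑ m (λ i → f i j))
  ∑-swap zero    n f = sym (∑-0 n)
  ∑-swap (suc m) n f = trans (+-congʳ (∑-swap m n f)) (sym (∑-+ n _ _))

  ∑-cons : ∀ n f → ∑ (suc n) f ≈ f 0 + ∑ n (f ∘ suc)
  ∑-cons zero    f = +-comm _ _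
  ∑-cons (suc n) f = trans (+-congʳ (∑-cons n f)) (+-assoc _ _ _)

  ∑-split : ∀ m n f → ∑ (m ℕ.+ n) f ≈ ∑ m f + ∑ n (λ i → f (m ℕ.+ i))
  ∑-split zero    n f = sym (+-identityˡ _)
  ∑-split (suc m) n f = begin
    ∑ (suc (m ℕ.+ n)) f                                   ≈⟨ ∑-cons (m ℕ.+ n) f ⟩
    f 0 + ∑ (m ℕ.+ n) (f ∘ suc)                           ≈⟨ +-congˡ (∑-split m n (f ∘ suc)) ⟩
    f 0 + (∑ m (f ∘ suc) + ∑ n (λ i → f (suc m ℕ.+ i)))   ≈⟨ +-assoc _ _ _ ⟨
    f 0 + ∑ m (f ∘ suc) + ∑ n (λ i → f (suc m ℕ.+ i))     ≈⟨ +-congʳ (∑-cons m f) ⟨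
    ∑ (suc m) f + ∑ n (λ i → f (suc m ℕ.+ i))             ∎

  ∑-rev : ∀ n f → ∑ n (λ i → f (n ∸ suc i)) ≈ ∑ n f
  ∑-rev zero    f = refl
  ∑-rev (suc n) f = begin
    ∑ (suc n) (λ i → f (n ∸ i))           ≈⟨ ∑-cons n (λ i → f (n ∸ i)) ⟩
    f n + ∑ n (λ i → f (n ∸ suc i))       ≈⟨ +-congˡ (∑-rev n f) ⟩
    f n + ∑ n f                           ≈⟨ +-comm _ _ ⟩
    ∑ n f + f n                           ∎

  infix 4 _≗′_
  _≗′_ : (ℕ → Carrier) → (ℕ → Carrier) → Set
  f ≗′ g = ∀ n → f n ≈ g n

  -- Binomial convolution, the product of exponential generating functions,
  -- defined through the Leibniz rule for the shift.
  infixl 7 _⋆_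
  _⋆_ : (ℕ → Carrier) → (ℕ → Carrier) → ℕ → Carrier
  (f ⋆ g) zero    = f 0 * g 0
  (f ⋆ g) (suc n) = ((f ∘ suc) ⋆ g) n + (f ⋆ (g ∘ suc)) n

  ⋆-cong : ∀ {f f′ g g′} → f ≗′ f′ → g ≗′ g′ → f ⋆ g ≗′ f′ ⋆ g′
  ⋆-cong p q zero    = *-cong (p 0) (q 0)
  ⋆-cong p q (suc n) = +-cong (⋆-cong (p ∘ suc) q n) (⋆-cong p (q ∘ suc) n)

  ⋆-comm : ∀ f g → f ⋆ g ≗′ g ⋆ f
  ⋆-comm f g zero    = *-comm _ _
  ⋆-comm f g (suc n) = trans (+-cong (⋆-comm (f ∘ suc) g n) (⋆-comm f (g ∘ suc) n)) (+-comm _ _)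

  ⋆-distribʳ : ∀ f g h → (λ n → f n + g n) ⋆ h ≗′ (λ n → (f ⋆ h) n + (g ⋆ h) n)
  ⋆-distribʳ f g h zero    = distribʳ _ _ _
  ⋆-distribʳ f g h (suc n) = trans (+-cong (⋆-distribʳ (f ∘ suc) (g ∘ suc) h n) (⋆-distribʳ f g (h ∘ suc) n))
    (solve {4} (λ a b c d → (a :+ b) :+ (c :+ d) := (a :+ c) :+ (b :+ d)) (_ ∷ _ ∷ _ ∷ _ ∷ []))

  ⋆-distribˡ : ∀ f g h → f ⋆ (λ n → g n + h n) ≗′ (λ n → (f ⋆ g) n + (f ⋆ h) n)
  ⋆-distribˡ f g h n = trans (⋆-comm f _ n) (trans (⋆-distribʳ g h f n) (+-cong (⋆-comm g f n) (⋆-comm h f n)))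

  ⋆-scale : ∀ c f g → (λ n → c * f n) ⋆ g ≗′ (λ n → c * (f ⋆ g) n)
  ⋆-scale c f g zero    = *-assoc _ _ _
  ⋆-scale c f g (suc n) = trans (+-cong (⋆-scale c (f ∘ suc) g n) (⋆-scale c f (g ∘ suc) n)) (sym (distribˡ _ _ _))

  ⋆-assoc : ∀ f g h → (f ⋆ g) ⋆ h ≗′ f ⋆ (g ⋆ h)
  ⋆-assoc f g h zero    = *-assoc _ _ _
  ⋆-assoc f g h (suc n) = begin
    (((f ⋆ g) ∘ suc) ⋆ h) n + ((f ⋆ g) ⋆ (h ∘ suc)) n
      ≈⟨ +-congʳ (⋆-distribʳ ((f ∘ suc) ⋆ g) (f ⋆ (g ∘ suc)) h n) ⟩
    (((f ∘ suc) ⋆ g) ⋆ h) n + ((f ⋆ (g ∘ suc)) ⋆ h) n + ((f ⋆ g) ⋆ (h ∘ suc)) n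
      ≈⟨ +-cong (+-cong (⋆-assoc (f ∘ suc) g h n) (⋆-assoc f (g ∘ suc) h n)) (⋆-assoc f g (h ∘ suc) n) ⟩
    ((f ∘ suc) ⋆ (g ⋆ h)) n + (f ⋆ ((g ∘ suc) ⋆ h)) n + (f ⋆ (g ⋆ (h ∘ suc))) n
      ≈⟨ +-assoc _ _ _ ⟩
    ((f ∘ suc) ⋆ (g ⋆ h)) n + ((f ⋆ ((g ∘ suc) ⋆ h)) n + (f ⋆ (g ⋆ (h ∘ suc))) n)
      ≈⟨ +-congˡ (⋆-distribˡ f _ _ n) ⟨
    ((f ∘ suc) ⋆ (g ⋆ h)) n + (f ⋆ ((g ⋆ h) ∘ suc)) n ∎

  -- The Leibniz recursion becomes Pascal's rule once the second sum is padded by the index n + 1,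
  -- where its term is zero, and shifted by one.
  ⋆-closed : ∀ n f g → (f ⋆ g) n ≈ ∑ (suc n) (λ k → ι (n C k) * (f k * g (n ∸ k)))
  ⋆-closed zero    f g = solve {1} (λ a → a := # 0 :+ # 1 :* a) (_ ∷ [])
  ⋆-closed (suc n) f g = begin
    ((f ∘ suc) ⋆ g) n + (f ⋆ (g ∘ suc)) n
      ≈⟨ +-cong (⋆-closed n (f ∘ suc) g) (⋆-closed n f (g ∘ suc)) ⟩
    ∑ (suc n) a + ∑ (suc n) (λ k → ι (n C k) * (f k * g (suc (n ∸ k))))
      ≈⟨ +-congˡ (∑-cong (suc n) λ k k≤n → reflexive (≡.cong (λ z → ι (n C k) * (f k * g z)) (≡.sym (ℕₚ.+-∸-assoc 1 (ℕₚ.≤-pred k≤n))))) ⟩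
    ∑ (suc n) a + ∑ (suc n) b
      ≈⟨ +-congˡ (sym (trans (+-congˡ b-last) (+-identityʳ _))) ⟩
    ∑ (suc n) a + ∑ (suc (suc n)) b
      ≈⟨ +-congˡ (∑-cons (suc n) b) ⟩
    ∑ (suc n) a + (b 0 + ∑ (suc n) (b ∘ suc))
      ≈⟨ solve {3} (λ x y z → x :+ (y :+ z) := y :+ (x :+ z)) (_ ∷ _ ∷ _ ∷ []) ⟩
    b 0 + (∑ (suc n) a + ∑ (suc n) (b ∘ suc))
      ≈⟨ +-cong (sym (*-congʳ refl)) (sym (∑-+ (suc n) a (b ∘ suc))) ⟩
    c 0 + ∑ (suc n) (λ k → a k + b (suc k))
      ≈⟨ +-congˡ (∑-cong′ (suc n) λ k → pascal k) ⟩
    c 0 + ∑ (suc n) (c ∘ suc)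
      ≈⟨ ∑-cons (suc n) c ⟨
    ∑ (suc (suc n)) c ∎
    where
    a b c : ℕ → Carrier
    a k = ι (n C k) * (f (suc k) * g (n ∸ k))
    b k = ι (n C k) * (f k * g (suc n ∸ k))
    c k = ι (suc n C k) * (f k * g (suc n ∸ k))
    b-last : b (suc n) ≈ 0#
    b-last = trans (*-congʳ (reflexive (≡.cong ι (k>n⇒nCk≡0 {n} {suc n} ℕₚ.≤-refl)))) (zeroˡ _)
    pascal : ∀ k → a k + b (suc k) ≈ c (suc k)
    pascal k = begin
      a k + b (suc k)                                            ≈⟨ distribʳ _ _ _ ⟨
      (ι (n C k) + ι (n C suc k)) * (f (suc k) * g (n ∸ k))      ≈⟨ *-congʳ (ι-+ (n C k) (n C suc k)) ⟨
      ι (n C k ℕ.+ n C suc k) * (f (suc k) * g (n ∸ k))          ≡⟨ ≡.cong (λ z → ι z * (f (suc k) * g (n ∸ k))) (nCk+nC[k+1]≡[n+1]C[k+1] n k) ⟩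
      c (suc k)                                                  ∎

  pow : Carrier → ℕ → Carrier
  pow x n = x ^ n

  -- The identity e ^ (x t) e ^ (y t) = e ^ ((x + y) t); the binomial theorem is its coefficient
  -- form.
  ⋆-pow : ∀ x y → pow x ⋆ pow y ≗′ pow (x + y)
  ⋆-pow x y zero    = *-identityʳ _
  ⋆-pow x y (suc n) = begin
    ((λ m → x * x ^ m) ⋆ pow y) n + (pow x ⋆ (λ m → y * y ^ m)) n
      ≈⟨ +-cong (⋆-scale x (pow x) (pow y) n) (trans (⋆-comm (pow x) (λ m → y * y ^ m) n) (trans (⋆-scale y (pow y) (pow x) n) (*-congˡ (⋆-comm (pow y) (pow x) n)))) ⟩
    x * (pow x ⋆ pow y) n + y * (pow x ⋆ pow y) n
      ≈⟨ distribʳ _ _ _ ⟨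
    (x + y) * (pow x ⋆ pow y) n
      ≈⟨ *-congˡ (⋆-pow x y n) ⟩
    (x + y) ^ suc n ∎

  unit : ℕ → Carrier
  unit zero    = 1#
  unit (suc _) = 0#

  ⋆-0 : ∀ f → (λ _ → 0#) ⋆ f ≗′ (λ _ → 0#)
  ⋆-0 f zero    = zeroˡ _
  ⋆-0 f (suc n) = trans (+-cong (⋆-0 f n) (⋆-0 (f ∘ suc) n)) (+-identityʳ _)

  ⋆-unit : ∀ f → unit ⋆ f ≗′ f
  ⋆-unit f zero    = *-identityˡ _
  ⋆-unit f (suc n) = trans (+-cong (⋆-0 f n) (⋆-unit (f ∘ suc) n)) (+-identityˡ _)

  -- The exponential generating function t.
  egf-t : ℕ → Carrier
  egf-t zero    = 0#
  egf-t (suc n) = unit n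

  ⋆-t-suc : ∀ f n → (egf-t ⋆ f) (suc n) ≈ ι (suc n) * f n
  ⋆-t-suc f zero    = begin
    1# * f 0 + 0# * f 1  ≈⟨ solve {2} (λ a b → # 1 :* a :+ # 0 :* b := # 1 :* a) (_ ∷ _ ∷ []) ⟩
    1# * f 0             ∎
  ⋆-t-suc f (suc n) = begin
    (unit ⋆ f) (suc n) + (egf-t ⋆ (f ∘ suc)) (suc n)  ≈⟨ +-cong (⋆-unit f (suc n)) (⋆-t-suc (f ∘ suc) n) ⟩
    f (suc n) + ι (suc n) * f (suc n)               ≈⟨ solve {2} (λ a b → a :+ b :* a := (# 1 :+ b) :* a) (_ ∷ _ ∷ []) ⟩
    ι (suc (suc n)) * f (suc n)                     ∎

  absorption : ∀ n k → ι (suc k) * ι (suc n C suc k) ≈ ι (suc n) * ι (n C k)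
  absorption n zero = begin
    1# * ι (suc n C 1)   ≡⟨ ≡.cong (λ z → 1# * ι z) (nC1≡n (suc n)) ⟩
    1# * ι (suc n)       ≈⟨ *-comm _ _ ⟩
    ι (suc n) * 1#       ∎
  absorption zero (suc k) = begin
    ι (suc (suc k)) * ι (1 C suc (suc k))   ≡⟨ ≡.cong (λ z → ι (suc (suc k)) * ι z) (k>n⇒nCk≡0 {1} {suc (suc k)} (s≤s (s≤s z≤n))) ⟩
    ι (suc (suc k)) * 0#                    ≈⟨ zeroʳ _ ⟩
    0#                                      ≈⟨ zeroʳ _ ⟨
    1# * 0#                                 ∎
  absorption (suc n) (suc k) = begin
    ι (suc (suc k)) * ι (suc (suc n) C suc (suc k))
      ≡⟨ ≡.cong (λ z → ι (suc (suc k)) * ι z) (nCk+nC[k+1]≡[n+1]C[k+1] (suc n) (suc k)) ⟨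
    ι (suc (suc k)) * ι (suc n C suc k ℕ.+ suc n C suc (suc k))
      ≈⟨ *-congˡ (ι-+ (suc n C suc k) _) ⟩
    (1# + ι (suc k)) * (ι (suc n C suc k) + ι (suc n C suc (suc k)))
      ≈⟨ solve {3} (λ k a b → (# 1 :+ k) :* (a :+ b) := (a :+ k :* a) :+ (# 1 :+ k) :* b) (ι (suc k) ∷ ι (suc n C suc k) ∷ ι (suc n C suc (suc k)) ∷ []) ⟩
    ι (suc n C suc k) + ι (suc k) * ι (suc n C suc k) + ι (suc (suc k)) * ι (suc n C suc (suc k))
      ≈⟨ +-cong (+-congˡ (absorption n k)) (absorption n (suc k)) ⟩
    ι (suc n C suc k) + ι (suc n) * ι (n C k) + ι (suc n) * ι (n C suc k)
      ≈⟨ solve {4} (λ a n b c → a :+ n :* b :+ n :* c := a :+ n :* (b :+ c)) (ι (suc n C suc k) ∷ ι (suc n) ∷ ι (n C k) ∷ ι (n C suc k) ∷ []) ⟩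
    ι (suc n C suc k) + ι (suc n) * (ι (n C k) + ι (n C suc k))
      ≈⟨ +-congˡ (*-congˡ (trans (sym (ι-+ (n C k) _)) (reflexive (≡.cong ι (nCk+nC[k+1]≡[n+1]C[k+1] n k))))) ⟩
    ι (suc n C suc k) + ι (suc n) * ι (suc n C suc k)
      ≈⟨ solve {2} (λ a n → a :+ n :* a := (# 1 :+ n) :* a) (ι (suc n C suc k) ∷ ι (suc n) ∷ []) ⟩
    ι (suc (suc n)) * ι (suc n C suc k) ∎

  1^ : ∀ n → 1# ^ n ≈ 1#
  1^ zero    = refl
  1^ (suc n) = trans (*-identityˡ _) (1^ n)

  binomial : ∀ n x → (x + 1#) ^ n ≈ ∑ (suc n) (λ k → ι (n C k) * x ^ k)
  binomial n x = trans (sym (⋆-pow x 1# n)) (trans (⋆-closed n (pow x) (pow 1#))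
    (∑-cong′ (suc n) λ k → *-congˡ (trans (*-congˡ (1^ (n ∸ k))) (*-identityʳ _))))

-- Parity

Even Odd : ℕ → Set
Even n = ∃ λ k → n ≡ 2 ℕ.* k
Odd n  = ∃ λ k → n ≡ suc (2 ℕ.* k)

2*suc : ∀ k → 2 ℕ.* suc k ≡ suc (suc (2 ℕ.* k))
2*suc k = ℕₚ.*-suc 2 k

parity : ∀ n → Even n ⊎ Odd n
parity zero    = inj₁ (0 , ≡.refl)
parity (suc n) with parity n
... | inj₁ (k , e) = inj₂ (k , ≡.cong suc e)
... | inj₂ (k , e) = inj₁ (suc k , ≡.trans (≡.cong suc e) (≡.sym (2*suc k)))

even-suc : ∀ {n} → Even (suc n) → Odd n
even-suc {n} (suc k , e) = k , ℕₚ.suc-injective (≡.trans e (2*suc k))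

odd-suc : ∀ {n} → Odd (suc n) → Even n
odd-suc (k , e) = k , ℕₚ.suc-injective e

suc-even : ∀ {n} → Even n → Odd (suc n)
suc-even (k , e) = k , ≡.cong suc e

even+even : ∀ {m n} → Even m → Even n → Even (m ℕ.+ n)
even+even (k , e) (l , f) = k ℕ.+ l , ≡.trans (≡.cong₂ ℕ._+_ e f) (≡.sym (ℕₚ.*-distribˡ-+ 2 k l))

¬even∧odd : ∀ {n} → Even n → ¬ Odd n
¬even∧odd {zero}  _ (k , ())
¬even∧odd {suc n} e o = ¬even∧odd (odd-suc o) (even-suc e)

even∸even : ∀ {m n} → n ℕ.≤ m → Even m → Even n → Even (m ∸ n)
even∸even {m} {n} n≤m (k , ≡.refl) (l , ≡.refl) = k ∸ l , ≡.sym (ℕₚ.*-distribˡ-∸ 2 k l)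

-- Congruences modulo powers of an element

module Congruence (R : CommutativeRing 0ℓ 0ℓ) (π : CommutativeRing.Carrier R) where
  open Numerals R
  open Sums R

  open CommutativeRing R hiding (zero)
  open import Algebra.Properties.Semiring.Exp semiring using (_^_; ^-homo-*)
  import Relation.Binary.Reasoning.Setoid as SetoidReasoning
  private module ≈-Reasoning = SetoidReasoning setoid

  open Mod π public
  open Congruences π public

  private variable
    k l : ℕ
    x y z u v : Carrier

  exact : x ≈ y → x ≈[ k ] y
  exact {x} {y} {k} h = mk 0# (trans h (sym (trans (+-congˡ (zeroʳ (π ^ k))) (+-identityʳ y))))

  reflᵐ : x ≈[ k ] x
  reflᵐ = exact refl

  symᵐ : x ≈[ k ] y → y ≈[ k ] x
  symᵐ {x} {k} {y} (mk q h) = mk (- q) (begin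
    y                                ≈⟨ solve {3} (λ y a q → y := (y :+ a :* q) :+ a :* :- q) (y ∷ π ^ k ∷ q ∷ []) ⟩
    y + π ^ k * q + π ^ k * - q      ≈⟨ +-congʳ h ⟨
    x + π ^ k * - q                  ∎)
    where open ≈-Reasoning

  transᵐ : x ≈[ k ] y → y ≈[ k ] z → x ≈[ k ] z
  transᵐ {x} {k} {y} {z} (mk q h) (mk r i) = mk (r + q) (begin
    x                              ≈⟨ h ⟩
    y + π ^ k * q                  ≈⟨ +-congʳ i ⟩
    z + π ^ k * r + π ^ k * q      ≈⟨ solve {4} (λ z a r q → (z :+ a :* r) :+ a :* q := z :+ a :* (r :+ q)) (z ∷ π ^ k ∷ r ∷ q ∷ []) ⟩
    z + π ^ k * (r + q)            ∎)
    where open ≈-Reasoning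

  +-congᵐ : x ≈[ k ] y → u ≈[ k ] v → x + u ≈[ k ] y + v
  +-congᵐ {x} {k} {y} {u} {v} (mk q h) (mk r i) = mk (q + r) (trans (+-cong h i)
    (solve {5} (λ y v a r q → (y :+ a :* q) :+ (v :+ a :* r) := (y :+ v) :+ a :* (q :+ r)) (y ∷ v ∷ π ^ k ∷ r ∷ q ∷ [])))

  *-congᵐ : x ≈[ k ] y → u ≈[ k ] v → x * u ≈[ k ] y * v
  *-congᵐ {x} {k} {y} {u} {v} (mk q h) (mk r i) = mk (q * v + (y * r + π ^ k * q * r)) (trans (*-cong h i)
    (solve {5} (λ y v a r q → (y :+ a :* q) :* (v :+ a :* r) := (y :* v) :+ a :* (q :* v :+ (y :* r :+ a :* q :* r))) (y ∷ v ∷ π ^ k ∷ r ∷ q ∷ [])))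

  -‿congᵐ : x ≈[ k ] y → - x ≈[ k ] - y
  -‿congᵐ {x} {k} {y} (mk q h) = mk (- q) (trans (-‿cong h) (solve {3} (λ y a q → :- (y :+ a :* q) := :- y :+ a :* :- q) (y ∷ π ^ k ∷ q ∷ [])))

  infix 8 R/_
  -- A coarser equality on the same carrier, so that elements need no transport when the modulus
  -- changes.
  R/_ : ℕ → CommutativeRing 0ℓ 0ℓ
  R/ k = record
    { Carrier = Carrier ; _≈_ = λ x y → x ≈[ k ] y ; _+_ = _+_ ; _*_ = _*_ ; -_ = -_ ; 0# = 0# ; 1# = 1#
    ; isCommutativeRing = record
      { isRing = record
        { +-isAbelianGroup = record
          { isGroup = record
            { isMonoid = record
              { isSemigroup = record
                { isMagma = record
                  { isEquivalence = record { refl = reflᵐ ; sym = symᵐ ; trans = transᵐ }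
                  ; ∙-cong = +-congᵐ }
                ; assoc = λ x y z → exact (+-assoc x y z) }
              ; identity = (λ x → exact (+-identityˡ x)) , (λ x → exact (+-identityʳ x)) }
            ; inverse = (λ x → exact (-‿inverseˡ x)) , (λ x → exact (-‿inverseʳ x))
            ; ⁻¹-cong = -‿congᵐ }
          ; comm = λ x y → exact (+-comm x y) }
        ; *-cong = *-congᵐ
        ; *-assoc = λ x y z → exact (*-assoc x y z)
        ; *-identity = (λ x → exact (*-identityˡ x)) , (λ x → exact (*-identityʳ x))
        ; distrib = (λ x y z → exact (distribˡ x y z)) , (λ x y z → exact (distribʳ x y z)) }
      ; *-comm = λ x y → exact (*-comm x y) } }

  module Reasoning {k : ℕ} = SetoidReasoning (CommutativeRing.setoid (R/ k))

  +-congˡᵐ : u ≈[ k ] v → x + u ≈[ k ] x + v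
  +-congˡᵐ = +-congᵐ reflᵐ

  +-congʳᵐ : x ≈[ k ] y → x + u ≈[ k ] y + u
  +-congʳᵐ h = +-congᵐ h reflᵐ

  *-congˡᵐ : u ≈[ k ] v → x * u ≈[ k ] x * v
  *-congˡᵐ = *-congᵐ reflᵐ

  *-congʳᵐ : x ≈[ k ] y → x * u ≈[ k ] y * u
  *-congʳᵐ h = *-congᵐ h reflᵐ

  ^-congᵐ : ∀ n → x ≈[ k ] y → x ^ n ≈[ k ] y ^ n
  ^-congᵐ zero    h = reflᵐ
  ^-congᵐ (suc n) h = *-congᵐ h (^-congᵐ n h)

  reduce : l ℕ.≤ k → x ≈[ k ] y → x ≈[ l ] y
  reduce {l} {k} {x} {y} l≤k (mk q h) = mk (π ^ (k ∸ l) * q) (begin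
    x                                 ≈⟨ h ⟩
    y + π ^ k * q                     ≡⟨ ≡.cong (λ n → y + π ^ n * q) (ℕₚ.m+[n∸m]≡n l≤k) ⟨
    y + π ^ (l ℕ.+ (k ∸ l)) * q       ≈⟨ +-congˡ (*-congʳ (^-homo-* π l (k ∸ l))) ⟩
    y + π ^ l * π ^ (k ∸ l) * q       ≈⟨ +-congˡ (*-assoc _ _ _) ⟩
    y + π ^ l * (π ^ (k ∸ l) * q)     ∎)
    where open ≈-Reasoning

  π*-cong : x ≈[ k ] y → π * x ≈[ suc k ] π * y
  π*-cong {x} {k} {y} (mk q h) = mk q (trans (*-congˡ h) (solve {4} (λ p y a q → p :* (y :+ a :* q) := p :* y :+ (p :* a) :* q) (π ∷ y ∷ π ^ k ∷ q ∷ [])))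

  π^*-cong : ∀ l → x ≈[ k ] y → π ^ l * x ≈[ l ℕ.+ k ] π ^ l * y
  π^*-cong zero    h = *-congˡᵐ h
  π^*-cong (suc l) h = transᵐ (exact (*-assoc _ _ _)) (transᵐ (π*-cong (π^*-cong l h)) (symᵐ (exact (*-assoc _ _ _))))

  π*-cancel : (∀ {a b} → π * a ≈ π * b → a ≈ b) → π * x ≈[ suc k ] π * y → x ≈[ k ] y
  π*-cancel {x} {k} {y} cancel (mk q h) = mk q (cancel (trans h
    (solve {4} (λ p y a q → p :* y :+ (p :* a) :* q := p :* (y :+ a :* q)) (π ∷ y ∷ π ^ k ∷ q ∷ []))))

  x-y≈0⇒x≈yᵐ : x - y ≈[ k ] 0# → x ≈[ k ] y
  x-y≈0⇒x≈yᵐ {x} {y} h = transᵐ (exact (solve {2} (λ x y → x := (x :- y) :+ y) (x ∷ y ∷ []))) (transᵐ (+-congʳᵐ h) (exact (+-identityˡ y)))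

  x≈y⇒x-y≈0ᵐ : x ≈[ k ] y → x - y ≈[ k ] 0#
  x≈y⇒x-y≈0ᵐ h = transᵐ (+-congʳᵐ h) (exact (-‿inverseʳ _))

  Unit : Carrier → Set
  Unit x = ∃ λ y → x * y ≈ 1#

  unit-cancel : Unit u → u * x ≈[ k ] u * y → x ≈[ k ] y
  unit-cancel {u} {x} {k} {y} (v , uv≈1) h = transᵐ (symᵐ (one x)) (transᵐ (*-congˡᵐ h) (one y))
    where
    one : ∀ z → v * (u * z) ≈[ k ] z
    one z = exact (trans (solve {3} (λ v u z → v :* (u :* z) := (u :* v) :* z) (v ∷ u ∷ z ∷ [])) (trans (*-congʳ uv≈1) (*-identityˡ z)))

  -- An element invertible modulo π is cancellable modulo every power of π: if v u = 1 + π t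
  -- and u z = 0, then z = - π t z, hence z = (- π t) ^ k z.
  unit₁-cancel : ∀ {u v z} → u * v ≈[ 1 ] 1# → u * z ≈[ k ] 0# → z ≈[ k ] 0#
  unit₁-cancel {k} {u} {v} {z} (mk t h) uz≈0 = transᵐ (iterate k) (transᵐ (*-congʳᵐ (pow-small k)) (exact (zeroˡ z)))
    where
    c = - (π * t)
    step : z ≈[ k ] c * z
    step = begin
      z                                     ≈⟨ exact (solve {3} (λ z p t → z := (# 1 :+ p :^ 1 :* t) :* z :+ (:- (p :* t)) :* z) (z ∷ π ∷ t ∷ [])) ⟩
      (1# + π ^ 1 * t) * z + c * z          ≈⟨ +-congʳᵐ (exact (*-congʳ (sym h))) ⟩
      u * v * z + c * z                     ≈⟨ exact (solve {4} (λ u v z c → (u :* v) :* z :+ c :* z := v :* (u :* z) :+ c :* z) (u ∷ v ∷ z ∷ c ∷ [])) ⟩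
      v * (u * z) + c * z                   ≈⟨ +-congʳᵐ (*-congˡᵐ uz≈0) ⟩
      v * 0# + c * z                        ≈⟨ exact (solve {2} (λ v w → v :* # 0 :+ w := w) (v ∷ c * z ∷ [])) ⟩
      c * z                                 ∎
      where open Reasoning
    iterate : ∀ n → z ≈[ k ] c ^ n * z
    iterate zero    = exact (sym (*-identityˡ z))
    iterate (suc n) = transᵐ step (transᵐ (*-congˡᵐ (iterate n)) (exact (sym (*-assoc _ _ _))))
    pow-small : ∀ n → c ^ n ≈[ n ] 0#
    pow-small zero    = mk 1# (solve {0} (# 1 := # 0 :+ # 1 :* # 1) [])
    pow-small (suc n) = transᵐ (exact (trans (solve {3} (λ p t w → (:- (p :* t)) :* w := p :* ((:- t) :* w)) (π ∷ t ∷ c ^ n ∷ []))  refl))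
      (transᵐ (π*-cong (*-congˡᵐ (pow-small n))) (exact (solve {2} (λ p t → p :* (t :* # 0) := # 0) (π ∷ - t ∷ []))))

  ∑-congᵐ : ∀ n {f g} → (∀ i → i ℕ.< n → f i ≈[ k ] g i) → ∑ n f ≈[ k ] ∑ n g
  ∑-congᵐ zero    h = reflᵐ
  ∑-congᵐ (suc n) h = +-congᵐ (∑-congᵐ n (λ i i<n → h i (ℕₚ.m<n⇒m<1+n i<n))) (h n ℕₚ.≤-refl)

  ∑-zeroᵐ : ∀ n {f} → (∀ i → i ℕ.< n → f i ≈[ k ] 0#) → ∑ n f ≈[ k ] 0#
  ∑-zeroᵐ n h = transᵐ (∑-congᵐ n h) (exact (∑-0 n))

  ∑-pickᵐ : ∀ n m {f} → m ℕ.< n → (∀ i → i ℕ.< n → i ≢ m → f i ≈[ k ] 0#) → ∑ n f ≈[ k ] f m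
  ∑-pickᵐ (suc n) m {f} m<1+n h with ℕₚ.<-cmp m n
  ... | tri< m<n _ _ = transᵐ (+-congᵐ (∑-pickᵐ n m m<n (λ i i<n → h i (ℕₚ.m<n⇒m<1+n i<n))) (h n ℕₚ.≤-refl (λ { ≡.refl → ℕₚ.n≮n _ m<n }))) (exact (+-identityʳ _))
  ... | tri≈ _ ≡.refl _ = transᵐ (+-congʳᵐ (∑-zeroᵐ n (λ i i<n → h i (ℕₚ.m<n⇒m<1+n i<n) (λ { ≡.refl → ℕₚ.n≮n _ i<n })))) (exact (+-identityˡ _))
  ... | tri> _ _ n<m = contradiction (ℕₚ.≤-pred m<1+n) (ℕₚ.<⇒≱ n<m)

-- Axioms for the numbers p B n in a localisation

module _ (R : CommutativeRing 0ℓ 0ℓ) where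
  open CommutativeRing R hiding (zero)
  open import Algebra.Properties.Semiring.Exp semiring using (_^_)
  open Numerals R
  open Sums R using (∑)

  -- In the localisation of ℤ at p = r + 2, the element b n is p B_n.
  record Regular (r : ℕ) (b : ℕ → Carrier) : Set where
    private
      p : ℕ
      p = suc (suc r)

      π : Carrier
      π = ι p
    open Mod π
    field
      cancel      : ∀ {x y} → π * x ≈ π * y → x ≈ y
      9≤r         : 9 ℕ.≤ r
      unit-∤      : ∀ n → ¬ (p ∣ n) → Σ Carrier λ y → ι n * y ≈ 1#
      p∤720       : ¬ (p ∣ 720)
      m-even      : Even (suc r)
      b-faulhaber : ∀ n → ι 24 * ∑ p (λ a → ι a ^ n) ≈[ 4 ]
        ι 24 * b n + ι 12 * ι n * π * b (n ∸ 1) + ι 4 * (ι n * (ι n - 1#)) * π ^ 2 * b (n ∸ 2)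
          + ι n * (ι n - 1#) * (ι n - ι 2) * π ^ 3 * b (n ∸ 3)
      b-0         : b 0 ≈ π
      b-1         : ι 2 * b 1 ≈ - π
      b-odd       : ∀ k → b (3 ℕ.+ 2 ℕ.* k) ≈ 0#

    p∤n : ∀ n → 0 ℕ.< n → n ℕ.< p → ¬ (p ∣ n)
    p∤n (suc n) _ n<p h = ℕₚ.<⇒≱ n<p (∣⇒≤ h)

    unit-ι : ∀ n → 0 ℕ.< n → n ℕ.< p → Σ Carrier λ y → ι n * y ≈ 1#
    unit-ι n 0<n n<p = unit-∤ n (p∤n n 0<n n<p)

-- Fermat quotients and the lifts ω

module FermatQuotients (R : CommutativeRing 0ℓ 0ℓ) (r : ℕ) (b : ℕ → CommutativeRing.Carrier R) (regular : Regular R r b) where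
  open Regular regular
  open Numerals R hiding (lhs; rhs)
  open Sums R

  m p : ℕ
  m = suc r
  p = suc m

  open CommutativeRing R hiding (zero)
  open import Algebra.Properties.Semiring.Exp semiring using (_^_; ^-congˡ; ^-homo-*; ^-assocʳ)
  open import Algebra.Properties.CommutativeSemiring.Exp commutativeSemiring using (^-distrib-*)
  import Relation.Binary.Reasoning.Setoid as SetoidReasoning
  module ≈-Reasoning = SetoidReasoning setoid

  π : Carrier
  π = ι p

  open Congruence R π public

  unit-cancelι : ∀ {k} n → 0 ℕ.< n → n ℕ.< p → ∀ {x y} → ι n * x ≈[ k ] ι n * y → x ≈[ k ] y
  unit-cancelι n 0<n n<p = unit-cancel (unit-ι n 0<n n<p)

  π*≈0 : ∀ x → π * x ≈[ 1 ] 0#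
  π*≈0 x = solveMod 1 {1} (λ π x → π :* x := # 0) (x ∷ [])

  pC-middle : ∀ k → k ℕ.< m → ι (p C suc k) ≈[ 1 ] 0#
  pC-middle k k<m = unit-cancelι (suc k) (s≤s z≤n) (s≤s k<m) (transᵐ (exact (absorption m k)) (transᵐ (π*≈0 _) (exact (sym (zeroʳ _)))))

  frobenius : ∀ x → (x + 1#) ^ p ≈[ 1 ] x ^ p + 1#
  frobenius x = begin
    (x + 1#) ^ p                                               ≈⟨ exact (binomial p x) ⟩
    ∑ p t + ι (p C p) * x ^ p                                  ≈⟨ +-congᵐ (exact (∑-cons m t)) (exact (trans (*-congʳ (reflexive (≡.cong ι (nCn≡1 p)))) (*-identityˡ _))) ⟩
    t 0 + ∑ m (t ∘ suc) + x ^ p                                ≈⟨ +-congʳᵐ (+-congˡᵐ (∑-zeroᵐ m λ k k<m → transᵐ (*-congʳᵐ (pC-middle k k<m)) (exact (zeroˡ _)))) ⟩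
    1# * 1# + 0# + x ^ p                                       ≈⟨ exact (solve {1} (λ a → # 1 :* # 1 :+ # 0 :+ a := a :+ # 1) (x ^ p ∷ [])) ⟩
    x ^ p + 1#                                                 ∎
    where
    open Reasoning
    t : ℕ → Carrier
    t k = ι (p C k) * x ^ k

  fermat : ∀ a → ι a ^ p ≈[ 1 ] ι a
  fermat zero    = exact (zeroˡ _)
  fermat (suc a) = begin
    ι (suc a) ^ p     ≈⟨ exact (^-congˡ p (trans (ι-suc a) (+-comm _ _))) ⟩
    (ι a + 1#) ^ p    ≈⟨ frobenius (ι a) ⟩
    ι a ^ p + 1#      ≈⟨ +-congʳᵐ (fermat a) ⟩
    ι a + 1#          ≈⟨ exact (trans (+-comm _ _) (sym (ι-suc a))) ⟩
    ι (suc a)         ∎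
    where open Reasoning

  -- The residues 1, …, p - 1 are indexed by i = 0, …, m - 1; q i is the Fermat quotient of i + 1.
  q-spec : ∀ i → i ℕ.< m → ι (suc i) ^ m ≈[ 1 ] 1#
  q-spec i i<m = unit-cancelι (suc i) (s≤s z≤n) (s≤s i<m) (transᵐ (fermat (suc i)) (exact (sym (*-identityʳ _))))

  q : ℕ → Carrier
  q i with i ℕ.<? m
  ... | yes i<m = quot (q-spec i i<m)
  ... | no  _   = 0#

  u : ℕ → Carrier
  u i = 1# + π * q i

  u-spec : ∀ i → i ℕ.< m → ι (suc i) ^ m ≈ u i
  u-spec i i<m with i ℕ.<? m
  ... | yes i<m = trans (eq (q-spec i i<m)) (+-congˡ (*-congʳ (*-identityʳ π)))
  ... | no  i≮m = contradiction i<m i≮m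

  -- The exponent p ^ 2 sends u = 1 + p q to 1 modulo p ^ 3, by `binom₃`, and changes nothing modulo
  -- p, by Fermat. So this explicit power is the required lift, and no successive approximation is
  -- needed.
  ω : ℕ → Carrier
  ω i = ι (suc i) ^ (p ℕ.* p)

  ω≈ : ∀ i → ω i ≈[ 1 ] ι (suc i)
  ω≈ i = transᵐ (exact (sym (^-assocʳ (ι (suc i)) p p))) (transᵐ (^-congᵐ p (fermat (suc i))) (fermat (suc i)))

  binom₃ : ∀ n x → ι 2 * (1# + π * x) ^ n ≈[ 3 ] ι 2 + ι 2 * ι n * π * x + ι n * (ι n - 1#) * π ^ 2 * x ^ 2
  binom₃ zero    x = solveMod 3 {1} (λ π x → # 2 :* # 1 := # 2 :+ # 2 :* # 0 :* π :* x :+ # 0 :* (# 0 :- # 1) :* π :^ 2 :* x :^ 2) (x ∷ [])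
  binom₃ (suc n) x = begin
    ι 2 * ((1# + π * x) * (1# + π * x) ^ n)                                        ≈⟨ exact (solve {2} (λ a b → # 2 :* (a :* b) := a :* (# 2 :* b)) (1# + π * x ∷ (1# + π * x) ^ n ∷ [])) ⟩
    (1# + π * x) * (ι 2 * (1# + π * x) ^ n)                                        ≈⟨ *-congˡᵐ (binom₃ n x) ⟩
    (1# + π * x) * (ι 2 + ι 2 * ι n * π * x + ι n * (ι n - 1#) * π ^ 2 * x ^ 2)    ≈⟨ solveMod 3 {2} (λ π x n → (# 1 :+ π :* x) :* (# 2 :+ # 2 :* n :* π :* x :+ n :* (n :- # 1) :* π :^ 2 :* x :^ 2) := # 2 :+ # 2 :* (# 1 :+ n) :* π :* x :+ (# 1 :+ n) :* (# 1 :+ n :- # 1) :* π :^ 2 :* x :^ 2) (x ∷ ι n ∷ []) ⟩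
    ι 2 + ι 2 * (1# + ι n) * π * x + (1# + ι n) * (1# + ι n - 1#) * π ^ 2 * x ^ 2
      ≈⟨ exact (+-cong (+-congˡ (*-congʳ (*-congʳ (*-congˡ (sym (ι-suc n)))))) (*-congʳ (*-congʳ (*-cong (sym (ι-suc n)) (+-congʳ (sym (ι-suc n))))))) ⟩
    ι 2 + ι 2 * ι (suc n) * π * x + ι (suc n) * (ι (suc n) - 1#) * π ^ 2 * x ^ 2   ∎
    where open Reasoning

  10≤m : 10 ℕ.≤ m
  10≤m = s≤s 9≤r

  small-unit : ∀ {k} n {x y} → 0 ℕ.< n → n ℕ.≤ 10 → ι n * x ≈[ k ] ι n * y → x ≈[ k ] y
  small-unit n 0<n n≤10 = unit-cancelι n 0<n (s≤s (ℕₚ.≤-trans n≤10 10≤m))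

  π-cancel : ∀ {k x y} → π * x ≈[ suc k ] π * y → x ≈[ k ] y
  π-cancel = π*-cancel cancel

  ω^m : ∀ i → i ℕ.< m → ω i ^ m ≈[ 3 ] 1#
  ω^m i i<m = small-unit 2 (s≤s z≤n) (s≤s (s≤s z≤n)) (begin
    ι 2 * ω i ^ m                  ≈⟨ *-congˡᵐ (exact (trans (^-assocʳ (ι (suc i)) (p ℕ.* p) m) (trans (reflexive (≡.cong (ι (suc i) ^_) (ℕₚ.*-comm (p ℕ.* p) m))) (sym (^-assocʳ (ι (suc i)) m (p ℕ.* p)))))) ⟩
    ι 2 * (ι (suc i) ^ m) ^ (p ℕ.* p)  ≈⟨ *-congˡᵐ (exact (^-congˡ (p ℕ.* p) (u-spec i i<m))) ⟩
    ι 2 * u i ^ (p ℕ.* p)          ≈⟨ binom₃ (p ℕ.* p) (q i) ⟩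
    ι 2 + ι 2 * n * π * q i + n * (n - 1#) * π ^ 2 * q i ^ 2
      ≈⟨ exact (+-cong (+-congˡ (*-congʳ (*-congʳ (*-congˡ (ι-* p p))))) (*-congʳ (*-congʳ (*-cong (ι-* p p) (+-congʳ (ι-* p p)))))) ⟩
    ι 2 + ι 2 * (π * π) * π * q i + (π * π) * (π * π - 1#) * π ^ 2 * q i ^ 2
      ≈⟨ solveMod 3 {1} (λ π q → # 2 :+ # 2 :* (π :* π) :* π :* q :+ (π :* π) :* (π :* π :- # 1) :* π :^ 2 :* q :^ 2 := # 2 :* # 1) (q i ∷ []) ⟩
    ι 2 * 1#                       ∎)
    where
    open Reasoning
    n = ι (p ℕ.* p)

  ω-periodic : ∀ i k → i ℕ.< m → ω i ^ (m ℕ.+ k) ≈[ 3 ] ω i ^ k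
  ω-periodic i k i<m = transᵐ (exact (^-homo-* (ω i) m k)) (transᵐ (*-congʳᵐ (ω^m i i<m)) (exact (*-identityˡ _)))

  -- Orthogonality of the powers of ω

  -- The exponent N - n in place of N - 1 - n costs the factor y on the right and gives the sum the
  -- shape of `kernel`.
  geometric : ∀ N x y → ∑ N (λ n → x ^ n * y ^ (N ∸ n)) * (x - y) ≈ y * (x ^ N - y ^ N)
  geometric zero    x y = solve {2} (λ x y → # 0 :* (x :- y) := y :* (# 1 :- # 1)) (x ∷ y ∷ [])
  geometric (suc N) x y = begin
    (∑ N (λ n → x ^ n * y ^ (suc N ∸ n)) + x ^ N * y ^ (suc N ∸ N)) * (x - y)
      ≈⟨ *-congʳ (+-cong (∑-cong N λ n n<N → trans (*-congˡ (reflexive (≡.cong (y ^_) (ℕₚ.+-∸-assoc 1 (ℕₚ.<⇒≤ n<N))))) (solve {3} (λ a y b → a :* (y :* b) := y :* (a :* b)) (x ^ n ∷ y ∷ y ^ (N ∸ n) ∷ [])))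
           (*-congˡ (trans (reflexive (≡.cong (y ^_) (≡.trans (ℕₚ.+-∸-assoc 1 (ℕₚ.≤-refl {N})) (≡.cong suc (ℕₚ.n∸n≡0 N))))) (*-identityʳ y)))) ⟩
    (∑ N (λ n → y * (x ^ n * y ^ (N ∸ n))) + x ^ N * y) * (x - y)
      ≈⟨ *-congʳ (+-congʳ (∑-*ˡ N y _)) ⟩
    (y * g + x ^ N * y) * (x - y)
      ≈⟨ solve {4} (λ y g a x → (y :* g :+ a :* y) :* (x :- y) := y :* (g :* (x :- y)) :+ a :* y :* (x :- y)) (y ∷ g ∷ x ^ N ∷ x ∷ []) ⟩
    y * (g * (x - y)) + x ^ N * y * (x - y)
      ≈⟨ +-congʳ (*-congˡ (geometric N x y)) ⟩
    y * (y * (x ^ N - y ^ N)) + x ^ N * y * (x - y)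
      ≈⟨ solve {4} (λ x y a b → y :* (y :* (a :- b)) :+ a :* y :* (x :- y) := y :* (x :* a :- y :* b)) (x ∷ y ∷ x ^ N ∷ y ^ N ∷ []) ⟩
    y * (x ^ suc N - y ^ suc N) ∎
    where
    open ≈-Reasoning
    g = ∑ N (λ n → x ^ n * y ^ (N ∸ n))

  ∸-bound : ∀ {i j} → i ℕ.< j → j ℕ.< m → j ∸ i ℕ.< p
  ∸-bound {i} {j} i<j j<m = ℕₚ.≤-<-trans (ℕₚ.m∸n≤m j i) (ℕₚ.m<n⇒m<1+n j<m)

  -- Modulo p the difference is that of two distinct residues, hence an integer prime to p. An
  -- inverse modulo p is enough for cancelling modulo p ^ 3, by `unit₁-cancel`.
  ω-difference : ∀ {i j} → i ℕ.< m → j ℕ.< m → i ≢ j → ∃ λ v → (ω i - ω j) * v ≈[ 1 ] 1#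
  ω-difference {i} {j} i<m j<m i≢j with ℕₚ.<-cmp i j
  ... | tri≈ _ i≡j _ = contradiction i≡j i≢j
  ... | tri> _ _ j<i = v , (begin
    (ω i - ω j) * v                 ≈⟨ *-congʳᵐ (+-congᵐ (ω≈ i) (-‿congᵐ (ω≈ j))) ⟩
    (ι (suc i) - ι (suc j)) * v     ≈⟨ *-congʳᵐ (exact (sym (ι-∸ {suc i} {suc j} (s≤s (ℕₚ.<⇒≤ j<i))))) ⟩
    ι (i ∸ j) * v                   ≈⟨ exact e ⟩
    1#                              ∎)
    where
    open Reasoning
    inverse = unit-ι (i ∸ j) (ℕₚ.m<n⇒0<n∸m j<i) (∸-bound j<i i<m)
    v = proj₁ inverse
    e = proj₂ inverse
  ... | tri< i<j _ _ = - v , (begin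
    (ω i - ω j) * - v               ≈⟨ *-congʳᵐ (+-congᵐ (ω≈ i) (-‿congᵐ (ω≈ j))) ⟩
    (ι (suc i) - ι (suc j)) * - v   ≈⟨ exact (solve {3} (λ a b v → (a :- b) :* :- v := (b :- a) :* v) (ι (suc i) ∷ ι (suc j) ∷ v ∷ [])) ⟩
    (ι (suc j) - ι (suc i)) * v     ≈⟨ *-congʳᵐ (exact (sym (ι-∸ {suc j} {suc i} (s≤s (ℕₚ.<⇒≤ i<j))))) ⟩
    ι (j ∸ i) * v                   ≈⟨ exact e ⟩
    1#                              ∎)
    where
    open Reasoning
    inverse = unit-ι (j ∸ i) (ℕₚ.m<n⇒0<n∸m i<j) (∸-bound i<j j<m)
    v = proj₁ inverse
    e = proj₂ inverse

  -- The orthogonality sum of the characters given by powers of ω, with ω j ^ (m - n) standing for ω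
  -- j ^ (- n).
  kernel : ℕ → ℕ → Carrier
  kernel i j = ∑ m (λ n → ω i ^ n * ω j ^ (m ∸ n))

  kernel-diag : ∀ i → i ℕ.< m → kernel i i ≈[ 3 ] ι m
  kernel-diag i i<m = begin
    kernel i i         ≈⟨ ∑-congᵐ m (λ n n<m → transᵐ (exact (trans (sym (^-homo-* (ω i) n (m ∸ n))) (reflexive (≡.cong (ω i ^_) (ℕₚ.m+[n∸m]≡n (ℕₚ.<⇒≤ n<m)))))) (ω^m i i<m)) ⟩
    ∑ m (λ _ → 1#)     ≈⟨ exact (trans (∑-const m 1#) (*-identityʳ _)) ⟩
    ι m                ∎
    where open Reasoning

  kernel-off : ∀ i j → i ℕ.< m → j ℕ.< m → i ≢ j → kernel i j ≈[ 3 ] 0#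
  kernel-off i j i<m j<m i≢j = unit₁-cancel (proj₂ (ω-difference i<m j<m i≢j)) (begin
    (ω i - ω j) * kernel i j             ≈⟨ exact (trans (*-comm _ _) (geometric m (ω i) (ω j))) ⟩
    ω j * (ω i ^ m - ω j ^ m)            ≈⟨ *-congˡᵐ (+-congᵐ (ω^m i i<m) (-‿congᵐ (ω^m j j<m))) ⟩
    ω j * (1# - 1#)                      ≈⟨ exact (solve {1} (λ a → a :* (# 1 :- # 1) := # 0) (ω j ∷ [])) ⟩
    0#                                   ∎)
    where open Reasoning

  ⟨_⟩ : (ℕ → Carrier) → Carrier
  ⟨ f ⟩ = ∑ m f

  plancherel : ∀ (f g : ℕ → Carrier) → ∑ m (λ n → ⟨ (λ i → ω i ^ n * f i) ⟩ * ⟨ (λ j → ω j ^ (m ∸ n) * g j) ⟩) ≈[ 3 ] ι m * ⟨ (λ i → f i * g i) ⟩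
  plancherel f g = begin
    ∑ m (λ n → ⟨ (λ i → ω i ^ n * f i) ⟩ * ⟨ (λ j → ω j ^ (m ∸ n) * g j) ⟩)
      ≈⟨ exact (∑-cong′ m λ n → trans (sym (∑-*ʳ m _ _)) (∑-cong′ m λ i → trans (sym (∑-*ˡ m _ _)) (∑-cong′ m λ j →
           solve {4} (λ a b c d → (a :* b) :* (c :* d) := (b :* d) :* (a :* c)) (ω i ^ n ∷ f i ∷ ω j ^ (m ∸ n) ∷ g j ∷ [])))) ⟩
    ∑ m (λ n → ∑ m (λ i → ∑ m (λ j → f i * g j * (ω i ^ n * ω j ^ (m ∸ n)))))
      ≈⟨ exact (trans (∑-swap m m _) (∑-cong′ m λ i → trans (∑-swap m m _) (∑-cong′ m λ j → ∑-*ˡ m _ _))) ⟩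
    ∑ m (λ i → ∑ m (λ j → f i * g j * kernel i j))
      ≈⟨ ∑-congᵐ m (λ i i<m → ∑-pickᵐ m i i<m λ j j<m j≢i → transᵐ (*-congˡᵐ (kernel-off i j i<m j<m (j≢i ∘ ≡.sym))) (exact (zeroʳ _))) ⟩
    ∑ m (λ i → f i * g i * kernel i i)
      ≈⟨ ∑-congᵐ m (λ i i<m → transᵐ (*-congˡᵐ (kernel-diag i i<m)) (exact (*-comm _ _))) ⟩
    ∑ m (λ i → ι m * (f i * g i))
      ≈⟨ exact (∑-*ˡ m _ _) ⟩
    ι m * ⟨ (λ i → f i * g i) ⟩ ∎
    where open Reasoning

  -- Power sums

  -- The residue 0 is included because the telescoping sum behind the recurrence starts there; it
  -- contributes 1 for n = 0 and nothing otherwise.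
  powerSum₀ : ℕ → Carrier
  powerSum₀ n = ∑ p (λ a → ι a ^ n)

  ∑-telescope : ∀ N (f : ℕ → Carrier) → ∑ N (λ a → f (suc a) - f a) ≈ f N - f 0
  ∑-telescope zero    f = sym (-‿inverseʳ (f 0))
  ∑-telescope (suc N) f = trans (+-congʳ (∑-telescope N f)) (solve {3} (λ a b c → a :- b :+ (c :- a) := c :- b) (f N ∷ f 0 ∷ f (suc N) ∷ []))

  powerSum₀-recurrence : ∀ n → ∑ (suc n) (λ k → ι (suc n C k) * powerSum₀ k) ≈ π ^ suc n
  powerSum₀-recurrence n = begin
    ∑ (suc n) (λ k → ι (suc n C k) * powerSum₀ k)
      ≈⟨ ∑-cong′ (suc n) (λ k → sym (∑-*ˡ p _ _)) ⟩
    ∑ (suc n) (λ k → ∑ p (λ a → ι (suc n C k) * ι a ^ k))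
      ≈⟨ ∑-swap (suc n) p _ ⟩
    ∑ p (λ a → ∑ (suc n) (λ k → ι (suc n C k) * ι a ^ k))
      ≈⟨ ∑-cong′ p step ⟩
    ∑ p (λ a → ι (suc a) ^ suc n - ι a ^ suc n)
      ≈⟨ ∑-telescope p (λ a → ι a ^ suc n) ⟩
    π ^ suc n - 0# * 0# ^ n
      ≈⟨ solve {2} (λ a b → a :- # 0 :* b := a) (π ^ suc n ∷ 0# ^ n ∷ []) ⟩
    π ^ suc n ∎
    where
    open ≈-Reasoning
    step : ∀ a → ∑ (suc n) (λ k → ι (suc n C k) * ι a ^ k) ≈ ι (suc a) ^ suc n - ι a ^ suc n
    step a = begin
      s                                                ≈⟨ solve {2} (λ s x → s := s :+ # 1 :* x :- x) (s ∷ ι a ^ suc n ∷ []) ⟩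
      s + 1# * ι a ^ suc n - ι a ^ suc n               ≡⟨ ≡.cong (λ z → s + ι z * ι a ^ suc n - ι a ^ suc n) (nCn≡1 (suc n)) ⟨
      s + ι (suc n C suc n) * ι a ^ suc n - ι a ^ suc n ≈⟨ +-congʳ (binomial (suc n) (ι a)) ⟨
      (ι a + 1#) ^ suc n - ι a ^ suc n                 ≈⟨ +-congʳ (^-congˡ (suc n) (trans (+-comm _ _) (sym (ι-suc a)))) ⟩
      ι (suc a) ^ suc n - ι a ^ suc n                  ∎
      where s = ∑ (suc n) (λ k → ι (suc n C k) * ι a ^ k)

  -- The recurrence determines the sum of exponent n from the earlier ones as long as the
  -- coefficient n + 1 is prime to p, that is, up to n = p - 2; its right-hand side is a power of p.
  powerSum₀≈0 : ∀ n → n ℕ.< m → powerSum₀ n ≈[ 1 ] 0#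
  powerSum₀≈0 = <-rec (λ n → n ℕ.< m → powerSum₀ n ≈[ 1 ] 0#) go
    where
    open Reasoning
    nC[n-1] : ∀ n → suc n C n ≡ suc n
    nC[n-1] n = ≡.trans (nCk≡nC[n∸k] (ℕₚ.n≤1+n n)) (≡.trans (≡.cong (suc n C_) (≡.trans (ℕₚ.+-∸-assoc 1 (ℕₚ.≤-refl {n})) (≡.cong suc (ℕₚ.n∸n≡0 n)))) (nC1≡n (suc n)))
    go : ∀ n → (∀ {k} → k ℕ.< n → k ℕ.< m → powerSum₀ k ≈[ 1 ] 0#) → n ℕ.< m → powerSum₀ n ≈[ 1 ] 0#
    go n rec n<m = unit-cancelι (suc n) (s≤s z≤n) (s≤s n<m) (begin
      ι (suc n) * powerSum₀ n                         ≈⟨ exact (trans (*-congʳ (reflexive (≡.cong ι (≡.sym (nC[n-1] n))))) (sym (+-identityˡ _))) ⟩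
      0# + ι (suc n C n) * powerSum₀ n                ≈⟨ +-congʳᵐ (∑-zeroᵐ n (λ k k<n → transᵐ (*-congˡᵐ (rec k<n (ℕₚ.<-trans k<n n<m))) (exact (zeroʳ _)))) ⟨
      ∑ (suc n) (λ k → ι (suc n C k) * powerSum₀ k)   ≈⟨ exact (powerSum₀-recurrence n) ⟩
      π ^ suc n                                       ≈⟨ π*≈0 (π ^ n) ⟩
      0#                                              ≈⟨ exact (zeroʳ _) ⟨
      ι (suc n) * 0#                                  ∎)

  s : ℕ → Carrier
  s n = ⟨ (λ i → ω i ^ n) ⟩

  s-periodic : ∀ n → s (m ℕ.+ n) ≈[ 3 ] s n
  s-periodic n = ∑-congᵐ m λ i i<m → ω-periodic i n i<m

  s-m : s m ≈[ 3 ] ι m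
  s-m = transᵐ (∑-congᵐ m (λ i i<m → ω^m i i<m)) (exact (trans (∑-const m 1#) (*-identityʳ _)))

  s-0 : s 0 ≈[ 3 ] ι m
  s-0 = exact (trans (∑-const m 1#) (*-identityʳ _))

  ι-suc^≈ω : ∀ n → ⟨ (λ i → ι (suc i) ^ n) ⟩ ≈[ 1 ] s n
  ι-suc^≈ω n = ∑-congᵐ m λ i i<m → ^-congᵐ n (symᵐ (ω≈ i))

  powerSum₀-suc : ∀ n → powerSum₀ (suc n) ≈ ⟨ (λ i → ι (suc i) ^ suc n) ⟩
  powerSum₀-suc n = trans (∑-cons m (λ a → ι a ^ suc n)) (trans (+-congʳ (zeroˡ _)) (+-identityˡ _))

  product≈0 : ∀ {k l x y} → x ≈[ k ] 0# → y ≈[ l ] 0# → x * y ≈[ k ℕ.+ l ] 0#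
  product≈0 {k} {l} {x} {y} (mk a e) (mk b f) = mk (a * b) (begin
    x * y                                       ≈⟨ *-cong e f ⟩
    (0# + π ^ k * a) * (0# + π ^ l * b)         ≈⟨ solve {4} (λ c d a b → (# 0 :+ c :* a) :* (# 0 :+ d :* b) := # 0 :+ c :* d :* (a :* b)) (π ^ k ∷ π ^ l ∷ a ∷ b ∷ []) ⟩
    0# + π ^ k * π ^ l * (a * b)                ≈⟨ +-congˡ (*-congʳ (^-homo-* π k l)) ⟨
    0# + π ^ (k ℕ.+ l) * (a * b)                ∎)
    where open ≈-Reasoning

  -- Plancherel's formula for the constant 1 and the function ω ^ c.
  convolution-s : ∀ c → ∑ m (λ n → s n * s (m ∸ n ℕ.+ c)) ≈[ 3 ] ι m * s c
  convolution-s c = begin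
    ∑ m (λ n → s n * s (m ∸ n ℕ.+ c))
      ≈⟨ exact (∑-cong′ m λ n → *-cong (∑-cong′ m λ i → sym (*-identityʳ _)) (∑-cong′ m λ j → ^-homo-* (ω j) (m ∸ n) c)) ⟩
    ∑ m (λ n → ⟨ (λ i → ω i ^ n * 1#) ⟩ * ⟨ (λ j → ω j ^ (m ∸ n) * ω j ^ c) ⟩)
      ≈⟨ plancherel (λ _ → 1#) (λ j → ω j ^ c) ⟩
    ι m * ⟨ (λ i → 1# * ω i ^ c) ⟩
      ≈⟨ exact (*-congˡ (∑-cong′ m λ i → *-identityˡ _)) ⟩
    ι m * s c ∎
    where open Reasoning

  ι-m-cancel : ∀ {k x} → ι m * x ≈[ k ] 0# → x ≈[ k ] 0#
  ι-m-cancel h = unit-cancelι m (s≤s z≤n) ℕₚ.≤-refl (transᵐ h (exact (sym (zeroʳ _))))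

  -- In ∑ₙ sₙ s_{m-n+c} = m s_c every term with n ≠ 0, c is a product of two of the sums to be
  -- estimated, so a congruence modulo π ^ j for all of them improves to one modulo π ^ 2j.
  bootstrap : ∀ j j′ → j′ ℕ.≤ j ℕ.+ j → j ℕ.≤ 3 → j′ ℕ.≤ 3 → (∀ n → 0 ℕ.< n → n ℕ.< m → s n ≈[ j ] 0#) →
              ∀ c → 0 ℕ.< c → c ℕ.< m → s c ≈[ j′ ] 0#
  bootstrap j j′ j′≤2j j≤3 j′≤3 small (suc c′) (s≤s z≤n) c<m = ι-m-cancel (begin
    ι m * s c                      ≈⟨ reduce j′≤3 (transᵐ (exact (*-comm _ _)) (*-congˡᵐ (symᵐ s-m))) ⟩
    s c * s m                      ≈⟨ exact (*-congˡ (reflexive (≡.cong s (≡.sym (ℕₚ.m∸n+n≡m (ℕₚ.<⇒≤ c<m)))))) ⟩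
    s c * s (m ∸ c ℕ.+ c)          ≈⟨ ∑-pickᵐ r c′ {λ n → s (suc n) * s (m ∸ suc n ℕ.+ c)} (ℕₚ.≤-pred c<m) other ⟨
    rest                           ≈⟨ rest≈0 ⟩
    0#                             ∎)
    where
    open Reasoning
    c = suc c′
    rest = ∑ r (λ n → s (suc n) * s (m ∸ suc n ℕ.+ c))
    rest≈0 : rest ≈[ j′ ] 0#
    rest≈0 = reduce j′≤3 (begin
      rest                                         ≈⟨ exact (solve {2} (λ a b → b := a :+ b :- a) (ι m * s c ∷ rest ∷ [])) ⟩
      ι m * s c + rest - ι m * s c                 ≈⟨ +-congʳᵐ (+-congʳᵐ (*-congᵐ (symᵐ s-0) (symᵐ (s-periodic c)))) ⟩
      s 0 * s (m ∸ 0 ℕ.+ c) + rest - ι m * s c     ≈⟨ +-congʳᵐ (exact (∑-cons r (λ n → s n * s (m ∸ n ℕ.+ c)))) ⟨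
      ∑ m (λ n → s n * s (m ∸ n ℕ.+ c)) - ι m * s c ≈⟨ +-congʳᵐ (convolution-s c) ⟩
      ι m * s c - ι m * s c                        ≈⟨ exact (-‿inverseʳ _) ⟩
      0#                                           ∎)
    second : ∀ n → suc n ℕ.< m → n ≢ c′ → s (m ∸ suc n ℕ.+ c) ≈[ j ] 0#
    second n n<m n≢c with ℕₚ.<-cmp (suc n) c
    ... | tri≈ _ e _ = contradiction (ℕₚ.suc-injective e) n≢c
    -- Below c the index exceeds m and is reduced by one period; above c it lies strictly between 0
    -- and m already.
    ... | tri< n<c _ _ = transᵐ (exact (reflexive (≡.cong s index))) (transᵐ (reduce j≤3 (s-periodic (c ∸ suc n)))
        (small (c ∸ suc n) (ℕₚ.m<n⇒0<n∸m n<c) (ℕₚ.≤-<-trans (ℕₚ.m∸n≤m c (suc n)) c<m)))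
      where
      index : m ∸ suc n ℕ.+ c ≡ m ℕ.+ (c ∸ suc n)
      index = ≡.trans (ℕₚ.+-comm (m ∸ suc n) c) (≡.trans (≡.sym (ℕₚ.+-∸-assoc c (ℕₚ.<⇒≤ n<m))) (≡.trans (≡.cong (_∸ suc n) (ℕₚ.+-comm c m)) (ℕₚ.+-∸-assoc m (ℕₚ.<⇒≤ n<c))))
    ... | tri> _ _ c<n = small (m ∸ suc n ℕ.+ c) (ℕₚ.<-≤-trans (s≤s z≤n) (ℕₚ.m≤n+m c (m ∸ suc n)))
        (ℕₚ.<-≤-trans (ℕₚ.+-monoʳ-< (m ∸ suc n) c<n) (ℕₚ.≤-reflexive (ℕₚ.m∸n+n≡m (ℕₚ.<⇒≤ n<m))))
    other : ∀ n → n ℕ.< r → n ≢ c′ → s (suc n) * s (m ∸ suc n ℕ.+ c) ≈[ j′ ] 0#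
    other n n<r n≢c = reduce j′≤2j (product≈0 {j} {j} (small (suc n) (s≤s z≤n) (s≤s n<r)) (second n (s≤s n<r) n≢c))

  -- The recurrence for power sums gives the vanishing modulo p; two rounds of `bootstrap` lift it
  -- to p ^ 2 and then, as 3 ≤ 2 + 2, to p ^ 3. No primitive root is used.
  s≈0 : ∀ n → 0 ℕ.< n → n ℕ.< m → s n ≈[ 3 ] 0#
  s≈0 = bootstrap 2 3 (s≤s (s≤s (s≤s z≤n))) (s≤s (s≤s z≤n)) ℕₚ.≤-refl
       (bootstrap 1 2 ℕₚ.≤-refl (s≤s z≤n) (s≤s (s≤s z≤n)) base)
    where
    base : ∀ n → 0 ℕ.< n → n ℕ.< m → s n ≈[ 1 ] 0#
    base (suc n) _ n<m = transᵐ (symᵐ (ι-suc^≈ω (suc n))) (transᵐ (exact (sym (powerSum₀-suc n))) (powerSum₀≈0 (suc n) n<m))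

  -- Moments of the Fermat quotients

  A M : ℕ → Carrier
  A n = ⟨ (λ i → ω i ^ n * q i) ⟩
  M n = ⟨ (λ i → ω i ^ n * q i ^ 2) ⟩

  A-periodic : ∀ n → A (m ℕ.+ n) ≈[ 3 ] A n
  A-periodic n = ∑-congᵐ m λ i i<m → *-congʳᵐ (ω-periodic i n i<m)

  M-periodic : ∀ n → M (m ℕ.+ n) ≈[ 3 ] M n
  M-periodic n = ∑-congᵐ m λ i i<m → *-congʳᵐ (ω-periodic i n i<m)

  -- a = ω u ^ e modulo π ^ 3, because ω = a u ^ (p + 1) and p + 1 + e = p ^ 2.
  e : ℕ
  e = p ℕ.* p ∸ suc p

  suc-p≤p*p : suc p ℕ.≤ p ℕ.* p
  suc-p≤p*p = ℕₚ.≤-trans (ℕₚ.+-monoˡ-≤ p {1} {p} (s≤s z≤n)) (ℕₚ.≤-trans (ℕₚ.≤-reflexive (≡.cong (p ℕ.+_) (≡.sym (ℕₚ.+-identityʳ p)))) (ℕₚ.*-monoˡ-≤ p {2} {p} (s≤s (s≤s z≤n))))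

  ι-e : ι e ≈ π * π - (1# + π)
  ι-e = trans (ι-∸ suc-p≤p*p) (+-cong (ι-* p p) (-‿cong (ι-suc p)))

  teichmüller : ∀ i → i ℕ.< m → ι (suc i) ≈[ 3 ] ω i * u i ^ e
  teichmüller i i<m = symᵐ (begin
    ω i * u i ^ e                    ≈⟨ *-congˡᵐ (exact (^-congˡ e (sym (u-spec i i<m)))) ⟩
    a ^ (p ℕ.* p) * (a ^ m) ^ e      ≈⟨ *-congˡᵐ (exact (trans (^-assocʳ a m e) (sym (^-assocˡ a e m)))) ⟩
    a ^ (p ℕ.* p) * (a ^ e) ^ m      ≈⟨ exact (trans (*-congʳ pp) refl) ⟩
    a * (a ^ m) ^ suc p * (a ^ e) ^ m ≈⟨ exact (trans (*-congˡ (trans (^-assocʳ a e m) (trans (reflexive (≡.cong (a ^_) (ℕₚ.*-comm e m))) (sym (^-assocʳ a m e))))) (trans (*-assoc _ _ _) (*-congˡ (sym (^-homo-* (a ^ m) (suc p) e))))) ⟩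
    a * (a ^ m) ^ (suc p ℕ.+ e)      ≈⟨ exact (*-congˡ (reflexive (≡.cong ((a ^ m) ^_) (ℕₚ.m+[n∸m]≡n suc-p≤p*p)))) ⟩
    a * (a ^ m) ^ (p ℕ.* p)          ≈⟨ exact (*-congˡ (trans (^-assocʳ a m (p ℕ.* p)) (trans (reflexive (≡.cong (a ^_) (ℕₚ.*-comm m (p ℕ.* p)))) (sym (^-assocʳ a (p ℕ.* p) m))))) ⟩
    a * ω i ^ m                      ≈⟨ *-congˡᵐ (ω^m i i<m) ⟩
    a * 1#                           ≈⟨ exact (*-identityʳ a) ⟩
    a                                ∎)
    where
    open Reasoning
    a = ι (suc i)
    ^-assocˡ : ∀ x m′ n → (x ^ m′) ^ n ≈ x ^ (n ℕ.* m′)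
    ^-assocˡ x m′ n = trans (^-assocʳ x m′ n) (reflexive (≡.cong (x ^_) (ℕₚ.*-comm m′ n)))
    exponent : p ℕ.* p ≡ suc (m ℕ.* suc p)
    exponent = ≡.cong suc (≡.trans (≡.cong (m ℕ.+_) (ℕₚ.*-comm m p)) (≡.trans (≡.cong (m ℕ.+_) (ℕₚ.*-comm p m)) (≡.sym (ℕₚ.*-suc m p))))
    pp : a ^ (p ℕ.* p) ≈ a * (a ^ m) ^ suc p
    pp = trans (reflexive (≡.cong (a ^_) exponent)) (*-congˡ (sym (^-assocʳ a m (suc p))))

  -- The exponent e is - (1 + p) modulo p ^ 2. In the second-order expansion of u ^ (e n) the linear
  -- term therefore sees - (1 + p) n, and the quadratic one only - n.
  ι-suc^ : ∀ i n → i ℕ.< m → ι 2 * ι (suc i) ^ n ≈[ 3 ] ω i ^ n * (ι 2 - ι 2 * (1# + π) * ι n * π * q i + ι n * (ι n + 1#) * π ^ 2 * q i ^ 2)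
  ι-suc^ i n i<m = begin
    ι 2 * ι (suc i) ^ n                ≈⟨ *-congˡᵐ (^-congᵐ n (teichmüller i i<m)) ⟩
    ι 2 * (ω i * u i ^ e) ^ n          ≈⟨ *-congˡᵐ (exact (trans (^-distrib-* (ω i) (u i ^ e) n) (*-congˡ (^-assocʳ (u i) e n)))) ⟩
    ι 2 * (ω i ^ n * u i ^ (e ℕ.* n))  ≈⟨ exact (solve {2} (λ a b → # 2 :* (a :* b) := a :* (# 2 :* b)) (ω i ^ n ∷ u i ^ (e ℕ.* n) ∷ [])) ⟩
    ω i ^ n * (ι 2 * u i ^ (e ℕ.* n))  ≈⟨ *-congˡᵐ (binom₃ (e ℕ.* n) (q i)) ⟩
    ω i ^ n * (ι 2 + ι 2 * N * π * q i + N * (N - 1#) * π ^ 2 * q i ^ 2)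
      ≈⟨ *-congˡᵐ (exact (+-cong (+-congˡ (*-congʳ (*-congʳ (*-congˡ N≈)))) (*-congʳ (*-congʳ (*-cong N≈ (+-congʳ N≈)))))) ⟩
    ω i ^ n * (ι 2 + ι 2 * N′ * π * q i + N′ * (N′ - 1#) * π ^ 2 * q i ^ 2)
      ≈⟨ *-congˡᵐ (solveMod 3 {2} (λ π n q → # 2 :+ # 2 :* ((π :* π :- (# 1 :+ π)) :* n) :* π :* q :+ ((π :* π :- (# 1 :+ π)) :* n) :* ((π :* π :- (# 1 :+ π)) :* n :- # 1) :* π :^ 2 :* q :^ 2
            := # 2 :- # 2 :* (# 1 :+ π) :* n :* π :* q :+ n :* (n :+ # 1) :* π :^ 2 :* q :^ 2) (ι n ∷ q i ∷ [])) ⟩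
    ω i ^ n * (ι 2 - ι 2 * (1# + π) * ι n * π * q i + ι n * (ι n + 1#) * π ^ 2 * q i ^ 2) ∎
    where
    open Reasoning
    N = ι (e ℕ.* n)
    N′ = (π * π - (1# + π)) * ι n
    N≈ : N ≈ N′
    N≈ = trans (ι-* e n) (*-congʳ ι-e)

  S : ℕ → Carrier
  S n = ⟨ (λ i → ι (suc i) ^ n) ⟩

  powerSum-expansion : ∀ n → s n ≈[ 3 ] 0# → ι 2 * S n ≈[ 3 ] π * (ι n * (π * (ι n + 1#) * M n - ι 2 * (1# + π) * A n))
  powerSum-expansion n sn≈0 = begin
    ι 2 * S n
      ≈⟨ exact (sym (∑-*ˡ m _ _)) ⟩
    ∑ m (λ i → ι 2 * ι (suc i) ^ n)
      ≈⟨ ∑-congᵐ m (λ i i<m → ι-suc^ i n i<m) ⟩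
    ∑ m (λ i → ω i ^ n * (ι 2 - ι 2 * (1# + π) * ι n * π * q i + ι n * (ι n + 1#) * π ^ 2 * q i ^ 2))
      ≈⟨ exact (∑-cong′ m λ i → solve {4} (λ π w n q → w :* (# 2 :- # 2 :* (# 1 :+ π) :* n :* π :* q :+ n :* (n :+ # 1) :* π :^ 2 :* q :^ 2)
           := # 2 :* w :+ (:- (# 2 :* (# 1 :+ π) :* n :* π) :* (w :* q) :+ n :* (n :+ # 1) :* π :^ 2 :* (w :* q :^ 2))) (π ∷ ω i ^ n ∷ ι n ∷ q i ∷ [])) ⟩
    ∑ m (λ i → ι 2 * ω i ^ n + (- (ι 2 * (1# + π) * ι n * π) * (ω i ^ n * q i) + ι n * (ι n + 1#) * π ^ 2 * (ω i ^ n * q i ^ 2)))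
      ≈⟨ exact (trans (∑-+ m _ _) (+-cong (∑-*ˡ m _ _) (trans (∑-+ m _ _) (+-cong (∑-*ˡ m _ _) (∑-*ˡ m _ _))))) ⟩
    ι 2 * s n + (- (ι 2 * (1# + π) * ι n * π) * A n + ι n * (ι n + 1#) * π ^ 2 * M n)
      ≈⟨ +-congʳᵐ (*-congˡᵐ sn≈0) ⟩
    ι 2 * 0# + (- (ι 2 * (1# + π) * ι n * π) * A n + ι n * (ι n + 1#) * π ^ 2 * M n)
      ≈⟨ exact (solve {4} (λ π n a b → # 2 :* # 0 :+ (:- (# 2 :* (# 1 :+ π) :* n :* π) :* a :+ n :* (n :+ # 1) :* π :^ 2 :* b)
           := π :* (n :* (π :* (n :+ # 1) :* b :- # 2 :* (# 1 :+ π) :* a))) (π ∷ ι n ∷ A n ∷ M n ∷ [])) ⟩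
    π * (ι n * (π * (ι n + 1#) * M n - ι 2 * (1# + π) * A n)) ∎
    where open Reasoning

  -- Divided Bernoulli numbers modulo p ^ 2

  p∤p+n : ∀ n → 0 ℕ.< n → n ℕ.< p → ¬ (p ∣ p ℕ.+ n)
  p∤p+n n 0<n n<p h = p∤n n 0<n n<p (∣m+n∣m⇒∣n h ∣-refl)

  b-odd′ : ∀ n → Odd (3 ℕ.+ n) → b (3 ℕ.+ n) ≈ 0#
  b-odd′ n o with odd-suc (even-suc (odd-suc o))
  ... | k , e = trans (reflexive (≡.cong (λ z → b (3 ℕ.+ z)) e)) (b-odd k)

  b-1≈0 : b 1 ≈[ 1 ] 0#
  b-1≈0 = small-unit 2 (s≤s z≤n) (s≤s (s≤s z≤n)) (transᵐ (exact b-1) (solveMod 1 {0} (λ π → :- π := # 2 :* # 0) []))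

  b-odd≈0 : ∀ n → Odd n → b n ≈[ 1 ] 0#
  b-odd≈0 zero                o = contradiction o (¬even∧odd (0 , ≡.refl))
  b-odd≈0 (suc zero)          o = b-1≈0
  b-odd≈0 (suc (suc zero))    o = contradiction o (¬even∧odd (1 , ≡.refl))
  b-odd≈0 (suc (suc (suc n))) o = exact (b-odd′ n o)

  b-faulhaber′ : ∀ n → ι 24 * S (suc n) ≈[ 4 ]
    ι 24 * b (suc n) + ι 12 * ι (suc n) * π * b n + ι 4 * (ι (suc n) * (ι (suc n) - 1#)) * π ^ 2 * b (n ∸ 1) + ι (suc n) * (ι (suc n) - 1#) * (ι (suc n) - ι 2) * π ^ 3 * b (n ∸ 2)
  b-faulhaber′ n = transᵐ (exact (*-congˡ (sym (powerSum₀-suc n)))) (b-faulhaber (suc n))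

  cancel-24 : ∀ {k x y} → ι 24 * x ≈[ k ] ι 24 * y → x ≈[ k ] y
  cancel-24 {k} {x} {y} h = small-unit 4 (s≤s z≤n) (ℕₚ.m≤m+n 4 6) (small-unit 6 (s≤s z≤n) (ℕₚ.m≤m+n 6 4) (transᵐ (split x) (transᵐ h (symᵐ (split y)))))
    where
    split : ∀ x → ι 6 * (ι 4 * x) ≈[ k ] ι 24 * x
    split x = exact (solve {1} (λ x → # 6 :* (# 4 :* x) := # 24 :* x) (x ∷ []))

  b≈s : ∀ n → 0 ℕ.< n → b n ≈[ 1 ] s n
  b≈s (suc n) _ = transᵐ (cancel-24 (symᵐ (transᵐ (reduce (s≤s z≤n) (b-faulhaber′ n))
    (solveMod 1 {5} (λ π n b₀ b₁ b₂ b₃ → # 24 :* b₀ :+ # 12 :* n :* π :* b₁ :+ # 4 :* (n :* (n :- # 1)) :* π :^ 2 :* b₂ :+ n :* (n :- # 1) :* (n :- # 2) :* π :^ 3 :* b₃ := # 24 :* b₀)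
      (ι (suc n) ∷ b (suc n) ∷ b n ∷ b (n ∸ 1) ∷ b (n ∸ 2) ∷ []))))) (ι-suc^≈ω (suc n))

  -- A p-integral value of B n / n.
  DividedBernoulli : ℕ → Carrier → Set
  DividedBernoulli n β = b n ≈ π * (ι n * β)

  dividedBernoulli : ∀ n → 0 ℕ.< n → ¬ (p ∣ n) → s n ≈[ 3 ] 0# → ∃ (DividedBernoulli n)
  dividedBernoulli n 0<n p∤n s≈0 = v * quot b≈0 , (begin
    b n                                ≈⟨ eq b≈0 ⟩
    0# + π ^ 1 * quot b≈0              ≈⟨ solve {2} (λ π B → # 0 :+ π :^ 1 :* B := π :* (# 1 :* B)) (π ∷ quot b≈0 ∷ []) ⟩
    π * (1# * quot b≈0)                ≈⟨ *-congˡ (*-congʳ (sym (proj₂ (unit-∤ n p∤n)))) ⟩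
    π * (ι n * v * quot b≈0)           ≈⟨ *-congˡ (*-assoc _ _ _) ⟩
    π * (ι n * (v * quot b≈0))         ∎)
    where
    open ≈-Reasoning
    v = proj₁ (unit-∤ n p∤n)
    b≈0 : b n ≈[ 1 ] 0#
    b≈0 = transᵐ (b≈s n 0<n) (reduce (s≤s z≤n) s≈0)

  private
    cancel-πn : ∀ n → ¬ (p ∣ n) → ∀ {x y} → π * (ι n * x) ≈[ 3 ] π * (ι n * y) → x ≈[ 2 ] y
    cancel-πn n p∤n h = unit-cancel (unit-∤ n p∤n) (π-cancel h)

  -- Here y is what Faulhaber's formula yields for 2 S n / (p n). Division by p lowers the modulus
  -- from p ^ 3 to p ^ 2.
  divided-powerSum : ∀ n → ¬ (p ∣ n) → s n ≈[ 3 ] 0# → ∀ {y} → ι 2 * (ι 24 * S n) ≈[ 3 ] ι 24 * (π * (ι n * y)) →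
    y ≈[ 2 ] π * (ι n + 1#) * M n - ι 2 * (1# + π) * A n
  divided-powerSum n p∤n sn≈0 {y} h = cancel-πn n p∤n (transᵐ (symᵐ (cancel-24 (transᵐ (exact (solve {1} (λ x → # 24 :* (# 2 :* x) := # 2 :* (# 24 :* x)) (S n ∷ []))) h))) (powerSum-expansion n sn≈0))

  b-odd″ : ∀ n → 3 ℕ.≤ n → Odd n → b n ≈ 0#
  b-odd″ (suc (suc (suc n))) _ o = b-odd′ n o
  b-odd″ (suc zero)       (s≤s ()) _
  b-odd″ (suc (suc zero)) (s≤s (s≤s ())) _

  b-faulhaber₃ : ∀ n → 0 ℕ.< n → ι 24 * S n ≈[ 3 ] ι 24 * b n + ι 12 * ι n * π * b (n ∸ 1) + ι 4 * (ι n * (ι n - 1#)) * π ^ 2 * b (n ∸ 2)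
  b-faulhaber₃ (suc n) _ = transᵐ (reduce (s≤s (s≤s (s≤s z≤n))) (b-faulhaber′ n)) (drop (ι (suc n)) (b (suc n)) (b n) (b (n ∸ 1)) (b (n ∸ 2)))
    where
    drop : ∀ n b₀ b₁ b₂ b₃ → ι 24 * b₀ + ι 12 * n * π * b₁ + ι 4 * (n * (n - 1#)) * π ^ 2 * b₂ + n * (n - 1#) * (n - ι 2) * π ^ 3 * b₃ ≈[ 3 ] ι 24 * b₀ + ι 12 * n * π * b₁ + ι 4 * (n * (n - 1#)) * π ^ 2 * b₂
    drop n b₀ b₁ b₂ b₃ = solveMod 3 {5} (λ π n b₀ b₁ b₂ b₃ → # 24 :* b₀ :+ # 12 :* n :* π :* b₁ :+ # 4 :* (n :* (n :- # 1)) :* π :^ 2 :* b₂ :+ n :* (n :- # 1) :* (n :- # 2) :* π :^ 3 :* b₃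
      := # 24 :* b₀ :+ # 12 :* n :* π :* b₁ :+ # 4 :* (n :* (n :- # 1)) :* π :^ 2 :* b₂) (n ∷ b₀ ∷ b₁ ∷ b₂ ∷ b₃ ∷ [])

  -- In Faulhaber's formula the term with B (n - 1) is gone, since n - 1 is odd and at least 3. The
  -- hypothesis on b (n - 2) disposes of the term of order p ^ 2; it includes the factor n (n - 1)
  -- because for n = p + 1 it is n - 1, not b (n - 2), that vanishes modulo p.
  even-formula : ∀ n {β} → 4 ℕ.≤ n → Even n → ¬ (p ∣ n) → s n ≈[ 3 ] 0# → ι n * (ι n - 1#) * b (n ∸ 2) ≈[ 1 ] 0# →
    DividedBernoulli n β → ι 2 * β ≈[ 2 ] π * (ι n + 1#) * M n - ι 2 * (1# + π) * A n
  even-formula n {β} 4≤n even p∤n sn≈0 b₂≈0 bn = divided-powerSum n p∤n sn≈0 (begin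
    ι 2 * (ι 24 * S n)
      ≈⟨ *-congˡᵐ (b-faulhaber₃ n (ℕₚ.≤-trans (s≤s z≤n) 4≤n)) ⟩
    ι 2 * (ι 24 * b n + ι 12 * ι n * π * b (n ∸ 1) + ι 4 * (ι n * (ι n - 1#)) * π ^ 2 * b (n ∸ 2))
      ≈⟨ *-congˡᵐ (+-congʳᵐ (+-congᵐ (*-congˡᵐ (exact bn)) (*-congˡᵐ (exact (b-odd″ (n ∸ 1) (ℕₚ.∸-monoˡ-≤ 1 4≤n) odd₁))))) ⟩
    ι 2 * (ι 24 * (π * (ι n * β)) + ι 12 * ι n * π * 0# + ι 4 * (ι n * (ι n - 1#)) * π ^ 2 * b (n ∸ 2))
      ≈⟨ exact (solve {4} (λ π n β b₂ → # 2 :* (# 24 :* (π :* (n :* β)) :+ # 12 :* n :* π :* # 0 :+ # 4 :* (n :* (n :- # 1)) :* π :^ 2 :* b₂)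
           := # 24 :* (π :* (n :* (# 2 :* β))) :+ # 8 :* (π :^ 2 :* (n :* (n :- # 1) :* b₂))) (π ∷ ι n ∷ β ∷ b (n ∸ 2) ∷ [])) ⟩
    ι 24 * (π * (ι n * (ι 2 * β))) + ι 8 * (π ^ 2 * (ι n * (ι n - 1#) * b (n ∸ 2)))
      ≈⟨ +-congˡᵐ (*-congˡᵐ (π^*-cong 2 b₂≈0)) ⟩
    ι 24 * (π * (ι n * (ι 2 * β))) + ι 8 * (π ^ 2 * 0#)
      ≈⟨ exact (solve {2} (λ b π → b :+ # 8 :* (π :^ 2 :* # 0) := b) (ι 24 * (π * (ι n * (ι 2 * β))) ∷ π ∷ [])) ⟩
    ι 24 * (π * (ι n * (ι 2 * β))) ∎)
    where
    open Reasoning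
    odd₁ : Odd (n ∸ 1)
    odd₁ = even-suc (≡.subst Even (≡.sym (ℕₚ.m+[n∸m]≡n {1} {n} (ℕₚ.≤-trans (s≤s z≤n) 4≤n))) even)

  -- For n = 2 the term with B 1 = - 1/2 survives and contributes - p; the term with b 0 = p is of
  -- order p ^ 3.
  even-formula-2 : ∀ n {β} → n ≡ 2 → DividedBernoulli n β → ι 4 * β - π ≈[ 2 ] ι 2 * (π * (ι n + 1#) * M n - ι 2 * (1# + π) * A n)
  even-formula-2 n {β} n≡2 bn = begin
    ι 4 * β - π                          ≈⟨ exact (solve {2} (λ π β → # 4 :* β :- π := # 2 :* (# 2 :* β) :- π) (π ∷ β ∷ [])) ⟩
    ι 2 * (ι 2 * β) - π                  ≈⟨ double _ ⟨
    ι 2 * (ι 2 * β - h * π)              ≈⟨ *-congˡᵐ (divided-powerSum n p∤n′ (s≈0 n 0<n n<m) S≈) ⟩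
    ι 2 * (π * (ι n + 1#) * M n - ι 2 * (1# + π) * A n) ∎
    where
    open Reasoning
    0<n : 0 ℕ.< n
    0<n = ≡.subst (0 ℕ.<_) (≡.sym n≡2) (s≤s z≤n)
    n<m : n ℕ.< m
    n<m = ≡.subst (ℕ._< m) (≡.sym n≡2) (ℕₚ.≤-trans (ℕₚ.m≤m+n 3 7) 10≤m)
    p∤n′ : ¬ (p ∣ n)
    p∤n′ = p∤n n 0<n (ℕₚ.m<n⇒m<1+n n<m)
    h = proj₁ (unit-∤ 2 (p∤n 2 (s≤s z≤n) (ℕₚ.≤-trans (ℕₚ.m≤m+n 3 8) (s≤s 10≤m))))
    2h≈1 : ι 2 * h ≈ 1#
    2h≈1 = proj₂ (unit-∤ 2 (p∤n 2 (s≤s z≤n) (ℕₚ.≤-trans (ℕₚ.m≤m+n 3 8) (s≤s 10≤m))))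
    double : ∀ {k} y → ι 2 * (y - h * π) ≈[ k ] ι 2 * y - π
    double y = exact (trans (solve {3} (λ y h π → # 2 :* (y :- h :* π) := # 2 :* y :- (# 2 :* h) :* π) (y ∷ h ∷ π ∷ [])) (+-congˡ (-‿cong (trans (*-congʳ 2h≈1) (*-identityˡ π)))))
    n-values : ι n ≈ ι 2 × b (n ∸ 1) ≈ b 1 × b (n ∸ 2) ≈ π
    n-values = reflexive (≡.cong ι n≡2) , reflexive (≡.cong (λ z → b (z ∸ 1)) n≡2) , trans (reflexive (≡.cong (λ z → b (z ∸ 2)) n≡2)) b-0
    S≈ : ι 2 * (ι 24 * S n) ≈[ 3 ] ι 24 * (π * (ι n * (ι 2 * β - h * π)))
    S≈ = begin
      ι 2 * (ι 24 * S n)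
        ≈⟨ *-congˡᵐ (b-faulhaber₃ n 0<n) ⟩
      ι 2 * (ι 24 * b n + ι 12 * ι n * π * b (n ∸ 1) + ι 4 * (ι n * (ι n - 1#)) * π ^ 2 * b (n ∸ 2))
        ≈⟨ exact (*-congˡ (+-cong (+-cong (*-congˡ (trans bn (*-congˡ (*-congʳ (proj₁ n-values))))) (*-cong (*-congʳ (*-congˡ (proj₁ n-values))) (proj₁ (proj₂ n-values))))
             (*-cong (*-congʳ (*-congˡ (*-cong (proj₁ n-values) (+-congʳ (proj₁ n-values))))) (proj₂ (proj₂ n-values))))) ⟩
      ι 2 * (ι 24 * (π * (ι 2 * β)) + ι 12 * ι 2 * π * b 1 + ι 4 * (ι 2 * (ι 2 - 1#)) * π ^ 2 * π)
        ≈⟨ exact (solve {3} (λ π β b₁ → # 2 :* (# 24 :* (π :* (# 2 :* β)) :+ # 12 :* # 2 :* π :* b₁ :+ # 4 :* (# 2 :* (# 2 :- # 1)) :* π :^ 2 :* π)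
             := # 96 :* π :* β :+ # 24 :* π :* (# 2 :* b₁) :+ # 16 :* π :^ 3) (π ∷ β ∷ b 1 ∷ [])) ⟩
      ι 96 * π * β + ι 24 * π * (ι 2 * b 1) + ι 16 * π ^ 3
        ≈⟨ exact (+-congʳ (+-congˡ (*-congˡ b-1))) ⟩
      ι 96 * π * β + ι 24 * π * - π + ι 16 * π ^ 3
        ≈⟨ solveMod 3 {1} (λ π β → # 96 :* π :* β :+ # 24 :* π :* :- π :+ # 16 :* π :^ 3 := # 24 :* (π :* (# 2 :* (# 2 :* β) :- π))) (β ∷ []) ⟩
      ι 24 * (π * (ι 2 * (ι 2 * β) - π))
        ≈⟨ *-congˡᵐ (*-congˡᵐ (symᵐ (double (ι 2 * β)))) ⟩
      ι 24 * (π * (ι 2 * (ι 2 * β - h * π)))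
        ≈⟨ exact (*-congˡ (*-congˡ (*-congʳ (sym (proj₁ n-values))))) ⟩
      ι 24 * (π * (ι n * (ι 2 * β - h * π))) ∎

  -- For odd n the leading Bernoulli number is zero and the next term, with B (n - 1), takes over.
  -- It carries an extra factor p, so that A n is a multiple of p.
  odd-formula : ∀ n {β} → 3 ℕ.≤ n → Odd n → ¬ (p ∣ n) → s n ≈[ 3 ] 0# → DividedBernoulli (n ∸ 1) β →
    π * ι (n ∸ 1) * β ≈[ 2 ] π * (ι n + 1#) * M n - ι 2 * (1# + π) * A n
  odd-formula n {β} 3≤n odd p∤n sn≈0 bn-1 = divided-powerSum n p∤n sn≈0 (begin
    ι 2 * (ι 24 * S n)
      ≈⟨ *-congˡᵐ (b-faulhaber₃ n (ℕₚ.≤-trans (s≤s z≤n) 3≤n)) ⟩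
    ι 2 * (ι 24 * b n + ι 12 * ι n * π * b (n ∸ 1) + ι 4 * (ι n * (ι n - 1#)) * π ^ 2 * b (n ∸ 2))
      ≈⟨ *-congˡᵐ (+-congʳᵐ (+-congᵐ (*-congˡᵐ (exact (b-odd″ n 3≤n odd))) (*-congˡᵐ (exact bn-1)))) ⟩
    ι 2 * (ι 24 * 0# + ι 12 * ι n * π * (π * (ι (n ∸ 1) * β)) + ι 4 * (ι n * (ι n - 1#)) * π ^ 2 * b (n ∸ 2))
      ≈⟨ exact (solve {5} (λ π n k β b₂ → # 2 :* (# 24 :* # 0 :+ # 12 :* n :* π :* (π :* (k :* β)) :+ # 4 :* (n :* (n :- # 1)) :* π :^ 2 :* b₂)
           := # 24 :* (π :* (n :* (π :* k :* β))) :+ # 8 :* (n :* (n :- # 1)) :* (π :^ 2 :* b₂)) (π ∷ ι n ∷ ι (n ∸ 1) ∷ β ∷ b (n ∸ 2) ∷ [])) ⟩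
    ι 24 * (π * (ι n * (π * ι (n ∸ 1) * β))) + ι 8 * (ι n * (ι n - 1#)) * (π ^ 2 * b (n ∸ 2))
      ≈⟨ +-congˡᵐ (*-congˡᵐ (π^*-cong 2 (b-odd≈0 (n ∸ 2) odd₂))) ⟩
    ι 24 * (π * (ι n * (π * ι (n ∸ 1) * β))) + ι 8 * (ι n * (ι n - 1#)) * (π ^ 2 * 0#)
      ≈⟨ exact (solve {3} (λ a n π → a :+ # 8 :* (n :* (n :- # 1)) :* (π :^ 2 :* # 0) := a) (ι 24 * (π * (ι n * (π * ι (n ∸ 1) * β))) ∷ ι n ∷ π ∷ [])) ⟩
    ι 24 * (π * (ι n * (π * ι (n ∸ 1) * β))) ∎)
    where
    open Reasoning
    odd₂ : Odd (n ∸ 2)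
    odd₂ = even-suc (odd-suc (≡.subst Odd (≡.sym (ℕₚ.m+[n∸m]≡n {2} {n} (ℕₚ.≤-trans (s≤s (s≤s z≤n)) 3≤n))) odd))

  -- The exceptional odd index, since B 1 is not zero: here 2 S 1 = p (p - 1). The resulting value
  -- 1/2 of A 1 is the source of the term in x in `q≈`.
  odd-formula-1 : ∀ n → n ≡ 1 → ι 2 * A n ≈[ 1 ] 1#
  odd-formula-1 n n≡1 = begin
    ι 2 * A n                                              ≈⟨ solveMod 1 {3} (λ π a b k → # 2 :* a := :- (π :* (k :+ # 1) :* b :- # 2 :* (# 1 :+ π) :* a)) (A n ∷ M n ∷ ι n ∷ []) ⟩
    - (π * (ι n + 1#) * M n - ι 2 * (1# + π) * A n)        ≈⟨ -‿congᵐ (reduce (s≤s z≤n) (divided-powerSum n p∤n′ (s≈0 n 0<n n<m) S≈)) ⟨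
    - (π - 1#)                                             ≈⟨ solveMod 1 {0} (λ π → :- (π :- # 1) := # 1) [] ⟩
    1#                                                     ∎
    where
    open Reasoning
    0<n : 0 ℕ.< n
    0<n = ≡.subst (0 ℕ.<_) (≡.sym n≡1) (s≤s z≤n)
    n<m : n ℕ.< m
    n<m = ≡.subst (ℕ._< m) (≡.sym n≡1) (ℕₚ.≤-trans (ℕₚ.m≤m+n 2 8) 10≤m)
    p∤n′ : ¬ (p ∣ n)
    p∤n′ = p∤n n 0<n (ℕₚ.m<n⇒m<1+n n<m)
    ιn : ι n ≈ 1#
    ιn = reflexive (≡.cong ι n≡1)
    S≈ : ι 2 * (ι 24 * S n) ≈[ 3 ] ι 24 * (π * (ι n * (π - 1#)))
    S≈ = begin
      ι 2 * (ι 24 * S n)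
        ≈⟨ *-congˡᵐ (b-faulhaber₃ n 0<n) ⟩
      ι 2 * (ι 24 * b n + ι 12 * ι n * π * b (n ∸ 1) + ι 4 * (ι n * (ι n - 1#)) * π ^ 2 * b (n ∸ 2))
        ≈⟨ exact (*-congˡ (+-cong (+-cong (*-congˡ (reflexive (≡.cong b n≡1))) (*-cong (*-congʳ (*-congˡ ιn)) (trans (reflexive (≡.cong (λ z → b (z ∸ 1)) n≡1)) b-0)))
             (*-congʳ (*-congʳ (*-congˡ (*-congˡ (+-congʳ ιn))))))) ⟩
      ι 2 * (ι 24 * b 1 + ι 12 * 1# * π * π + ι 4 * (ι n * (1# - 1#)) * π ^ 2 * b (n ∸ 2))
        ≈⟨ exact (solve {4} (λ π b₁ k b₂ → # 2 :* (# 24 :* b₁ :+ # 12 :* # 1 :* π :* π :+ # 4 :* (k :* (# 1 :- # 1)) :* π :^ 2 :* b₂)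
             := # 24 :* (# 2 :* b₁) :+ # 24 :* π :* π) (π ∷ b 1 ∷ ι n ∷ b (n ∸ 2) ∷ [])) ⟩
      ι 24 * (ι 2 * b 1) + ι 24 * π * π
        ≈⟨ exact (+-congʳ (*-congˡ b-1)) ⟩
      ι 24 * - π + ι 24 * π * π
        ≈⟨ exact (solve {1} (λ π → # 24 :* :- π :+ # 24 :* π :* π := # 24 :* (π :* (# 1 :* (π :- # 1)))) (π ∷ [])) ⟩
      ι 24 * (π * (1# * (π - 1#)))
        ≈⟨ exact (*-congˡ (*-congˡ (*-congʳ (sym ιn)))) ⟩
      ι 24 * (π * (ι n * (π - 1#))) ∎

  open import Data.List using (List; []; _∷_)

  -- Generating polynomials of divided Bernoulli numbers

  x : ℕ → Carrier
  x i = ω i ^ r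

  ω^n*x^n : ∀ i n → i ℕ.< m → ω i ^ n * x i ^ n ≈[ 3 ] 1#
  ω^n*x^n i n i<m = transᵐ (exact (trans (sym (^-distrib-* (ω i) (x i) n)) refl)) (transᵐ (^-congᵐ n (ω^m i i<m)) (exact (1^ n)))

  x^≈ω^ : ∀ i n → i ℕ.< m → n ℕ.≤ m → x i ^ n ≈[ 3 ] ω i ^ (m ∸ n)
  x^≈ω^ i n i<m n≤m = begin
    x i ^ n                              ≈⟨ exact (sym (*-identityˡ _)) ⟩
    1# * x i ^ n                         ≈⟨ *-congʳᵐ (ω^m i i<m) ⟨
    ω i ^ m * x i ^ n                    ≈⟨ exact (*-congʳ (trans (reflexive (≡.cong (ω i ^_) (≡.sym (ℕₚ.m∸n+n≡m n≤m)))) (^-homo-* (ω i) (m ∸ n) n))) ⟩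
    ω i ^ (m ∸ n) * ω i ^ n * x i ^ n    ≈⟨ exact (*-assoc _ _ _) ⟩
    ω i ^ (m ∸ n) * (ω i ^ n * x i ^ n)  ≈⟨ *-congˡᵐ (ω^n*x^n i n i<m) ⟩
    ω i ^ (m ∸ n) * 1#                   ≈⟨ exact (*-identityʳ _) ⟩
    ω i ^ (m ∸ n)                        ∎
    where open Reasoning

  X : ℕ → Carrier
  X n = ⟨ (λ i → x i ^ n) ⟩

  x^m : ∀ i → i ℕ.< m → x i ^ m ≈[ 3 ] 1#
  x^m i i<m = transᵐ (x^≈ω^ i m i<m ℕₚ.≤-refl) (exact (reflexive (≡.cong (ω i ^_) (ℕₚ.n∸n≡0 m))))

  X-periodic : ∀ n → X (m ℕ.+ n) ≈[ 3 ] X n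
  X-periodic n = ∑-congᵐ m λ i i<m → transᵐ (exact (^-homo-* (x i) m n)) (transᵐ (*-congʳᵐ (x^m i i<m)) (exact (*-identityˡ _)))

  X-small : ∀ n → 0 ℕ.< n → n ℕ.< m → X n ≈[ 3 ] 0#
  X-small n 0<n n<m = transᵐ (∑-congᵐ m λ i i<m → x^≈ω^ i n i<m (ℕₚ.<⇒≤ n<m))
    (s≈0 (m ∸ n) (ℕₚ.m<n⇒0<n∸m n<m) (ℕₚ.∸-monoʳ-< {o = 0} 0<n (ℕₚ.<⇒≤ n<m)))

  X-0 : X 0 ≈[ 3 ] ι m
  X-0 = exact (trans (∑-const m 1#) (*-identityʳ _))

  X-m : X m ≈[ 3 ] ι m
  X-m = transᵐ (exact (reflexive (≡.cong X (≡.sym (ℕₚ.+-identityʳ m))))) (transᵐ (X-periodic 0) X-0)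

  ι-m : ι m ≈ π - 1#
  ι-m = trans (solve {1} (λ a → a := (# 1 :+ a) :- # 1) (ι m ∷ [])) (+-congʳ (sym (ι-suc m)))

  ι-m≈-1 : ι m ≈[ 1 ] - 1#
  ι-m≈-1 = transᵐ (exact ι-m) (solveMod 1 {0} (λ π → π :- # 1 := :- # 1) [])

  X-m₁ : X m ≈[ 1 ] - 1#
  X-m₁ = transᵐ (reduce (s≤s z≤n) X-m) ι-m≈-1

  m-Even : Even m
  m-Even = m-even

  -- Power sums of x survive only at multiples of m, and m is even. The range below 2 m covers
  -- exponents of the forms n + 1 and k + n + 1.
  X-odd : ∀ n → Odd n → n ℕ.< m ℕ.+ m → X n ≈[ 1 ] 0#
  X-odd zero    o _ = contradiction o (¬even∧odd (0 , ≡.refl))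
  X-odd (suc n) o n<2m with ℕₚ.<-cmp (suc n) m
  ... | tri< n<m _ _ = reduce (s≤s z≤n) (X-small (suc n) (s≤s z≤n) n<m)
  ... | tri≈ _ ≡.refl _ = contradiction o (¬even∧odd m-Even)
  ... | tri> _ _ m<n = reduce (s≤s z≤n) (transᵐ (exact (reflexive (≡.cong X (≡.sym (ℕₚ.m+[n∸m]≡n (ℕₚ.<⇒≤ m<n)))))) (transᵐ (X-periodic (suc n ∸ m))
      (X-small (suc n ∸ m) (ℕₚ.m<n⇒0<n∸m m<n) (ℕₚ.+-cancelˡ-< m _ _ (≡.subst (ℕ._< m ℕ.+ m) (≡.sym (ℕₚ.m+[n∸m]≡n (ℕₚ.<⇒≤ m<n))) n<2m)))))

  -- The coefficients B n / n in the range 2 ≤ n ≤ m - 2, extended by zero.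
  𝔠-spec : ∀ n → 2 ℕ.+ n ℕ.< r → ∃ (DividedBernoulli (2 ℕ.+ n))
  𝔠-spec n n<r = dividedBernoulli (2 ℕ.+ n) (s≤s z≤n) (p∤n (2 ℕ.+ n) (s≤s z≤n) (ℕₚ.m<n⇒m<1+n (ℕₚ.m<n⇒m<1+n n<r))) (s≈0 (2 ℕ.+ n) (s≤s z≤n) (ℕₚ.m<n⇒m<1+n n<r))

  𝔠 : ℕ → Carrier
  𝔠 zero          = 0#
  𝔠 (suc zero)    = 0#
  𝔠 (suc (suc n)) with 2 ℕ.+ n ℕ.<? r
  ... | yes n<r = proj₁ (𝔠-spec n n<r)
  ... | no  _   = 0#

  𝔠-divided : ∀ n → 2 ℕ.≤ n → n ℕ.< r → DividedBernoulli n (𝔠 n)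
  𝔠-divided (suc (suc n)) (s≤s (s≤s z≤n)) n<r with 2 ℕ.+ n ℕ.<? r
  ... | yes n<r = proj₂ (𝔠-spec n n<r)
  ... | no  n≮r = contradiction n<r n≮r

  𝔠-high : ∀ n → r ℕ.≤ n → 𝔠 n ≈ 0#
  𝔠-high zero          _ = refl
  𝔠-high (suc zero)    _ = refl
  𝔠-high (suc (suc n)) r≤n with 2 ℕ.+ n ℕ.<? r
  ... | yes n<r = contradiction r≤n (ℕₚ.<⇒≱ n<r)
  ... | no  _   = refl

  𝔠-odd : ∀ {k} n → Odd n → 𝔠 n ≈[ k ] 0#
  𝔠-odd zero          o = reflᵐ
  𝔠-odd (suc zero)    o = reflᵐ
  𝔠-odd (suc (suc zero)) o = contradiction o (¬even∧odd (1 , ≡.refl))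
  𝔠-odd {k} N@(suc (suc (suc n))) o with N ℕ.<? r
  ... | yes n<r = unit-cancelι N (s≤s z≤n) (ℕₚ.m<n⇒m<1+n (ℕₚ.m<n⇒m<1+n n<r)) (π-cancel (begin
    π * (ι N * _)         ≈⟨ exact (sym (proj₂ (𝔠-spec (suc n) n<r))) ⟩
    b N                   ≈⟨ exact (b-odd′ n o) ⟩
    0#                    ≈⟨ exact (solve {2} (λ π n → # 0 := π :* (n :* # 0)) (π ∷ ι N ∷ [])) ⟩
    π * (ι N * 0#)        ∎))
    where open Reasoning
  ... | no  _   = reflᵐ

  -- A disjunction, because vanishing modulo p is not decided in the ring: a summand with factor
  -- `f n` is either dropped or comes with bounds and parity of n.
  Supported : (ℕ → Carrier) → Set
  Supported f = ∀ n → f n ≈[ 1 ] 0# ⊎ (2 ℕ.≤ n × n ℕ.< r × Even n)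

  𝔠-supported : Supported 𝔠
  𝔠-supported n with parity n
  ... | inj₂ o = inj₁ (𝔠-odd n o)
  ... | inj₁ e with n ℕ.<? r
  ...   | no  n≮r = inj₁ (exact (𝔠-high n (ℕₚ.≮⇒≥ n≮r)))
  ...   | yes n<r with 2 ℕ.≤? n
  ...     | yes 2≤n = inj₂ (2≤n , n<r , e)
  ...     | no  2≰n = inj₁ (low n 2≰n)
    where
    low : ∀ n → ¬ (2 ℕ.≤ n) → 𝔠 n ≈[ 1 ] 0#
    low zero          _ = reflᵐ
    low (suc zero)    _ = reflᵐ
    low (suc (suc n)) h = contradiction (s≤s (s≤s z≤n)) h

  n𝔠 : ℕ → Carrier
  n𝔠 n = ι n * 𝔠 n

  n𝔠-supported : Supported n𝔠
  n𝔠-supported n with 𝔠-supported n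
  ... | inj₁ h = inj₁ (transᵐ (*-congˡᵐ h) (exact (zeroʳ _)))
  ... | inj₂ h = inj₂ h

  Poly : (ℕ → Carrier) → ℕ → Carrier
  Poly f i = ∑ m (λ n → f n * x i ^ n)

  G D : ℕ → Carrier
  G = Poly 𝔠
  D = Poly n𝔠

  ⟨Poly⟩ : ∀ f t → ⟨ (λ i → Poly f i * x i ^ t) ⟩ ≈ ∑ m (λ n → f n * X (n ℕ.+ t))
  ⟨Poly⟩ f t = begin
    ∑ m (λ i → Poly f i * x i ^ t)
      ≈⟨ ∑-cong′ m (λ i → trans (sym (∑-*ʳ m _ _)) (∑-cong′ m λ n → trans (*-assoc _ _ _) (*-congˡ (sym (^-homo-* (x i) n t))))) ⟩
    ∑ m (λ i → ∑ m (λ n → f n * x i ^ (n ℕ.+ t)))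
      ≈⟨ trans (∑-swap m m _) (∑-cong′ m λ n → ∑-*ˡ m _ _) ⟩
    ∑ m (λ n → f n * X (n ℕ.+ t)) ∎
    where open ≈-Reasoning

  ⟨Poly²⟩ : ∀ f g t → ⟨ (λ i → Poly f i * Poly g i * x i ^ t) ⟩ ≈ ∑ m (λ n → f n * ∑ m (λ k → g k * X (k ℕ.+ (n ℕ.+ t))))
  ⟨Poly²⟩ f g t = begin
    ∑ m (λ i → Poly f i * Poly g i * x i ^ t)
      ≈⟨ ∑-cong′ m (λ i → trans (*-assoc _ _ _) (trans (sym (∑-*ʳ m _ _)) (∑-cong′ m λ n →
           trans (solve {4} (λ f a g b → (f :* a) :* (g :* b) := f :* (g :* (a :* b))) (f n ∷ x i ^ n ∷ Poly g i ∷ x i ^ t ∷ [])) (*-congˡ (*-congˡ (sym (^-homo-* (x i) n t))))))) ⟩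
    ∑ m (λ i → ∑ m (λ n → f n * (Poly g i * x i ^ (n ℕ.+ t))))
      ≈⟨ trans (∑-swap m m _) (∑-cong′ m λ n → trans (∑-*ˡ m _ _) (*-congˡ (⟨Poly⟩ g (n ℕ.+ t)))) ⟩
    ∑ m (λ n → f n * ∑ m (λ k → g k * X (k ℕ.+ (n ℕ.+ t)))) ∎
    where open ≈-Reasoning

  ⟨Poly³⟩ : ∀ f g h → ⟨ (λ i → Poly f i * (Poly g i * Poly h i)) ⟩ ≈ ∑ m (λ n → f n * ∑ m (λ k → g k * ∑ m (λ l → h l * X (l ℕ.+ (k ℕ.+ n)))))
  ⟨Poly³⟩ f g h = begin
    ∑ m (λ i → Poly f i * (Poly g i * Poly h i))
      ≈⟨ ∑-cong′ m (λ i → trans (sym (∑-*ʳ m _ _)) (∑-cong′ m λ n → solve {3} (λ f a g → (f :* a) :* g := f :* (g :* a)) (f n ∷ x i ^ n ∷ Poly g i * Poly h i ∷ []))) ⟩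
    ∑ m (λ i → ∑ m (λ n → f n * (Poly g i * Poly h i * x i ^ n)))
      ≈⟨ trans (∑-swap m m _) (∑-cong′ m λ n → trans (∑-*ˡ m _ _) (*-congˡ (⟨Poly²⟩ g h n))) ⟩
    ∑ m (λ n → f n * ∑ m (λ k → g k * ∑ m (λ l → h l * X (l ℕ.+ (k ℕ.+ n))))) ∎
    where open ≈-Reasoning

  supported-*0 : ∀ {f} → Supported f → ∀ n {z} → (2 ℕ.≤ n → n ℕ.< r → Even n → z ≈[ 1 ] 0#) → f n * z ≈[ 1 ] 0#
  supported-*0 sup n h with sup n
  ... | inj₁ f≈0             = transᵐ (*-congʳᵐ f≈0) (exact (zeroˡ _))
  ... | inj₂ (2≤n , n<r , e) = transᵐ (*-congˡᵐ (h 2≤n n<r e)) (exact (zeroʳ _))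

  supported-cong : ∀ {f} → Supported f → ∀ n {z w} → (2 ℕ.≤ n → n ℕ.< r → Even n → z ≈[ 1 ] w) → f n * z ≈[ 1 ] f n * w
  supported-cong sup n h with sup n
  ... | inj₁ f≈0             = transᵐ (*-congʳᵐ f≈0) (transᵐ (exact (trans (zeroˡ _) (sym (zeroˡ _)))) (symᵐ (*-congʳᵐ f≈0)))
  ... | inj₂ (2≤n , n<r , e) = *-congˡᵐ (h 2≤n n<r e)

  r<m : r ℕ.< m
  r<m = ℕₚ.≤-refl

  ⟨Poly⟩≈0 : ∀ {f} → Supported f → ⟨ Poly f ⟩ ≈[ 1 ] 0#
  ⟨Poly⟩≈0 {f} sup = begin
    ⟨ Poly f ⟩                            ≈⟨ exact (∑-cong′ m λ i → sym (*-identityʳ _)) ⟩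
    ⟨ (λ i → Poly f i * x i ^ 0) ⟩        ≈⟨ exact (⟨Poly⟩ f 0) ⟩
    ∑ m (λ n → f n * X (n ℕ.+ 0))         ≈⟨ ∑-zeroᵐ m (λ n _ → supported-*0 sup n λ 2≤n n<r _ → transᵐ (exact (reflexive (≡.cong X (ℕₚ.+-identityʳ n))))
                                               (reduce (s≤s z≤n) (X-small n (ℕₚ.<-≤-trans (s≤s z≤n) 2≤n) (ℕₚ.m<n⇒m<1+n n<r)))) ⟩
    0#                                    ∎
    where open Reasoning

  ⟨Poly*x⟩≈0 : ∀ {f} → Supported f → ⟨ (λ i → Poly f i * x i ^ 1) ⟩ ≈[ 1 ] 0#
  ⟨Poly*x⟩≈0 {f} sup = transᵐ (exact (⟨Poly⟩ f 1)) (∑-zeroᵐ m λ n n<m → supported-*0 sup n λ _ n<r e →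
    X-odd (n ℕ.+ 1) (≡.subst Odd (ℕₚ.+-comm 1 n) (suc-even e)) (ℕₚ.+-mono-<-≤ n<m (s≤s z≤n)))

  2+r∸1 : (r ∸ 1) ℕ.+ 2 ≡ m
  2+r∸1 = ≡.trans (ℕₚ.+-comm (r ∸ 1) 2) (≡.cong suc (ℕₚ.m+[n∸m]≡n {1} {r} (ℕₚ.≤-trans (s≤s z≤n) 9≤r)))

  -- Only the coefficient of index m - 2 = r - 1 meets an exponent divisible by m.
  ⟨Poly*x²⟩ : ∀ {f} → Supported f → ⟨ (λ i → Poly f i * x i ^ 2) ⟩ ≈[ 1 ] - f (r ∸ 1)
  ⟨Poly*x²⟩ {f} sup = begin
    ⟨ (λ i → Poly f i * x i ^ 2) ⟩        ≈⟨ exact (⟨Poly⟩ f 2) ⟩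
    ∑ m (λ n → f n * X (n ℕ.+ 2))         ≈⟨ ∑-pickᵐ m (r ∸ 1) (ℕₚ.≤-<-trans (ℕₚ.m∸n≤m r 1) r<m) (λ n n<m n≢ → supported-*0 sup n λ 2≤n n<r _ →
                                               reduce (s≤s z≤n) (X-small (n ℕ.+ 2) (ℕₚ.<-≤-trans (s≤s z≤n) (ℕₚ.m≤n+m 2 n)) (bound n n<r n≢))) ⟩
    f (r ∸ 1) * X (r ∸ 1 ℕ.+ 2)           ≈⟨ *-congˡᵐ (transᵐ (exact (reflexive (≡.cong X 2+r∸1))) X-m₁) ⟩
    f (r ∸ 1) * - 1#                      ≈⟨ exact (solve {1} (λ a → a :* :- # 1 := :- a) (f (r ∸ 1) ∷ [])) ⟩
    - f (r ∸ 1)                           ∎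
    where
    open Reasoning
    bound : ∀ n → n ℕ.< r → n ≢ r ∸ 1 → n ℕ.+ 2 ℕ.< m
    bound n n<r n≢ = ≡.subst (n ℕ.+ 2 ℕ.<_) 2+r∸1 (ℕₚ.+-monoˡ-< 2 (ℕₚ.≤∧≢⇒< (ℕₚ.∸-monoˡ-≤ 1 n<r) n≢))

  conv : ℕ → Carrier
  conv k = ∑ (suc k) (λ n → 𝔠 n * 𝔠 (k ∸ n))

  X-pair : ∀ n k → 0 ℕ.< n → n ℕ.< m → k ℕ.< m → k ≢ m ∸ n → X (k ℕ.+ (n ℕ.+ 0)) ≈[ 1 ] 0#
  X-pair n k 0<n n<m k<m k≢ with ℕₚ.<-cmp (k ℕ.+ n) m
  ... | tri≈ _ e _ = contradiction (≡.trans (≡.sym (ℕₚ.m+n∸n≡m k n)) (≡.cong (_∸ n) e)) k≢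
  ... | tri< k+n<m _ _ = transᵐ (exact (reflexive (≡.cong (λ z → X (k ℕ.+ z)) (ℕₚ.+-identityʳ n)))) (reduce (s≤s z≤n) (X-small (k ℕ.+ n) (ℕₚ.<-≤-trans 0<n (ℕₚ.m≤n+m n k)) k+n<m))
  ... | tri> _ _ m<k+n = transᵐ (exact (reflexive (≡.cong X (≡.trans (≡.cong (k ℕ.+_) (ℕₚ.+-identityʳ n)) (≡.sym (ℕₚ.m+[n∸m]≡n (ℕₚ.<⇒≤ m<k+n)))))))
      (reduce (s≤s z≤n) (transᵐ (X-periodic (k ℕ.+ n ∸ m)) (X-small (k ℕ.+ n ∸ m) (ℕₚ.m<n⇒0<n∸m m<k+n)
        (ℕₚ.+-cancelˡ-< m _ _ (≡.subst (ℕ._< m ℕ.+ m) (≡.sym (ℕₚ.m+[n∸m]≡n (ℕₚ.<⇒≤ m<k+n))) (ℕₚ.+-mono-< k<m n<m))))))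

  ⟨Poly*Poly⟩ : ∀ {f g} → Supported f → Supported g → ⟨ (λ i → Poly f i * Poly g i) ⟩ ≈[ 1 ] - ∑ m (λ n → f n * g (m ∸ n))
  ⟨Poly*Poly⟩ {f} {g} sf sg = begin
    ⟨ (λ i → Poly f i * Poly g i) ⟩               ≈⟨ exact (∑-cong′ m λ i → sym (*-identityʳ _)) ⟩
    ⟨ (λ i → Poly f i * Poly g i * x i ^ 0) ⟩     ≈⟨ exact (⟨Poly²⟩ f g 0) ⟩
    ∑ m (λ n → f n * ∑ m (λ k → g k * X (k ℕ.+ (n ℕ.+ 0))))
      ≈⟨ ∑-congᵐ m (λ n n<m → supported-cong sf n λ 2≤n n<r _ → inner n n<m (ℕₚ.<-≤-trans (s≤s z≤n) 2≤n)) ⟩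
    ∑ m (λ n → f n * - g (m ∸ n))                 ≈⟨ exact (trans (∑-cong′ m λ n → solve {2} (λ a b → a :* :- b := (:- # 1) :* (a :* b)) (f n ∷ g (m ∸ n) ∷ [])) (∑-*ˡ m (- 1#) _)) ⟩
    - 1# * ∑ m (λ n → f n * g (m ∸ n))            ≈⟨ exact (solve {1} (λ a → (:- # 1) :* a := :- a) (∑ m (λ n → f n * g (m ∸ n)) ∷ [])) ⟩
    - ∑ m (λ n → f n * g (m ∸ n))                 ∎
    where
    open Reasoning
    inner : ∀ n → n ℕ.< m → 0 ℕ.< n → ∑ m (λ k → g k * X (k ℕ.+ (n ℕ.+ 0))) ≈[ 1 ] - g (m ∸ n)
    inner n n<m 0<n = begin
      ∑ m (λ k → g k * X (k ℕ.+ (n ℕ.+ 0)))   ≈⟨ ∑-pickᵐ m (m ∸ n) (ℕₚ.∸-monoʳ-< {o = 0} 0<n (ℕₚ.<⇒≤ n<m)) (λ k k<m k≢ → transᵐ (*-congˡᵐ (X-pair n k 0<n n<m k<m k≢)) (exact (zeroʳ _))) ⟩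
      g (m ∸ n) * X (m ∸ n ℕ.+ (n ℕ.+ 0))     ≈⟨ *-congˡᵐ (transᵐ (exact (reflexive (≡.cong X (≡.trans (≡.cong (m ∸ n ℕ.+_) (ℕₚ.+-identityʳ n)) (ℕₚ.m∸n+n≡m (ℕₚ.<⇒≤ n<m)))))) X-m₁) ⟩
      g (m ∸ n) * - 1#                        ≈⟨ exact (solve {1} (λ a → a :* :- # 1 := :- a) (g (m ∸ n) ∷ [])) ⟩
      - g (m ∸ n)                             ∎

  ⟨Poly*Poly*x⟩≈0 : ∀ {f g} → Supported f → Supported g → ⟨ (λ i → Poly f i * Poly g i * x i ^ 1) ⟩ ≈[ 1 ] 0#
  ⟨Poly*Poly*x⟩≈0 {f} {g} sf sg = transᵐ (exact (⟨Poly²⟩ f g 1)) (∑-zeroᵐ m λ n n<m → supported-*0 sf n λ _ n<r en →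
    ∑-zeroᵐ m λ k k<m → supported-*0 sg k λ _ k<r ek → X-odd (k ℕ.+ (n ℕ.+ 1))
      (≡.subst Odd (≡.trans (≡.cong suc ≡.refl) (≡.trans (≡.sym (ℕₚ.+-suc k n)) (≡.cong (k ℕ.+_) (ℕₚ.+-comm 1 n)))) (suc-even (even+even ek en)))
      (ℕₚ.+-mono-<-≤ k<m (≡.subst (ℕ._≤ m) (ℕₚ.+-comm 1 n) n<m)))

  𝔠-m : 𝔠 m ≈ 0#
  𝔠-m = 𝔠-high m (ℕₚ.<⇒≤ r<m)

  conv-m : conv m ≈ ∑ m (λ n → 𝔠 n * 𝔠 (m ∸ n))
  conv-m = trans (+-congˡ (trans (*-congʳ 𝔠-m) (zeroˡ _))) (+-identityʳ _)

  ⟨GG⟩ : ⟨ (λ i → G i * G i) ⟩ ≈[ 1 ] - conv m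
  ⟨GG⟩ = transᵐ (⟨Poly*Poly⟩ 𝔠-supported 𝔠-supported) (-‿congᵐ (exact (sym conv-m)))

  -- Exchanging n and m - n symmetrises the factor n to n + (m - n) = m, which is - 1 modulo p.
  ⟨DG⟩ : ι 2 * ⟨ (λ i → D i * G i) ⟩ ≈[ 1 ] conv m
  ⟨DG⟩ = begin
    ι 2 * ⟨ (λ i → D i * G i) ⟩              ≈⟨ *-congˡᵐ (⟨Poly*Poly⟩ n𝔠-supported 𝔠-supported) ⟩
    ι 2 * - ∑ m f                            ≈⟨ exact (*-congˡ (-‿cong (sym (trans (+-congˡ f-m) (+-identityʳ _))))) ⟩
    ι 2 * - ∑ (suc m) f                      ≈⟨ exact (solve {1} (λ a → # 2 :* :- a := :- (a :+ a)) (∑ (suc m) f ∷ [])) ⟩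
    - (∑ (suc m) f + ∑ (suc m) f)            ≈⟨ exact (-‿cong (trans (+-congˡ (sym (∑-rev (suc m) f))) (sym (∑-+ (suc m) f _)))) ⟩
    - ∑ (suc m) (λ n → f n + f (m ∸ n))      ≈⟨ exact (-‿cong (∑-cong (suc m) λ n n≤m → step n (ℕₚ.≤-pred n≤m))) ⟩
    - ∑ (suc m) (λ n → ι m * (𝔠 n * 𝔠 (m ∸ n)))  ≈⟨ exact (-‿cong (∑-*ˡ (suc m) (ι m) _)) ⟩
    - (ι m * conv m)                         ≈⟨ -‿congᵐ (*-congʳᵐ ι-m≈-1) ⟩
    - (- 1# * conv m)                        ≈⟨ exact (solve {1} (λ a → :- ((:- # 1) :* a) := a) (conv m ∷ [])) ⟩
    conv m                                   ∎
    where
    open Reasoning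
    f : ℕ → Carrier
    f n = n𝔠 n * 𝔠 (m ∸ n)
    f-m : f m ≈ 0#
    f-m = trans (*-congʳ (trans (*-congˡ 𝔠-m) (zeroʳ _))) (zeroˡ _)
    step : ∀ n → n ℕ.≤ m → f n + f (m ∸ n) ≈ ι m * (𝔠 n * 𝔠 (m ∸ n))
    step n n≤m = trans (+-congˡ (*-congˡ (reflexive (≡.cong 𝔠 (ℕₚ.m∸[m∸n]≡n n≤m))))) (trans
      (solve {4} (λ n k a b → (n :* a) :* b :+ (k :* b) :* a := (n :+ k) :* (a :* b)) (ι n ∷ ι (m ∸ n) ∷ 𝔠 n ∷ 𝔠 (m ∸ n) ∷ []))
      (*-congʳ (trans (sym (ι-+ n (m ∸ n))) (reflexive (≡.cong ι (ℕₚ.m+[n∸m]≡n n≤m))))))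

  β : Carrier
  β = 𝔠 (r ∸ 1)

  ∑-cons₂ : ∀ n → 2 ℕ.≤ n → ∀ f → ∑ n f ≈ f 0 + (f 1 + ∑ (n ∸ 2) (λ i → f (2 ℕ.+ i)))
  ∑-cons₂ (suc (suc n)) (s≤s (s≤s z≤n)) f = trans (∑-cons (suc n) f) (+-congˡ (∑-cons n (f ∘ suc)))

  𝕋 : Carrier
  𝕋 = ∑ (suc m) (λ n → 𝔠 n * conv (m ∸ n))

  K : ℕ → Carrier
  K N = (ι 2 + ι N) * X N

  X-1 : ∀ n → 0 ℕ.< n → n ℕ.< m → X n ≈[ 1 ] 0#
  X-1 n 0<n n<m = reduce (s≤s z≤n) (X-small n 0<n n<m)

  -- The multiples of m in the range are m and 2 m, and at 2 m the factor 2 + 2 m vanishes modulo p.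
  K-off : ∀ N → 0 ℕ.< N → N ℕ.< m ℕ.+ (m ℕ.+ m) → N ≢ m → K N ≈[ 1 ] 0#
  K-off N 0<N N<3m N≢m with ℕₚ.<-cmp N m
  ... | tri≈ _ e _   = contradiction e N≢m
  ... | tri< N<m _ _ = transᵐ (*-congˡᵐ (X-1 N 0<N N<m)) (exact (zeroʳ _))
  ... | tri> _ _ m<N with ℕₚ.m+[n∸m]≡n (ℕₚ.<⇒≤ m<N) | ℕₚ.<-cmp (N ∸ m) m
  ...   | e | tri< l _ _ = transᵐ (*-congˡᵐ (transᵐ (exact (reflexive (≡.cong X (≡.sym e)))) (transᵐ (reduce (s≤s z≤n) (X-periodic (N ∸ m))) (X-1 (N ∸ m) (ℕₚ.m<n⇒0<n∸m m<N) l)))) (exact (zeroʳ _))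
  ...   | e | tri≈ _ e′ _ = transᵐ (*-congʳᵐ (begin
    ι 2 + ι N            ≈⟨ exact (+-congˡ (trans (reflexive (≡.cong ι (≡.trans (≡.sym e) (≡.cong (m ℕ.+_) e′)))) (ι-+ m m))) ⟩
    ι 2 + (ι m + ι m)    ≈⟨ +-congˡᵐ (+-congᵐ ι-m≈-1 ι-m≈-1) ⟩
    ι 2 + (- 1# + - 1#)  ≈⟨ exact (solve {0} (# 2 :+ (:- # 1 :+ :- # 1) := # 0) []) ⟩
    0#                   ∎)) (exact (zeroˡ _))
    where open Reasoning
  ...   | e | tri> _ _ l with ℕₚ.m+[n∸m]≡n (ℕₚ.<⇒≤ l)
  ...     | e″ = transᵐ (*-congˡᵐ (transᵐ (exact (reflexive (≡.cong X (≡.trans (≡.sym e) (≡.cong (m ℕ.+_) (≡.sym e″))))))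
      (transᵐ (reduce (s≤s z≤n) (transᵐ (X-periodic (m ℕ.+ (N ∸ m ∸ m))) (X-periodic (N ∸ m ∸ m))))
        (X-1 (N ∸ m ∸ m) (ℕₚ.m<n⇒0<n∸m l) (ℕₚ.+-cancelˡ-< m _ _ (ℕₚ.+-cancelˡ-< m _ _ (≡.subst (ℕ._< m ℕ.+ (m ℕ.+ m)) (≡.trans (≡.sym e) (≡.cong (m ℕ.+_) (≡.sym e″))) N<3m))))))) (exact (zeroʳ _))

  K-m : K m ≈[ 1 ] - 1#
  K-m = transᵐ (*-congᵐ (+-congˡᵐ ι-m≈-1) X-m₁) (exact (solve {0} ((# 2 :+ :- # 1) :* :- # 1 := :- # 1) []))

  -- For t ≥ m truncated subtraction makes `m ∸ t` zero, where `𝔠` is zero, so that one formula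
  -- covers both ranges of t.
  K-sum : ∀ t → 0 ℕ.< t → t ℕ.< m ℕ.+ m → ∑ m (λ l → 𝔠 l * K (l ℕ.+ t)) ≈[ 1 ] - 𝔠 (m ∸ t)
  K-sum t 0<t t<2m = begin
    ∑ m (λ l → 𝔠 l * K (l ℕ.+ t))       ≈⟨ ∑-pickᵐ m (m ∸ t) (m∸t<m t 0<t) (λ l l<m l≢ → supported-*0 𝔠-supported l λ 2≤l l<r _ →
                                            K-off (l ℕ.+ t) (ℕₚ.<-≤-trans 0<t (ℕₚ.m≤n+m t l)) (ℕₚ.+-mono-< l<m t<2m) (λ e → l≢ (≡.trans (≡.sym (ℕₚ.m+n∸n≡m l t)) (≡.cong (_∸ t) e)))) ⟩
    𝔠 (m ∸ t) * K (m ∸ t ℕ.+ t)         ≈⟨ supported-cong 𝔠-supported (m ∸ t) (λ 2≤ _ _ → transᵐ (exact (reflexive (≡.cong K (index 2≤)))) K-m) ⟩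
    𝔠 (m ∸ t) * - 1#                    ≈⟨ exact (solve {1} (λ a → a :* :- # 1 := :- a) (𝔠 (m ∸ t) ∷ [])) ⟩
    - 𝔠 (m ∸ t)                         ∎
    where
    open Reasoning
    index : 2 ℕ.≤ m ∸ t → m ∸ t ℕ.+ t ≡ m
    index 2≤ = ℕₚ.m∸n+n≡m {m} {t} (ℕₚ.<⇒≤ (ℕₚ.m∸n≢0⇒n<m (λ z → ℕₚ.n≮0 (≡.subst (2 ℕ.≤_) z 2≤))))
    m∸t<m : ∀ t → 0 ℕ.< t → m ∸ t ℕ.< m
    m∸t<m (suc t) _ = s≤s (ℕₚ.m∸n≤m r t)

  -- In the additional terms k + n exceeds m, so truncated subtraction turns the second factor into
  -- `𝔠 0`, which is zero.
  conv-extend : ∀ n → 0 ℕ.< n → n ℕ.≤ m → ∑ m (λ k → 𝔠 k * 𝔠 (m ∸ (k ℕ.+ n))) ≈ conv (m ∸ n)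
  conv-extend n 0<n n≤m = begin
    ∑ m f                                                    ≡⟨ ≡.cong (λ z → ∑ z f) index ⟩
    ∑ (suc (m ∸ n) ℕ.+ (n ∸ 1)) f                            ≈⟨ ∑-split (suc (m ∸ n)) (n ∸ 1) f ⟩
    ∑ (suc (m ∸ n)) f + ∑ (n ∸ 1) (λ i → f (suc (m ∸ n) ℕ.+ i)) ≈⟨ +-cong (∑-cong′ (suc (m ∸ n)) λ k → *-congˡ (reflexive (≡.cong 𝔠 (≡.trans (≡.cong (m ∸_) (ℕₚ.+-comm k n)) (≡.sym (ℕₚ.∸-+-assoc m n k))))))
                                                                   (trans (∑-cong′ (n ∸ 1) tail) (∑-0 (n ∸ 1))) ⟩
    conv (m ∸ n) + 0#                                        ≈⟨ +-identityʳ _ ⟩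
    conv (m ∸ n)                                             ∎
    where
    open ≈-Reasoning
    f : ℕ → Carrier
    f k = 𝔠 k * 𝔠 (m ∸ (k ℕ.+ n))
    index : m ≡ suc (m ∸ n) ℕ.+ (n ∸ 1)
    index = ≡.trans (≡.sym (ℕₚ.m∸n+n≡m n≤m)) (≡.trans (≡.cong (m ∸ n ℕ.+_) (≡.sym (ℕₚ.m+[n∸m]≡n 0<n))) (ℕₚ.+-suc (m ∸ n) (n ∸ 1)))
    big : ∀ i → m ℕ.≤ suc (m ∸ n) ℕ.+ i ℕ.+ n
    big i = ℕₚ.≤-trans (ℕₚ.≤-reflexive (≡.sym (ℕₚ.m∸n+n≡m n≤m))) (ℕₚ.+-monoˡ-≤ n (ℕₚ.≤-trans (ℕₚ.n≤1+n (m ∸ n)) (ℕₚ.m≤m+n (suc (m ∸ n)) i)))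
    tail : ∀ i → f (suc (m ∸ n) ℕ.+ i) ≈ 0#
    tail i = trans (*-congˡ (reflexive (≡.cong 𝔠 (ℕₚ.m≤n⇒m∸n≡0 (big i))))) (zeroʳ _)

  ⟨GGG⟩ ⟨DGG⟩ : Carrier
  ⟨GGG⟩ = ⟨ (λ i → G i * (G i * G i)) ⟩
  ⟨DGG⟩ = ⟨ (λ i → D i * (G i * G i)) ⟩

  triple : (ℕ → ℕ → ℕ → Carrier) → Carrier
  triple f = ∑ m (λ n → ∑ m (λ k → ∑ m (λ l → f n k l)))

  triple-+ : ∀ f g → triple (λ n k l → f n k l + g n k l) ≈ triple f + triple g
  triple-+ f g = trans (∑-cong′ m λ n → trans (∑-cong′ m λ k → ∑-+ m _ _) (∑-+ m _ _)) (∑-+ m _ _)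

  triple-cong : ∀ {f g} → (∀ n k l → f n k l ≈ g n k l) → triple f ≈ triple g
  triple-cong h = ∑-cong′ m λ n → ∑-cong′ m λ k → ∑-cong′ m λ l → h n k l

  triple-*ˡ : ∀ c f → triple (λ n k l → c * f n k l) ≈ c * triple f
  triple-*ˡ c f = trans (∑-cong′ m λ n → trans (∑-cong′ m λ k → ∑-*ˡ m _ _) (∑-*ˡ m _ _)) (∑-*ˡ m _ _)

  ⟨Poly³⟩-triple : ∀ f g h → ⟨ (λ i → Poly f i * (Poly g i * Poly h i)) ⟩ ≈ triple (λ n k l → f n * (g k * (h l * X (l ℕ.+ (k ℕ.+ n)))))
  ⟨Poly³⟩-triple f g h = trans (⟨Poly³⟩ f g h) (∑-cong′ m λ n → trans (sym (∑-*ˡ m _ _)) (∑-cong′ m λ k → trans (*-congˡ (sym (∑-*ˡ m _ _))) (sym (∑-*ˡ m _ _))))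

  -- The factor 2 + n + k + l separates the two values m and 2m of n + k + l at which the power
  -- sum of the x i does not vanish modulo π.
  𝕋-moments : ι 2 * ⟨GGG⟩ + ι 3 * ⟨DGG⟩ ≈[ 1 ] - 𝕋
  𝕋-moments = begin
    ι 2 * ⟨GGG⟩ + ι 3 * ⟨DGG⟩
      ≈⟨ exact (solve {2} (λ a b → # 2 :* a :+ # 3 :* b := ((# 2 :* a :+ b) :+ b) :+ b) (⟨GGG⟩ ∷ ⟨DGG⟩ ∷ [])) ⟩
    ι 2 * ⟨GGG⟩ + ⟨DGG⟩ + ⟨DGG⟩ + ⟨DGG⟩
      ≈⟨ exact (+-cong (+-cong (+-cong (trans (*-congˡ (⟨Poly³⟩-triple 𝔠 𝔠 𝔠)) (sym (triple-*ˡ (ι 2) _))) (⟨Poly³⟩-triple n𝔠 𝔠 𝔠))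
           (trans (∑-cong′ m λ i → solve {2} (λ d g → d :* (g :* g) := g :* (d :* g)) (D i ∷ G i ∷ [])) (⟨Poly³⟩-triple 𝔠 n𝔠 𝔠)))
           (trans (∑-cong′ m λ i → solve {2} (λ d g → d :* (g :* g) := g :* (g :* d)) (D i ∷ G i ∷ [])) (⟨Poly³⟩-triple 𝔠 𝔠 n𝔠))) ⟩
    triple _ + triple _ + triple _ + triple _
      ≈⟨ exact (trans (+-congʳ (trans (+-congʳ (sym (triple-+ _ _))) (sym (triple-+ _ _)))) (sym (triple-+ _ _))) ⟩
    triple _
      ≈⟨ exact (triple-cong λ n k l → trans (solve {8} (λ a b c x n k l t → t :* (a :* (b :* (c :* x))) :+ (n :* a) :* (b :* (c :* x)) :+ a :* ((k :* b) :* (c :* x)) :+ a :* (b :* ((l :* c) :* x))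
             := a :* (b :* (c :* ((t :+ (l :+ (k :+ n))) :* x)))) (𝔠 n ∷ 𝔠 k ∷ 𝔠 l ∷ X (l ℕ.+ (k ℕ.+ n)) ∷ ι n ∷ ι k ∷ ι l ∷ ι 2 ∷ []))
           (*-congˡ (*-congˡ (*-congˡ (*-congʳ (+-congˡ (sym (trans (ι-+ l (k ℕ.+ n)) (+-congˡ (ι-+ k n)))))))))) ⟩
    triple (λ n k l → 𝔠 n * (𝔠 k * (𝔠 l * K (l ℕ.+ (k ℕ.+ n)))))
      ≈⟨ exact (∑-cong′ m λ n → trans (∑-cong′ m λ k → trans (∑-*ˡ m _ _) (*-congˡ (∑-*ˡ m _ _))) (∑-*ˡ m _ _)) ⟩
    ∑ m (λ n → 𝔠 n * ∑ m (λ k → 𝔠 k * ∑ m (λ l → 𝔠 l * K (l ℕ.+ (k ℕ.+ n)))))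
      ≈⟨ ∑-congᵐ m (λ n n<m → supported-cong 𝔠-supported n λ 2≤n _ _ → inner n n<m (ℕₚ.<-≤-trans (s≤s z≤n) 2≤n)) ⟩
    ∑ m (λ n → 𝔠 n * - conv (m ∸ n))
      ≈⟨ exact (trans (∑-cong′ m λ n → solve {2} (λ a b → a :* :- b := (:- # 1) :* (a :* b)) (𝔠 n ∷ conv (m ∸ n) ∷ [])) (∑-*ˡ m (- 1#) _)) ⟩
    - 1# * ∑ m (λ n → 𝔠 n * conv (m ∸ n))
      ≈⟨ exact (trans (solve {1} (λ a → (:- # 1) :* a := :- (a :+ # 0)) (∑ m (λ n → 𝔠 n * conv (m ∸ n)) ∷ [])) (-‿cong (+-congˡ (sym (trans (*-congʳ 𝔠-m) (zeroˡ _)))))) ⟩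
    - 𝕋 ∎
    where
    open Reasoning
    inner : ∀ n → n ℕ.< m → 0 ℕ.< n → ∑ m (λ k → 𝔠 k * ∑ m (λ l → 𝔠 l * K (l ℕ.+ (k ℕ.+ n)))) ≈[ 1 ] - conv (m ∸ n)
    inner n n<m 0<n = begin
      ∑ m (λ k → 𝔠 k * ∑ m (λ l → 𝔠 l * K (l ℕ.+ (k ℕ.+ n))))
        ≈⟨ ∑-congᵐ m (λ k k<m → *-congˡᵐ (K-sum (k ℕ.+ n) (ℕₚ.<-≤-trans 0<n (ℕₚ.m≤n+m n k)) (ℕₚ.+-mono-< k<m n<m))) ⟩
      ∑ m (λ k → 𝔠 k * - 𝔠 (m ∸ (k ℕ.+ n)))
        ≈⟨ exact (trans (∑-cong′ m λ k → solve {2} (λ a b → a :* :- b := (:- # 1) :* (a :* b)) (𝔠 k ∷ 𝔠 (m ∸ (k ℕ.+ n)) ∷ [])) (∑-*ˡ m (- 1#) _)) ⟩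
      - 1# * ∑ m (λ k → 𝔠 k * 𝔠 (m ∸ (k ℕ.+ n)))
        ≈⟨ exact (trans (*-congˡ (conv-extend n 0<n (ℕₚ.<⇒≤ n<m))) (solve {1} (λ a → (:- # 1) :* a := :- a) (conv (m ∸ n) ∷ []))) ⟩
      - conv (m ∸ n) ∎

  -- Moments of q expressed by divided Bernoulli numbers

  -- `F n` is the correction of order p in - 4 (1 + p) A n = 4 𝔠 n - p F n for even n. Its summand κ
  -- is the trace of B 1 = - 1/2, felt only at n = 2.
  F κ : ℕ → Carrier
  κ (suc (suc zero)) = 1#
  κ _                = 0#
  F n = ι 2 * (ι n + 1#) * M n + κ n

  κ-2 : ∀ n → n ≡ 2 → κ n ≈ 1#
  κ-2 n e = reflexive (≡.cong κ e)

  κ-other : ∀ n → n ≢ 2 → κ n ≈ 0#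
  κ-other zero                _ = refl
  κ-other (suc zero)          _ = refl
  κ-other (suc (suc zero))    h = contradiction ≡.refl h
  κ-other (suc (suc (suc n))) _ = refl

  private
    A-from : ∀ n {β k} → ι 2 * (π * (ι n + 1#) * M n - ι 2 * (1# + π) * A n) ≈[ 2 ] ι 4 * β - π * k → κ n ≈ k →
      - (ι 4 * (1# + π) * A n) ≈[ 2 ] ι 4 * β - π * F n
    A-from n {β} {k} h κn = begin
      - (ι 4 * (1# + π) * A n)
        ≈⟨ exact (solve {4} (λ π n a b → :- (# 4 :* (# 1 :+ π) :* a) := # 2 :* (π :* (n :+ # 1) :* b :- # 2 :* (# 1 :+ π) :* a) :- # 2 :* π :* (n :+ # 1) :* b) (π ∷ ι n ∷ A n ∷ M n ∷ [])) ⟩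
      ι 2 * (π * (ι n + 1#) * M n - ι 2 * (1# + π) * A n) - ι 2 * π * (ι n + 1#) * M n
        ≈⟨ +-congʳᵐ h ⟩
      ι 4 * β - π * k - ι 2 * π * (ι n + 1#) * M n
        ≈⟨ exact (solve {5} (λ π c n b k → # 4 :* c :- π :* k :- # 2 :* π :* (n :+ # 1) :* b := # 4 :* c :- π :* (# 2 :* (n :+ # 1) :* b :+ k)) (π ∷ β ∷ ι n ∷ M n ∷ k ∷ [])) ⟩
      ι 4 * β - π * (ι 2 * (ι n + 1#) * M n + k)
        ≈⟨ exact (+-congˡ (-‿cong (*-congˡ (+-congˡ (sym κn))))) ⟩
      ι 4 * β - π * F n ∎
      where open Reasoning

  A-even : ∀ n → 2 ℕ.≤ n → n ℕ.< r → Even n → - (ι 4 * (1# + π) * A n) ≈[ 2 ] ι 4 * 𝔠 n - π * F n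
  A-even n 2≤n n<r even with n ℕ.≟ 2
  ... | yes n≡2 = A-from n (transᵐ (symᵐ (even-formula-2 n n≡2 (𝔠-divided n 2≤n n<r))) (exact (+-congˡ (-‿cong (sym (*-identityʳ π)))))) (κ-2 n n≡2)
  ... | no  n≢2 = A-from n (transᵐ (*-congˡᵐ (symᵐ (even-formula n 4≤n even (p∤n n 0<n (ℕₚ.m<n⇒m<1+n n<m)) (s≈0 n 0<n n<m) low (𝔠-divided n 2≤n n<r))))
        (exact (solve {2} (λ c π → # 2 :* (# 2 :* c) := # 4 :* c :- π :* # 0) (𝔠 n ∷ π ∷ [])))) (κ-other n n≢2)
    where
    n<m : n ℕ.< m
    n<m = ℕₚ.m<n⇒m<1+n n<r
    0<n : 0 ℕ.< n
    0<n = ℕₚ.≤-trans (s≤s z≤n) 2≤n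
    n≢3 : 3 ≢ n
    n≢3 3≡n = ¬even∧odd even (1 , ≡.sym 3≡n)
    4≤n : 4 ℕ.≤ n
    4≤n = ℕₚ.≤∧≢⇒< (ℕₚ.≤∧≢⇒< 2≤n (n≢2 ∘ ≡.sym)) n≢3
    0<n-2 : 0 ℕ.< n ∸ 2
    0<n-2 = ℕₚ.m<n⇒0<n∸m (ℕₚ.≤-trans (ℕₚ.n≤1+n 3) 4≤n)
    low : ι n * (ι n - 1#) * b (n ∸ 2) ≈[ 1 ] 0#
    low = transᵐ (*-congˡᵐ (transᵐ (b≈s (n ∸ 2) 0<n-2) (reduce (s≤s z≤n) (s≈0 (n ∸ 2) 0<n-2 (ℕₚ.≤-<-trans (ℕₚ.m∸n≤m n 2) n<m))))) (exact (zeroʳ _))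

  A-odd₂ : ∀ n → 3 ℕ.≤ n → n ℕ.< m → Odd n → π * ι (n ∸ 1) * 𝔠 (n ∸ 1) ≈[ 2 ] π * (ι n + 1#) * M n - ι 2 * (1# + π) * A n
  A-odd₂ n 3≤n n<m odd = odd-formula n 3≤n odd (p∤n n 0<n (ℕₚ.m<n⇒m<1+n n<m)) (s≈0 n 0<n n<m) (𝔠-divided (n ∸ 1) (ℕₚ.∸-monoˡ-≤ 1 3≤n) (ℕₚ.<-≤-trans (ℕₚ.∸-monoʳ-< {o = 0} (s≤s z≤n) 0<n) (ℕₚ.≤-pred n<m)))
    where
    0<n : 0 ℕ.< n
    0<n = ℕₚ.≤-trans (s≤s z≤n) 3≤n

  A-odd : ∀ n → 2 ℕ.≤ n → n ℕ.< m → Odd n → A n ≈[ 1 ] 0#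
  A-odd n 2≤n n<m odd = small-unit 2 (s≤s z≤n) (s≤s (s≤s z≤n)) (begin
    ι 2 * A n                                               ≈⟨ solveMod 1 {3} (λ π k a b → # 2 :* a := :- (π :* (k :+ # 1) :* b :- # 2 :* (# 1 :+ π) :* a)) (ι n ∷ A n ∷ M n ∷ []) ⟩
    - (π * (ι n + 1#) * M n - ι 2 * (1# + π) * A n)         ≈⟨ -‿congᵐ (reduce (s≤s z≤n) (A-odd₂ n 3≤n n<m odd)) ⟨
    - (π * ι (n ∸ 1) * 𝔠 (n ∸ 1))                           ≈⟨ solveMod 1 {2} (λ π k c → :- (π :* k :* c) := # 2 :* # 0) (ι (n ∸ 1) ∷ 𝔠 (n ∸ 1) ∷ []) ⟩
    ι 2 * 0#                                                ∎)
    where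
    open Reasoning
    3≤n : 3 ℕ.≤ n
    3≤n = ℕₚ.≤∧≢⇒< 2≤n λ 2≡n → ¬even∧odd (1 , ≡.sym 2≡n) odd

  A≈-𝔠 : ∀ n → 2 ℕ.≤ n → n ℕ.< m → A n ≈[ 1 ] - 𝔠 n
  A≈-𝔠 n 2≤n n<m with parity n
  ... | inj₂ o = transᵐ (A-odd n 2≤n n<m o) (transᵐ (exact (solve {0} (# 0 := :- # 0) [])) (-‿congᵐ (symᵐ (𝔠-odd n o))))
  ... | inj₁ e = small-unit 4 (s≤s z≤n) (ℕₚ.m≤m+n 4 6) (begin
    ι 4 * A n                            ≈⟨ solveMod 1 {1} (λ π a → # 4 :* a := :- :- (# 4 :* (# 1 :+ π) :* a)) (A n ∷ []) ⟩
    - - (ι 4 * (1# + π) * A n)           ≈⟨ -‿congᵐ (reduce (s≤s z≤n) (A-even n 2≤n n<r e)) ⟩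
    - (ι 4 * 𝔠 n - π * F n)              ≈⟨ solveMod 1 {2} (λ π c f → :- (# 4 :* c :- π :* f) := # 4 :* :- c) (𝔠 n ∷ F n ∷ []) ⟩
    ι 4 * - 𝔠 n                          ∎)
    where
    open Reasoning
    n<r : n ℕ.< r
    n<r = ℕₚ.≤∧≢⇒< (ℕₚ.≤-pred n<m) λ { ≡.refl → ¬even∧odd m-Even (suc-even e) }

  -- Fourier expansion of the Fermat quotient

  Q₁ Q₂ Q₃ : Carrier
  Q₁ = ⟨ q ⟩
  Q₂ = ⟨ (λ i → q i ^ 2) ⟩
  Q₃ = ⟨ (λ i → q i ^ 3) ⟩

  A-0 : A 0 ≈ Q₁
  A-0 = ∑-cong′ m λ i → *-identityˡ _

  2≤m : 2 ℕ.≤ m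
  2≤m = ℕₚ.≤-trans (s≤s (s≤s z≤n)) 10≤m

  fourier-inversion : ∀ i → i ℕ.< m → ∑ m (λ n → A n * ω i ^ (m ∸ n)) ≈[ 1 ] - q i
  fourier-inversion i i<m = begin
    ∑ m (λ n → A n * ω i ^ (m ∸ n))
      ≈⟨ exact (trans (∑-cong′ m λ n → trans (sym (∑-*ʳ m _ _)) (∑-cong′ m λ j → solve {3} (λ a b c → (a :* b) :* c := b :* (a :* c)) (ω j ^ n ∷ q j ∷ ω i ^ (m ∸ n) ∷ [])))
           (trans (∑-swap m m _) (∑-cong′ m λ j → ∑-*ˡ m _ _))) ⟩
    ∑ m (λ j → q j * kernel j i)
      ≈⟨ ∑-pickᵐ m i i<m (λ j j<m j≢i → transᵐ (*-congˡᵐ (reduce (s≤s z≤n) (kernel-off j i j<m i<m j≢i))) (exact (zeroʳ _))) ⟩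
    q i * kernel i i
      ≈⟨ *-congˡᵐ (transᵐ (reduce (s≤s z≤n) (kernel-diag i i<m)) ι-m≈-1) ⟩
    q i * - 1#
      ≈⟨ exact (solve {1} (λ a → a :* :- # 1 := :- a) (q i ∷ [])) ⟩
    - q i ∎
    where open Reasoning

  -- The coefficients of the finite Fourier expansion are A 0 = Q₁, A 1 = 1/2 and A n = - 𝔠 n for n
  -- ≥ 2; the overall sign comes from 1 / m, which is - 1 modulo p.
  q≈ : ∀ i → i ℕ.< m → ι 2 * q i ≈[ 1 ] ι 2 * G i - ι 2 * Q₁ - x i
  q≈ i i<m = begin
    ι 2 * q i                                       ≈⟨ exact (solve {1} (λ a → # 2 :* a := :- (# 2 :* :- a)) (q i ∷ [])) ⟩
    - (ι 2 * - q i)                                 ≈⟨ -‿congᵐ (*-congˡᵐ (symᵐ (fourier-inversion i i<m))) ⟩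
    - (ι 2 * ∑ m (λ n → A n * ω i ^ (m ∸ n)))       ≈⟨ exact (-‿cong (*-congˡ (∑-cons₂ m 2≤m _))) ⟩
    - (ι 2 * (A 0 * ω i ^ m + (A 1 * x i + ∑ (m ∸ 2) (λ n → A (2 ℕ.+ n) * ω i ^ (m ∸ (2 ℕ.+ n))))))
      ≈⟨ -‿congᵐ (*-congˡᵐ (+-congᵐ (*-congᵐ (exact A-0) (reduce (s≤s z≤n) (ω^m i i<m))) (+-congˡᵐ (∑-congᵐ (m ∸ 2) (λ n n< →
           *-congᵐ (A≈-𝔠 (2 ℕ.+ n) (s≤s (s≤s z≤n)) (bound n n<)) (symᵐ (reduce (s≤s z≤n) (x^≈ω^ i (2 ℕ.+ n) i<m (ℕₚ.<⇒≤ (bound n n<))))))))) ) ⟩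
    - (ι 2 * (Q₁ * 1# + (A 1 * x i + ∑ (m ∸ 2) (λ n → - 𝔠 (2 ℕ.+ n) * x i ^ (2 ℕ.+ n)))))
      ≈⟨ exact (-‿cong (*-congˡ (+-congˡ (+-congˡ (trans (∑-cong′ (m ∸ 2) λ n → solve {2} (λ a b → (:- a) :* b := (:- # 1) :* (a :* b)) (𝔠 (2 ℕ.+ n) ∷ x i ^ (2 ℕ.+ n) ∷ [])) (∑-*ˡ (m ∸ 2) (- 1#) _)))))) ⟩
    - (ι 2 * (Q₁ * 1# + (A 1 * x i + - 1# * g)))
      ≈⟨ exact (solve {4} (λ q a x g → :- (# 2 :* (q :* # 1 :+ (a :* x :+ (:- # 1) :* g))) := # 2 :* g :- # 2 :* q :- (# 2 :* a) :* x) (Q₁ ∷ A 1 ∷ x i ∷ g ∷ [])) ⟩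
    ι 2 * g - ι 2 * Q₁ - ι 2 * A 1 * x i
      ≈⟨ +-congᵐ (+-congʳᵐ (*-congˡᵐ (exact g≈G))) (-‿congᵐ (transᵐ (*-congʳᵐ (odd-formula-1 1 ≡.refl)) (exact (*-identityˡ _)))) ⟩
    ι 2 * G i - ι 2 * Q₁ - x i                      ∎
    where
    open Reasoning
    g : Carrier
    g = ∑ (m ∸ 2) (λ n → 𝔠 (2 ℕ.+ n) * x i ^ (2 ℕ.+ n))
    bound : ∀ n → n ℕ.< m ∸ 2 → 2 ℕ.+ n ℕ.< m
    bound n n< = ≡.subst (2 ℕ.+ n ℕ.<_) (ℕₚ.m+[n∸m]≡n 2≤m) (ℕₚ.+-monoʳ-< 2 n<)
    g≈G : g ≈ G i
    g≈G = sym (trans (∑-cons₂ m 2≤m _) (solve {3} (λ a b g → # 0 :* a :+ (# 0 :* b :+ g) := g) (x i ^ 0 ∷ x i ^ 1 ∷ g ∷ [])))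

  -- Convolution sums modulo p ^ 2

  -- Lists of coefficients and functions let `⟨linear⟩` sum an expanded product in one step: the
  -- solver supplies the pointwise expansion, and `_⊕_` replaces each summand by its value.
  linear : List (Carrier × (ℕ → Carrier)) → ℕ → Carrier
  linear []             i = 0#
  linear ((c , f) ∷ ts) i = c * f i + linear ts i

  linear-sum : List (Carrier × (ℕ → Carrier)) → Carrier
  linear-sum []             = 0#
  linear-sum ((c , f) ∷ ts) = c * ⟨ f ⟩ + linear-sum ts

  ⟨linear⟩ : ∀ ts → ⟨ linear ts ⟩ ≈ linear-sum ts
  ⟨linear⟩ []             = ∑-0 m
  ⟨linear⟩ ((c , f) ∷ ts) = trans (∑-+ m _ _) (+-cong (∑-*ˡ m c f) (⟨linear⟩ ts))

  infixr 5 _⊕_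
  _⊕_ : ∀ {k c x y z w} → x ≈[ k ] y → z ≈[ k ] w → c * x + z ≈[ k ] c * y + w
  h ⊕ h′ = +-congᵐ (*-congˡᵐ h) h′

  X-0₁ : X 0 ≈[ 1 ] - 1#
  X-0₁ = transᵐ (reduce (s≤s z≤n) X-0) ι-m≈-1

  3<m : 3 ℕ.< m
  3<m = ℕₚ.≤-trans (ℕₚ.m≤m+n 4 6) 10≤m

  X-1₁ : X 1 ≈[ 1 ] 0#
  X-1₁ = X-1 1 (s≤s z≤n) (ℕₚ.≤-trans (s≤s (s≤s z≤n)) 3<m)

  X-2₁ : X 2 ≈[ 1 ] 0#
  X-2₁ = X-1 2 (s≤s z≤n) (ℕₚ.≤-trans (s≤s (s≤s (s≤s z≤n))) 3<m)

  X-3₁ : X 3 ≈[ 1 ] 0#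
  X-3₁ = X-1 3 (s≤s z≤n) 3<m

  ⟨GGx⟩≈0 : ⟨ (λ i → G i * G i * x i ^ 1) ⟩ ≈[ 1 ] 0#
  ⟨GGx⟩≈0 = ⟨Poly*Poly*x⟩≈0 𝔠-supported 𝔠-supported

  DQ : Carrier
  DQ = ⟨ (λ i → D i * q i ^ 2) ⟩

  -- In the sum of (2 G - 2 Q₁ - x) ^ 2 the terms in G, G x, x and x ^ 2 vanish modulo p; only G ^ 2
  -- and the constant 4 Q₁ ^ 2 remain.
  conv≈ : conv m ≈[ 1 ] - (Q₁ ^ 2 + Q₂)
  conv≈ = small-unit 4 (s≤s z≤n) (ℕₚ.m≤m+n 4 6) (begin
    ι 4 * conv m
      ≈⟨ exact (solve {3} (λ c a b → # 4 :* c := (# 4 :* c :+ (# 4 :* b :+ # 4 :* a :^ 2)) :- # 4 :* (a :^ 2 :+ b)) (conv m ∷ Q₁ ∷ Q₂ ∷ [])) ⟩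
    ι 4 * conv m + (ι 4 * Q₂ + ι 4 * Q₁ ^ 2) - ι 4 * (Q₁ ^ 2 + Q₂)
      ≈⟨ +-congʳᵐ (+-congˡᵐ (+-congʳᵐ moments)) ⟩
    ι 4 * conv m + (- (ι 4 * conv m) - ι 4 * Q₁ ^ 2 + ι 4 * Q₁ ^ 2) - ι 4 * (Q₁ ^ 2 + Q₂)
      ≈⟨ exact (solve {3} (λ c a b → (# 4 :* c :+ (:- (# 4 :* c) :- # 4 :* a :^ 2 :+ # 4 :* a :^ 2)) :- # 4 :* (a :^ 2 :+ b) := # 4 :* :- (a :^ 2 :+ b)) (conv m ∷ Q₁ ∷ Q₂ ∷ [])) ⟩
    ι 4 * - (Q₁ ^ 2 + Q₂) ∎)
    where
    open Reasoning
    terms : List (Carrier × (ℕ → Carrier))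
    terms = (ι 4 , λ i → G i * G i) ∷ (- (ι 8 * Q₁) , G) ∷ (- ι 4 , λ i → G i * x i ^ 1) ∷ (ι 4 * Q₁ ^ 2 , λ i → x i ^ 0) ∷ (ι 4 * Q₁ , λ i → x i ^ 1) ∷ (1# , λ i → x i ^ 2) ∷ []
    moments : ι 4 * Q₂ ≈[ 1 ] - (ι 4 * conv m) - ι 4 * Q₁ ^ 2
    moments = begin
      ι 4 * Q₂
        ≈⟨ exact (trans (sym (∑-*ˡ m _ _)) (∑-cong′ m λ i → solve {1} (λ q → # 4 :* q :^ 2 := (# 2 :* q) :^ 2) (q i ∷ []))) ⟩
      ⟨ (λ i → (ι 2 * q i) ^ 2) ⟩
        ≈⟨ ∑-congᵐ m (λ i i<m → ^-congᵐ 2 (q≈ i i<m)) ⟩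
      ⟨ (λ i → (ι 2 * G i - ι 2 * Q₁ - x i) ^ 2) ⟩
        ≈⟨ exact (trans (∑-cong′ m λ i → solve {3} (λ g q x → (# 2 :* g :- # 2 :* q :- x) :^ 2 := # 4 :* (g :* g) :+ (:- (# 8 :* q) :* g :+ (:- # 4 :* (g :* x :^ 1) :+ (# 4 :* q :^ 2 :* x :^ 0 :+ (# 4 :* q :* x :^ 1 :+ (# 1 :* x :^ 2 :+ # 0))))))
              (G i ∷ Q₁ ∷ x i ∷ [])) (⟨linear⟩ terms)) ⟩
      linear-sum terms
        ≈⟨ ⟨GG⟩ ⊕ ⟨Poly⟩≈0 𝔠-supported ⊕ ⟨Poly*x⟩≈0 𝔠-supported ⊕ X-0₁ ⊕ X-1₁ ⊕ X-2₁ ⊕ reflᵐ ⟩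
      _ ≈⟨ exact (solve {2} (λ c q → # 4 :* :- c :+ (:- (# 8 :* q) :* # 0 :+ (:- # 4 :* # 0 :+ (# 4 :* q :^ 2 :* :- # 1 :+ (# 4 :* q :* # 0 :+ (# 1 :* # 0 :+ # 0))))) := :- (# 4 :* c) :- # 4 :* q :^ 2) (conv m ∷ Q₁ ∷ [])) ⟩
      - (ι 4 * conv m) - ι 4 * Q₁ ^ 2 ∎

  -- Since `x i` is `ω i ^ r`, M r is the sum of x q ^ 2; after substituting `q≈` only the term in G
  -- x ^ 2 survives.
  M-r : M r ≈[ 1 ] β
  M-r = small-unit 4 (s≤s z≤n) (ℕₚ.m≤m+n 4 6) (begin
    ι 4 * M r
      ≈⟨ exact (trans (sym (∑-*ˡ m _ _)) (∑-cong′ m λ i → solve {2} (λ x q → # 4 :* (x :* q :^ 2) := x :* (# 2 :* q) :^ 2) (x i ∷ q i ∷ []))) ⟩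
    ⟨ (λ i → x i * (ι 2 * q i) ^ 2) ⟩
      ≈⟨ ∑-congᵐ m (λ i i<m → *-congˡᵐ (^-congᵐ 2 (q≈ i i<m))) ⟩
    ⟨ (λ i → x i * (ι 2 * G i - ι 2 * Q₁ - x i) ^ 2) ⟩
      ≈⟨ exact (trans (∑-cong′ m λ i → solve {3} (λ g q x → x :* (# 2 :* g :- # 2 :* q :- x) :^ 2 := # 4 :* (g :* g :* x :^ 1) :+ (:- (# 8 :* q) :* (g :* x :^ 1) :+ (:- # 4 :* (g :* x :^ 2) :+ (# 4 :* q :^ 2 :* x :^ 1 :+ (# 4 :* q :* x :^ 2 :+ (# 1 :* x :^ 3 :+ # 0))))))
            (G i ∷ Q₁ ∷ x i ∷ [])) (⟨linear⟩ terms)) ⟩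
    linear-sum terms
      ≈⟨ ⟨GGx⟩≈0 ⊕ ⟨Poly*x⟩≈0 𝔠-supported ⊕ ⟨Poly*x²⟩ 𝔠-supported ⊕ X-1₁ ⊕ X-2₁ ⊕ X-3₁ ⊕ reflᵐ ⟩
    _ ≈⟨ exact (solve {2} (λ b q → # 4 :* # 0 :+ (:- (# 8 :* q) :* # 0 :+ (:- # 4 :* :- b :+ (# 4 :* q :^ 2 :* # 0 :+ (# 4 :* q :* # 0 :+ (# 1 :* # 0 :+ # 0))))) := # 4 :* b) (β ∷ Q₁ ∷ [])) ⟩
    ι 4 * β ∎)
    where
    open Reasoning
    terms : List (Carrier × (ℕ → Carrier))
    terms = (ι 4 , λ i → G i * G i * x i ^ 1) ∷ (- (ι 8 * Q₁) , λ i → G i * x i ^ 1) ∷ (- ι 4 , λ i → G i * x i ^ 2) ∷ (ι 4 * Q₁ ^ 2 , λ i → x i ^ 1) ∷ (ι 4 * Q₁ , λ i → x i ^ 2) ∷ (1# , λ i → x i ^ 3) ∷ []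

  -- The surviving terms of the cube are G ^ 3, G ^ 2, G x ^ 2 and the constant; G ^ 2 x drops out
  -- because its exponents are odd.
  Q₃≈ : ι 8 * Q₃ ≈[ 1 ] ι 8 * ⟨GGG⟩ + ι 24 * Q₁ * conv m - ι 6 * β + ι 8 * Q₁ ^ 3
  Q₃≈ = begin
    ι 8 * Q₃
      ≈⟨ exact (trans (sym (∑-*ˡ m _ _)) (∑-cong′ m λ i → solve {1} (λ q → # 8 :* q :^ 3 := (# 2 :* q) :^ 3) (q i ∷ []))) ⟩
    ⟨ (λ i → (ι 2 * q i) ^ 3) ⟩
      ≈⟨ ∑-congᵐ m (λ i i<m → ^-congᵐ 3 (q≈ i i<m)) ⟩
    ⟨ (λ i → (ι 2 * G i - ι 2 * Q₁ - x i) ^ 3) ⟩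
      ≈⟨ exact (trans (∑-cong′ m λ i → solve {3} (λ g q x → (# 2 :* g :- # 2 :* q :- x) :^ 3 :=
            # 8 :* (g :* (g :* g)) :+ (:- (# 24 :* q) :* (g :* g) :+ (:- # 12 :* (g :* g :* x :^ 1) :+ (# 24 :* q :^ 2 :* g :+ (# 24 :* q :* (g :* x :^ 1) :+ (# 6 :* (g :* x :^ 2)
              :+ (:- (# 8 :* q :^ 3) :* x :^ 0 :+ (:- (# 12 :* q :^ 2) :* x :^ 1 :+ (:- (# 6 :* q) :* x :^ 2 :+ (:- # 1 :* x :^ 3 :+ # 0))))))))))
            (G i ∷ Q₁ ∷ x i ∷ [])) (⟨linear⟩ terms)) ⟩
    linear-sum terms
      ≈⟨ reflᵐ ⊕ ⟨GG⟩ ⊕ ⟨GGx⟩≈0 ⊕ ⟨Poly⟩≈0 𝔠-supported ⊕ ⟨Poly*x⟩≈0 𝔠-supported ⊕ ⟨Poly*x²⟩ 𝔠-supported ⊕ X-0₁ ⊕ X-1₁ ⊕ X-2₁ ⊕ X-3₁ ⊕ reflᵐ ⟩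
    _ ≈⟨ exact (solve {4} (λ t c b q → # 8 :* t :+ (:- (# 24 :* q) :* :- c :+ (:- # 12 :* # 0 :+ (# 24 :* q :^ 2 :* # 0 :+ (# 24 :* q :* # 0 :+ (# 6 :* :- b
              :+ (:- (# 8 :* q :^ 3) :* :- # 1 :+ (:- (# 12 :* q :^ 2) :* # 0 :+ (:- (# 6 :* q) :* # 0 :+ (:- # 1 :* # 0 :+ # 0)))))))))
            := # 8 :* t :+ # 24 :* q :* c :- # 6 :* b :+ # 8 :* q :^ 3) (⟨GGG⟩ ∷ conv m ∷ β ∷ Q₁ ∷ [])) ⟩
    ι 8 * ⟨GGG⟩ + ι 24 * Q₁ * conv m - ι 6 * β + ι 8 * Q₁ ^ 3 ∎
    where
    open Reasoning
    terms : List (Carrier × (ℕ → Carrier))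
    terms = (ι 8 , λ i → G i * (G i * G i)) ∷ (- (ι 24 * Q₁) , λ i → G i * G i) ∷ (- ι 12 , λ i → G i * G i * x i ^ 1) ∷ (ι 24 * Q₁ ^ 2 , G) ∷ (ι 24 * Q₁ , λ i → G i * x i ^ 1) ∷ (ι 6 , λ i → G i * x i ^ 2)
      ∷ (- (ι 8 * Q₁ ^ 3) , λ i → x i ^ 0) ∷ (- (ι 12 * Q₁ ^ 2) , λ i → x i ^ 1) ∷ (- (ι 6 * Q₁) , λ i → x i ^ 2) ∷ (- 1# , λ i → x i ^ 3) ∷ []

  n𝔠-last : n𝔠 (r ∸ 1) ≈[ 1 ] - (ι 3 * β)
  n𝔠-last = transᵐ (*-congʳᵐ (begin
    ι (r ∸ 1)                      ≈⟨ exact (solve {1} (λ a → a := (# 3 :+ a) :- # 3) (ι (r ∸ 1) ∷ [])) ⟩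
    ι 3 + ι (r ∸ 1) - ι 3          ≈⟨ +-congʳᵐ (exact (trans (sym (ι-+ 3 (r ∸ 1))) (reflexive (≡.cong ι (≡.cong (ℕ.suc ∘ ℕ.suc) (ℕₚ.m+[n∸m]≡n {1} {r} (ℕₚ.≤-trans (s≤s z≤n) 9≤r))))))) ⟩
    π - ι 3                        ≈⟨ solveMod 1 {0} (λ π → π :- # 3 := :- # 3) [] ⟩
    - ι 3                          ∎)) (exact (solve {1} (λ b → (:- # 3) :* b := :- (# 3 :* b)) (β ∷ [])))
    where open Reasoning

  -- Together with `Q₃≈` this trades the two cubic sums in `𝕋-moments` for Q₃ and `DQ`, in which no
  -- product of generating polynomials is left.
  DQ≈ : ι 4 * DQ ≈[ 1 ] ι 4 * ⟨DGG⟩ - ι 4 * Q₁ * conv m + ι 3 * β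
  DQ≈ = begin
    ι 4 * DQ
      ≈⟨ exact (trans (sym (∑-*ˡ m _ _)) (∑-cong′ m λ i → solve {2} (λ x q → # 4 :* (x :* q :^ 2) := x :* (# 2 :* q) :^ 2) (D i ∷ q i ∷ []))) ⟩
    ⟨ (λ i → D i * (ι 2 * q i) ^ 2) ⟩
      ≈⟨ ∑-congᵐ m (λ i i<m → *-congˡᵐ (^-congᵐ 2 (q≈ i i<m))) ⟩
    ⟨ (λ i → D i * (ι 2 * G i - ι 2 * Q₁ - x i) ^ 2) ⟩
      ≈⟨ exact (trans (∑-cong′ m λ i → solve {4} (λ d g q x → d :* (# 2 :* g :- # 2 :* q :- x) :^ 2 := # 4 :* (d :* (g :* g)) :+ (:- (# 4 :* q) :* (# 2 :* (d :* g)) :+ (:- # 4 :* (d :* g :* x :^ 1) :+ (# 4 :* q :^ 2 :* d :+ (# 4 :* q :* (d :* x :^ 1) :+ (# 1 :* (d :* x :^ 2) :+ # 0))))))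
            (D i ∷ G i ∷ Q₁ ∷ x i ∷ [])) (⟨linear⟩ terms)) ⟩
    linear-sum terms
      ≈⟨ reflᵐ ⊕ transᵐ (exact (∑-*ˡ m (ι 2) _)) ⟨DG⟩ ⊕ ⟨Poly*Poly*x⟩≈0 n𝔠-supported 𝔠-supported ⊕ ⟨Poly⟩≈0 n𝔠-supported ⊕ ⟨Poly*x⟩≈0 n𝔠-supported ⊕ transᵐ (⟨Poly*x²⟩ n𝔠-supported) (-‿congᵐ n𝔠-last) ⊕ reflᵐ ⟩
    _ ≈⟨ exact (solve {4} (λ t c b q → # 4 :* t :+ (:- (# 4 :* q) :* c :+ (:- # 4 :* # 0 :+ (# 4 :* q :^ 2 :* # 0 :+ (# 4 :* q :* # 0 :+ (# 1 :* :- :- (# 3 :* b) :+ # 0))))) := # 4 :* t :- # 4 :* q :* c :+ # 3 :* b) (⟨DGG⟩ ∷ conv m ∷ β ∷ Q₁ ∷ [])) ⟩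
    ι 4 * ⟨DGG⟩ - ι 4 * Q₁ * conv m + ι 3 * β ∎
    where
    open Reasoning
    terms : List (Carrier × (ℕ → Carrier))
    terms = (ι 4 , λ i → D i * (G i * G i)) ∷ (- (ι 4 * Q₁) , λ i → ι 2 * (D i * G i)) ∷ (- ι 4 , λ i → D i * G i * x i ^ 1) ∷ (ι 4 * Q₁ ^ 2 , D) ∷ (ι 4 * Q₁ , λ i → D i * x i ^ 1) ∷ (1# , λ i → D i * x i ^ 2) ∷ []

  𝕋≈ : ι 8 * 𝕋 ≈[ 1 ] - (ι 16 * Q₃) - ι 24 * Q₁ * Q₂ - ι 8 * Q₁ ^ 3 + ι 6 * β - ι 24 * DQ
  𝕋≈ = begin
    ι 8 * 𝕋
      ≈⟨ exact (solve {1} (λ t → # 8 :* t := :- (# 8 :* :- t)) (𝕋 ∷ [])) ⟩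
    - (ι 8 * - 𝕋)
      ≈⟨ -‿congᵐ (*-congˡᵐ (symᵐ 𝕋-moments)) ⟩
    - (ι 8 * (ι 2 * ⟨GGG⟩ + ι 3 * ⟨DGG⟩))
      ≈⟨ exact (solve {5} (λ t d c b q → :- (# 8 :* (# 2 :* t :+ # 3 :* d)) := :- (# 2 :* (# 8 :* t :+ # 24 :* q :* c :- # 6 :* b :+ # 8 :* q :^ 3)) :- # 6 :* (# 4 :* d :- # 4 :* q :* c :+ # 3 :* b) :+ (# 24 :* q :* c :+ # 6 :* b :+ # 16 :* q :^ 3)) (⟨GGG⟩ ∷ ⟨DGG⟩ ∷ conv m ∷ β ∷ Q₁ ∷ [])) ⟩
    - (ι 2 * (ι 8 * ⟨GGG⟩ + ι 24 * Q₁ * conv m - ι 6 * β + ι 8 * Q₁ ^ 3)) - ι 6 * (ι 4 * ⟨DGG⟩ - ι 4 * Q₁ * conv m + ι 3 * β) + (ι 24 * Q₁ * conv m + ι 6 * β + ι 16 * Q₁ ^ 3)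
      ≈⟨ +-congᵐ (+-congᵐ (-‿congᵐ (*-congˡᵐ (symᵐ Q₃≈))) (-‿congᵐ (*-congˡᵐ (symᵐ DQ≈)))) (+-congʳᵐ (+-congʳᵐ (*-congˡᵐ conv≈))) ⟩
    - (ι 2 * (ι 8 * Q₃)) - ι 6 * (ι 4 * DQ) + (ι 24 * Q₁ * - (Q₁ ^ 2 + Q₂) + ι 6 * β + ι 16 * Q₁ ^ 3)
      ≈⟨ exact (solve {5} (λ a b c d e → :- (# 2 :* (# 8 :* c)) :- # 6 :* (# 4 :* d) :+ (# 24 :* a :* :- (a :^ 2 :+ b) :+ # 6 :* e :+ # 16 :* a :^ 3) := :- (# 16 :* c) :- # 24 :* a :* b :- # 8 :* a :^ 3 :+ # 6 :* e :- # 24 :* d) (Q₁ ∷ Q₂ ∷ Q₃ ∷ DQ ∷ β ∷ [])) ⟩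
    - (ι 16 * Q₃) - ι 24 * Q₁ * Q₂ - ι 8 * Q₁ ^ 3 + ι 6 * β - ι 24 * DQ ∎
    where open Reasoning

  -- The index r = p - 2 is odd, so `odd-formula` applies; p - 3 being - 3 and M r being β, it gives
  -- (3 β - β) / 2. The value is needed modulo p ^ 2 because A r is multiplied by A 1, about 1/2, in
  -- Plancherel's formula.
  A-r : A r ≈[ 2 ] π * β
  A-r = small-unit 2 (s≤s z≤n) (s≤s (s≤s z≤n)) (begin
    ι 2 * A r
      ≈⟨ solveMod 2 {3} (λ π a k b → # 2 :* a := :- ((# 1 :- π) :* (π :* (k :+ # 1) :* b :- # 2 :* (# 1 :+ π) :* a)) :+ π :* ((k :+ # 1) :* b)) (A r ∷ ι r ∷ M r ∷ []) ⟩
    - ((1# - π) * (π * (ι r + 1#) * M r - ι 2 * (1# + π) * A r)) + π * ((ι r + 1#) * M r)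
      ≈⟨ +-congᵐ (-‿congᵐ (*-congˡᵐ (symᵐ odd-r))) (π*-cong (*-congᵐ r+1≈-1 M-r)) ⟩
    - ((1# - π) * (π * n𝔠 (r ∸ 1))) + π * (- 1# * β)
      ≈⟨ +-congʳᵐ (-‿congᵐ (*-congˡᵐ (π*-cong n𝔠-last))) ⟩
    - ((1# - π) * (π * - (ι 3 * β))) + π * (- 1# * β)
      ≈⟨ solveMod 2 {1} (λ π b → :- ((# 1 :- π) :* (π :* :- (# 3 :* b))) :+ π :* ((:- # 1) :* b) := # 2 :* (π :* b)) (β ∷ []) ⟩
    ι 2 * (π * β) ∎)
    where
    open Reasoning
    r+1≈-1 : ι r + 1# ≈[ 1 ] - 1#
    r+1≈-1 = transᵐ (exact (trans (+-comm _ _) (sym (ι-suc r)))) ι-m≈-1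
    odd-r : π * n𝔠 (r ∸ 1) ≈[ 2 ] π * (ι r + 1#) * M r - ι 2 * (1# + π) * A r
    odd-r = transᵐ (exact (sym (*-assoc π _ _))) (A-odd₂ r (ℕₚ.≤-trans (ℕₚ.m≤m+n 3 6) 9≤r) r<m (even-suc m-Even))

  private
    Z : Carrier
    Z = ∑ (suc m) (λ n → 𝔠 n * F (m ∸ n))

    -- `PP n` is a summand of Plancherel's formula, scaled by 16 (1 + p) ^ 2 so as to be a product
    -- of two left-hand sides of `A-even`; `RR n` is the product of the right-hand sides, truncated
    -- at p ^ 2.
    PP RR : ℕ → Carrier
    PP n = ι 16 * (1# + π) ^ 2 * (A n * A (m ∸ n))
    RR n = ι 16 * (𝔠 n * 𝔠 (m ∸ n)) - ι 4 * π * (𝔠 n * F (m ∸ n) + 𝔠 (m ∸ n) * F n)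

    even-term : ∀ {a a′ c c′ f f′} → - (ι 4 * (1# + π) * a) ≈[ 2 ] ι 4 * c - π * f → - (ι 4 * (1# + π) * a′) ≈[ 2 ] ι 4 * c′ - π * f′ →
      ι 16 * (1# + π) ^ 2 * (a * a′) ≈[ 2 ] ι 16 * (c * c′) - ι 4 * π * (c * f′ + c′ * f)
    even-term {a} {a′} {c} {c′} {f} {f′} h h′ = begin
      ι 16 * (1# + π) ^ 2 * (a * a′)
        ≈⟨ exact (solve {3} (λ π a b → # 16 :* (# 1 :+ π) :^ 2 :* (a :* b) := (:- (# 4 :* (# 1 :+ π) :* a)) :* (:- (# 4 :* (# 1 :+ π) :* b))) (π ∷ a ∷ a′ ∷ [])) ⟩
      - (ι 4 * (1# + π) * a) * - (ι 4 * (1# + π) * a′)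
        ≈⟨ *-congᵐ h h′ ⟩
      (ι 4 * c - π * f) * (ι 4 * c′ - π * f′)
        ≈⟨ solveMod 2 {4} (λ π c d f g → (# 4 :* c :- π :* f) :* (# 4 :* d :- π :* g) := # 16 :* (c :* d) :- # 4 :* π :* (c :* g :+ d :* f)) (c ∷ c′ ∷ f ∷ f′ ∷ []) ⟩
      ι 16 * (c * c′) - ι 4 * π * (c * f′ + c′ * f) ∎
      where open Reasoning

    middle : ∀ n → 2 ℕ.≤ n → n ℕ.< r → PP n ≈[ 2 ] RR n
    middle n 2≤n n<r with parity n
    ... | inj₁ e = even-term (A-even n 2≤n n<r e) (A-even (m ∸ n) 2≤n′ n′<r (even∸even (ℕₚ.<⇒≤ (ℕₚ.m<n⇒m<1+n n<r)) m-Even e))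
      where
      2≤n′ : 2 ℕ.≤ m ∸ n
      2≤n′ = ℕₚ.≤-trans (ℕₚ.≤-reflexive (≡.sym (≡.trans (ℕₚ.+-∸-assoc 2 (ℕₚ.≤-refl {n})) (≡.cong (2 ℕ.+_) (ℕₚ.n∸n≡0 n))))) (ℕₚ.∸-monoˡ-≤ n (s≤s n<r))
      n′<r : m ∸ n ℕ.< r
      n′<r = ℕₚ.<-≤-trans (ℕₚ.∸-monoʳ-< {m = m} {o = 1} 2≤n (ℕₚ.<⇒≤ (ℕₚ.m<n⇒m<1+n n<r))) ℕₚ.≤-refl
    -- At odd n both moments are multiples of p, so their product is zero modulo p ^ 2 without any
    -- finer information.
    ... | inj₂ o = begin
      PP n
        ≈⟨ *-congˡᵐ (product≈0 {1} {1} (A-odd n 2≤n n<m o) (A-odd (m ∸ n) 2≤n′ n′<m o′)) ⟩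
      ι 16 * (1# + π) ^ 2 * 0#
        ≈⟨ exact (solve {3} (λ π f g → # 16 :* (# 1 :+ π) :^ 2 :* # 0 := # 16 :* (# 0 :* # 0) :- # 4 :* π :* (# 0 :* g :+ # 0 :* f)) (π ∷ F n ∷ F (m ∸ n) ∷ [])) ⟩
      ι 16 * (0# * 0#) - ι 4 * π * (0# * F (m ∸ n) + 0# * F n)
        ≈⟨ +-congᵐ (*-congˡᵐ (*-congᵐ (symᵐ (𝔠-odd n o)) (symᵐ (𝔠-odd (m ∸ n) o′)))) (-‿congᵐ (*-congˡᵐ (+-congᵐ (*-congʳᵐ (symᵐ (𝔠-odd n o))) (*-congʳᵐ (symᵐ (𝔠-odd (m ∸ n) o′)))))) ⟩
      RR n ∎
      where
      open Reasoning
      n<m : n ℕ.< m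
      n<m = ℕₚ.m<n⇒m<1+n n<r
      o′ : Odd (m ∸ n)
      o′ with parity (m ∸ n)
      ... | inj₂ o″ = o″
      ... | inj₁ e  = contradiction o (¬even∧odd (≡.subst Even (ℕₚ.m∸[m∸n]≡n (ℕₚ.<⇒≤ n<m)) (even∸even (ℕₚ.m∸n≤m m n) m-Even e)))
      2≤n′ : 2 ℕ.≤ m ∸ n
      2≤n′ = ℕₚ.≤-trans (ℕₚ.≤-reflexive (≡.sym (≡.trans (ℕₚ.+-∸-assoc 2 (ℕₚ.≤-refl {n})) (≡.cong (2 ℕ.+_) (ℕₚ.n∸n≡0 n))))) (ℕₚ.∸-monoˡ-≤ n (s≤s n<r))
      n′<m : m ∸ n ℕ.< m
      n′<m = ℕₚ.∸-monoʳ-< {o = 0} (ℕₚ.<-≤-trans (s≤s z≤n) 2≤n) (ℕₚ.<⇒≤ n<m)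

    2≤r : 2 ℕ.≤ r
    2≤r = ℕₚ.≤-trans (ℕₚ.m≤m+n 2 7) 9≤r

    edges : ∀ f → ∑ m f ≈ f 0 + (f 1 + ∑ (r ∸ 2) (λ n → f (2 ℕ.+ n))) + f r
    edges f = +-congʳ (∑-cons₂ r 2≤r f)

    RR-edge : ∀ n → 𝔠 n ≈ 0# → 𝔠 (m ∸ n) ≈ 0# → RR n ≈ 0#
    RR-edge n h h′ = trans (+-cong (*-congˡ (*-cong h h′)) (-‿cong (*-congˡ (+-cong (*-congʳ h) (*-congʳ h′)))))
      (solve {3} (λ π f g → # 16 :* (# 0 :* # 0) :- # 4 :* π :* (# 0 :* g :+ # 0 :* f) := # 0) (π ∷ F n ∷ F (m ∸ n) ∷ []))

    -- The indices 0, 1 and r are set apart: 𝔠 is zero there by convention and does not describe A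
    -- to the required precision. As RR vanishes at these indices and at m, the middle sum completes
    -- to a full one.
    ∑PP : ∑ m PP ≈[ 2 ] PP 0 + PP 1 + PP r + ∑ (suc m) RR
    ∑PP = begin
      ∑ m PP
        ≈⟨ exact (edges PP) ⟩
      PP 0 + (PP 1 + ∑ (r ∸ 2) (λ n → PP (2 ℕ.+ n))) + PP r
        ≈⟨ +-congʳᵐ (+-congˡᵐ (+-congˡᵐ (∑-congᵐ (r ∸ 2) λ n n< → middle (2 ℕ.+ n) (s≤s (s≤s z≤n)) (≡.subst (2 ℕ.+ n ℕ.<_) (ℕₚ.m+[n∸m]≡n 2≤r) (ℕₚ.+-monoʳ-< 2 n<))))) ⟩
      PP 0 + (PP 1 + ∑ (r ∸ 2) (λ n → RR (2 ℕ.+ n))) + PP r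
        ≈⟨ exact (solve {4} (λ a b c s → a :+ (b :+ s) :+ c := a :+ b :+ c :+ ((# 0 :+ (# 0 :+ s) :+ # 0) :+ # 0)) (PP 0 ∷ PP 1 ∷ PP r ∷ ∑ (r ∸ 2) (λ n → RR (2 ℕ.+ n)) ∷ [])) ⟩
      PP 0 + PP 1 + PP r + ((0# + (0# + ∑ (r ∸ 2) (λ n → RR (2 ℕ.+ n))) + 0#) + 0#)
        ≈⟨ exact (+-congˡ (+-cong (+-cong (+-cong (sym (RR-edge 0 refl 𝔠-m)) (+-congʳ (sym (RR-edge 1 refl (𝔠-high r ℕₚ.≤-refl))))) (sym (RR-edge r (𝔠-high r ℕₚ.≤-refl) (reflexive (≡.cong 𝔠 m∸r)))))
             (sym (RR-edge m 𝔠-m (reflexive (≡.cong 𝔠 (ℕₚ.n∸n≡0 m))))))) ⟩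
      PP 0 + PP 1 + PP r + (RR 0 + (RR 1 + ∑ (r ∸ 2) (λ n → RR (2 ℕ.+ n))) + RR r + RR m)
        ≈⟨ exact (+-congˡ (+-congʳ (sym (edges RR)))) ⟩
      PP 0 + PP 1 + PP r + ∑ (suc m) RR ∎
      where
      open Reasoning
      m∸r : m ∸ r ≡ 1
      m∸r = ≡.trans (ℕₚ.+-∸-assoc 1 (ℕₚ.≤-refl {r})) (≡.cong suc (ℕₚ.n∸n≡0 r))

    ∑RR : ∑ (suc m) RR ≈ ι 16 * conv m - ι 8 * π * Z
    ∑RR = begin
      ∑ (suc m) RR
        ≈⟨ ∑-cong′ (suc m) (λ n → solve {4} (λ π c a b → # 16 :* c :- # 4 :* π :* (a :+ b) := # 16 :* c :+ (:- (# 4 :* π)) :* (a :+ b)) (π ∷ 𝔠 n * 𝔠 (m ∸ n) ∷ 𝔠 n * F (m ∸ n) ∷ 𝔠 (m ∸ n) * F n ∷ [])) ⟩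
      ∑ (suc m) (λ n → ι 16 * (𝔠 n * 𝔠 (m ∸ n)) + - (ι 4 * π) * (𝔠 n * F (m ∸ n) + 𝔠 (m ∸ n) * F n))
        ≈⟨ trans (∑-+ (suc m) _ _) (+-cong (∑-*ˡ (suc m) _ _) (trans (∑-*ˡ (suc m) _ _) (*-congˡ (∑-+ (suc m) _ _)))) ⟩
      ι 16 * conv m + - (ι 4 * π) * (Z + ∑ (suc m) (λ n → 𝔠 (m ∸ n) * F n))
        ≈⟨ +-congˡ (*-congˡ (+-congˡ (trans (sym (∑-rev (suc m) _)) (∑-cong (suc m) λ n n≤m → *-congʳ (reflexive (≡.cong 𝔠 (ℕₚ.m∸[m∸n]≡n (ℕₚ.≤-pred n≤m)))))))) ⟩
      ι 16 * conv m + - (ι 4 * π) * (Z + Z)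
        ≈⟨ solve {3} (λ π c z → # 16 :* c :+ (:- (# 4 :* π)) :* (z :+ z) := # 16 :* c :- # 8 :* π :* z) (π ∷ conv m ∷ Z ∷ []) ⟩
      ι 16 * conv m - ι 8 * π * Z ∎
      where open ≈-Reasoning

  DQ-sum : DQ ≈[ 1 ] ∑ m (λ n → n𝔠 n * M (m ∸ n))
  DQ-sum = begin
    DQ
      ≈⟨ exact (∑-cong′ m λ i → trans (sym (∑-*ʳ m _ _)) (∑-cong′ m λ n → *-assoc _ _ _)) ⟩
    ∑ m (λ i → ∑ m (λ n → n𝔠 n * (x i ^ n * q i ^ 2)))
      ≈⟨ exact (trans (∑-swap m m _) (∑-cong′ m λ n → ∑-*ˡ m _ _)) ⟩
    ∑ m (λ n → n𝔠 n * ⟨ (λ i → x i ^ n * q i ^ 2) ⟩)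
      ≈⟨ ∑-congᵐ m (λ n n<m → *-congˡᵐ (∑-congᵐ m λ i i<m → *-congʳᵐ (reduce (s≤s z≤n) (x^≈ω^ i n i<m (ℕₚ.<⇒≤ n<m))))) ⟩
    ∑ m (λ n → n𝔠 n * M (m ∸ n)) ∎
    where open Reasoning

  private
    -- The factor (m - n) + 1 in F is - n modulo p, which turns 𝔠 into n 𝔠 and the sum into DQ; κ
    -- picks out the single index n = p - 3.
    Z≈ : Z ≈[ 1 ] β - ι 2 * DQ
    Z≈ = begin
      Z
        ≈⟨ exact (trans (+-congˡ (trans (*-congʳ 𝔠-m) (zeroˡ _))) (+-identityʳ _)) ⟩
      ∑ m (λ n → 𝔠 n * F (m ∸ n))
        ≈⟨ ∑-congᵐ m (λ n n<m → step n (ℕₚ.<⇒≤ n<m)) ⟩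
      ∑ m (λ n → - ι 2 * (n𝔠 n * M (m ∸ n)) + 𝔠 n * κ (m ∸ n))
        ≈⟨ exact (trans (∑-+ m _ _) (+-congʳ (∑-*ˡ m _ _))) ⟩
      - ι 2 * ∑ m (λ n → n𝔠 n * M (m ∸ n)) + ∑ m (λ n → 𝔠 n * κ (m ∸ n))
        ≈⟨ +-congᵐ (*-congˡᵐ (symᵐ DQ-sum)) (∑-pickᵐ m (r ∸ 1) (ℕₚ.≤-<-trans (ℕₚ.m∸n≤m r 1) r<m) (λ n n<m n≢ → transᵐ (*-congˡᵐ (exact (κ-rest n n<m n≢))) (exact (zeroʳ _)))) ⟩
      - ι 2 * DQ + β * κ (m ∸ (r ∸ 1))
        ≈⟨ exact (+-congˡ (*-congˡ (reflexive (≡.cong κ m∸)))) ⟩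
      - ι 2 * DQ + β * 1#
        ≈⟨ exact (solve {2} (λ d b → (:- # 2) :* d :+ b :* # 1 := b :- # 2 :* d) (DQ ∷ β ∷ [])) ⟩
      β - ι 2 * DQ ∎
      where
      open Reasoning
      m∸ : m ∸ (r ∸ 1) ≡ 2
      m∸ = ≡.trans (≡.cong (_∸ (r ∸ 1)) (≡.sym 2+r∸1)) (ℕₚ.m+n∸m≡n (r ∸ 1) 2)
      κ-rest : ∀ n → n ℕ.< m → n ≢ r ∸ 1 → κ (m ∸ n) ≈ 0#
      κ-rest n n<m n≢ = κ-other (m ∸ n) (λ e → n≢ (≡.trans (≡.sym (ℕₚ.m∸[m∸n]≡n (ℕₚ.<⇒≤ n<m))) (≡.trans (≡.cong (m ∸_) e) (≡.trans (≡.cong (_∸ 2) (≡.sym 2+r∸1)) (ℕₚ.m+n∸n≡m (r ∸ 1) 2)))))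
      step : ∀ n → n ℕ.≤ m → 𝔠 n * F (m ∸ n) ≈[ 1 ] - ι 2 * (n𝔠 n * M (m ∸ n)) + 𝔠 n * κ (m ∸ n)
      step n n≤m = begin
        𝔠 n * (ι 2 * (ι (m ∸ n) + 1#) * M (m ∸ n) + κ (m ∸ n))
          ≈⟨ *-congˡᵐ (+-congʳᵐ (*-congʳᵐ (*-congˡᵐ (+-congʳᵐ (transᵐ (exact (ι-∸ n≤m)) (+-congʳᵐ ι-m≈-1)))))) ⟩
        𝔠 n * (ι 2 * (- 1# - ι n + 1#) * M (m ∸ n) + κ (m ∸ n))
          ≈⟨ exact (solve {4} (λ c n b k → c :* (# 2 :* (:- # 1 :- n :+ # 1) :* b :+ k) := (:- # 2) :* (n :* c :* b) :+ c :* k) (𝔠 n ∷ ι n ∷ M (m ∸ n) ∷ κ (m ∸ n) ∷ [])) ⟩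
        - ι 2 * (n𝔠 n * M (m ∸ n)) + 𝔠 n * κ (m ∸ n) ∎

  -- Plancherel's formula for q against itself, solved for the convolution: the full sum gives (p -
  -- 1) Q₂, the index 0 gives Q₁ ^ 2, the indices 1 and r together give p β, and the corrections of
  -- order p add up to Z.
  conv≈₂ : ι 2 * conv m ≈[ 2 ] - (ι 2 * (1# + π) * Q₂) - ι 2 * (1# + ι 2 * π) * Q₁ ^ 2 - π * β - ι 2 * π * DQ
  conv≈₂ = small-unit 8 (s≤s z≤n) (ℕₚ.m≤m+n 8 2) (begin
    ι 8 * (ι 2 * conv m)
      ≈⟨ exact (solve {5} (λ π c z a b → # 8 :* (# 2 :* c) := (a :+ b :+ (# 16 :* c :- # 8 :* π :* z)) :- a :- b :+ # 8 :* (π :* z)) (π ∷ conv m ∷ Z ∷ PP 0 ∷ PP 1 + PP r ∷ [])) ⟩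
    PP 0 + (PP 1 + PP r) + (ι 16 * conv m - ι 8 * π * Z) - PP 0 - (PP 1 + PP r) + ι 8 * (π * Z)
      ≈⟨ +-congʳᵐ (+-congʳᵐ (+-congʳᵐ (transᵐ (+-congᵐ (exact (sym (+-assoc _ _ _))) (exact (sym ∑RR))) (symᵐ ∑PP)))) ⟩
    ∑ m PP - PP 0 - (PP 1 + PP r) + ι 8 * (π * Z)
      ≈⟨ +-congᵐ (+-congᵐ (+-congᵐ total (-‿congᵐ PP-0)) (-‿congᵐ PP-1-r)) (*-congˡᵐ (π*-cong Z≈)) ⟩
    ι 16 * (1# + π) ^ 2 * ((π - 1#) * Q₂) - ι 16 * (1# + π) ^ 2 * (Q₁ * Q₁) - ι 16 * (1# + π) ^ 2 * (π * β) + ι 8 * (π * (β - ι 2 * DQ))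
      ≈⟨ solveMod 2 {4} (λ π a b e d → # 16 :* (# 1 :+ π) :^ 2 :* ((π :- # 1) :* b) :- # 16 :* (# 1 :+ π) :^ 2 :* (a :* a) :- # 16 :* (# 1 :+ π) :^ 2 :* (π :* e) :+ # 8 :* (π :* (e :- # 2 :* d))
           := # 8 :* (:- (# 2 :* (# 1 :+ π) :* b) :- # 2 :* (# 1 :+ # 2 :* π) :* a :^ 2 :- π :* e :- # 2 :* π :* d)) (Q₁ ∷ Q₂ ∷ β ∷ DQ ∷ []) ⟩
    ι 8 * (- (ι 2 * (1# + π) * Q₂) - ι 2 * (1# + ι 2 * π) * Q₁ ^ 2 - π * β - ι 2 * π * DQ) ∎)
    where
    open Reasoning
    total : ∑ m PP ≈[ 2 ] ι 16 * (1# + π) ^ 2 * ((π - 1#) * Q₂)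
    total = transᵐ (exact (∑-*ˡ m _ _)) (*-congˡᵐ (transᵐ (reduce (s≤s (s≤s z≤n)) (plancherel q q))
      (exact (*-cong ι-m (∑-cong′ m λ i → solve {1} (λ q → q :* q := q :^ 2) (q i ∷ []))))))
    PP-0 : PP 0 ≈[ 2 ] ι 16 * (1# + π) ^ 2 * (Q₁ * Q₁)
    PP-0 = *-congˡᵐ (*-congᵐ (exact A-0) (transᵐ (exact (reflexive (≡.cong A (≡.sym (ℕₚ.+-identityʳ m))))) (transᵐ (reduce (s≤s (s≤s z≤n)) (A-periodic 0)) (exact A-0))))
    PP-1-r : PP 1 + PP r ≈[ 2 ] ι 16 * (1# + π) ^ 2 * (π * β)
    PP-1-r = begin
      PP 1 + PP r
        ≈⟨ exact (+-congˡ (*-congˡ (*-congˡ (reflexive (≡.cong A (≡.trans (ℕₚ.+-∸-assoc 1 (ℕₚ.≤-refl {r})) (≡.cong suc (ℕₚ.n∸n≡0 r)))))))) ⟩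
      ι 16 * (1# + π) ^ 2 * (A 1 * A r) + ι 16 * (1# + π) ^ 2 * (A r * A 1)
        ≈⟨ exact (solve {3} (λ c a b → c :* (a :* b) :+ c :* (b :* a) := c :* ((# 2 :* a) :* b)) (ι 16 * (1# + π) ^ 2 ∷ A 1 ∷ A r ∷ [])) ⟩
      ι 16 * (1# + π) ^ 2 * (ι 2 * A 1 * A r)
        ≈⟨ *-congˡᵐ (transᵐ (*-congˡᵐ A-r) (transᵐ (exact (solve {3} (λ a π b → a :* (π :* b) := π :* (a :* b)) (ι 2 * A 1 ∷ π ∷ β ∷ []))) (π*-cong (transᵐ (*-congʳᵐ (odd-formula-1 1 ≡.refl)) (exact (*-identityˡ β)))))) ⟩
      ι 16 * (1# + π) ^ 2 * (π * β) ∎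

  -- Kummer congruences modulo p ^ 2

  1≤3 : 1 ℕ.≤ 3
  1≤3 = s≤s z≤n

  2≤3 : 2 ℕ.≤ 3
  2≤3 = s≤s (s≤s z≤n)

  m+j≡p+[j-1] : ∀ j → 0 ℕ.< j → p ℕ.+ (j ∸ 1) ≡ m ℕ.+ j
  m+j≡p+[j-1] (suc j) _ = ≡.sym (ℕₚ.+-suc m j)

  p∤m+j : ∀ j → 2 ℕ.≤ j → j ℕ.< m → ¬ (p ∣ m ℕ.+ j)
  p∤m+j j 2≤j j<m = ≡.subst (λ z → ¬ (p ∣ z)) (m+j≡p+[j-1] j (ℕₚ.≤-trans (s≤s z≤n) 2≤j))
    (p∤p+n (j ∸ 1) (ℕₚ.m<n⇒0<n∸m 2≤j) (ℕₚ.≤-<-trans (ℕₚ.m∸n≤m j 1) (ℕₚ.m<n⇒m<1+n j<m)))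

  s-shift≈0 : ∀ j → 0 ℕ.< j → j ℕ.< m → s (m ℕ.+ j) ≈[ 3 ] 0#
  s-shift≈0 j 0<j j<m = transᵐ (s-periodic j) (s≈0 j 0<j j<m)

  shifted-exists : ∀ j → 2 ℕ.≤ j → j ℕ.< m → ∃ (DividedBernoulli (m ℕ.+ j))
  shifted-exists j 2≤j j<m = dividedBernoulli (m ℕ.+ j) (ℕₚ.<-≤-trans (s≤s z≤n) (ℕₚ.m≤m+n m j)) (p∤m+j j 2≤j j<m) (s-shift≈0 j (ℕₚ.≤-trans (s≤s z≤n) 2≤j) j<m)

  shifted-formula : ∀ j {β′} → 2 ℕ.≤ j → j ℕ.< m → Even j → DividedBernoulli (m ℕ.+ j) β′ →
    ι 2 * β′ ≈[ 2 ] π * (ι m + ι j + 1#) * M j - ι 2 * (1# + π) * A j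
  shifted-formula j {β′} 2≤j j<m even d = begin
    ι 2 * β′
      ≈⟨ even-formula N (ℕₚ.≤-trans (ℕₚ.m≤m+n 4 6) (ℕₚ.≤-trans 10≤m (ℕₚ.m≤m+n m j))) (even+even m-Even even) (p∤m+j j 2≤j j<m) (s-shift≈0 j 0<j j<m) low d ⟩
    π * (ι N + 1#) * M N - ι 2 * (1# + π) * A N
      ≈⟨ +-congᵐ (*-congᵐ (*-congˡᵐ (+-congʳᵐ (exact (ι-+ m j)))) (reduce 2≤3 (M-periodic j))) (-‿congᵐ (*-congˡᵐ (reduce 2≤3 (A-periodic j)))) ⟩
    π * (ι m + ι j + 1#) * M j - ι 2 * (1# + π) * A j ∎
    where
    open Reasoning
    N = m ℕ.+ j
    0<j : 0 ℕ.< j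
    0<j = ℕₚ.≤-trans (s≤s z≤n) 2≤j
    low : ι N * (ι N - 1#) * b (N ∸ 2) ≈[ 1 ] 0#
    low with j ℕ.≟ 2
    -- Here N - 2 is p - 1, where b is not divisible by p, but N - 1 is p.
    ... | yes j≡2 = transᵐ (*-congʳᵐ (*-congˡᵐ (begin
      ι N - 1#            ≈⟨ exact (+-congʳ (trans (reflexive (≡.cong ι (≡.trans (≡.cong (m ℕ.+_) j≡2) (≡.trans (ℕₚ.+-comm m 2) ≡.refl)))) (ι-suc p))) ⟩
      1# + π - 1#         ≈⟨ solveMod 1 {0} (λ π → # 1 :+ π :- # 1 := # 0) [] ⟩
      0#                  ∎))) (exact (trans (*-congʳ (zeroʳ _)) (zeroˡ _)))
    ... | no  j≢2 = transᵐ (*-congˡᵐ (transᵐ (b≈s (N ∸ 2) 0<N-2) (transᵐ (exact (reflexive (≡.cong s (ℕₚ.+-∸-assoc m 2≤j))))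
        (reduce 1≤3 (s-shift≈0 (j ∸ 2) 0<j-2 (ℕₚ.≤-<-trans (ℕₚ.m∸n≤m j 2) j<m)))))) (exact (zeroʳ _))
      where
      0<j-2 : 0 ℕ.< j ∸ 2
      0<j-2 = ℕₚ.m<n⇒0<n∸m (ℕₚ.≤∧≢⇒< 2≤j (j≢2 ∘ ≡.sym))
      0<N-2 : 0 ℕ.< N ∸ 2
      0<N-2 = ≡.subst (0 ℕ.<_) (≡.sym (ℕₚ.+-∸-assoc m 2≤j)) (ℕₚ.<-≤-trans 0<j-2 (ℕₚ.m≤n+m (j ∸ 2) m))

  unshifted-formula : ∀ j → 2 ℕ.≤ j → j ℕ.< r → Even j → ι 4 * 𝔠 j ≈[ 2 ] π * κ j + ι 2 * (π * (ι j + 1#) * M j - ι 2 * (1# + π) * A j)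
  unshifted-formula j 2≤j j<r even = begin
    ι 4 * 𝔠 j                                          ≈⟨ exact (solve {3} (λ c π f → # 4 :* c := (# 4 :* c :- π :* f) :+ π :* f) (𝔠 j ∷ π ∷ F j ∷ [])) ⟩
    ι 4 * 𝔠 j - π * F j + π * F j                      ≈⟨ +-congʳᵐ (symᵐ (A-even j 2≤j j<r even)) ⟩
    - (ι 4 * (1# + π) * A j) + π * F j                 ≈⟨ exact (solve {5} (λ π n a b k → :- (# 4 :* (# 1 :+ π) :* a) :+ π :* (# 2 :* (n :+ # 1) :* b :+ k)
                                                            := π :* k :+ # 2 :* (π :* (n :+ # 1) :* b :- # 2 :* (# 1 :+ π) :* a)) (π ∷ ι j ∷ A j ∷ M j ∷ κ j ∷ [])) ⟩
    π * κ j + ι 2 * (π * (ι j + 1#) * M j - ι 2 * (1# + π) * A j) ∎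
    where open Reasoning

  -- A and M have period p - 1, so the formulas for both Bernoulli numbers differ only in the factor
  -- n + 1 of M, which drops by 1 modulo p when p - 1 is added to n, and in the exceptional term κ.
  kummer : ∀ j {β′} → 2 ℕ.≤ j → j ℕ.< r → Even j → DividedBernoulli (m ℕ.+ j) β′ → ι 4 * β′ ≈[ 2 ] ι 4 * 𝔠 j - π * κ j - ι 2 * π * M j
  kummer j {β′} 2≤j j<r even d = begin
    ι 4 * β′
      ≈⟨ exact (solve {1} (λ a → # 4 :* a := # 2 :* (# 2 :* a)) (β′ ∷ [])) ⟩
    ι 2 * (ι 2 * β′)
      ≈⟨ *-congˡᵐ (shifted-formula j 2≤j (ℕₚ.m<n⇒m<1+n j<r) even d) ⟩
    ι 2 * (π * (ι m + ι j + 1#) * M j - ι 2 * (1# + π) * A j)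
      ≈⟨ *-congˡᵐ (+-congʳᵐ (*-congʳᵐ (*-congˡᵐ (+-congʳᵐ (+-congʳᵐ (exact ι-m)))))) ⟩
    ι 2 * (π * (π - 1# + ι j + 1#) * M j - ι 2 * (1# + π) * A j)
      ≈⟨ solveMod 2 {4} (λ π n a b k → # 2 :* (π :* (π :- # 1 :+ n :+ # 1) :* b :- # 2 :* (# 1 :+ π) :* a)
           := (π :* k :+ # 2 :* (π :* (n :+ # 1) :* b :- # 2 :* (# 1 :+ π) :* a)) :- π :* k :- # 2 :* π :* b) (ι j ∷ A j ∷ M j ∷ κ j ∷ []) ⟩
    π * κ j + ι 2 * (π * (ι j + 1#) * M j - ι 2 * (1# + π) * A j) - π * κ j - ι 2 * π * M j
      ≈⟨ +-congʳᵐ (+-congʳᵐ (symᵐ (unshifted-formula j 2≤j j<r even))) ⟩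
    ι 4 * 𝔠 j - π * κ j - ι 2 * π * M j ∎
    where open Reasoning

  kummer₁ : ∀ j {β′} → 2 ℕ.≤ j → j ℕ.< r → Even j → DividedBernoulli (m ℕ.+ j) β′ → β′ ≈[ 1 ] 𝔠 j
  kummer₁ j {β′} 2≤j j<r even d = small-unit 4 (s≤s z≤n) (ℕₚ.m≤m+n 4 6) (transᵐ (reduce (s≤s z≤n) (kummer j 2≤j j<r even d))
    (solveMod 1 {3} (λ π c k b → # 4 :* c :- π :* k :- # 2 :* π :* b := # 4 :* c) (𝔠 j ∷ κ j ∷ M j ∷ [])))

  kummer-quotient : ∀ j {β′ δ} → 2 ℕ.< j → j ℕ.< r → Even j → DividedBernoulli (m ℕ.+ j) β′ → β′ ≈ 𝔠 j + π * δ → ι 2 * δ ≈[ 1 ] - M j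
  kummer-quotient j {β′} {δ} 2<j j<r even d e = small-unit 2 (s≤s z≤n) (s≤s (s≤s z≤n)) (π-cancel (begin
    π * (ι 2 * (ι 2 * δ))                                ≈⟨ exact (solve {3} (λ π δ c → π :* (# 2 :* (# 2 :* δ)) := # 4 :* (c :+ π :* δ) :- # 4 :* c) (π ∷ δ ∷ 𝔠 j ∷ [])) ⟩
    ι 4 * (𝔠 j + π * δ) - ι 4 * 𝔠 j                      ≈⟨ +-congʳᵐ (*-congˡᵐ (exact (sym e))) ⟩
    ι 4 * β′ - ι 4 * 𝔠 j                                 ≈⟨ +-congʳᵐ (kummer j (ℕₚ.<⇒≤ 2<j) j<r even d) ⟩
    ι 4 * 𝔠 j - π * κ j - ι 2 * π * M j - ι 4 * 𝔠 j      ≈⟨ +-congʳᵐ (+-congʳᵐ (+-congˡᵐ (-‿congᵐ (*-congˡᵐ (exact (κ-other j λ { ≡.refl → ℕₚ.n≮n 2 2<j })))))) ⟩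
    ι 4 * 𝔠 j - π * 0# - ι 2 * π * M j - ι 4 * 𝔠 j       ≈⟨ exact (solve {3} (λ π b c → # 4 :* c :- π :* # 0 :- # 2 :* π :* b :- # 4 :* c := π :* (# 2 :* :- b)) (π ∷ M j ∷ 𝔠 j ∷ [])) ⟩
    π * (ι 2 * - M j)                                    ∎))
    where open Reasoning

  -- B (p + 1) = (1 + p θ) / 12 with θ = - 2 - 6 M 2 modulo p.
  B[p+1] : ∀ {β′ θ} → ι 12 * 𝔠 2 ≈ 1# → DividedBernoulli (m ℕ.+ 2) β′ → ι 12 * ((1# + π) * β′) ≈ 1# + π * θ → θ ≈[ 1 ] - ι 2 - ι 6 * M 2
  B[p+1] {β′} {θ} c₂ d e = π-cancel (begin
    π * θ                                                        ≈⟨ exact (solve {2} (λ π θ → π :* θ := (# 1 :+ π :* θ) :- # 1) (π ∷ θ ∷ [])) ⟩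
    1# + π * θ - 1#                                              ≈⟨ +-congʳᵐ (exact (sym e)) ⟩
    ι 12 * ((1# + π) * β′) - 1#                                  ≈⟨ exact (solve {2} (λ π b → # 12 :* ((# 1 :+ π) :* b) :- # 1 := # 3 :* (# 1 :+ π) :* (# 4 :* b) :- # 1) (π ∷ β′ ∷ [])) ⟩
    ι 3 * (1# + π) * (ι 4 * β′) - 1#                             ≈⟨ +-congʳᵐ (*-congˡᵐ (kummer 2 ℕₚ.≤-refl 2<r (1 , ≡.refl) d)) ⟩
    ι 3 * (1# + π) * (ι 4 * 𝔠 2 - π * 1# - ι 2 * π * M 2) - 1#   ≈⟨ exact (solve {3} (λ π c b → # 3 :* (# 1 :+ π) :* (# 4 :* c :- π :* # 1 :- # 2 :* π :* b) :- # 1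
                                                                       := (# 1 :+ π) :* (# 12 :* c) :- # 3 :* (# 1 :+ π) :* (π :+ # 2 :* π :* b) :- # 1) (π ∷ 𝔠 2 ∷ M 2 ∷ [])) ⟩
    (1# + π) * (ι 12 * 𝔠 2) - ι 3 * (1# + π) * (π + ι 2 * π * M 2) - 1#
                                                                 ≈⟨ +-congʳᵐ (+-congʳᵐ (*-congˡᵐ (exact c₂))) ⟩
    (1# + π) * 1# - ι 3 * (1# + π) * (π + ι 2 * π * M 2) - 1#    ≈⟨ solveMod 2 {1} (λ π b → (# 1 :+ π) :* # 1 :- # 3 :* (# 1 :+ π) :* (π :+ # 2 :* π :* b) :- # 1 := π :* (:- # 2 :- # 6 :* b)) (M 2 ∷ []) ⟩
    π * (- ι 2 - ι 6 * M 2)                                      ∎)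
    where
    open Reasoning
    2<r : 2 ℕ.< r
    2<r = ℕₚ.≤-trans (ℕₚ.m≤m+n 3 6) 9≤r

  -- The numbers p B (k (p - 1)) modulo p ^ 4

  m-even-4≤ : ∀ k → 4 ℕ.≤ suc k ℕ.* m
  m-even-4≤ k = ℕₚ.≤-trans (ℕₚ.≤-trans (ℕₚ.m≤m+n 4 6) 10≤m) (ℕₚ.m≤m+n m (k ℕ.* m))

  *m-even : ∀ k → Even (k ℕ.* m)
  *m-even zero    = 0 , ≡.refl
  *m-even (suc k) = even+even m-Even (*m-even k)

  A-periodic* : ∀ k n → A (k ℕ.* m ℕ.+ n) ≈[ 3 ] A n
  A-periodic* zero    n = reflᵐ
  A-periodic* (suc k) n = transᵐ (exact (reflexive (≡.cong A (ℕₚ.+-assoc m (k ℕ.* m) n)))) (transᵐ (A-periodic (k ℕ.* m ℕ.+ n)) (A-periodic* k n))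

  s-periodic* : ∀ k n → s (k ℕ.* m ℕ.+ n) ≈[ 3 ] s n
  s-periodic* zero    n = reflᵐ
  s-periodic* (suc k) n = transᵐ (exact (reflexive (≡.cong s (ℕₚ.+-assoc m (k ℕ.* m) n)))) (transᵐ (s-periodic (k ℕ.* m ℕ.+ n)) (s-periodic* k n))

  b≈₂ : ∀ n → 4 ℕ.≤ n → Even n → s n ≈[ 3 ] 0# → b n ≈[ 2 ] - (π * (ι n * A n))
  b≈₂ n 4≤n even sn≈0 = small-unit 2 (s≤s z≤n) (s≤s (s≤s z≤n)) (begin
    ι 2 * b n
      ≈⟨ *-congˡᵐ (cancel-24 (symᵐ S≈)) ⟩
    ι 2 * S n
      ≈⟨ reduce 2≤3 (powerSum-expansion n sn≈0) ⟩
    π * (ι n * (π * (ι n + 1#) * M n - ι 2 * (1# + π) * A n))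
      ≈⟨ solveMod 2 {3} (λ π n a b → π :* (n :* (π :* (n :+ # 1) :* b :- # 2 :* (# 1 :+ π) :* a)) := # 2 :* :- (π :* (n :* a))) (ι n ∷ A n ∷ M n ∷ []) ⟩
    ι 2 * - (π * (ι n * A n)) ∎)
    where
    open Reasoning
    0<n : 0 ℕ.< n
    0<n = ℕₚ.≤-trans (s≤s z≤n) 4≤n
    odd₁ : Odd (n ∸ 1)
    odd₁ = even-suc (≡.subst Even (≡.sym (ℕₚ.m+[n∸m]≡n {1} {n} 0<n)) even)
    S≈ : ι 24 * S n ≈[ 2 ] ι 24 * b n
    S≈ = begin
      ι 24 * S n
        ≈⟨ reduce 2≤3 (b-faulhaber₃ n 0<n) ⟩
      ι 24 * b n + ι 12 * ι n * π * b (n ∸ 1) + ι 4 * (ι n * (ι n - 1#)) * π ^ 2 * b (n ∸ 2)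
        ≈⟨ +-congʳᵐ (+-congˡᵐ (*-congˡᵐ (exact (b-odd″ (n ∸ 1) (ℕₚ.∸-monoˡ-≤ 1 4≤n) odd₁)))) ⟩
      ι 24 * b n + ι 12 * ι n * π * 0# + ι 4 * (ι n * (ι n - 1#)) * π ^ 2 * b (n ∸ 2)
        ≈⟨ solveMod 2 {3} (λ π n b₀ b₂ → # 24 :* b₀ :+ # 12 :* n :* π :* # 0 :+ # 4 :* (n :* (n :- # 1)) :* π :^ 2 :* b₂ := # 24 :* b₀) (ι n ∷ b n ∷ b (n ∸ 2) ∷ []) ⟩
      ι 24 * b n ∎

  -- Write K for `suc k`. The term of Faulhaber's formula with b (n - 2) survives at order p ^ 3: n
  -- is - K modulo p and b (n - 2) is - (K + 2) p β modulo p ^ 2, whence the binomial coefficient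
  -- C(K + 2, 3).
  b-multiple : ∀ k → ι 6 * b (suc k ℕ.* m) ≈[ 4 ] ι 6 * S (suc k ℕ.* m) + ι (suc k) * (ι (suc k) + 1#) * (ι (suc k) + ι 2) * π ^ 3 * β
  b-multiple k = small-unit 4 (s≤s z≤n) (ℕₚ.m≤m+n 4 6) (begin
    ι 4 * (ι 6 * b n)
      ≈⟨ exact (solve {2} (λ b₀ t → # 4 :* (# 6 :* b₀) := (# 24 :* b₀ :+ t) :- t) (b n ∷ ι 4 * (ι n * (ι n - 1#)) * π ^ 2 * b (n ∸ 2) ∷ [])) ⟩
    ι 24 * b n + ι 4 * (ι n * (ι n - 1#)) * π ^ 2 * b (n ∸ 2) - ι 4 * (ι n * (ι n - 1#)) * π ^ 2 * b (n ∸ 2)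
      ≈⟨ +-congʳᵐ (symᵐ S≈) ⟩
    ι 24 * S n - ι 4 * (ι n * (ι n - 1#)) * π ^ 2 * b (n ∸ 2)
      ≈⟨ exact (solve {4} (λ s n π b₂ → # 24 :* s :- # 4 :* (n :* (n :- # 1)) :* π :^ 2 :* b₂ := # 24 :* s :- # 4 :* (n :* (n :- # 1)) :* (π :^ 2 :* b₂)) (S n ∷ ι n ∷ π ∷ b (n ∸ 2) ∷ [])) ⟩
    ι 24 * S n - ι 4 * (ι n * (ι n - 1#)) * (π ^ 2 * b (n ∸ 2))
      ≈⟨ +-congˡᵐ (-‿congᵐ (*-congᵐ (*-congˡᵐ (*-congᵐ n≈ (+-congʳᵐ n≈))) (π^*-cong 2 b-2))) ⟩
    ι 24 * S n - ι 4 * (N * (N - 1#)) * (π ^ 2 * (π * ((N - ι 2) * β)))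
      ≈⟨ solveMod 4 {3} (λ π s k β → # 24 :* s :- # 4 :* (((π :- # 1) :* k) :* ((π :- # 1) :* k :- # 1)) :* (π :^ 2 :* (π :* (((π :- # 1) :* k :- # 2) :* β)))
           := # 4 :* (# 6 :* s :+ k :* (k :+ # 1) :* (k :+ # 2) :* π :^ 3 :* β)) (S n ∷ ι (suc k) ∷ β ∷ []) ⟩
    ι 4 * (ι 6 * S n + ι (suc k) * (ι (suc k) + 1#) * (ι (suc k) + ι 2) * π ^ 3 * β) ∎)
    where
    open Reasoning
    n = suc k ℕ.* m
    4≤n = m-even-4≤ k
    N = (π - 1#) * ι (suc k)
    n≈ : ∀ {l} → ι n ≈[ l ] N
    n≈ = exact (trans (ι-* (suc k) m) (trans (*-comm _ _) (*-congʳ ι-m)))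
    odd₁ : Odd (n ∸ 1)
    odd₁ = even-suc (≡.subst Even (≡.sym (ℕₚ.m+[n∸m]≡n {1} {n} (ℕₚ.≤-trans (s≤s z≤n) 4≤n))) (*m-even (suc k)))
    odd₃ : Odd (n ∸ 3)
    odd₃ = even-suc (odd-suc (even-suc (≡.subst Even (≡.sym (ℕₚ.m+[n∸m]≡n {3} {n} (ℕₚ.≤-trans (ℕₚ.n≤1+n 3) 4≤n))) (*m-even (suc k)))))
    9≤n : 9 ℕ.≤ n
    9≤n = ℕₚ.≤-trans (ℕₚ.≤-trans (ℕₚ.n≤1+n 9) 10≤m) (ℕₚ.m≤m+n m (k ℕ.* m))
    index : n ∸ 2 ≡ k ℕ.* m ℕ.+ (r ∸ 1)
    index = ≡.trans (≡.cong (_∸ 2) (ℕₚ.+-comm m (k ℕ.* m))) (ℕₚ.+-∸-assoc (k ℕ.* m) 2≤m)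
    2≤r-1 : 2 ℕ.≤ r ∸ 1
    2≤r-1 = ℕₚ.∸-monoˡ-≤ 1 (ℕₚ.≤-trans (ℕₚ.m≤m+n 3 6) 9≤r)
    r-1<m : r ∸ 1 ℕ.< m
    r-1<m = ℕₚ.≤-<-trans (ℕₚ.m∸n≤m r 1) r<m
    b-2 : b (n ∸ 2) ≈[ 2 ] π * ((N - ι 2) * β)
    b-2 = begin
      b (n ∸ 2)
        ≈⟨ b≈₂ (n ∸ 2) (ℕₚ.≤-trans (ℕₚ.m≤m+n 4 3) (ℕₚ.∸-monoˡ-≤ 2 9≤n)) (even∸even (ℕₚ.≤-trans (s≤s (s≤s z≤n)) 4≤n) (*m-even (suc k)) (1 , ≡.refl))
             (transᵐ (exact (reflexive (≡.cong s index))) (transᵐ (s-periodic* k (r ∸ 1)) (s≈0 (r ∸ 1) (ℕₚ.≤-trans (s≤s z≤n) 2≤r-1) r-1<m))) ⟩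
      - (π * (ι (n ∸ 2) * A (n ∸ 2)))
        ≈⟨ -‿congᵐ (π*-cong (*-congᵐ (transᵐ (exact (ι-∸ (ℕₚ.≤-trans (s≤s (s≤s z≤n)) 4≤n))) (+-congʳᵐ n≈))
             (transᵐ (exact (reflexive (≡.cong A index))) (transᵐ (reduce 1≤3 (A-periodic* k (r ∸ 1))) (A≈-𝔠 (r ∸ 1) 2≤r-1 r-1<m))))) ⟩
      - (π * ((N - ι 2) * - β))
        ≈⟨ exact (solve {3} (λ π n β → :- (π :* (n :* :- β)) := π :* (n :* β)) (π ∷ N - ι 2 ∷ β ∷ [])) ⟩
      π * ((N - ι 2) * β) ∎
    S≈ : ι 24 * S n ≈[ 4 ] ι 24 * b n + ι 4 * (ι n * (ι n - 1#)) * π ^ 2 * b (n ∸ 2)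
    S≈ = begin
      ι 24 * S n
        ≈⟨ S-faulhaber n (ℕₚ.≤-trans (s≤s z≤n) 4≤n) ⟩
      ι 24 * b n + ι 12 * ι n * π * b (n ∸ 1) + ι 4 * (ι n * (ι n - 1#)) * π ^ 2 * b (n ∸ 2) + ι n * (ι n - 1#) * (ι n - ι 2) * π ^ 3 * b (n ∸ 3)
        ≈⟨ exact (+-cong (+-congʳ (+-congˡ (*-congˡ (b-odd″ (n ∸ 1) (ℕₚ.∸-monoˡ-≤ 1 4≤n) odd₁)))) (*-congˡ (b-odd″ (n ∸ 3) (ℕₚ.≤-trans (ℕₚ.m≤m+n 3 3) (ℕₚ.∸-monoˡ-≤ 3 9≤n)) odd₃))) ⟩
      ι 24 * b n + ι 12 * ι n * π * 0# + ι 4 * (ι n * (ι n - 1#)) * π ^ 2 * b (n ∸ 2) + ι n * (ι n - 1#) * (ι n - ι 2) * π ^ 3 * 0#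
        ≈⟨ exact (solve {4} (λ π n b₀ b₂ → # 24 :* b₀ :+ # 12 :* n :* π :* # 0 :+ b₂ :+ n :* (n :- # 1) :* (n :- # 2) :* π :^ 3 :* # 0 := # 24 :* b₀ :+ b₂) (π ∷ ι n ∷ b n ∷ ι 4 * (ι n * (ι n - 1#)) * π ^ 2 * b (n ∸ 2) ∷ [])) ⟩
      ι 24 * b n + ι 4 * (ι n * (ι n - 1#)) * π ^ 2 * b (n ∸ 2) ∎
      where
      S-faulhaber : ∀ n → 0 ℕ.< n → ι 24 * S n ≈[ 4 ] ι 24 * b n + ι 12 * ι n * π * b (n ∸ 1) + ι 4 * (ι n * (ι n - 1#)) * π ^ 2 * b (n ∸ 2) + ι n * (ι n - 1#) * (ι n - ι 2) * π ^ 3 * b (n ∸ 3)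
      S-faulhaber (suc n) _ = b-faulhaber′ n

  S-multiple : ∀ k → S (k ℕ.* m) ≈ ⟨ (λ i → u i ^ k) ⟩
  S-multiple k = ∑-cong m λ i i<m → trans (reflexive (≡.cong (ι (suc i) ^_) (ℕₚ.*-comm k m))) (trans (sym (^-assocʳ (ι (suc i)) m k)) (^-congˡ k (u-spec i i<m)))

  ⟨1⟩ : ⟨ (λ _ → 1#) ⟩ ≈ π - 1#
  ⟨1⟩ = trans (∑-const m 1#) (trans (*-identityʳ _) ι-m)

  S-1 : S (1 ℕ.* m) ≈ π - 1# + π * Q₁
  S-1 = trans (S-multiple 1) (trans (∑-cong′ m λ i → solve {2} (λ π q → (# 1 :+ π :* q) :^ 1 := # 1 :* # 1 :+ (π :* q :+ # 0)) (π ∷ q i ∷ []))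
    (trans (⟨linear⟩ ((1# , λ _ → 1#) ∷ (π , q) ∷ [])) (trans (+-congʳ (*-congˡ ⟨1⟩)) (solve {2} (λ π a → # 1 :* (π :- # 1) :+ (π :* a :+ # 0) := π :- # 1 :+ π :* a) (π ∷ Q₁ ∷ [])))))

  S-2 : S (2 ℕ.* m) ≈ π - 1# + ι 2 * π * Q₁ + π ^ 2 * Q₂
  S-2 = trans (S-multiple 2) (trans (∑-cong′ m λ i → solve {2} (λ π q → (# 1 :+ π :* q) :^ 2 := # 1 :* # 1 :+ (# 2 :* π :* q :+ (π :^ 2 :* q :^ 2 :+ # 0))) (π ∷ q i ∷ []))
    (trans (⟨linear⟩ ((1# , λ _ → 1#) ∷ (ι 2 * π , q) ∷ (π ^ 2 , λ i → q i ^ 2) ∷ [])) (trans (+-congʳ (*-congˡ ⟨1⟩))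
      (solve {3} (λ π a b → # 1 :* (π :- # 1) :+ (# 2 :* π :* a :+ (π :^ 2 :* b :+ # 0)) := π :- # 1 :+ # 2 :* π :* a :+ π :^ 2 :* b) (π ∷ Q₁ ∷ Q₂ ∷ [])))))

  S-3 : S (3 ℕ.* m) ≈ π - 1# + ι 3 * π * Q₁ + ι 3 * π ^ 2 * Q₂ + π ^ 3 * Q₃
  S-3 = trans (S-multiple 3) (trans (∑-cong′ m λ i → solve {2} (λ π q → (# 1 :+ π :* q) :^ 3 := # 1 :* # 1 :+ (# 3 :* π :* q :+ (# 3 :* π :^ 2 :* q :^ 2 :+ (π :^ 3 :* q :^ 3 :+ # 0)))) (π ∷ q i ∷ []))
    (trans (⟨linear⟩ ((1# , λ _ → 1#) ∷ (ι 3 * π , q) ∷ (ι 3 * π ^ 2 , λ i → q i ^ 2) ∷ (π ^ 3 , λ i → q i ^ 3) ∷ [])) (trans (+-congʳ (*-congˡ ⟨1⟩))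
      (solve {4} (λ π a b c → # 1 :* (π :- # 1) :+ (# 3 :* π :* a :+ (# 3 :* π :^ 2 :* b :+ (π :^ 3 :* c :+ # 0))) := π :- # 1 :+ # 3 :* π :* a :+ # 3 :* π :^ 2 :* b :+ π :^ 3 :* c) (π ∷ Q₁ ∷ Q₂ ∷ Q₃ ∷ [])))))

  -- The part of the formula that is linear in p B (p - 1), p B (2 (p - 1)) and p B (3 (p - 1)).
  linear-part : ι 6 * ((ι 12 * π - ι 12) + - (ι 18 * b (1 ℕ.* m)) + ι 12 * b (2 ℕ.* m) - ι 3 * b (3 ℕ.* m)) ≈[ 4 ] ι 18 * (π - 1# - π * Q₁ + π ^ 2 * Q₂ - π ^ 3 * Q₃)
  linear-part = begin
    ι 6 * ((ι 12 * π - ι 12) + - (ι 18 * b (1 ℕ.* m)) + ι 12 * b (2 ℕ.* m) - ι 3 * b (3 ℕ.* m))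
      ≈⟨ exact (solve {4} (λ π a b c → # 6 :* ((# 12 :* π :- # 12) :+ :- (# 18 :* a) :+ # 12 :* b :- # 3 :* c) := # 72 :* (π :- # 1) :- # 18 :* (# 6 :* a) :+ # 12 :* (# 6 :* b) :- # 3 :* (# 6 :* c)) (π ∷ b (1 ℕ.* m) ∷ b (2 ℕ.* m) ∷ b (3 ℕ.* m) ∷ [])) ⟩
    ι 72 * (π - 1#) - ι 18 * (ι 6 * b (1 ℕ.* m)) + ι 12 * (ι 6 * b (2 ℕ.* m)) - ι 3 * (ι 6 * b (3 ℕ.* m))
      ≈⟨ +-congᵐ (+-congᵐ (+-congˡᵐ (-‿congᵐ (*-congˡᵐ (transᵐ (b-multiple 0) (+-congʳᵐ (*-congˡᵐ (exact S-1))))))) (*-congˡᵐ (transᵐ (b-multiple 1) (+-congʳᵐ (*-congˡᵐ (exact S-2))))))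
           (-‿congᵐ (*-congˡᵐ (transᵐ (b-multiple 2) (+-congʳᵐ (*-congˡᵐ (exact S-3)))))) ⟩
    -- The multiples of p ^ 3 β are C(K + 2, 3) = 1, 4, 10 for K = 1, 2, 3, and - 6 + 4 · 4 - 10 = 0
    -- removes β.
    _ ≈⟨ solveMod 4 {4} (λ π a b c β → # 72 :* (π :- # 1) :- # 18 :* (# 6 :* (π :- # 1 :+ π :* a) :+ # 1 :* (# 1 :+ # 1) :* (# 1 :+ # 2) :* π :^ 3 :* β)
           :+ # 12 :* (# 6 :* (π :- # 1 :+ # 2 :* π :* a :+ π :^ 2 :* b) :+ # 2 :* (# 2 :+ # 1) :* (# 2 :+ # 2) :* π :^ 3 :* β)
           :- # 3 :* (# 6 :* (π :- # 1 :+ # 3 :* π :* a :+ # 3 :* π :^ 2 :* b :+ π :^ 3 :* c) :+ # 3 :* (# 3 :+ # 1) :* (# 3 :+ # 2) :* π :^ 3 :* β)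
           := # 18 :* (π :- # 1 :- π :* a :+ π :^ 2 :* b :- π :^ 3 :* c)) (Q₁ ∷ Q₂ ∷ Q₃ ∷ β ∷ []) ⟩
    ι 18 * (π - 1# - π * Q₁ + π ^ 2 * Q₂ - π ^ 3 * Q₃) ∎
    where open Reasoning

  b-m≈ : b (1 ℕ.* m) ≈[ 2 ] π - 1# + π * Q₁
  b-m≈ = small-unit 6 (s≤s z≤n) (ℕₚ.m≤m+n 6 4) (transᵐ (reduce (s≤s (s≤s z≤n)) (b-multiple 0)) (transᵐ (+-congʳᵐ (*-congˡᵐ (exact S-1)))
    (solveMod 2 {2} (λ π a β → # 6 :* (π :- # 1 :+ π :* a) :+ # 1 :* (# 1 :+ # 1) :* (# 1 :+ # 2) :* π :^ 3 :* β := # 6 :* (π :- # 1 :+ π :* a)) (Q₁ ∷ β ∷ []))))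

  b-multiple≈-1 : ∀ k → b (suc k ℕ.* m) ≈[ 1 ] - 1#
  b-multiple≈-1 k = transᵐ (b≈s (suc k ℕ.* m) (ℕₚ.≤-trans (s≤s z≤n) (m-even-4≤ k))) (transᵐ (reduce 1≤3 (transᵐ (exact (reflexive (≡.cong s (≡.sym (ℕₚ.+-identityʳ (suc k ℕ.* m)))))) (transᵐ (s-periodic* (suc k) 0) s-0))) ι-m≈-1)

  -- The left-hand side is p ^ 2 times the combination X of the statement, up to the unit m ^ 2.
  X≈conv : ∀ {y} → ι m * (ι m * y) ≈ ι m * b (2 ℕ.* m) - b (1 ℕ.* m) * b (1 ℕ.* m) → y ≈[ 3 ] π ^ 2 * conv m
  X≈conv {y} h = unit-cancelι m 0<m ℕₚ.≤-refl (unit-cancelι m 0<m ℕₚ.≤-refl (begin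
    ι m * (ι m * y)
      ≈⟨ exact h ⟩
    ι m * b (2 ℕ.* m) - b (1 ℕ.* m) * b (1 ℕ.* m)
      ≈⟨ +-congᵐ (*-congᵐ (exact ι-m) (transᵐ (b≈S 1) (exact S-2))) (-‿congᵐ (*-congᵐ (transᵐ (b≈S 0) (exact S-1)) (transᵐ (b≈S 0) (exact S-1)))) ⟩
    (π - 1#) * (π - 1# + ι 2 * π * Q₁ + π ^ 2 * Q₂) - (π - 1# + π * Q₁) * (π - 1# + π * Q₁)
      ≈⟨ solveMod 3 {2} (λ π a b → (π :- # 1) :* (π :- # 1 :+ # 2 :* π :* a :+ π :^ 2 :* b) :- (π :- # 1 :+ π :* a) :* (π :- # 1 :+ π :* a)
           := (π :- # 1) :* ((π :- # 1) :* (π :^ 2 :* :- (a :^ 2 :+ b)))) (Q₁ ∷ Q₂ ∷ []) ⟩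
    (π - 1#) * ((π - 1#) * (π ^ 2 * - (Q₁ ^ 2 + Q₂)))
      ≈⟨ *-congᵐ (exact (sym ι-m)) (*-congᵐ (exact (sym ι-m)) (π^*-cong 2 (symᵐ conv≈))) ⟩
    ι m * (ι m * (π ^ 2 * conv m)) ∎))
    where
    open Reasoning
    0<m : 0 ℕ.< m
    0<m = s≤s z≤n
    b≈S : ∀ k → b (suc k ℕ.* m) ≈[ 3 ] S (suc k ℕ.* m)
    b≈S k = small-unit 6 (s≤s z≤n) (ℕₚ.m≤m+n 6 4) (transᵐ (reduce (ℕₚ.n≤1+n 3) (b-multiple k))
      (solveMod 3 {3} (λ π s k β → # 6 :* s :+ k :* (k :+ # 1) :* (k :+ # 2) :* π :^ 3 :* β := # 6 :* s) (S (suc k ℕ.* m) ∷ ι (suc k) ∷ β ∷ [])))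

  -- Wilson's theorem and the factorial modulo p ^ 4

  sign : ℕ → Carrier
  sign j = (- 1#) ^ j

  -- Up to sign, the k-th finite difference of x ↦ x ^ n at 0.
  W : ℕ → ℕ → Carrier
  W k n = ∑ (suc k) (λ j → ι (k C j) * sign j * ι j ^ n)

  -- Absorption replaces j C(k + 1, j) by (k + 1) C(k, j - 1), and Pascal's rule writes the
  -- resulting sum as a difference of two W.
  W-suc : ∀ k n → W (suc k) (suc n) ≈ ι (suc k) * (W (suc k) n - W k n)
  W-suc k n = begin
    W (suc k) (suc n)
      ≈⟨ ∑-cons (suc k) _ ⟩
    1# * 1# * (0# * 0# ^ n) + ∑ (suc k) (λ j → ι (suc k C suc j) * (- 1# * sign j) * (ι (suc j) * ι (suc j) ^ n))
      ≈⟨ +-cong (solve {1} (λ z → # 1 :* # 1 :* (# 0 :* z) := # 0) (0# ^ n ∷ [])) (∑-cong′ (suc k) λ j → trans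
           (solve {4} (λ c s a e → c :* ((:- # 1) :* s) :* (a :* e) := (:- (s :* e)) :* (a :* c)) (ι (suc k C suc j) ∷ sign j ∷ ι (suc j) ∷ ι (suc j) ^ n ∷ []))
           (trans (*-congˡ (absorption k j)) (solve {4} (λ c s a e → (:- (s :* e)) :* (a :* c) := a :* (c :* :- s :* e)) (ι (k C j) ∷ sign j ∷ ι (suc k) ∷ ι (suc j) ^ n ∷ [])))) ⟩
    0# + ∑ (suc k) (λ j → ι (suc k) * (ι (k C j) * - sign j * ι (suc j) ^ n))
      ≈⟨ trans (+-identityˡ _) (∑-*ˡ (suc k) _ _) ⟩
    ι (suc k) * ∑ (suc k) (λ j → ι (k C j) * - sign j * ι (suc j) ^ n)
      ≈⟨ *-congˡ (∑-cong′ (suc k) λ j → trans (solve {4} (λ c d s e → c :* :- s :* e := (c :+ d) :* ((:- # 1) :* s) :* e :- d :* ((:- # 1) :* s) :* e) (ι (k C j) ∷ ι (k C suc j) ∷ sign j ∷ ι (suc j) ^ n ∷ []))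
           (+-congʳ (*-congʳ (*-congʳ (trans (sym (ι-+ (k C j) (k C suc j))) (reflexive (≡.cong ι (nCk+nC[k+1]≡[n+1]C[k+1] k j)))))))) ⟩
    ι (suc k) * ∑ (suc k) (λ j → f (suc j) - g (suc j))
      ≈⟨ *-congˡ (trans (∑-cong′ (suc k) λ j → +-congˡ (solve {1} (λ a → :- a := (:- # 1) :* a) (g (suc j) ∷ []))) (trans (∑-+ (suc k) _ _) (+-congˡ (∑-*ˡ (suc k) (- 1#) _)))) ⟩
    ι (suc k) * (∑ (suc k) (f ∘ suc) + - 1# * ∑ (suc k) (g ∘ suc))
      ≈⟨ *-congˡ (solve {3} (λ a b c → b :+ (:- # 1) :* c := (a :+ b) :- (a :+ c)) (f 0 ∷ ∑ (suc k) (f ∘ suc) ∷ ∑ (suc k) (g ∘ suc) ∷ [])) ⟩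
    ι (suc k) * (f 0 + ∑ (suc k) (f ∘ suc) - (g 0 + ∑ (suc k) (g ∘ suc)))
      ≈⟨ *-congˡ (+-cong (sym (∑-cons (suc k) f)) (-‿cong (trans (sym (∑-cons (suc k) g)) (trans (+-congˡ g-last) (+-identityʳ _))))) ⟩
    ι (suc k) * (W (suc k) n - W k n) ∎
    where
    open ≈-Reasoning
    f g : ℕ → Carrier
    f j = ι (suc k C j) * sign j * ι j ^ n
    g j = ι (k C j) * sign j * ι j ^ n
    g-last : g (suc k) ≈ 0#
    g-last = trans (*-congʳ (trans (*-congʳ (reflexive (≡.cong ι (k>n⇒nCk≡0 {k} {suc k} ℕₚ.≤-refl)))) (zeroˡ _))) (zeroˡ _)

  W-suc-0 : ∀ k → W (suc k) 0 ≈ 0#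
  W-suc-0 k = trans (∑-cong′ (suc (suc k)) λ j → *-identityʳ _) (trans (sym (binomial (suc k) (- 1#))) (trans (*-congʳ (-‿inverseˡ 1#)) (zeroˡ _)))

  W-low : ∀ k n → n ℕ.< k → W k n ≈ 0#
  W-low (suc k) zero    _         = W-suc-0 k
  W-low (suc k) (suc n) (s≤s n<k) = trans (W-suc k n) (trans (*-congˡ (+-cong (W-low (suc k) n (ℕₚ.m<n⇒m<1+n n<k)) (-‿cong (W-low k n n<k))))
    (solve {1} (λ a → a :* (# 0 :- # 0) := # 0) (ι (suc k) ∷ [])))

  W-diag : ∀ n → W n n ≈ sign n * ι (n !)
  W-diag zero    = solve {0} (# 0 :+ # 1 :* # 1 :* # 1 := # 1 :* # 1) []
  W-diag (suc n) = begin
    W (suc n) (suc n)                            ≈⟨ W-suc n n ⟩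
    ι (suc n) * (W (suc n) n - W n n)            ≈⟨ *-congˡ (+-cong (W-low (suc n) n ℕₚ.≤-refl) (-‿cong (W-diag n))) ⟩
    ι (suc n) * (0# - sign n * ι (n !))          ≈⟨ solve {3} (λ a s f → a :* (# 0 :- s :* f) := (:- # 1) :* s :* (a :* f)) (ι (suc n) ∷ sign n ∷ ι (n !) ∷ []) ⟩
    sign (suc n) * (ι (suc n) * ι (n !))         ≈⟨ *-congˡ (ι-* (suc n) (n !)) ⟨
    sign (suc n) * ι (suc n !)                   ∎
    where open ≈-Reasoning

  mC : ∀ j → j ℕ.≤ m → ι (m C j) * sign j ≈[ 1 ] 1#
  mC zero    _   = exact (*-identityˡ _)
  mC (suc j) j<m = begin
    ι (m C suc j) * (- 1# * sign j)
      ≈⟨ exact (solve {3} (λ c d s → d :* ((:- # 1) :* s) := c :* s :- (c :+ d) :* s) (ι (m C j) ∷ ι (m C suc j) ∷ sign j ∷ [])) ⟩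
    ι (m C j) * sign j - (ι (m C j) + ι (m C suc j)) * sign j
      ≈⟨ +-congᵐ (mC j (ℕₚ.<⇒≤ j<m)) (-‿congᵐ (*-congʳᵐ (transᵐ (exact (trans (sym (ι-+ (m C j) (m C suc j))) (reflexive (≡.cong ι (nCk+nC[k+1]≡[n+1]C[k+1] m j))))) (pC-middle j j<m)))) ⟩
    1# - 0# * sign j
      ≈⟨ exact (solve {1} (λ s → # 1 :- # 0 :* s := # 1) (sign j ∷ [])) ⟩
    1# ∎
    where open Reasoning

  square-^ : ∀ y h → (- y) ^ (2 ℕ.* h) ≈ y ^ (2 ℕ.* h)
  square-^ y h = trans (sym (^-assocʳ (- y) 2 h)) (trans (^-congˡ h (solve {1} (λ y → (:- y) :^ 2 := y :^ 2) (y ∷ []))) (^-assocʳ y 2 h))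

  neg-^m : ∀ y → (- y) ^ m ≈ y ^ m
  neg-^m y = trans (reflexive (≡.cong ((- y) ^_) (proj₂ m-even))) (trans (square-^ y (proj₁ m-even)) (reflexive (≡.cong (y ^_) (≡.sym (proj₂ m-even)))))

  -- The factorial is the m-th finite difference of the m-th power. Its weights (- 1) ^ j C(p - 1,
  -- j) are all 1 modulo p, so it is the power sum of exponent p - 1.
  wilson : ι (m !) ≈[ 1 ] - 1#
  wilson = begin
    ι (m !)                     ≈⟨ exact (sym (trans (*-congʳ (trans (neg-^m 1#) (1^ m))) (*-identityˡ _))) ⟩
    sign m * ι (m !)            ≈⟨ exact (sym (W-diag m)) ⟩
    W m m                       ≈⟨ ∑-congᵐ (suc m) (λ j j≤m → transᵐ (*-congʳᵐ (mC j (ℕₚ.≤-pred j≤m))) (exact (*-identityˡ _))) ⟩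
    powerSum₀ m                 ≈⟨ exact (powerSum₀-suc r) ⟩
    S m                         ≈⟨ ι-suc^≈ω m ⟩
    s m                         ≈⟨ reduce 1≤3 s-m ⟩
    ι m                         ≈⟨ ι-m≈-1 ⟩
    - 1#                        ∎
    where open Reasoning

  ∏ : ℕ → (ℕ → Carrier) → Carrier
  ∏ zero    f = 1#
  ∏ (suc n) f = ∏ n f * f n

  factorial : ∀ n → ι (n !) ≈ ∏ n (λ i → ι (suc i))
  factorial zero    = refl
  factorial (suc n) = trans (ι-* (suc n) (n !)) (trans (*-comm _ _) (*-congʳ (factorial n)))

  ∏-u : ∀ n → n ℕ.≤ m → ∏ n (λ i → ι (suc i)) ^ m ≈ ∏ n u
  ∏-u zero    _   = 1^ m
  ∏-u (suc n) n<m = trans (^-distrib-* (∏ n (λ i → ι (suc i))) (ι (suc n)) m) (*-cong (∏-u n (ℕₚ.<⇒≤ n<m)) (u-spec n n<m))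

  ∏-expansion : ∀ n → ι 6 * ∏ n u ≈[ 4 ] ι 6 + ι 6 * π * ∑ n q + ι 3 * π ^ 2 * (∑ n q ^ 2 - ∑ n (λ i → q i ^ 2)) + π ^ 3 * (∑ n q ^ 3 - ι 3 * ∑ n q * ∑ n (λ i → q i ^ 2) + ι 2 * ∑ n (λ i → q i ^ 3))
  ∏-expansion zero    = exact (solve {1} (λ π → # 6 :* # 1 := # 6 :+ # 6 :* π :* # 0 :+ # 3 :* π :^ 2 :* (# 0 :^ 2 :- # 0) :+ π :^ 3 :* (# 0 :^ 3 :- # 3 :* # 0 :* # 0 :+ # 2 :* # 0)) (π ∷ []))
  ∏-expansion (suc n) = begin
    ι 6 * (∏ n u * u n)
      ≈⟨ exact (sym (*-assoc _ _ _)) ⟩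
    ι 6 * ∏ n u * u n
      ≈⟨ *-congʳᵐ (∏-expansion n) ⟩
    _ ≈⟨ solveMod 4 {4} (λ π a b c q → (# 6 :+ # 6 :* π :* a :+ # 3 :* π :^ 2 :* (a :^ 2 :- b) :+ π :^ 3 :* (a :^ 3 :- # 3 :* a :* b :+ # 2 :* c)) :* (# 1 :+ π :* q)
           := # 6 :+ # 6 :* π :* (a :+ q) :+ # 3 :* π :^ 2 :* ((a :+ q) :^ 2 :- (b :+ q :^ 2)) :+ π :^ 3 :* ((a :+ q) :^ 3 :- # 3 :* (a :+ q) :* (b :+ q :^ 2) :+ # 2 :* (c :+ q :^ 3)))
           (∑ n q ∷ ∑ n (λ i → q i ^ 2) ∷ ∑ n (λ i → q i ^ 3) ∷ q n ∷ []) ⟩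
    _ ∎
    where open Reasoning

  binom₄ : ∀ n x → ι 6 * (1# + π * x) ^ n ≈[ 4 ] ι 6 + ι 6 * ι n * π * x + ι 3 * (ι n * (ι n - 1#)) * π ^ 2 * x ^ 2 + ι n * (ι n - 1#) * (ι n - ι 2) * π ^ 3 * x ^ 3
  binom₄ zero    x = exact (solve {2} (λ π x → # 6 :* # 1 := # 6 :+ # 6 :* # 0 :* π :* x :+ # 3 :* (# 0 :* (# 0 :- # 1)) :* π :^ 2 :* x :^ 2 :+ # 0 :* (# 0 :- # 1) :* (# 0 :- # 2) :* π :^ 3 :* x :^ 3) (π ∷ x ∷ []))
  binom₄ (suc n) x = begin
    ι 6 * ((1# + π * x) * (1# + π * x) ^ n)
      ≈⟨ exact (solve {2} (λ a b → # 6 :* (a :* b) := a :* (# 6 :* b)) (1# + π * x ∷ (1# + π * x) ^ n ∷ [])) ⟩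
    (1# + π * x) * (ι 6 * (1# + π * x) ^ n)
      ≈⟨ *-congˡᵐ (binom₄ n x) ⟩
    _ ≈⟨ solveMod 4 {2} (λ π x n → (# 1 :+ π :* x) :* (# 6 :+ # 6 :* n :* π :* x :+ # 3 :* (n :* (n :- # 1)) :* π :^ 2 :* x :^ 2 :+ n :* (n :- # 1) :* (n :- # 2) :* π :^ 3 :* x :^ 3)
           := # 6 :+ # 6 :* (# 1 :+ n) :* π :* x :+ # 3 :* ((# 1 :+ n) :* (# 1 :+ n :- # 1)) :* π :^ 2 :* x :^ 2 :+ (# 1 :+ n) :* (# 1 :+ n :- # 1) :* (# 1 :+ n :- # 2) :* π :^ 3 :* x :^ 3) (x ∷ ι n ∷ []) ⟩
    _ ≈⟨ exact (+-cong (+-cong (+-congˡ (*-congʳ (*-congʳ (*-congˡ N≈)))) (*-congʳ (*-congʳ (*-congˡ (*-cong N≈ (+-congʳ N≈)))))) (*-congʳ (*-congʳ (*-cong (*-cong N≈ (+-congʳ N≈)) (+-congʳ N≈))))) ⟩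
    ι 6 + ι 6 * ι (suc n) * π * x + ι 3 * (ι (suc n) * (ι (suc n) - 1#)) * π ^ 2 * x ^ 2 + ι (suc n) * (ι (suc n) - 1#) * (ι (suc n) - ι 2) * π ^ 3 * x ^ 3 ∎
    where
    open Reasoning
    N≈ : 1# + ι n ≈ ι (suc n)
    N≈ = sym (ι-suc n)

  module _ {w : Carrier} (w-spec : ι (m !) ≈ π * w - 1#) where

    private
      v = 1# + π * - w

    -- Here v is - (p - 1)!, and the sign is lost in the m-th power because m is even; the m-th
    -- power of each factor a of the factorial is its u.
    v-product : v * ∏ m u ≈ v ^ p
    v-product = *-congˡ (sym (begin
      v ^ m                          ≈⟨ neg-^m v ⟨
      (- v) ^ m                      ≈⟨ ^-congˡ m (trans (solve {2} (λ π w → :- (# 1 :+ π :* :- w) := π :* w :- # 1) (π ∷ w ∷ [])) (sym w-spec)) ⟩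
      ι (m !) ^ m                    ≈⟨ ^-congˡ m (factorial m) ⟩
      ∏ m (λ i → ι (suc i)) ^ m      ≈⟨ ∏-u m ℕₚ.≤-refl ⟩
      ∏ m u                          ∎))
      where open ≈-Reasoning

    v-product₄ : v * (ι 6 + ι 6 * π * Q₁ + ι 3 * π ^ 2 * (Q₁ ^ 2 - Q₂) + π ^ 3 * (Q₁ ^ 3 - ι 3 * Q₁ * Q₂ + ι 2 * Q₃)) ≈[ 4 ] ι 6 - ι 6 * π ^ 2 * w - ι 3 * π ^ 3 * w ^ 2
    v-product₄ = begin
      _                   ≈⟨ *-congˡᵐ (∏-expansion m) ⟨
      v * (ι 6 * ∏ m u)   ≈⟨ exact (trans (solve {2} (λ v y → v :* (# 6 :* y) := # 6 :* (v :* y)) (v ∷ ∏ m u ∷ [])) (*-congˡ v-product)) ⟩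
      ι 6 * v ^ p         ≈⟨ binom₄ p (- w) ⟩
      _                   ≈⟨ solveMod 4 {1} (λ π w → # 6 :+ # 6 :* π :* π :* :- w :+ # 3 :* (π :* (π :- # 1)) :* π :^ 2 :* (:- w) :^ 2 :+ π :* (π :- # 1) :* (π :- # 2) :* π :^ 3 :* (:- w) :^ 3
                               := # 6 :- # 6 :* π :^ 2 :* w :- # 3 :* π :^ 3 :* w :^ 2) (w ∷ []) ⟩
      _                   ∎
      where open Reasoning

    -- Comparison of the terms of order p in `v-product₄`, whose right-hand side has none.
    w≈Q₁ : w ≈[ 1 ] Q₁
    w≈Q₁ = small-unit 6 (s≤s z≤n) (ℕₚ.m≤m+n 6 4) (π-cancel (begin
      π * (ι 6 * w)
        ≈⟨ solveMod 2 {4} (λ π w a b c → π :* (# 6 :* w) := π :* (# 6 :* a) :- ((# 1 :+ π :* :- w) :* (# 6 :+ # 6 :* π :* a :+ # 3 :* π :^ 2 :* (a :^ 2 :- b) :+ π :^ 3 :* (a :^ 3 :- # 3 :* a :* b :+ # 2 :* c)) :- # 6)) (w ∷ Q₁ ∷ Q₂ ∷ Q₃ ∷ []) ⟩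
      π * (ι 6 * Q₁) - (v * (ι 6 + ι 6 * π * Q₁ + ι 3 * π ^ 2 * (Q₁ ^ 2 - Q₂) + π ^ 3 * (Q₁ ^ 3 - ι 3 * Q₁ * Q₂ + ι 2 * Q₃)) - ι 6)
        ≈⟨ +-congˡᵐ (-‿congᵐ (+-congʳᵐ (reduce (s≤s (s≤s z≤n)) v-product₄))) ⟩
      π * (ι 6 * Q₁) - (ι 6 - ι 6 * π ^ 2 * w - ι 3 * π ^ 3 * w ^ 2 - ι 6)
        ≈⟨ solveMod 2 {2} (λ π w a → π :* (# 6 :* a) :- (# 6 :- # 6 :* π :^ 2 :* w :- # 3 :* π :^ 3 :* w :^ 2 :- # 6) := π :* (# 6 :* a)) (w ∷ Q₁ ∷ []) ⟩
      π * (ι 6 * Q₁) ∎))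
      where open Reasoning

    -- The first factor is 6 ∏ u - 6 p + 3 p ^ 3 Q₁ ^ 2. After multiplication by p w - 1 and use of
    -- `v-product₄`, the terms in p ^ 2 w cancel, and for p ^ 3 w ^ 2 the residue of w modulo p
    -- suffices.
    wilson₄ : (ι 6 + ι 6 * π * (Q₁ - 1#) + ι 3 * π ^ 2 * (Q₁ ^ 2 - Q₂) + π ^ 3 * (ι 2 * Q₃ + ι 3 * Q₁ ^ 2 - ι 3 * Q₁ * Q₂ + Q₁ ^ 3)) * ι (m !) ≈[ 4 ] ι 6 * (π - 1#)
    wilson₄ = begin
      _ ≈⟨ *-congˡᵐ (exact w-spec) ⟩
      _ ≈⟨ solveMod 4 {4} (λ π w a b c → (# 6 :+ # 6 :* π :* (a :- # 1) :+ # 3 :* π :^ 2 :* (a :^ 2 :- b) :+ π :^ 3 :* (# 2 :* c :+ # 3 :* a :^ 2 :- # 3 :* a :* b :+ a :^ 3)) :* (π :* w :- # 1)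
             := :- ((# 1 :+ π :* :- w) :* (# 6 :+ # 6 :* π :* a :+ # 3 :* π :^ 2 :* (a :^ 2 :- b) :+ π :^ 3 :* (a :^ 3 :- # 3 :* a :* b :+ # 2 :* c))) :+ # 6 :* π :- # 6 :* π :^ 2 :* w :- # 3 :* (π :^ 3 :* (a :* a)))
             (w ∷ Q₁ ∷ Q₂ ∷ Q₃ ∷ []) ⟩
      - (v * (ι 6 + ι 6 * π * Q₁ + ι 3 * π ^ 2 * (Q₁ ^ 2 - Q₂) + π ^ 3 * (Q₁ ^ 3 - ι 3 * Q₁ * Q₂ + ι 2 * Q₃))) + ι 6 * π - ι 6 * π ^ 2 * w - ι 3 * (π ^ 3 * (Q₁ * Q₁))
        ≈⟨ +-congᵐ (+-congʳᵐ (+-congʳᵐ (-‿congᵐ v-product₄))) (-‿congᵐ (*-congˡᵐ (π^*-cong 3 (*-congᵐ (symᵐ w≈Q₁) (symᵐ w≈Q₁))))) ⟩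
      - (ι 6 - ι 6 * π ^ 2 * w - ι 3 * π ^ 3 * w ^ 2) + ι 6 * π - ι 6 * π ^ 2 * w - ι 3 * (π ^ 3 * (w * w))
        ≈⟨ exact (solve {2} (λ π w → :- (# 6 :- # 6 :* π :^ 2 :* w :- # 3 :* π :^ 3 :* w :^ 2) :+ # 6 :* π :- # 6 :* π :^ 2 :* w :- # 3 :* (π :^ 3 :* (w :* w)) := # 6 :* (π :- # 1)) (π ∷ w ∷ [])) ⟩
      ι 6 * (π - 1#) ∎
      where open Reasoning

  -- The double sum of the statement, modulo p.
  big : Carrier
  big = ∑ (r ∸ 8) (λ k → n𝔠 (6 ℕ.+ k) * M (m ∸ (6 ℕ.+ k)))

  -- The double sum of the theorem omits the indices 2, 4 and p - 3 of D. These carry exactly the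
  -- moments M (p - 3), M (p - 5) and M 2 that occur in the Kummer quotients and in B (p + 1); odd
  -- indices contribute nothing.
  DQ-split : DQ ≈[ 1 ] ι 2 * 𝔠 2 * M (m ∸ 2) + ι 4 * 𝔠 4 * M (m ∸ 4) + big - ι 3 * β * M 2
  DQ-split = begin
    DQ
      ≈⟨ DQ-sum ⟩
    ∑ m f
      ≈⟨ exact (trans (reflexive (≡.cong (λ z → ∑ z f) index)) (trans (∑-split 6 (t ℕ.+ 3) f) (+-congˡ (∑-split t 3 (λ i → f (6 ℕ.+ i)))))) ⟩
    (0# + f 0 + f 1 + f 2 + f 3 + f 4 + f 5) + (big + (0# + f (6 ℕ.+ (t ℕ.+ 0)) + f (6 ℕ.+ (t ℕ.+ 1)) + f (6 ℕ.+ (t ℕ.+ 2))))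
      ≈⟨ +-congᵐ (+-congᵐ (+-congʳᵐ (+-congᵐ (+-congʳᵐ (+-congᵐ (+-congˡᵐ f-0) f-1)) (f-odd 3 (1 , ≡.refl)))) (f-odd 5 (2 , ≡.refl)))
           (+-congˡᵐ (+-congᵐ (+-congᵐ (+-congˡᵐ (f-odd (6 ℕ.+ (t ℕ.+ 0)) odd)) f-last) f-r)) ⟩
    (0# + 0# + 0# + f 2 + 0# + f 4 + 0#) + (big + (0# + 0# + - (ι 3 * β) * M 2 + 0#))
      ≈⟨ exact (solve {5} (λ f₂ f₄ g β m → (# 0 :+ # 0 :+ # 0 :+ f₂ :+ # 0 :+ f₄ :+ # 0) :+ (g :+ (# 0 :+ # 0 :+ :- (# 3 :* β) :* m :+ # 0)) := f₂ :+ f₄ :+ g :- # 3 :* β :* m) (f 2 ∷ f 4 ∷ big ∷ β ∷ M 2 ∷ [])) ⟩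
    f 2 + f 4 + big - ι 3 * β * M 2 ∎
    where
    open Reasoning
    t = r ∸ 8
    f : ℕ → Carrier
    f n = n𝔠 n * M (m ∸ n)
    8+t : 8 ℕ.+ t ≡ r
    8+t = ℕₚ.m+[n∸m]≡n (ℕₚ.≤-trans (ℕₚ.n≤1+n 8) 9≤r)
    index : m ≡ 6 ℕ.+ (t ℕ.+ 3)
    index = ≡.trans (≡.cong suc (≡.sym 8+t)) (≡.cong (6 ℕ.+_) (ℕₚ.+-comm 3 t))
    f-zero : ∀ n → 𝔠 n ≈[ 1 ] 0# → f n ≈[ 1 ] 0#
    f-zero n h = transᵐ (*-congʳᵐ (transᵐ (*-congˡᵐ h) (exact (zeroʳ _)))) (exact (zeroˡ _))
    f-0 : f 0 ≈[ 1 ] 0#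
    f-0 = f-zero 0 reflᵐ
    f-1 : f 1 ≈[ 1 ] 0#
    f-1 = f-zero 1 reflᵐ
    f-odd : ∀ n → Odd n → f n ≈[ 1 ] 0#
    f-odd n o = f-zero n (𝔠-odd n o)
    odd : Odd (6 ℕ.+ (t ℕ.+ 0))
    odd = ≡.subst (λ z → Odd (6 ℕ.+ z)) (≡.sym (ℕₚ.+-identityʳ t)) (even-suc (odd-suc (≡.subst Odd (≡.sym 8+t) (even-suc m-Even))))
    last : 6 ℕ.+ (t ℕ.+ 1) ≡ r ∸ 1
    last = ≡.trans (≡.cong (6 ℕ.+_) (ℕₚ.+-comm t 1)) (≡.cong (_∸ 1) 8+t)
    m∸last : m ∸ (r ∸ 1) ≡ 2
    m∸last = ≡.trans (≡.cong (_∸ (r ∸ 1)) (≡.sym 2+r∸1)) (ℕₚ.m+n∸m≡n (r ∸ 1) 2)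
    f-last : f (6 ℕ.+ (t ℕ.+ 1)) ≈[ 1 ] - (ι 3 * β) * M 2
    f-last = transᵐ (exact (reflexive (≡.cong f last))) (*-congᵐ n𝔠-last (exact (reflexive (≡.cong M m∸last))))
    f-r : f (6 ℕ.+ (t ℕ.+ 2)) ≈[ 1 ] 0#
    f-r = f-zero (6 ℕ.+ (t ℕ.+ 2)) (exact (𝔠-high (6 ℕ.+ (t ℕ.+ 2)) (ℕₚ.≤-reflexive (≡.trans (≡.sym 8+t) (≡.cong (6 ℕ.+_) (ℕₚ.+-comm 2 t))))))

-- Evaluation of the formula in the abstract ring

module Assembly (R : CommutativeRing 0ℓ 0ℓ) (r : ℕ) (b : ℕ → CommutativeRing.Carrier R) (regular : Regular R r b) where
  open Regular regular
  open Numerals R using (ι; module Fractions)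
  open Sums R
  open CommutativeRing R hiding (zero)
  open import Algebra.Properties.Semiring.Exp semiring using (_^_)
  open FermatQuotients R r b regular public

  ν : Carrier
  ν = proj₁ (unit-∤ 720 p∤720)

  open Fractions 720 ν (proj₂ (unit-∤ 720 p∤720))
  open S using (Polynomial; _:+_; _:*_; _:-_; :-_; _:^_; _:=_; solve)
  module SM = S.Congruences π

  # #/ : ∀ {n} → ℕ → Polynomial n
  # n  = S.con (+ n , 0)
  #/ n = S.con (+ n , 1)

  -- 720 is a common denominator of the constants in the formula; the exponent 1 is the form in
  -- which the coefficients (n , 1) of the solver evaluate.
  _/720 : ℕ → Carrier
  n /720 = ι n * ν ^ 1

  module _ (T w β d₁ γ dC dX big b₁ b₂ b₃ β₂ B₁ γ₂ B₄ b″ AG : Carrier) where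

    t₁₃ t₁₄ t₁₅ linear-terms formula : Carrier
    t₁₃ = π * (ι 2 * β - β₂) * ((360 /720 - ι 3 * B₁) * π - 960 /720 * π ^ 2)
    t₁₄ = ι 2 * π * (β₂ - ι 2 * β) * (π * 60 /720 - 330 /720 * π ^ 2 + π ^ 2 * 60 /720 * AG)
    t₁₅ = ι 4 * π * (γ₂ - ι 2 * γ) * (π * (ι 2 * B₄ - b″) + 360 /720 * (7 /720 * π ^ 2 + ι 2 * π * b″ + ι 2 * π * B₄ * b₁))
    linear-terms = (ι 13 * π ^ 3 + ι 12 * π - ι 12) * 240 /720 + (ι 19 * π ^ 3 - ι 12) * 360 /720 * b₁ + (ι 4 - ι 7 * π ^ 3) * b₂ + (ι 11 * π ^ 3 - ι 6) * 120 /720 * b₃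
    formula =
        - (π ^ 3 * 240 /720 * T)
      + π ^ 3 * 180 /720 * (w * β + d₁)
      - π ^ 3 * 10 /720 * γ
      + 420 /720 * π ^ 3 * β
      + 360 /720 * π ^ 3 * dC
      + ((1# - π) * 360 /720) * (1# + π * w) * π ^ 2 * dX
      - π ^ 2 * 120 /720 * (1# + π * w) * (360 /720 * β + 144 /720 * γ)
      - π ^ 3 * 360 /720 * big
      + (ι 13 * π ^ 3 + ι 12 * π - ι 12) * 240 /720
      + (ι 19 * π ^ 3 - ι 12) * 360 /720 * b₁
      + (ι 4 - ι 7 * π ^ 3) * b₂
      + (ι 11 * π ^ 3 - ι 6) * 120 /720 * b₃
      + t₁₃ + t₁₄ + t₁₅

    β-terms γ-terms other-terms : Carrier
    β-terms = π ^ 3 * 180 /720 * (w * β + d₁) + 420 /720 * π ^ 3 * β - π ^ 2 * 120 /720 * (1# + π * w) * (360 /720 * β) + t₁₃ + t₁₄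
    γ-terms = - (π ^ 3 * 10 /720 * γ) - π ^ 2 * 120 /720 * (1# + π * w) * (144 /720 * γ) + t₁₅
    other-terms = - (π ^ 3 * 240 /720 * T) + 360 /720 * π ^ 3 * dC + ((1# - π) * 360 /720) * (1# + π * w) * π ^ 2 * dX - π ^ 3 * 360 /720 * big

    -- Terms are regrouped by the Bernoulli numbers in them, so that each group is expanded in few
    -- variables; the one summand with both β and γ is divided between two groups.
    formula-split : formula ≈ other-terms + β-terms + γ-terms + linear-terms
    formula-split = solve {17} (λ t₁ t₂ t₃ t₄ t₅ t₆ a x y t₈ t₉ t₁₀ t₁₁ t₁₂ t₁₃ t₁₄ t₁₅ →
        t₁ :+ t₂ :- t₃ :+ t₄ :+ t₅ :+ t₆ :- a :* (x :+ y) :- t₈ :+ t₉ :+ t₁₀ :+ t₁₁ :+ t₁₂ :+ t₁₃ :+ t₁₄ :+ t₁₅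
        := (t₁ :+ t₅ :+ t₆ :- t₈) :+ (t₂ :+ t₄ :- a :* x :+ t₁₃ :+ t₁₄) :+ (:- t₃ :- a :* y :+ t₁₅) :+ (t₉ :+ t₁₀ :+ t₁₁ :+ t₁₂))
      (- (π ^ 3 * 240 /720 * T) ∷ π ^ 3 * 180 /720 * (w * β + d₁) ∷ π ^ 3 * 10 /720 * γ ∷ 420 /720 * π ^ 3 * β ∷ 360 /720 * π ^ 3 * dC ∷ ((1# - π) * 360 /720) * (1# + π * w) * π ^ 2 * dX
       ∷ π ^ 2 * 120 /720 * (1# + π * w) ∷ 360 /720 * β ∷ 144 /720 * γ ∷ π ^ 3 * 360 /720 * big ∷ (ι 13 * π ^ 3 + ι 12 * π - ι 12) * 240 /720 ∷ (ι 19 * π ^ 3 - ι 12) * 360 /720 * b₁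
       ∷ (ι 4 - ι 7 * π ^ 3) * b₂ ∷ (ι 11 * π ^ 3 - ι 6) * 120 /720 * b₃ ∷ t₁₃ ∷ t₁₄ ∷ t₁₅ ∷ [])

  module _ {w d₁ γ dC dX b₂ b₃ δ θ ε φ AG : Carrier} where

    private
      b₁ = π * AG - 1#

    -- The arguments encode 𝓑 (2 p - 4) = β + p δ, B (p + 1) = (1 + p θ) / 12, 𝓑 (2 p - 6) = γ + p
    -- ε, 𝓑 4 = - 1/120 and 𝓑 (p + 3) = 𝓑 4 + p φ, which exposes every power of p; the double sum is
    -- replaced by moments.
    formula′ : Carrier
    formula′ = formula 𝕋 w β d₁ γ dC dX big b₁ b₂ b₃ (β + π * δ) (60 /720 * (1# + π * θ)) (γ + π * ε) (- (6 /720)) (- (6 /720) + π * φ) AG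

    -- The coefficient of p ^ 3 left over once the convolution and the terms linear in p B are set
    -- apart; only its residue modulo p matters.
    bracket : Carrier
    bracket = - (240 /720 * 𝕋) + 360 /720 * (w - 1#) * dX - 360 /720 * big - 24 /720 * ε + 180 /720 * d₁ - 60 /720 * δ - 180 /720 * θ * β
      + 120 /720 * β * (1# + w - AG) - 24 /720 * γ * (1# + w - AG)

    -- At order p ^ 2 the multiples of β are - 1/12, 1/4 and - 1/6, with sum zero; the 1/4 is 1/2 -
    -- 3/12 from the leading value of B (p + 1).
    β-group : β-terms 𝕋 w β d₁ γ dC dX big b₁ b₂ b₃ (β + π * δ) (60 /720 * (1# + π * θ)) (γ + π * ε) (- (6 /720)) (- (6 /720) + π * φ) AG
      ≈[ 4 ] π ^ 3 * (180 /720 * d₁ - 60 /720 * δ - 180 /720 * θ * β + 120 /720 * β * (1# + w - AG))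
    β-group = SM.solveMod 4 {6} (λ π w β d₁ δ θ AG →
      π :^ 3 :* #/ 180 :* (w :* β :+ d₁) :+ #/ 420 :* π :^ 3 :* β :- π :^ 2 :* #/ 120 :* (# 1 :+ π :* w) :* (#/ 360 :* β)
        :+ π :* (# 2 :* β :- (β :+ π :* δ)) :* ((#/ 360 :- # 3 :* (#/ 60 :* (# 1 :+ π :* θ))) :* π :- #/ 960 :* π :^ 2)
        :+ # 2 :* π :* (β :+ π :* δ :- # 2 :* β) :* (π :* #/ 60 :- #/ 330 :* π :^ 2 :+ π :^ 2 :* #/ 60 :* AG)
      := π :^ 3 :* (#/ 180 :* d₁ :- #/ 60 :* δ :- #/ 180 :* θ :* β :+ #/ 120 :* β :* (# 1 :+ w :- AG))) (w ∷ β ∷ d₁ ∷ δ ∷ θ ∷ AG ∷ [])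

    -- The number 𝓑 (p + 3) enters with the factors - p and p and cancels, so φ disappears. At order
    -- p ^ 2 the multiples of γ are - 1/30 and 4/120.
    γ-group : γ-terms 𝕋 w β d₁ γ dC dX big b₁ b₂ b₃ (β + π * δ) (60 /720 * (1# + π * θ)) (γ + π * ε) (- (6 /720)) (- (6 /720) + π * φ) AG
      ≈[ 4 ] π ^ 3 * (- (24 /720 * ε) - 24 /720 * γ * (1# + w - AG))
    γ-group = SM.solveMod 4 {5} (λ π w γ ε φ AG →
      :- (π :^ 3 :* #/ 10 :* γ) :- π :^ 2 :* #/ 120 :* (# 1 :+ π :* w) :* (#/ 144 :* γ)
        :+ # 4 :* π :* (γ :+ π :* ε :- # 2 :* γ) :* (π :* (# 2 :* :- #/ 6 :- (:- #/ 6 :+ π :* φ)) :+ #/ 360 :* (#/ 7 :* π :^ 2 :+ # 2 :* π :* (:- #/ 6 :+ π :* φ) :+ # 2 :* π :* :- #/ 6 :* (π :* AG :- # 1)))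
      := π :^ 3 :* (:- (#/ 24 :* ε) :- #/ 24 :* γ :* (# 1 :+ w :- AG))) (w ∷ γ ∷ ε ∷ φ ∷ AG ∷ [])

    -- The prefactor (1 - p) (1 + p w) is 1 + p (w - 1) modulo p ^ 2; its constant part lets the two
    -- digits combine to dX + p dC.
    other-group : other-terms 𝕋 w β d₁ γ dC dX big b₁ b₂ b₃ (β + π * δ) (60 /720 * (1# + π * θ)) (γ + π * ε) (- (6 /720)) (- (6 /720) + π * φ) AG
      ≈[ 4 ] 360 /720 * (π ^ 2 * (dX + π * dC)) + π ^ 3 * (- (240 /720 * 𝕋) + 360 /720 * (w - 1#) * dX - 360 /720 * big)
    other-group = SM.solveMod 4 {5} (λ π T w dC dX g →
      :- (π :^ 3 :* #/ 240 :* T) :+ #/ 360 :* π :^ 3 :* dC :+ ((# 1 :- π) :* #/ 360) :* (# 1 :+ π :* w) :* π :^ 2 :* dX :- π :^ 3 :* #/ 360 :* g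
      := #/ 360 :* (π :^ 2 :* (dX :+ π :* dC)) :+ π :^ 3 :* (:- (#/ 240 :* T) :+ #/ 360 :* (w :- # 1) :* dX :- #/ 360 :* g)) (𝕋 ∷ w ∷ dC ∷ dX ∷ big ∷ [])

    module _ (b₁-spec : b (1 ℕ.* m) ≈ b₁) (b₂-spec : b (2 ℕ.* m) ≈ b₂) (b₃-spec : b (3 ℕ.* m) ≈ b₃) where

      -- The part of order p ^ 3 in the coefficients of the linear terms. It disappears because
      -- every p B (k (p - 1)) is - 1 modulo p and 13/3 - 19/2 + 7 - 11/6 = 0.
      b-total : Carrier
      b-total = π ^ 3 * (13 /720 * ι 240 + 19 /720 * ι 360 * b₁ - ι 7 * b₂ + 11 /720 * ι 120 * b₃)

      b-total≈0 : b-total ≈[ 4 ] 0#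
      b-total≈0 = transᵐ (π^*-cong 3 (begin
        13 /720 * ι 240 + 19 /720 * ι 360 * b₁ - ι 7 * b₂ + 11 /720 * ι 120 * b₃
          ≈⟨ +-congᵐ (+-congᵐ (+-congˡᵐ (*-congˡᵐ (≈-1 0 b₁-spec))) (-‿congᵐ (*-congˡᵐ (≈-1 1 b₂-spec)))) (*-congˡᵐ (≈-1 2 b₃-spec)) ⟩
        13 /720 * ι 240 + 19 /720 * ι 360 * - 1# - ι 7 * - 1# + 11 /720 * ι 120 * - 1#
          ≈⟨ exact (solve {0} (#/ 13 :* # 240 :+ #/ 19 :* # 360 :* :- # 1 :- # 7 :* :- # 1 :+ #/ 11 :* # 120 :* :- # 1 := # 0) []) ⟩
        0# ∎)) (exact (zeroʳ _))
        where
        open Reasoning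
        ≈-1 : ∀ k {y} → b (suc k ℕ.* m) ≈ y → y ≈[ 1 ] - 1#
        ≈-1 k h = transᵐ (exact (sym h)) (b-multiple≈-1 k)

      linear-group : linear-terms 𝕋 w β d₁ γ dC dX big b₁ b₂ b₃ (β + π * δ) (60 /720 * (1# + π * θ)) (γ + π * ε) (- (6 /720)) (- (6 /720) + π * φ) AG
        ≈[ 4 ] π - 1# - π * Q₁ + π ^ 2 * Q₂ - π ^ 3 * Q₃
      linear-group = begin
        (ι 13 * π ^ 3 + ι 12 * π - ι 12) * 240 /720 + (ι 19 * π ^ 3 - ι 12) * 360 /720 * b₁ + (ι 4 - ι 7 * π ^ 3) * b₂ + (ι 11 * π ^ 3 - ι 6) * 120 /720 * b₃
          ≈⟨ exact (solve {4} (λ π a b c → (# 13 :* π :^ 3 :+ # 12 :* π :- # 12) :* #/ 240 :+ (# 19 :* π :^ 3 :- # 12) :* #/ 360 :* a :+ (# 4 :- # 7 :* π :^ 3) :* b :+ (# 11 :* π :^ 3 :- # 6) :* #/ 120 :* c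
               := #/ 40 :* (# 6 :* ((# 12 :* π :- # 12) :+ :- (# 18 :* a) :+ # 12 :* b :- # 3 :* c)) :+ π :^ 3 :* (#/ 13 :* # 240 :+ #/ 19 :* # 360 :* a :- # 7 :* b :+ #/ 11 :* # 120 :* c)) (π ∷ b₁ ∷ b₂ ∷ b₃ ∷ [])) ⟩
        40 /720 * (ι 6 * ((ι 12 * π - ι 12) + - (ι 18 * b₁) + ι 12 * b₂ - ι 3 * b₃)) + b-total
          ≈⟨ +-congᵐ (*-congˡᵐ (transᵐ (exact (*-congˡ (sym (+-cong (+-cong (+-congˡ (-‿cong (*-congˡ b₁-spec))) (*-congˡ b₂-spec)) (-‿cong (*-congˡ b₃-spec)))))) linear-part)) b-total≈0 ⟩
        40 /720 * (ι 18 * (π - 1# - π * Q₁ + π ^ 2 * Q₂ - π ^ 3 * Q₃)) + 0#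
          ≈⟨ exact (solve {1} (λ y → #/ 40 :* (# 18 :* y) :+ # 0 := y) (π - 1# - π * Q₁ + π ^ 2 * Q₂ - π ^ 3 * Q₃ ∷ [])) ⟩
        π - 1# - π * Q₁ + π ^ 2 * Q₂ - π ^ 3 * Q₃ ∎
        where open Reasoning

      formula′≈ : formula′ ≈[ 4 ] 360 /720 * (π ^ 2 * (dX + π * dC)) + π ^ 3 * bracket + (π - 1# - π * Q₁ + π ^ 2 * Q₂ - π ^ 3 * Q₃)
      formula′≈ = begin
        formula′
          ≈⟨ exact (formula-split 𝕋 w β d₁ γ dC dX big b₁ b₂ b₃ (β + π * δ) (60 /720 * (1# + π * θ)) (γ + π * ε) (- (6 /720)) (- (6 /720) + π * φ) AG) ⟩
        _ ≈⟨ +-congᵐ (+-congᵐ (+-congᵐ other-group β-group) γ-group) linear-group ⟩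
        y + π ^ 3 * o + π ^ 3 * g + π ^ 3 * h + l
          ≈⟨ +-congʳᵐ (exact (trans (solve {5} (λ y π o g h → y :+ π :* o :+ π :* g :+ π :* h := y :+ π :* (o :+ g :+ h)) (y ∷ π ^ 3 ∷ o ∷ g ∷ h ∷ []))
               (+-congˡ (*-congˡ (solve {9} (λ a b c d e f i j k → (a :+ b :- c) :+ (d :- e :- f :+ i) :+ (:- j :- k) := a :+ b :- c :- j :+ d :- e :- f :+ i :- k)
                 (- (240 /720 * 𝕋) ∷ 360 /720 * (w - 1#) * dX ∷ 360 /720 * big ∷ 180 /720 * d₁ ∷ 60 /720 * δ ∷ 180 /720 * θ * β ∷ 120 /720 * β * (1# + w - AG) ∷ 24 /720 * ε ∷ 24 /720 * γ * (1# + w - AG) ∷ [])))))) ⟩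
        y + π ^ 3 * bracket + l ∎
        where
        open Reasoning
        y = 360 /720 * (π ^ 2 * (dX + π * dC))
        o = - (240 /720 * 𝕋) + 360 /720 * (w - 1#) * dX - 360 /720 * big
        g = 180 /720 * d₁ - 60 /720 * δ - 180 /720 * θ * β + 120 /720 * β * (1# + w - AG)
        h = - (24 /720 * ε) - 24 /720 * γ * (1# + w - AG)
        l = π - 1# - π * Q₁ + π ^ 2 * Q₂ - π ^ 3 * Q₃

      module _ (w-spec : ι (m !) ≈ π * w - 1#) (conv-digits : dX + π * dC ≈[ 2 ] conv m) (d₁≈δ : d₁ ≈[ 1 ] δ)
        (𝔠2≈ : ι 12 * 𝔠 2 ≈ 1#) (𝔠4≈ : ι 120 * 𝔠 4 ≈ - 1#)
        (δ≈ : ι 2 * δ ≈[ 1 ] - M (m ∸ 2)) (ε≈ : ι 2 * ε ≈[ 1 ] - M (m ∸ 4)) (θ≈ : θ ≈[ 1 ] - ι 2 - ι 6 * M 2) where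

        private
          w≈ : w ≈[ 1 ] Q₁
          w≈ = w≈Q₁ w-spec

          dX≈ : dX ≈[ 1 ] - (Q₁ ^ 2 + Q₂)
          dX≈ = transᵐ (transᵐ (SM.solveMod 1 {2} (λ π x c → x := x :+ π :* c) (dX ∷ dC ∷ [])) (reduce (s≤s z≤n) conv-digits)) conv≈

          AG≈ : AG ≈[ 1 ] 1# + Q₁
          AG≈ = π-cancel (begin
            π * AG                       ≈⟨ exact (solve {1} (λ y → y := y :- # 1 :+ # 1) (π * AG ∷ [])) ⟩
            π * AG - 1# + 1#             ≈⟨ +-congʳᵐ (transᵐ (exact (sym b₁-spec)) b-m≈) ⟩
            π - 1# + π * Q₁ + 1#         ≈⟨ exact (solve {2} (λ π a → π :- # 1 :+ π :* a :+ # 1 := π :* (# 1 :+ a)) (π ∷ Q₁ ∷ [])) ⟩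
            π * (1# + Q₁)                ∎)
            where open Reasoning

          -- Modulo p both the Wilson quotient and the Agoh-Giuga quotient are known through Q₁;
          -- this removes the remaining terms in γ.
          AG-w : 1# + w - AG ≈[ 1 ] 0#
          AG-w = transᵐ (+-congᵐ (+-congˡᵐ w≈) (-‿congᵐ AG≈)) (exact (-‿inverseʳ _))

          𝔠2 : 𝔠 2 ≈ 60 /720
          𝔠2 = trans (solve {1} (λ c → c := #/ 60 :* (# 12 :* c)) (𝔠 2 ∷ [])) (trans (*-congˡ 𝔠2≈) (*-identityʳ _))

          𝔠4 : 𝔠 4 ≈ - (6 /720)
          𝔠4 = trans (solve {1} (λ c → c := #/ 6 :* (# 120 :* c)) (𝔠 4 ∷ [])) (trans (*-congˡ 𝔠4≈) (solve {0} (#/ 6 :* :- # 1 := :- #/ 6) []))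

          big≈ : big ≈[ 1 ] DQ + 240 /720 * δ - 48 /720 * ε + ι 3 * β * M 2
          big≈ = begin
            big
              ≈⟨ exact (solve {3} (λ a b c → b := (a :+ b :- c) :- a :+ c) (ι 2 * 𝔠 2 * M (m ∸ 2) + ι 4 * 𝔠 4 * M (m ∸ 4) ∷ big ∷ ι 3 * β * M 2 ∷ [])) ⟩
            ι 2 * 𝔠 2 * M (m ∸ 2) + ι 4 * 𝔠 4 * M (m ∸ 4) + big - ι 3 * β * M 2 - (ι 2 * 𝔠 2 * M (m ∸ 2) + ι 4 * 𝔠 4 * M (m ∸ 4)) + ι 3 * β * M 2
              ≈⟨ +-congʳᵐ (+-congᵐ (symᵐ DQ-split) (-‿congᵐ (+-congᵐ (*-congᵐ (*-congˡᵐ (exact 𝔠2)) M-2) (*-congᵐ (*-congˡᵐ (exact 𝔠4)) M-4)))) ⟩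
            DQ - (ι 2 * 60 /720 * - (ι 2 * δ) + ι 4 * - (6 /720) * - (ι 2 * ε)) + ι 3 * β * M 2
              ≈⟨ exact (solve {4} (λ d a e f → d :- (# 2 :* #/ 60 :* :- (# 2 :* a) :+ # 4 :* :- #/ 6 :* :- (# 2 :* e)) :+ f := d :+ #/ 240 :* a :- #/ 48 :* e :+ f) (DQ ∷ δ ∷ ε ∷ ι 3 * β * M 2 ∷ [])) ⟩
            DQ + 240 /720 * δ - 48 /720 * ε + ι 3 * β * M 2 ∎
            where
            open Reasoning
            flip : ∀ {x y} → x ≈[ 1 ] - y → y ≈[ 1 ] - x
            flip h = transᵐ (exact (solve {1} (λ y → y := :- :- y) (_ ∷ []))) (-‿congᵐ (symᵐ h))
            M-2 : M (m ∸ 2) ≈[ 1 ] - (ι 2 * δ)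
            M-2 = flip δ≈
            M-4 : M (m ∸ 4) ≈[ 1 ] - (ι 2 * ε)
            M-4 = flip ε≈

          𝕋≈′ : 𝕋 ≈[ 1 ] 90 /720 * (- (ι 16 * Q₃) - ι 24 * Q₁ * Q₂ - ι 8 * Q₁ ^ 3 + ι 6 * β - ι 24 * DQ)
          𝕋≈′ = transᵐ (exact (solve {1} (λ t → t := #/ 90 :* (# 8 :* t)) (𝕋 ∷ []))) (*-congˡᵐ 𝕋≈)

          -- The Kummer quotients and M 2 cancel: δ has the coefficients 1/4, - 1/12 and - 1/6, ε
          -- has - 1/30 and 1/30, and θ contributes 3/2 β M 2 against - 3/2 β M 2 from the double
          -- sum.
          bracket≈ : bracket ≈[ 1 ] 480 /720 * Q₃ + 360 /720 * Q₁ * Q₂ - 120 /720 * Q₁ ^ 3 + 360 /720 * (Q₁ ^ 2 + Q₂) + 180 /720 * β + 360 /720 * DQ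
          bracket≈ = begin
            bracket
              ≈⟨ +-congᵐ (+-congᵐ (+-congᵐ (+-congʳᵐ (+-congᵐ (+-congʳᵐ (+-congᵐ (+-congᵐ (-‿congᵐ (*-congˡᵐ 𝕋≈′)) (*-congᵐ (*-congˡᵐ (+-congʳᵐ w≈)) dX≈)) (-‿congᵐ (*-congˡᵐ big≈))))
                   (*-congˡᵐ d₁≈δ))) (-‿congᵐ (*-congʳᵐ (*-congˡᵐ θ≈)))) (*-congˡᵐ AG-w)) (-‿congᵐ (*-congˡᵐ AG-w)) ⟩
            _ ≈⟨ exact (solve {9} (λ a b c d β δ ε γ e →
                   :- (#/ 240 :* (#/ 90 :* (:- (# 16 :* c) :- # 24 :* a :* b :- # 8 :* a :^ 3 :+ # 6 :* β :- # 24 :* d))) :+ #/ 360 :* (a :- # 1) :* :- (a :^ 2 :+ b) :- #/ 360 :* (d :+ #/ 240 :* δ :- #/ 48 :* ε :+ # 3 :* β :* e)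
                     :- #/ 24 :* ε :+ #/ 180 :* δ :- #/ 60 :* δ :- #/ 180 :* (:- # 2 :- # 6 :* e) :* β :+ #/ 120 :* β :* # 0 :- #/ 24 :* γ :* # 0
                   := #/ 480 :* c :+ #/ 360 :* a :* b :- #/ 120 :* a :^ 3 :+ #/ 360 :* (a :^ 2 :+ b) :+ #/ 180 :* β :+ #/ 360 :* d) (Q₁ ∷ Q₂ ∷ Q₃ ∷ DQ ∷ β ∷ δ ∷ ε ∷ γ ∷ M 2 ∷ [])) ⟩
            480 /720 * Q₃ + 360 /720 * Q₁ * Q₂ - 120 /720 * Q₁ ^ 3 + 360 /720 * (Q₁ ^ 2 + Q₂) + 180 /720 * β + 360 /720 * DQ ∎
            where open Reasoning

        -- The last quantities other than the Q, namely β and DQ, cancel between the convolution,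
        -- known from `conv≈₂`, and `bracket≈`. What remains is minus the first factor of `wilson₄`.
        formula′-value : ι 6 * formula′ ≈[ 4 ] - (ι 6 + ι 6 * π * (Q₁ - 1#) + ι 3 * π ^ 2 * (Q₁ ^ 2 - Q₂) + π ^ 3 * (ι 2 * Q₃ + ι 3 * Q₁ ^ 2 - ι 3 * Q₁ * Q₂ + Q₁ ^ 3))
        formula′-value = begin
          ι 6 * formula′
            ≈⟨ *-congˡᵐ formula′≈ ⟩
          ι 6 * (360 /720 * (π ^ 2 * (dX + π * dC)) + π ^ 3 * bracket + (π - 1# - π * Q₁ + π ^ 2 * Q₂ - π ^ 3 * Q₃))
            ≈⟨ *-congˡᵐ (+-congʳᵐ (+-congᵐ (transᵐ (*-congˡᵐ (π^*-cong 2 conv-digits)) (exact (solve {2} (λ a c → #/ 360 :* (a :* c) := #/ 180 :* (a :* (# 2 :* c))) (π ^ 2 ∷ conv m ∷ [])))) (π^*-cong 3 bracket≈))) ⟩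
          ι 6 * (180 /720 * (π ^ 2 * (ι 2 * conv m)) + π ^ 3 * _ + (π - 1# - π * Q₁ + π ^ 2 * Q₂ - π ^ 3 * Q₃))
            ≈⟨ *-congˡᵐ (+-congʳᵐ (+-congʳᵐ (*-congˡᵐ (π^*-cong 2 conv≈₂)))) ⟩
          _ ≈⟨ SM.solveMod 4 {5} (λ π a b c d β →
                 # 6 :* (#/ 180 :* (π :^ 2 :* (:- (# 2 :* (# 1 :+ π) :* b) :- # 2 :* (# 1 :+ # 2 :* π) :* a :^ 2 :- π :* β :- # 2 :* π :* d))
                   :+ π :^ 3 :* (#/ 480 :* c :+ #/ 360 :* a :* b :- #/ 120 :* a :^ 3 :+ #/ 360 :* (a :^ 2 :+ b) :+ #/ 180 :* β :+ #/ 360 :* d)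
                   :+ (π :- # 1 :- π :* a :+ π :^ 2 :* b :- π :^ 3 :* c))
                 := :- (# 6 :+ # 6 :* π :* (a :- # 1) :+ # 3 :* π :^ 2 :* (a :^ 2 :- b) :+ π :^ 3 :* (# 2 :* c :+ # 3 :* a :^ 2 :- # 3 :* a :* b :+ a :^ 3))) (Q₁ ∷ Q₂ ∷ Q₃ ∷ DQ ∷ β ∷ []) ⟩
          _ ∎
          where open Reasoning

        formula′*[p-1]! : formula′ * ι (m !) ≈[ 4 ] - ι m
        formula′*[p-1]! = small-unit 6 (s≤s z≤n) (ℕₚ.m≤m+n 6 4) (begin
          ι 6 * (formula′ * ι (m !))     ≈⟨ exact (sym (*-assoc _ _ _)) ⟩
          ι 6 * formula′ * ι (m !)       ≈⟨ *-congʳᵐ formula′-value ⟩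
          - _ * ι (m !)                  ≈⟨ exact (solve {2} (λ a f → (:- a) :* f := :- (a :* f)) (_ ∷ ι (m !) ∷ [])) ⟩
          - (_ * ι (m !))                ≈⟨ -‿congᵐ (wilson₄ w-spec) ⟩
          - (ι 6 * (π - 1#))             ≈⟨ exact (trans (solve {1} (λ a → :- (# 6 :* a) := # 6 :* :- a) (π - 1# ∷ [])) (*-congˡ (-‿cong (sym ι-m)))) ⟩
          ι 6 * - ι m                    ∎)
          where open Reasoning

module Numeralsℚ = Numerals ℚₚ.+-*-commutativeRing
module Sumsℚ = Sums ℚₚ.+-*-commutativeRing

-- Rational numbers and their division

module Rationals where
  open import Defs
  import Data.Integer.Properties as ℤₚ
  open import Data.Rational as ℚ using (ℚ; _+_; _*_; _-_; -_; ↥_; ↧ₙ_; 0ℚ; 1ℚ; fromℚᵘ; toℚᵘ)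
  import Data.Rational.Unnormalised as ℚᵘ
  import Data.Rational.Unnormalised.Properties as ℚᵘₚ
  open ≡ using (refl; sym; trans; cong; cong₂; module ≡-Reasoning)
  open Numeralsℚ using (ι; ι-suc; solve; _:=_; _:*_)

  fromℚᵘ-+ : ∀ x y → fromℚᵘ x + fromℚᵘ y ≡ fromℚᵘ (x ℚᵘ.+ y)
  fromℚᵘ-+ x y = ℚₚ.toℚᵘ-injective $ begin
    toℚᵘ (fromℚᵘ x + fromℚᵘ y)             ≈⟨ ℚₚ.toℚᵘ-homo-+ (fromℚᵘ x) (fromℚᵘ y) ⟩
    toℚᵘ (fromℚᵘ x) ℚᵘ.+ toℚᵘ (fromℚᵘ y)   ≈⟨ ℚᵘₚ.+-cong (ℚₚ.toℚᵘ-fromℚᵘ x) (ℚₚ.toℚᵘ-fromℚᵘ y) ⟩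
    x ℚᵘ.+ y                               ≈⟨ ℚₚ.toℚᵘ-fromℚᵘ (x ℚᵘ.+ y) ⟨
    toℚᵘ (fromℚᵘ (x ℚᵘ.+ y))               ∎
    where open ℚᵘₚ.≃-Reasoning

  fromℚᵘ-* : ∀ x y → fromℚᵘ x * fromℚᵘ y ≡ fromℚᵘ (x ℚᵘ.* y)
  fromℚᵘ-* x y = ℚₚ.toℚᵘ-injective $ begin
    toℚᵘ (fromℚᵘ x * fromℚᵘ y)             ≈⟨ ℚₚ.toℚᵘ-homo-* (fromℚᵘ x) (fromℚᵘ y) ⟩
    toℚᵘ (fromℚᵘ x) ℚᵘ.* toℚᵘ (fromℚᵘ y)   ≈⟨ ℚᵘₚ.*-cong (ℚₚ.toℚᵘ-fromℚᵘ x) (ℚₚ.toℚᵘ-fromℚᵘ y) ⟩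
    x ℚᵘ.* y                               ≈⟨ ℚₚ.toℚᵘ-fromℚᵘ (x ℚᵘ.* y) ⟨
    toℚᵘ (fromℚᵘ (x ℚᵘ.* y))               ∎
    where open ℚᵘₚ.≃-Reasoning

  ℤ→ℚ-+ : ∀ x y → ℤ→ℚ (x ℤ.+ y) ≡ ℤ→ℚ x + ℤ→ℚ y
  ℤ→ℚ-+ x y = sym (trans (fromℚᵘ-+ (ℚᵘ.mkℚᵘ x 0) (ℚᵘ.mkℚᵘ y 0))
    (ℚₚ.fromℚᵘ-cong {ℚᵘ.mkℚᵘ x 0 ℚᵘ.+ ℚᵘ.mkℚᵘ y 0} {ℚᵘ.mkℚᵘ (x ℤ.+ y) 0} (ℚᵘ.*≡* (cong (ℤ._* + 1) (cong₂ ℤ._+_ (ℤₚ.*-identityʳ x) (ℤₚ.*-identityʳ y))))))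

  ℤ→ℚ-* : ∀ x y → ℤ→ℚ (x ℤ.* y) ≡ ℤ→ℚ x * ℤ→ℚ y
  ℤ→ℚ-* x y = sym (trans (fromℚᵘ-* (ℚᵘ.mkℚᵘ x 0) (ℚᵘ.mkℚᵘ y 0)) (ℚₚ.fromℚᵘ-cong {ℚᵘ.mkℚᵘ x 0 ℚᵘ.* ℚᵘ.mkℚᵘ y 0} {ℚᵘ.mkℚᵘ (x ℤ.* y) 0} (ℚᵘ.*≡* refl)))

  ℤ→ℚ-neg : ∀ x → ℤ→ℚ (ℤ.- x) ≡ - ℤ→ℚ x
  ℤ→ℚ-neg x = begin
    ℤ→ℚ (ℤ.- x)          ≡⟨ cong ℤ→ℚ (ℤₚ.-1*i≡-i x) ⟨
    ℤ→ℚ (ℤ.- + 1 ℤ.* x)  ≡⟨ ℤ→ℚ-* (ℤ.- + 1) x ⟩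
    - 1ℚ * ℤ→ℚ x         ≡⟨ ℚₚ.neg-distribˡ-* 1ℚ (ℤ→ℚ x) ⟨
    - (1ℚ * ℤ→ℚ x)       ≡⟨ cong (-_) (ℚₚ.*-identityˡ (ℤ→ℚ x)) ⟩
    - ℤ→ℚ x              ∎
    where open ≡-Reasoning

  ℕ→ℚ-+ : ∀ m n → ℕ→ℚ (m ℕ.+ n) ≡ ℕ→ℚ m + ℕ→ℚ n
  ℕ→ℚ-+ m n = ℤ→ℚ-+ (+ m) (+ n)

  ℕ→ℚ-* : ∀ m n → ℕ→ℚ (m ℕ.* n) ≡ ℕ→ℚ m * ℕ→ℚ n
  ℕ→ℚ-* m n = trans (cong ℤ→ℚ (ℤₚ.pos-* m n)) (ℤ→ℚ-* (+ m) (+ n))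

  ι≡ℕ→ℚ : ∀ n → ι n ≡ ℕ→ℚ n
  ι≡ℕ→ℚ zero    = refl
  ι≡ℕ→ℚ (suc n) = trans (ι-suc n) (trans (cong (λ z → 1ℚ + z) (ι≡ℕ→ℚ n)) (sym (ℕ→ℚ-+ 1 n)))

  frac-* : ∀ z n → frac z (suc n) * ℕ→ℚ (suc n) ≡ ℤ→ℚ z
  frac-* z n = trans (fromℚᵘ-* (ℚᵘ.mkℚᵘ z n) (ℚᵘ.mkℚᵘ (+ suc n) 0))
    (ℚₚ.fromℚᵘ-cong {ℚᵘ.mkℚᵘ z n ℚᵘ.* ℚᵘ.mkℚᵘ (+ suc n) 0} {ℚᵘ.mkℚᵘ z 0} (ℚᵘ.*≡* (trans (ℤₚ.*-identityʳ _) (cong (λ k → z ℤ.* + suc k) (sym (ℕₚ.*-identityʳ n))))))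

  ↥-↧ : ∀ x → x * ℕ→ℚ (↧ₙ x) ≡ ℤ→ℚ (↥ x)
  ↥-↧ x = trans (cong (_* ℕ→ℚ (↧ₙ x)) (sym (ℚₚ.↥p/↧p≡p x))) (frac-* (↥ x) (ℚ.denominator-1 x))

  invℕ : ∀ n → ℕ→ℚ (suc n) * frac (+ 1) (suc n) ≡ 1ℚ
  invℕ n = trans (ℚₚ.*-comm (ℕ→ℚ (suc n)) _) (frac-* (+ 1) n)

  *-cancelʳ-ℕ : ∀ n {x y} → x * ℕ→ℚ (suc n) ≡ y * ℕ→ℚ (suc n) → x ≡ y
  *-cancelʳ-ℕ n {x} {y} h = begin
    x                                        ≡⟨ ℚₚ.*-identityʳ x ⟨
    x * 1ℚ                                   ≡⟨ cong (x *_) (invℕ n) ⟨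
    x * (ℕ→ℚ (suc n) * frac (+ 1) (suc n))   ≡⟨ ℚₚ.*-assoc x _ _ ⟨
    x * ℕ→ℚ (suc n) * frac (+ 1) (suc n)     ≡⟨ cong (_* frac (+ 1) (suc n)) h ⟩
    y * ℕ→ℚ (suc n) * frac (+ 1) (suc n)     ≡⟨ ℚₚ.*-assoc y _ _ ⟩
    y * (ℕ→ℚ (suc n) * frac (+ 1) (suc n))   ≡⟨ cong (y *_) (invℕ n) ⟩
    y * 1ℚ                                   ≡⟨ ℚₚ.*-identityʳ y ⟩
    y                                        ∎
    where open ≡-Reasoning

  private
    -- The common computation for both signs of y: F is the denominator of y over its absolute
    -- numerator m, s the sign, n the signed numerator and d the denominator.
    ÷q-lemma : ∀ x y F s m d n → F * m ≡ d → s * n ≡ m → y * d ≡ n → (x * F * s) * y * d ≡ x * d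
    ÷q-lemma x y F s m d n h₁ h₂ h₃ = begin
      (x * F * s) * y * d    ≡⟨ solve {5} (λ x F s y d → (x :* F :* s) :* y :* d := x :* (F :* (s :* (y :* d)))) (x ∷ F ∷ s ∷ y ∷ d ∷ []) ⟩
      x * (F * (s * (y * d))) ≡⟨ cong (λ z → x * (F * (s * z))) h₃ ⟩
      x * (F * (s * n))       ≡⟨ cong (λ z → x * (F * z)) h₂ ⟩
      x * (F * m)             ≡⟨ cong (x *_) h₁ ⟩
      x * d                   ∎
      where open ≡-Reasoning

  ÷q-* : ∀ x y → y ≢ 0ℚ → (x ÷q y) * y ≡ x
  ÷q-* x y@(ℚ.mkℚ (+ zero) d c)    y≢0 = contradiction (ℚₚ.↥p≡0⇒p≡0 y refl) y≢0
  ÷q-* x y@(ℚ.mkℚ (+ suc n) d c)   y≢0 = *-cancelʳ-ℕ d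
    (÷q-lemma x y _ 1ℚ (ℕ→ℚ (suc n)) _ (ℕ→ℚ (suc n)) (frac-* (+ suc d) n) (ℚₚ.*-identityˡ _) (↥-↧ y))
  ÷q-* x y@(ℚ.mkℚ (-[1+ n ]) d c) y≢0 = *-cancelʳ-ℕ d
    (÷q-lemma x y _ (- 1ℚ) (ℕ→ℚ (suc n)) _ (ℤ→ℚ -[1+ n ]) (frac-* (+ suc d) n)
      (trans (sym (ℚₚ.neg-distribˡ-* 1ℚ (ℤ→ℚ -[1+ n ]))) (trans (cong (-_) (ℚₚ.*-identityˡ (ℤ→ℚ -[1+ n ]))) (sym (ℤ→ℚ-neg -[1+ n ])))) (↥-↧ y))

-- Bernoulli numbers, Faulhaber's formula and reflection

module Bernoulli where
  open import Defs
  open import Data.List using (List; []; _∷_; _++_; length)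
  import Data.List.Properties as Listₚ
  open import Data.Rational as ℚ using (ℚ; _+_; _*_; _-_; -_; 0ℚ; 1ℚ)
  open ≡ using (refl; sym; trans; cong; cong₂; subst; module ≡-Reasoning)
  open Numeralsℚ hiding (lhs; rhs)
  open Sumsℚ
  open Rationals
  open import Algebra.Properties.Semiring.Exp (CommutativeRing.semiring ℚₚ.+-*-commutativeRing) using (_^_; ^-assocʳ)
  open ≡-Reasoning

  sumFrom≡∑ : ∀ lo c f → sumFrom lo c f ≡ ∑ c (λ i → f (lo ℕ.+ i))
  sumFrom≡∑ lo zero    f = refl
  sumFrom≡∑ lo (suc c) f = begin
    f lo + sumFrom (suc lo) c f                          ≡⟨ cong₂ _+_ (cong f (sym (ℕₚ.+-identityʳ lo))) (sumFrom≡∑ (suc lo) c f) ⟩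
    f (lo ℕ.+ 0) + ∑ c (λ i → f (suc lo ℕ.+ i))          ≡⟨ cong (λ z → f (lo ℕ.+ 0) + z) (∑-cong′ c λ i → cong f (sym (ℕₚ.+-suc lo i))) ⟩
    f (lo ℕ.+ 0) + ∑ c (λ i → f (lo ℕ.+ suc i))          ≡⟨ ∑-cons c (λ i → f (lo ℕ.+ i)) ⟨
    ∑ (suc c) (λ i → f (lo ℕ.+ i))                       ∎

  1/ : ℕ → ℚ
  1/ n = frac (+ 1) (suc n)

  ι-1/ : ∀ n → ι (suc n) * 1/ n ≡ 1ℚ
  ι-1/ n = trans (cong (_* 1/ n) (ι≡ℕ→ℚ (suc n))) (invℕ n)

  ι-cancel : ∀ n {x y} → ι (suc n) * x ≡ ι (suc n) * y → x ≡ y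
  ι-cancel n {x} {y} h = begin
    x                       ≡⟨ one x ⟨
    1/ n * (ι (suc n) * x)  ≡⟨ cong (1/ n *_) h ⟩
    1/ n * (ι (suc n) * y)  ≡⟨ one y ⟩
    y                       ∎
    where
    one : ∀ z → 1/ n * (ι (suc n) * z) ≡ z
    one z = begin
      1/ n * (ι (suc n) * z)  ≡⟨ solve {3} (λ a b c → a :* (b :* c) := (b :* a) :* c) (1/ n ∷ ι (suc n) ∷ z ∷ []) ⟩
      ι (suc n) * 1/ n * z    ≡⟨ cong (_* z) (ι-1/ n) ⟩
      1ℚ * z                  ≡⟨ ℚₚ.*-identityˡ z ⟩
      z                       ∎

  length-bernAll : ∀ n → length (bernAll n) ≡ suc n
  length-bernAll zero    = refl
  length-bernAll (suc n) = trans (Listₚ.length-++ (bernAll n)) (trans (ℕₚ.+-comm _ 1) (cong suc (length-bernAll n)))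

  index-++ˡ : ∀ xs ys {k} → k ℕ.< length xs → index (xs ++ ys) k ≡ index xs k
  index-++ˡ (x ∷ xs) ys {zero}  _       = refl
  index-++ˡ (x ∷ xs) ys {suc k} (s≤s h) = index-++ˡ xs ys h

  index-last : ∀ xs y {k} → k ≡ length xs → index (xs ++ (y ∷ [])) k ≡ y
  index-last []       y refl = refl
  index-last (x ∷ xs) y refl = index-last xs y refl

  index-bernAll : ∀ n {k} → k ℕ.≤ n → index (bernAll n) k ≡ B k
  index-bernAll zero    z≤n = refl
  index-bernAll (suc n) {k} k≤ with ℕₚ.m≤n⇒m<n∨m≡n k≤
  ... | inj₂ refl = refl
  ... | inj₁ k<   = trans (index-++ˡ (bernAll n) _ (subst (k ℕ.<_) (sym (length-bernAll n)) k<)) (index-bernAll n (ℕₚ.≤-pred k<))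

  B-suc : ∀ n → B (suc n) ≡ - (1/ (suc n) * ∑ (suc n) (λ k → ι (suc (suc n) C k) * B k))
  B-suc n = trans (index-last (bernAll n) _ (sym (length-bernAll n))) (cong (λ z → - (1/ (suc n) * z)) (begin
    sumFrom 0 (suc n) (λ k → ℕ→ℚ (suc (suc n) C k) * index (bernAll n) k)
      ≡⟨ sumFrom≡∑ 0 (suc n) _ ⟩
    ∑ (suc n) (λ k → ℕ→ℚ (suc (suc n) C k) * index (bernAll n) k)
      ≡⟨ ∑-cong (suc n) (λ k k< → cong₂ _*_ (sym (ι≡ℕ→ℚ (suc (suc n) C k))) (index-bernAll n (ℕₚ.≤-pred k<))) ⟩
    ∑ (suc n) (λ k → ι (suc (suc n) C k) * B k) ∎))

  nC[n-1] : ∀ n → suc n C n ≡ suc n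
  nC[n-1] n = trans (nCk≡nC[n∸k] (ℕₚ.n≤1+n n)) (trans (cong (suc n C_) (trans (ℕₚ.+-∸-assoc 1 (ℕₚ.≤-refl {n})) (cong suc (ℕₚ.n∸n≡0 n)))) (nC1≡n (suc n)))

  B-recurrence : ∀ n → ∑ (suc (suc n)) (λ k → ι (suc (suc n) C k) * B k) ≡ 0ℚ
  B-recurrence n = begin
    s + ι (suc (suc n) C suc n) * B (suc n)       ≡⟨ cong₂ (λ a b → s + ι a * b) (nC[n-1] (suc n)) (B-suc n) ⟩
    s + ι (suc (suc n)) * - (1/ (suc n) * s)      ≡⟨ solve {3} (λ s a b → s :+ a :* :- (b :* s) := s :- (a :* b) :* s) (s ∷ ι (suc (suc n)) ∷ 1/ (suc n) ∷ []) ⟩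
    s - ι (suc (suc n)) * 1/ (suc n) * s          ≡⟨ cong (λ z → s - z * s) (ι-1/ (suc n)) ⟩
    s - 1ℚ * s                                    ≡⟨ solve {1} (λ s → s :- # 1 :* s := # 0) (s ∷ []) ⟩
    0ℚ                                            ∎
    where s = ∑ (suc n) (λ k → ι (suc (suc n) C k) * B k)

  -- The generating function t / (e ^ t - 1) of the Bernoulli numbers, in the division-free form
  -- B(t) e ^ t = B(t) + t.
  B⋆pow1 : B ⋆ pow 1ℚ ≗′ λ n → B n + egf-t n
  B⋆pow1 zero          = refl
  B⋆pow1 (suc zero)    = refl
  B⋆pow1 (suc (suc n)) = begin
    (B ⋆ pow 1ℚ) m
      ≡⟨ ⋆-closed m B (pow 1ℚ) ⟩
    ∑ m (λ k → ι (m C k) * (B k * 1ℚ ^ (m ∸ k))) + ι (m C m) * (B m * 1ℚ ^ (m ∸ m))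
      ≡⟨ cong₂ _+_ (∑-cong′ m (λ k → cong (ι (m C k) *_) (one k))) (cong₂ (λ a b → ι a * b) (nCn≡1 m) (one m)) ⟩
    ∑ m (λ k → ι (m C k) * B k) + 1ℚ * B m
      ≡⟨ cong (_+ 1ℚ * B m) (B-recurrence n) ⟩
    0ℚ + 1ℚ * B m
      ≡⟨ solve {1} (λ b → # 0 :+ # 1 :* b := b :+ # 0) (B m ∷ []) ⟩
    B m + 0ℚ ∎
    where
    m = suc (suc n)
    one : ∀ k → B k * 1ℚ ^ (m ∸ k) ≡ B k
    one k = trans (cong (B k *_) (1^ (m ∸ k))) (ℚₚ.*-identityʳ _)

  -- The exponential generating function of this sequence is (e ^ (x t) - 1) / t.
  E : ℚ → ℕ → ℚ
  E x n = x ^ suc n * 1/ n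

  t⋆E : ∀ x → (λ n → (egf-t ⋆ E x) n + unit n) ≗′ pow x
  t⋆E x zero    = begin
    0ℚ * E x 0 + 1ℚ  ≡⟨ solve {1} (λ a → # 0 :* a :+ # 1 := # 1) (E x 0 ∷ []) ⟩
    1ℚ               ∎
  t⋆E x (suc n) = begin
    (egf-t ⋆ E x) (suc n) + 0ℚ               ≡⟨ cong (_+ 0ℚ) (⋆-t-suc (E x) n) ⟩
    ι (suc n) * (x ^ suc n * 1/ n) + 0ℚ    ≡⟨ solve {3} (λ a b c → a :* (b :* c) :+ # 0 := b :* (a :* c)) (ι (suc n) ∷ x ^ suc n ∷ 1/ n ∷ []) ⟩
    x ^ suc n * (ι (suc n) * 1/ n)         ≡⟨ cong (x ^ suc n *_) (ι-1/ n) ⟩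
    x ^ suc n * 1ℚ                         ≡⟨ ℚₚ.*-identityʳ _ ⟩
    x ^ suc n                              ∎

  t⋆-injective : ∀ {f g} → egf-t ⋆ f ≗′ egf-t ⋆ g → f ≗′ g
  t⋆-injective {f} {g} h n = ι-cancel n (trans (sym (⋆-t-suc f n)) (trans (h (suc n)) (⋆-t-suc g n)))

  +-cancelʳ : ∀ {x y} z → x + z ≡ y + z → x ≡ y
  +-cancelʳ {x} {y} z h = begin
    x            ≡⟨ solve {2} (λ x z → x := (x :+ z) :- z) (x ∷ z ∷ []) ⟩
    x + z - z    ≡⟨ cong (_- z) h ⟩
    y + z - z    ≡⟨ solve {2} (λ x z → (x :+ z) :- z := x) (y ∷ z ∷ []) ⟩
    y            ∎

  ⋆-swapˡ : ∀ f g h → f ⋆ (g ⋆ h) ≗′ g ⋆ (f ⋆ h)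
  ⋆-swapˡ f g h n = trans (sym (⋆-assoc f g h n)) (trans (⋆-cong (⋆-comm f g) (λ _ → refl) n) (⋆-assoc g f h n))

  -- The hypothesis reads F (e ^ t - 1) = t, and cancelling t makes F the inverse of (e ^ t - 1) /
  -- t. It is applied to B and to its reflection, which therefore agree.
  ⋆E1≗unit : ∀ F → F ⋆ pow 1ℚ ≗′ (λ n → F n + egf-t n) → F ⋆ E 1ℚ ≗′ unit
  ⋆E1≗unit F h = t⋆-injective λ n → +-cancelʳ (F n) (begin
    (egf-t ⋆ (F ⋆ E 1ℚ)) n + F n               ≡⟨ cong₂ _+_ (⋆-swapˡ egf-t F (E 1ℚ) n) (sym (trans (⋆-comm F unit n) (⋆-unit F n))) ⟩
    (F ⋆ (egf-t ⋆ E 1ℚ)) n + (F ⋆ unit) n      ≡⟨ ⋆-distribˡ F (egf-t ⋆ E 1ℚ) unit n ⟨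
    (F ⋆ (λ m → (egf-t ⋆ E 1ℚ) m + unit m)) n  ≡⟨ ⋆-cong {F} (λ _ → refl) (t⋆E 1ℚ) n ⟩
    (F ⋆ pow 1ℚ) n                           ≡⟨ h n ⟩
    F n + egf-t n                              ≡⟨ ℚₚ.+-comm (F n) (egf-t n) ⟩
    egf-t n + F n                              ≡⟨ cong (_+ F n) (trans (⋆-comm egf-t unit n) (⋆-unit egf-t n)) ⟨
    (egf-t ⋆ unit) n + F n                     ∎)

  E-suc : ∀ x → E (x + 1ℚ) ≗′ λ n → E x n + (pow x ⋆ E 1ℚ) n
  E-suc x = t⋆-injective λ n → +-cancelʳ (unit n) (begin
    (egf-t ⋆ E (x + 1ℚ)) n + unit n
      ≡⟨ t⋆E (x + 1ℚ) n ⟩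
    pow (x + 1ℚ) n
      ≡⟨ ⋆-pow x 1ℚ n ⟨
    (pow x ⋆ pow 1ℚ) n
      ≡⟨ ⋆-cong {pow x} (λ _ → refl) (λ m → sym (t⋆E 1ℚ m)) n ⟩
    (pow x ⋆ (λ m → (egf-t ⋆ E 1ℚ) m + unit m)) n
      ≡⟨ ⋆-distribˡ (pow x) (egf-t ⋆ E 1ℚ) unit n ⟩
    (pow x ⋆ (egf-t ⋆ E 1ℚ)) n + (pow x ⋆ unit) n
      ≡⟨ cong₂ _+_ (⋆-swapˡ (pow x) egf-t (E 1ℚ) n) (trans (⋆-comm (pow x) unit n) (⋆-unit (pow x) n)) ⟩
    (egf-t ⋆ (pow x ⋆ E 1ℚ)) n + pow x n
      ≡⟨ cong (λ z → (egf-t ⋆ (pow x ⋆ E 1ℚ)) n + z) (t⋆E x n) ⟨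
    (egf-t ⋆ (pow x ⋆ E 1ℚ)) n + ((egf-t ⋆ E x) n + unit n)
      ≡⟨ solve {3} (λ a b c → a :+ (b :+ c) := b :+ a :+ c) ((egf-t ⋆ (pow x ⋆ E 1ℚ)) n ∷ (egf-t ⋆ E x) n ∷ unit n ∷ []) ⟩
    (egf-t ⋆ E x) n + (egf-t ⋆ (pow x ⋆ E 1ℚ)) n + unit n
      ≡⟨ cong (_+ unit n) (⋆-distribˡ egf-t (E x) (pow x ⋆ E 1ℚ) n) ⟨
    (egf-t ⋆ (λ m → E x m + (pow x ⋆ E 1ℚ) m)) n + unit n ∎)

  powerSum : ℕ → ℕ → ℚ
  powerSum N n = ∑ N (λ a → ι a ^ n)

  E-0 : E 0ℚ ≗′ λ _ → 0ℚ
  E-0 n = trans (cong (_* 1/ n) (ℚₚ.*-zeroˡ (0ℚ ^ n))) (ℚₚ.*-zeroˡ (1/ n))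

  -- Induction on N: since B is inverse to (e ^ t - 1) / t, the new summand, with generating
  -- function e ^ (N t), is B times the increment of E from N to N + 1.
  faulhaber : ∀ N n → powerSum N n ≡ (E (ι N) ⋆ B) n
  faulhaber zero    n = sym (trans (⋆-cong {g = B} E-0 (λ _ → refl) n) (⋆-0 B n))
  faulhaber (suc N) n = begin
    powerSum N n + pow (ι N) n
      ≡⟨ cong₂ _+_ (faulhaber N n) (sym (trans (⋆-comm (pow (ι N)) unit n) (⋆-unit (pow (ι N)) n))) ⟩
    (E (ι N) ⋆ B) n + (pow (ι N) ⋆ unit) n
      ≡⟨ cong (λ z → (E (ι N) ⋆ B) n + z) (⋆-cong {pow (ι N)} (λ _ → refl) (λ m → trans (sym (⋆E1≗unit B B⋆pow1 m)) (⋆-comm B (E 1ℚ) m)) n) ⟩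
    (E (ι N) ⋆ B) n + (pow (ι N) ⋆ (E 1ℚ ⋆ B)) n
      ≡⟨ cong (λ z → (E (ι N) ⋆ B) n + z) (⋆-assoc (pow (ι N)) (E 1ℚ) B n) ⟨
    (E (ι N) ⋆ B) n + ((pow (ι N) ⋆ E 1ℚ) ⋆ B) n
      ≡⟨ ⋆-distribʳ (E (ι N)) (pow (ι N) ⋆ E 1ℚ) B n ⟨
    ((λ m → E (ι N) m + (pow (ι N) ⋆ E 1ℚ) m) ⋆ B) n
      ≡⟨ ⋆-cong {g = B} (λ m → sym (E-suc (ι N) m)) (λ _ → refl) n ⟩
    (E (ι N + 1ℚ) ⋆ B) n
      ≡⟨ cong (λ z → (E z ⋆ B) n) (trans (ℚₚ.+-comm (ι N) 1ℚ) (sym (ι-suc N))) ⟩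
    (E (ι (suc N)) ⋆ B) n ∎

  -- The substitution t ↦ - t in exponential generating functions.
  bar : (ℕ → ℚ) → ℕ → ℚ
  bar f n = (- 1ℚ) ^ n * f n

  bar-suc : ∀ f → (bar f ∘ suc) ≗′ λ n → - 1ℚ * bar (f ∘ suc) n
  bar-suc f n = ℚₚ.*-assoc (- 1ℚ) ((- 1ℚ) ^ n) (f (suc n))

  bar-⋆ : ∀ f g → bar f ⋆ bar g ≗′ bar (f ⋆ g)
  bar-⋆ f g zero    = solve {2} (λ a b → (# 1 :* a) :* (# 1 :* b) := # 1 :* (a :* b)) (f 0 ∷ g 0 ∷ [])
  bar-⋆ f g (suc n) = begin
    ((bar f ∘ suc) ⋆ bar g) n + (bar f ⋆ (bar g ∘ suc)) n
      ≡⟨ cong₂ _+_ (lem f g n) (trans (⋆-comm (bar f) (bar g ∘ suc) n) (trans (lem g f n) (cong (- 1ℚ *_) (⋆-comm (bar (g ∘ suc)) (bar f) n)))) ⟩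
    - 1ℚ * (bar (f ∘ suc) ⋆ bar g) n + - 1ℚ * (bar f ⋆ bar (g ∘ suc)) n
      ≡⟨ cong₂ (λ a b → - 1ℚ * a + - 1ℚ * b) (bar-⋆ (f ∘ suc) g n) (bar-⋆ f (g ∘ suc) n) ⟩
    - 1ℚ * ((- 1ℚ) ^ n * ((f ∘ suc) ⋆ g) n) + - 1ℚ * ((- 1ℚ) ^ n * (f ⋆ (g ∘ suc)) n)
      ≡⟨ solve {4} (λ m s a b → m :* (s :* a) :+ m :* (s :* b) := (m :* s) :* (a :+ b)) (- 1ℚ ∷ (- 1ℚ) ^ n ∷ ((f ∘ suc) ⋆ g) n ∷ (f ⋆ (g ∘ suc)) n ∷ []) ⟩
    bar (f ⋆ g) (suc n) ∎
    where
    lem : ∀ f g → ((bar f ∘ suc) ⋆ bar g) ≗′ λ n → - 1ℚ * (bar (f ∘ suc) ⋆ bar g) n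
    lem f g n = trans (⋆-cong {g = bar g} (bar-suc f) (λ _ → refl) n) (⋆-scale (- 1ℚ) (bar (f ∘ suc)) (bar g) n)

  bar-pow1 : pow (- 1ℚ) ≗′ bar (pow 1ℚ)
  bar-pow1 n = sym (trans (cong ((- 1ℚ) ^ n *_) (1^ n)) (ℚₚ.*-identityʳ _))

  bar-t : bar egf-t ≗′ λ n → - egf-t n
  bar-t zero          = refl
  bar-t (suc zero)    = refl
  bar-t (suc (suc n)) = ℚₚ.*-zeroʳ ((- 1ℚ) ^ suc (suc n))

  pow0≗unit : pow 0ℚ ≗′ unit
  pow0≗unit zero    = refl
  pow0≗unit (suc n) = ℚₚ.*-zeroˡ (0ℚ ^ n)

  -- The series B(- t) e ^ (- t) equals B(- t) - t and satisfies the equation that characterises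
  -- B(t).
  B-reflection : ∀ n → B n ≡ bar B n - egf-t n
  B-reflection n = begin
    B n                       ≡⟨ ⋆-unit B n ⟨
    (unit ⋆ B) n              ≡⟨ ⋆-cong {g = B} (λ m → sym (⋆E1≗unit D D-eq m)) (λ _ → refl) n ⟩
    ((D ⋆ E 1ℚ) ⋆ B) n        ≡⟨ ⋆-assoc D (E 1ℚ) B n ⟩
    (D ⋆ (E 1ℚ ⋆ B)) n        ≡⟨ ⋆-cong {D} (λ _ → refl) (λ m → trans (⋆-comm (E 1ℚ) B m) (⋆E1≗unit B B⋆pow1 m)) n ⟩
    (D ⋆ unit) n              ≡⟨ trans (⋆-comm D unit n) (⋆-unit D n) ⟩
    D n                       ≡⟨ D≗ n ⟩
    bar B n - egf-t n           ∎
    where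
    D : ℕ → ℚ
    D = bar B ⋆ pow (- 1ℚ)
    D≗ : D ≗′ λ n → bar B n - egf-t n
    D≗ n = begin
      (bar B ⋆ pow (- 1ℚ)) n       ≡⟨ ⋆-cong {bar B} (λ _ → refl) bar-pow1 n ⟩
      (bar B ⋆ bar (pow 1ℚ)) n     ≡⟨ bar-⋆ B (pow 1ℚ) n ⟩
      bar (B ⋆ pow 1ℚ) n           ≡⟨ cong ((- 1ℚ) ^ n *_) (B⋆pow1 n) ⟩
      (- 1ℚ) ^ n * (B n + egf-t n)   ≡⟨ ℚₚ.*-distribˡ-+ ((- 1ℚ) ^ n) (B n) (egf-t n) ⟩
      bar B n + bar egf-t n          ≡⟨ cong (λ z → bar B n + z) (bar-t n) ⟩
      bar B n - egf-t n              ∎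
    D-eq : D ⋆ pow 1ℚ ≗′ λ n → D n + egf-t n
    D-eq n = begin
      ((bar B ⋆ pow (- 1ℚ)) ⋆ pow 1ℚ) n   ≡⟨ ⋆-assoc (bar B) (pow (- 1ℚ)) (pow 1ℚ) n ⟩
      (bar B ⋆ (pow (- 1ℚ) ⋆ pow 1ℚ)) n   ≡⟨ ⋆-cong {bar B} (λ _ → refl) (λ m → trans (⋆-pow (- 1ℚ) 1ℚ m) (pow0≗unit m)) n ⟩
      (bar B ⋆ unit) n                    ≡⟨ trans (⋆-comm (bar B) unit n) (⋆-unit (bar B) n) ⟩
      bar B n                             ≡⟨ solve {2} (λ a b → a := (a :- b) :+ b) (bar B n ∷ egf-t n ∷ []) ⟩
      bar B n - egf-t n + egf-t n             ≡⟨ cong (_+ egf-t n) (D≗ n) ⟨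
      D n + egf-t n                         ∎

  B-odd : ∀ k → B (3 ℕ.+ 2 ℕ.* k) ≡ 0ℚ
  B-odd k = ι-cancel 1 (begin
    ι 2 * b                        ≡⟨ solve {1} (λ b → # 2 :* b := b :+ b) (b ∷ []) ⟩
    b + b                          ≡⟨ cong (_+ b) (trans (B-reflection n) (cong (λ s → s * b - 0ℚ) sign)) ⟩
    - 1ℚ * b - 0ℚ + b              ≡⟨ solve {1} (λ b → con -[1+ 0 ] :* b :- # 0 :+ b := # 2 :* # 0) (b ∷ []) ⟩
    ι 2 * 0ℚ                       ∎)
    where
    n = 3 ℕ.+ 2 ℕ.* k
    b = B n
    sign : (- 1ℚ) ^ n ≡ - 1ℚ
    sign = cong (λ z → - 1ℚ * (- 1ℚ * (- 1ℚ * z))) (trans (sym (^-assocʳ (- 1ℚ) 2 k)) (1^ k))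

-- The ring of p-integral rationals

module Localisation (p : ℕ) (prime : Prime p) (11≤p : 11 ℕ.≤ p) where
  open import Defs
  open import Data.Rational as ℚ using (ℚ; _+_; _*_; _-_; -_; 0ℚ; 1ℚ)
  open ≡ using (refl; sym; trans; cong; cong₂; subst; module ≡-Reasoning)
  open Numeralsℚ hiding (lhs; rhs)
  open Sumsℚ
  open Rationals
  open Bernoulli
  open import Algebra.Properties.Semiring.Exp (CommutativeRing.semiring ℚₚ.+-*-commutativeRing) using (_^_; ^-homo-*)
  open ≡-Reasoning

  record Int (x : ℚ) : Set where
    constructor isPInt
    field isInt : IsPInt p x
  open Int public

  p∤1 : ¬ p ∣ 1
  p∤1 h = ℕₚ.<⇒≱ (ℕₚ.≤-trans (s≤s (s≤s z≤n)) 11≤p) (∣⇒≤ h)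

  p∤* : ∀ {m n} → ¬ p ∣ m → ¬ p ∣ n → ¬ p ∣ m ℕ.* n
  p∤* {m} {n} pm pn h = [ pm , pn ]′ (euclidsLemma m n prime h)

  Int-ℤ : ∀ z → Int (ℤ→ℚ z)
  Int-ℤ z = isPInt (z , 1 , p∤1 , ℚₚ.*-identityʳ _)

  Int-+ : ∀ {x y} → Int x → Int y → Int (x + y)
  Int-+ {x} {y} (isPInt (a , b , pb , h)) (isPInt (c , d , pd , k)) = isPInt ((a ℤ.* + d) ℤ.+ (c ℤ.* + b) , b ℕ.* d , p∤* pb pd , (begin
    (x + y) * ℕ→ℚ (b ℕ.* d)            ≡⟨ cong ((x + y) *_) (ℕ→ℚ-* b d) ⟩
    (x + y) * (ℕ→ℚ b * ℕ→ℚ d)          ≡⟨ solve {4} (λ x y b d → (x :+ y) :* (b :* d) := (x :* b) :* d :+ (y :* d) :* b) (x ∷ y ∷ ℕ→ℚ b ∷ ℕ→ℚ d ∷ []) ⟩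
    x * ℕ→ℚ b * ℕ→ℚ d + y * ℕ→ℚ d * ℕ→ℚ b ≡⟨ cong₂ (λ u v → u * ℕ→ℚ d + v * ℕ→ℚ b) h k ⟩
    ℤ→ℚ a * ℤ→ℚ (+ d) + ℤ→ℚ c * ℤ→ℚ (+ b) ≡⟨ cong₂ _+_ (ℤ→ℚ-* a (+ d)) (ℤ→ℚ-* c (+ b)) ⟨
    ℤ→ℚ (a ℤ.* + d) + ℤ→ℚ (c ℤ.* + b)  ≡⟨ ℤ→ℚ-+ (a ℤ.* + d) (c ℤ.* + b) ⟨
    ℤ→ℚ ((a ℤ.* + d) ℤ.+ (c ℤ.* + b))  ∎))

  Int-* : ∀ {x y} → Int x → Int y → Int (x * y)
  Int-* {x} {y} (isPInt (a , b , pb , h)) (isPInt (c , d , pd , k)) = isPInt (a ℤ.* c , b ℕ.* d , p∤* pb pd , (begin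
    x * y * ℕ→ℚ (b ℕ.* d)            ≡⟨ cong (x * y *_) (ℕ→ℚ-* b d) ⟩
    x * y * (ℕ→ℚ b * ℕ→ℚ d)          ≡⟨ solve {4} (λ x y b d → (x :* y) :* (b :* d) := (x :* b) :* (y :* d)) (x ∷ y ∷ ℕ→ℚ b ∷ ℕ→ℚ d ∷ []) ⟩
    x * ℕ→ℚ b * (y * ℕ→ℚ d)          ≡⟨ cong₂ _*_ h k ⟩
    ℤ→ℚ a * ℤ→ℚ c                    ≡⟨ ℤ→ℚ-* a c ⟨
    ℤ→ℚ (a ℤ.* c)                    ∎))

  Int-neg : ∀ {x} → Int x → Int (- x)
  Int-neg {x} (isPInt (a , b , pb , h)) = isPInt (ℤ.- a , b , pb , trans (sym (ℚₚ.neg-distribˡ-* x (ℕ→ℚ b))) (trans (cong (-_) h) (sym (ℤ→ℚ-neg a))))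

  Int-ι : ∀ n → Int (ι n)
  Int-ι n = subst Int (sym (ι≡ℕ→ℚ n)) (Int-ℤ (+ n))

  Int-1/ : ∀ n → ¬ p ∣ suc n → Int (1/ n)
  Int-1/ n h = isPInt (+ 1 , suc n , h , frac-* (+ 1) n)

  record ℤₚ : Set where
    no-eta-equality
    constructor ⟨_,_⟩
    field
      val : ℚ
      int : Int val
  open ℤₚ public

  infix 4 _≈ₚ_
  _≈ₚ_ : ℤₚ → ℤₚ → Set
  x ≈ₚ y = val x ≡ val y

  -- Defined by copatterns, so that the operations do not unfold to their p-integrality proofs.
  infixl 7 _*ₚ_
  infixl 6 _+ₚ_
  infix  8 -ₚ_

  _+ₚ_ _*ₚ_ : ℤₚ → ℤₚ → ℤₚ
  val (x +ₚ y) = val x + val y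
  int (x +ₚ y) = Int-+ (int x) (int y)
  val (x *ₚ y) = val x * val y
  int (x *ₚ y) = Int-* (int x) (int y)

  -ₚ_ : ℤₚ → ℤₚ
  val (-ₚ x) = - val x
  int (-ₚ x) = Int-neg (int x)

  0ₚ 1ₚ : ℤₚ
  val 0ₚ = 0ℚ
  int 0ₚ = Int-ℤ (+ 0)
  val 1ₚ = 1ℚ
  int 1ₚ = Int-ℤ (+ 1)

  ringₚ : CommutativeRing 0ℓ 0ℓ
  ringₚ = record
    { Carrier = ℤₚ
    ; _≈_ = _≈ₚ_
    ; _+_ = _+ₚ_
    ; _*_ = _*ₚ_
    ; -_ = -ₚ_
    ; 0# = 0ₚ
    ; 1# = 1ₚ
    ; isCommutativeRing = record
      { isRing = record
        { +-isAbelianGroup = record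
          { isGroup = record
            { isMonoid = record
              { isSemigroup = record
                { isMagma = record
                  { isEquivalence = record { refl = refl ; sym = sym ; trans = trans }
                  ; ∙-cong = cong₂ _+_ }
                ; assoc = λ x y z → ℚₚ.+-assoc (val x) (val y) (val z) }
              ; identity = (λ x → ℚₚ.+-identityˡ (val x)) , (λ x → ℚₚ.+-identityʳ (val x)) }
            ; inverse = (λ x → ℚₚ.+-inverseˡ (val x)) , (λ x → ℚₚ.+-inverseʳ (val x))
            ; ⁻¹-cong = cong (-_) }
          ; comm = λ x y → ℚₚ.+-comm (val x) (val y) }
        ; *-cong = cong₂ _*_
        ; *-assoc = λ x y z → ℚₚ.*-assoc (val x) (val y) (val z)
        ; *-identity = (λ x → ℚₚ.*-identityˡ (val x)) , (λ x → ℚₚ.*-identityʳ (val x))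
        ; distrib = (λ x y z → ℚₚ.*-distribˡ-+ (val x) (val y) (val z)) , (λ x y z → ℚₚ.*-distribʳ-+ (val x) (val y) (val z)) }
      ; *-comm = λ x y → ℚₚ.*-comm (val x) (val y) } }

  Int-^ : ∀ {x} n → Int x → Int (x ^ n)
  Int-^ zero    h = Int-ℤ (+ 1)
  Int-^ (suc n) h = Int-* h (Int-^ n h)

  Int-∑ : ∀ n f → (∀ i → i ℕ.< n → Int (f i)) → Int (∑ n f)
  Int-∑ zero    f h = Int-ℤ (+ 0)
  Int-∑ (suc n) f h = Int-+ (Int-∑ n f (λ i i< → h i (ℕₚ.m<n⇒m<1+n i<))) (h n ℕₚ.≤-refl)

  P : ℚ
  P = ι p

  -- The bound on v makes p ^ (m - 1) / m divisible by p ^ 4.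
  valuation : ∀ m → m ≢ 0 → ∃₂ λ v u → m ≡ p ℕ.^ v ℕ.* u × ¬ p ∣ u × (v ≡ 0 ⊎ v ℕ.+ 5 ℕ.≤ m)
  valuation = <-rec _ go
    where
    go : ∀ m → (∀ {k} → k ℕ.< m → k ≢ 0 → ∃₂ λ v u → k ≡ p ℕ.^ v ℕ.* u × ¬ p ∣ u × (v ≡ 0 ⊎ v ℕ.+ 5 ℕ.≤ k)) →
         m ≢ 0 → ∃₂ λ v u → m ≡ p ℕ.^ v ℕ.* u × ¬ p ∣ u × (v ≡ 0 ⊎ v ℕ.+ 5 ℕ.≤ m)
    go m rec m≢0 with p ∣? m
    ... | no  p∤m = 0 , m , sym (ℕₚ.*-identityˡ m) , p∤m , inj₁ refl
    ... | yes (divides k eq) with rec k<m k≢0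
      where
      k≢0 : k ≢ 0
      k≢0 refl = m≢0 eq
      k<m : k ℕ.< m
      k<m = subst (k ℕ.<_) (sym eq) (ℕₚ.m<m*n k p {{ℕ.≢-nonZero k≢0}} (ℕₚ.≤-trans (s≤s (s≤s z≤n)) 11≤p))
    ... | v , u , eq′ , p∤u , bound = suc v , u , m≡ , p∤u , inj₂ (ℕₚ.≤-trans (lem v bound) (ℕₚ.≤-trans (ℕₚ.*-monoʳ-≤ k 11≤p) (ℕₚ.≤-reflexive (sym eq))))
      where
      m≡ : m ≡ p ℕ.^ suc v ℕ.* u
      m≡ = trans eq (trans (ℕₚ.*-comm k p) (trans (cong (p ℕ.*_) eq′) (sym (ℕₚ.*-assoc p (p ℕ.^ v) u))))
      1≤k : 1 ℕ.≤ k
      1≤k = ℕₚ.n≢0⇒n>0 (λ { refl → m≢0 eq })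
      lem : ∀ v → (v ≡ 0 ⊎ v ℕ.+ 5 ℕ.≤ k) → suc v ℕ.+ 5 ℕ.≤ k ℕ.* 11
      -- If v = 0, then 6 ≤ 11 k; otherwise v + 6 ≤ k + 1 ≤ 2 k. The factor 11 is the lower bound
      -- for p.
      lem v (inj₁ refl) = ℕₚ.≤-trans (s≤s (s≤s (s≤s (s≤s (s≤s (s≤s z≤n)))))) (ℕₚ.*-monoˡ-≤ 11 1≤k)
      lem v (inj₂ h)    = ℕₚ.≤-trans (ℕₚ.≤-trans (s≤s h) (ℕₚ.+-mono-≤ 1≤k (ℕₚ.≤-refl {k})))
                            (ℕₚ.≤-trans (ℕₚ.≤-reflexive (sym (trans (ℕₚ.*-comm k 2) (cong (k ℕ.+_) (ℕₚ.+-identityʳ k))))) (ℕₚ.*-monoʳ-≤ k (s≤s (s≤s z≤n))))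

  Int-p^/ : ∀ k v u j → suc k ≡ p ℕ.^ v ℕ.* u → ¬ p ∣ u → v ℕ.≤ j → Int (P ^ j * 1/ k)
  Int-p^/ k v zero    j eq p∤u v≤j = contradiction (divides 0 refl) p∤u
  Int-p^/ k v (suc u) j eq p∤u v≤j = subst Int (ι-cancel k (sym step)) (Int-* (Int-^ (j ∸ v) (Int-ι p)) (Int-1/ u p∤u))
    where
    split : P ^ j ≡ P ^ v * P ^ (j ∸ v)
    split = trans (cong (P ^_) (sym (ℕₚ.m+[n∸m]≡n v≤j))) (^-homo-* P v (j ∸ v))
    step : ι (suc k) * (P ^ j * 1/ k) ≡ ι (suc k) * (P ^ (j ∸ v) * 1/ u)
    step = begin
      ι (suc k) * (P ^ j * 1/ k)                            ≡⟨ solve {3} (λ a b c → a :* (b :* c) := b :* (a :* c)) (ι (suc k) ∷ P ^ j ∷ 1/ k ∷ []) ⟩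
      P ^ j * (ι (suc k) * 1/ k)                            ≡⟨ cong₂ _*_ split (ι-1/ k) ⟩
      P ^ v * P ^ (j ∸ v) * 1ℚ                              ≡⟨ cong (P ^ v * P ^ (j ∸ v) *_) (ι-1/ u) ⟨
      P ^ v * P ^ (j ∸ v) * (ι (suc u) * 1/ u)              ≡⟨ solve {4} (λ a b c d → (a :* b) :* (c :* d) := (a :* c) :* (b :* d)) (P ^ v ∷ P ^ (j ∸ v) ∷ ι (suc u) ∷ 1/ u ∷ []) ⟩
      P ^ v * ι (suc u) * (P ^ (j ∸ v) * 1/ u)              ≡⟨ cong (λ z → z * ι (suc u) * (P ^ (j ∸ v) * 1/ u)) (ι-^ p v) ⟨
      ι (p ℕ.^ v) * ι (suc u) * (P ^ (j ∸ v) * 1/ u)        ≡⟨ cong (_* (P ^ (j ∸ v) * 1/ u)) (ι-* (p ℕ.^ v) (suc u)) ⟨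
      ι (p ℕ.^ v ℕ.* suc u) * (P ^ (j ∸ v) * 1/ u)          ≡⟨ cong (λ z → ι z * (P ^ (j ∸ v) * 1/ u)) eq ⟨
      ι (suc k) * (P ^ (j ∸ v) * 1/ u)                      ∎

  Int-coeff : ∀ k → Int (P ^ k * 1/ k)
  Int-coeff k with valuation (suc k) (λ ())
  ... | v , u , eq , p∤u , bound = Int-p^/ k v u k eq p∤u (v≤k bound)
    where
    v≤k : (v ≡ 0 ⊎ v ℕ.+ 5 ℕ.≤ suc k) → v ℕ.≤ k
    v≤k (inj₁ refl) = z≤n
    v≤k (inj₂ h)    = ℕₚ.≤-pred (ℕₚ.≤-trans (subst (ℕ._≤ v ℕ.+ 5) (ℕₚ.+-comm v 1) (ℕₚ.+-monoʳ-≤ v (s≤s z≤n))) h)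

  -- The denominator is k + 5, and v + 5 ≤ k + 5 for its valuation v unless v = 0. Hence p ^ (4 + k)
  -- / (k + 5) is still a multiple of p ^ 4.
  Int-coeff₄ : ∀ k → Int (P ^ k * 1/ (4 ℕ.+ k))
  Int-coeff₄ k with valuation (5 ℕ.+ k) (λ ())
  ... | v , u , eq , p∤u , bound = Int-p^/ (4 ℕ.+ k) v u k eq p∤u (v≤k bound)
    where
    v≤k : (v ≡ 0 ⊎ v ℕ.+ 5 ℕ.≤ 5 ℕ.+ k) → v ℕ.≤ k
    v≤k (inj₁ refl) = z≤n
    v≤k (inj₂ h)    = ℕₚ.+-cancelʳ-≤ 5 v k (subst (v ℕ.+ 5 ℕ.≤_) (ℕₚ.+-comm 5 k) h)

  pB : ℕ → ℚ
  pB n = P * B n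

  -- One of the k + 1 factors p is moved to the Bernoulli number, so that the p-integral p B
  -- appears.
  faulhaber-p : ∀ n → powerSum p n ≡ ∑ (suc n) (λ k → ι (n C k) * (P ^ k * 1/ k * pB (n ∸ k)))
  faulhaber-p n = trans (faulhaber p n) (trans (⋆-closed n (E P) B) (∑-cong′ (suc n) λ k → cong (ι (n C k) *_)
    (solve {4} (λ x y i b → (x :* y) :* i :* b := y :* i :* (x :* b)) (P ∷ P ^ k ∷ 1/ k ∷ B (n ∸ k) ∷ []))))

  Int-powerSum : ∀ n → Int (powerSum p n)
  Int-powerSum n = Int-∑ p _ (λ i _ → Int-^ n (Int-ι i))

  pB≡ : ∀ n → pB n ≡ powerSum p n - ∑ n (λ k → ι (n C suc k) * (P ^ suc k * 1/ (suc k) * pB (n ∸ suc k)))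
  pB≡ n = begin
    pB n                                                  ≡⟨ solve {2} (λ b r → b := (# 1 :* (# 1 :* # 1 :* b) :+ r) :- r) (pB n ∷ r ∷ []) ⟩
    ι (n C 0) * (P ^ 0 * 1/ 0 * pB (n ∸ 0)) + r - r       ≡⟨ cong (_- r) (trans (faulhaber-p n) (∑-cons n (λ k → ι (n C k) * (P ^ k * 1/ k * pB (n ∸ k))))) ⟨
    powerSum p n - r                                      ∎
    where r = ∑ n (λ k → ι (n C suc k) * (P ^ suc k * 1/ (suc k) * pB (n ∸ suc k)))

  -- Faulhaber's formula solved for its leading term expresses p B n by an integer and by earlier p
  -- B with p-integral coefficients p ^ k / (k + 1), which is the integrality part of von Staudt's
  -- theorem.
  Int-pB : ∀ n → Int (pB n)
  Int-pB = <-rec _ λ n rec → subst Int (sym (pB≡ n)) (Int-+ (Int-powerSum n)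
    (Int-neg (Int-∑ n _ λ k k<n → Int-* (Int-ι (n C suc k)) (Int-* (Int-coeff (suc k)) (rec (ℕₚ.∸-monoʳ-< {o = 0} (s≤s z≤n) k<n))))))

module AtPrime (r : ℕ) (prime : Prime (suc (suc r))) (11≤p : 11 ℕ.≤ suc (suc r)) where
  open Localisation (suc (suc r)) prime 11≤p

  -- The localisation satisfies the axioms

  module Instance where
    open import Defs
    open import Data.Rational as ℚ using (ℚ; _+_; _*_; _-_; -_; 0ℚ; 1ℚ)
    open ≡ using (refl; sym; trans; cong; cong₂; subst; module ≡-Reasoning)
    open Numeralsℚ hiding (lhs; rhs)
    open Sumsℚ
    open Rationals
    open Bernoulli
    open import Algebra.Properties.Semiring.Exp (CommutativeRing.semiring ℚₚ.+-*-commutativeRing) using (_^_; ^-homo-*)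

    module Baseₚ = Numerals ringₚ
    module Sumsₚ = Sums ringₚ
    module Rₚ = CommutativeRing ringₚ
    open import Algebra.Properties.Semiring.Exp Rₚ.semiring using () renaming (_^_ to _^ₚ_)

    ιₚ : ℕ → ℤₚ
    ιₚ = Baseₚ.ι

    val-ι : ∀ n → val (ιₚ n) ≡ ι n
    val-ι zero          = refl
    val-ι (suc zero)    = refl
    val-ι (suc (suc n)) = cong (λ z → 1ℚ + z) (val-ι (suc n))

    val-^ : ∀ x n → val (x ^ₚ n) ≡ val x ^ n
    val-^ x zero    = refl
    val-^ x (suc n) = cong (val x *_) (val-^ x n)

    val-∑ : ∀ n f → val (Sumsₚ.∑ n f) ≡ ∑ n (λ i → val (f i))
    val-∑ zero    f = refl
    val-∑ (suc n) f = cong (_+ val (f n)) (val-∑ n f)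

    p : ℕ
    p = suc (suc r)

    cancelₚ : ∀ {a b : ℤₚ} → val (ιₚ p) * val a ≡ val (ιₚ p) * val b → val a ≡ val b
    cancelₚ h = ι-cancel (suc r) (trans (cong (_* _) (sym (val-ι p))) (trans h (cong (_* _) (val-ι p))))

    unit-∤ₚ : ∀ n → ¬ (p ∣ n) → Σ ℤₚ λ y → val (ιₚ n) * val y ≡ 1ℚ
    unit-∤ₚ zero    h = contradiction (p ∣0) h
    unit-∤ₚ (suc n) h = ⟨ 1/ n , Int-1/ n h ⟩ , trans (cong (_* 1/ n) (val-ι (suc n))) (ι-1/ n)

    p∤small : ∀ n → 0 ℕ.< n → n ℕ.< p → ¬ (p ∣ n)
    p∤small (suc n) _ n<p h = ℕₚ.<⇒≱ n<p (∣⇒≤ h)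

    unitₚ : ∀ n → 0 ℕ.< n → n ℕ.< p → Σ ℤₚ λ y → val (ιₚ n) * val y ≡ 1ℚ
    unitₚ n 0<n n<p = unit-∤ₚ n (p∤small n 0<n n<p)

    9≤r : 9 ℕ.≤ r
    9≤r = ℕₚ.≤-pred (ℕₚ.≤-pred 11≤p)

    m-evenₚ : Even (suc r)
    m-evenₚ with parity p
    ... | inj₂ o = odd-suc o
    ... | inj₁ (k , e) with prime⇒irreducible prime (divides k (trans e (ℕₚ.*-comm 2 k)))
    ...   | inj₁ ()
    ...   | inj₂ 2≡p = contradiction (subst (11 ℕ.≤_) (sym 2≡p) 11≤p) λ { (s≤s (s≤s ())) }

    bₚ : ℕ → ℤₚ
    val (bₚ n) = pB n
    int (bₚ n) = Int-pB n

    choose-2 : ∀ n → ι 2 * ι (n C 2) ≡ ι n * (ι n - 1ℚ)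
    choose-2 zero    = refl
    choose-2 (suc n) = trans (absorption n 1) (cong (ι (suc n) *_) (trans (cong ι (nC1≡n n)) (trans (solve {1} (λ a → a := (# 1 :+ a) :- # 1) (ι n ∷ [])) (cong (_- 1ℚ) (sym (ι-suc n))))))

    choose-3 : ∀ n → ι 6 * ι (n C 3) ≡ ι n * (ι n - 1ℚ) * (ι n - ι 2)
    choose-3 zero    = refl
    choose-3 (suc n) = begin
      ι 6 * ι (suc n C 3)                    ≡⟨ solve {1} (λ a → # 6 :* a := # 2 :* (# 3 :* a)) (ι (suc n C 3) ∷ []) ⟩
      ι 2 * (ι 3 * ι (suc n C 3))            ≡⟨ cong (ι 2 *_) (absorption n 2) ⟩
      ι 2 * (ι (suc n) * ι (n C 2))          ≡⟨ solve {2} (λ a b → # 2 :* (a :* b) := a :* (# 2 :* b)) (ι (suc n) ∷ ι (n C 2) ∷ []) ⟩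
      ι (suc n) * (ι 2 * ι (n C 2))          ≡⟨ cong (ι (suc n) *_) (choose-2 n) ⟩
      ι (suc n) * (ι n * (ι n - 1ℚ))         ≡⟨ solve {2} (λ s n → s :* (n :* (n :- # 1)) := s :* (((# 1 :+ n) :- # 1) :* ((# 1 :+ n) :- # 2))) (ι (suc n) ∷ ι n ∷ []) ⟩
      ι (suc n) * ((1ℚ + ι n - 1ℚ) * (1ℚ + ι n - ι 2)) ≡⟨ cong (λ z → ι (suc n) * ((z - 1ℚ) * (z - ι 2))) (sym (ι-suc n)) ⟩
      ι (suc n) * ((ι (suc n) - 1ℚ) * (ι (suc n) - ι 2)) ≡⟨ ℚₚ.*-assoc (ι (suc n)) _ _ ⟨
      ι (suc n) * (ι (suc n) - 1ℚ) * (ι (suc n) - ι 2) ∎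
      where open ≡-Reasoning

    private
      term : ℕ → ℕ → ℚ
      term n k = ι (n C k) * (P ^ k * 1/ k * pB (n ∸ k))

      term-vanishes : ∀ n k → n ℕ.< k → term n k ≡ 0ℚ
      term-vanishes n k n<k = trans (cong (λ z → ι z * (P ^ k * 1/ k * pB (n ∸ k))) (k>n⇒nCk≡0 n<k)) (ℚₚ.*-zeroˡ (P ^ k * 1/ k * pB (n ∸ k)))

      -- The terms k ≥ 4 of Faulhaber's formula with p ^ 4 taken out; `Int-coeff₄` keeps the
      -- remainder p-integral.
      rest : ℕ → ℚ
      rest n = ∑ n (λ i → ι (n C (4 ℕ.+ i)) * (P ^ i * 1/ (4 ℕ.+ i) * pB (n ∸ (4 ℕ.+ i))))

      Int-rest : ∀ n → Int (rest n)
      Int-rest n = Int-∑ n _ λ i _ → Int-* (Int-ι (n C (4 ℕ.+ i))) (Int-* (Int-coeff₄ i) (Int-pB (n ∸ (4 ℕ.+ i))))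

      faulhaber₄ : ∀ n → powerSum p n ≡ ∑ 4 (term n) + P ^ 4 * rest n
      faulhaber₄ n = begin
        powerSum p n
          ≡⟨ faulhaber-p n ⟩
        ∑ (suc n) (term n)
          -- Three vanishing terms beyond n are appended, so that the first four can be split off
          -- for every n, including n < 3.
          ≡⟨ solve {1} (λ a → a := a :+ # 0 :+ # 0 :+ # 0) (∑ (suc n) (term n) ∷ []) ⟩
        ∑ (suc n) (term n) + 0ℚ + 0ℚ + 0ℚ
          ≡⟨ cong₂ _+_ (cong₂ _+_ (cong (λ z → ∑ (suc n) (term n) + z) (term-vanishes n (suc n) ℕₚ.≤-refl)) (term-vanishes n (2 ℕ.+ n) (ℕₚ.n≤1+n _))) (term-vanishes n (3 ℕ.+ n) (ℕₚ.m≤n+m (suc n) 2)) ⟨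
        ∑ (4 ℕ.+ n) (term n)
          ≡⟨ ∑-split 4 n (term n) ⟩
        ∑ 4 (term n) + ∑ n (λ i → term n (4 ℕ.+ i))
          ≡⟨ cong (λ z → ∑ 4 (term n) + z) (trans (∑-cong′ n λ i → trans (cong (λ z → ι (n C (4 ℕ.+ i)) * (z * 1/ (4 ℕ.+ i) * pB (n ∸ (4 ℕ.+ i)))) (^-homo-* P 4 i))
               (solve {5} (λ c p q j b → c :* (p :* q :* j :* b) := p :* (c :* (q :* j :* b))) (ι (n C (4 ℕ.+ i)) ∷ P ^ 4 ∷ P ^ i ∷ 1/ (4 ℕ.+ i) ∷ pB (n ∸ (4 ℕ.+ i)) ∷ []))) (∑-*ˡ n (P ^ 4) _)) ⟩
        ∑ 4 (term n) + P ^ 4 * rest n ∎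
        where open ≡-Reasoning

      -- The numerals are parameters, so that `shape-cong` can exchange those of ℚ for the values of
      -- those in the localisation.
      shape : (b₀ b₁ b₂ b₃ n π c24 c12 c4 c2 : ℚ) → ℚ
      shape b₀ b₁ b₂ b₃ n π c24 c12 c4 c2 = c24 * b₀ + c12 * n * π * b₁ + c4 * (n * (n - 1ℚ)) * π ^ 2 * b₂ + n * (n - 1ℚ) * (n - c2) * π ^ 3 * b₃

      -- As polynomials in n, the coefficients C(n, k) / (k + 1) with k = 1, 2, 3 have the
      -- denominators 2, 6 and 24.
      faulhaber-24 : ∀ n → ι 24 * powerSum p n ≡ shape (pB n) (pB (n ∸ 1)) (pB (n ∸ 2)) (pB (n ∸ 3)) (ι n) P (ι 24) (ι 12) (ι 4) (ι 2) + P ^ 4 * (ι 24 * rest n)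
      faulhaber-24 n = begin
        ι 24 * powerSum p n
          ≡⟨ cong (ι 24 *_) (faulhaber₄ n) ⟩
        ι 24 * (∑ 4 (term n) + P ^ 4 * rest n)
          ≡⟨ solve {12} (λ π b₀ b₁ b₂ b₃ c₁ c₂ c₃ i₁ i₂ i₃ t →
               # 24 :* (# 0 :+ # 1 :* (# 1 :* # 1 :* b₀) :+ c₁ :* (π :^ 1 :* i₁ :* b₁) :+ c₂ :* (π :^ 2 :* i₂ :* b₂) :+ c₃ :* (π :^ 3 :* i₃ :* b₃) :+ π :^ 4 :* t)
               := # 24 :* b₀ :+ # 12 :* (# 2 :* i₁) :* c₁ :* π :* b₁ :+ # 4 :* (# 3 :* i₂) :* (# 2 :* c₂) :* π :^ 2 :* b₂ :+ (# 4 :* i₃) :* (# 6 :* c₃) :* π :^ 3 :* b₃ :+ π :^ 4 :* (# 24 :* t))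
             (P ∷ pB n ∷ pB (n ∸ 1) ∷ pB (n ∸ 2) ∷ pB (n ∸ 3) ∷ ι (n C 1) ∷ ι (n C 2) ∷ ι (n C 3) ∷ 1/ 1 ∷ 1/ 2 ∷ 1/ 3 ∷ rest n ∷ []) ⟩
        ι 24 * pB n + ι 12 * (ι 2 * 1/ 1) * ι (n C 1) * P * pB (n ∸ 1) + ι 4 * (ι 3 * 1/ 2) * (ι 2 * ι (n C 2)) * P ^ 2 * pB (n ∸ 2) + ι 4 * 1/ 3 * (ι 6 * ι (n C 3)) * P ^ 3 * pB (n ∸ 3) + P ^ 4 * (ι 24 * rest n)
          ≡⟨ cong (_+ P ^ 4 * (ι 24 * rest n)) (cong₂ _+_ (cong₂ _+_ (cong (λ z → ι 24 * pB n + ι 12 * 1ℚ * ι z * P * pB (n ∸ 1)) (nC1≡n n)) (cong (λ z → ι 4 * 1ℚ * z * P ^ 2 * pB (n ∸ 2)) (choose-2 n))) (cong (λ z → 1ℚ * z * P ^ 3 * pB (n ∸ 3)) (choose-3 n))) ⟩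
        ι 24 * pB n + ι 12 * 1ℚ * ι n * P * pB (n ∸ 1) + ι 4 * 1ℚ * (ι n * (ι n - 1ℚ)) * P ^ 2 * pB (n ∸ 2) + 1ℚ * (ι n * (ι n - 1ℚ) * (ι n - ι 2)) * P ^ 3 * pB (n ∸ 3) + P ^ 4 * (ι 24 * rest n)
          ≡⟨ solve {7} (λ π b₀ b₁ b₂ b₃ n t → # 24 :* b₀ :+ # 12 :* # 1 :* n :* π :* b₁ :+ # 4 :* # 1 :* (n :* (n :- # 1)) :* π :^ 2 :* b₂ :+ # 1 :* (n :* (n :- # 1) :* (n :- # 2)) :* π :^ 3 :* b₃ :+ t
               := # 24 :* b₀ :+ # 12 :* n :* π :* b₁ :+ # 4 :* (n :* (n :- # 1)) :* π :^ 2 :* b₂ :+ n :* (n :- # 1) :* (n :- # 2) :* π :^ 3 :* b₃ :+ t)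
             (P ∷ pB n ∷ pB (n ∸ 1) ∷ pB (n ∸ 2) ∷ pB (n ∸ 3) ∷ ι n ∷ P ^ 4 * (ι 24 * rest n) ∷ []) ⟩
        shape (pB n) (pB (n ∸ 1)) (pB (n ∸ 2)) (pB (n ∸ 3)) (ι n) P (ι 24) (ι 12) (ι 4) (ι 2) + P ^ 4 * (ι 24 * rest n) ∎
        where open ≡-Reasoning

      shape-cong : ∀ b₀ b₁ b₂ b₃ {n n′ π π′ a a′ b b′ c c′ d d′} → n ≡ n′ → π ≡ π′ → a ≡ a′ → b ≡ b′ → c ≡ c′ → d ≡ d′ →
        shape b₀ b₁ b₂ b₃ n π a b c d ≡ shape b₀ b₁ b₂ b₃ n′ π′ a′ b′ c′ d′
      shape-cong _ _ _ _ refl refl refl refl refl refl = refl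

    module Congₚ = Congruence ringₚ (ιₚ p)
    open Congₚ using (_≈[_]_; mk)
    open Rₚ using () renaming (_-_ to _-ₚ_)

    b-faulhaberₚ : ∀ n → ιₚ 24 *ₚ Sumsₚ.∑ p (λ a → ιₚ a ^ₚ n) ≈[ 4 ]
      ιₚ 24 *ₚ bₚ n +ₚ ιₚ 12 *ₚ ιₚ n *ₚ ιₚ p *ₚ bₚ (n ∸ 1) +ₚ ιₚ 4 *ₚ (ιₚ n *ₚ (ιₚ n -ₚ 1ₚ)) *ₚ ιₚ p ^ₚ 2 *ₚ bₚ (n ∸ 2)
        +ₚ ιₚ n *ₚ (ιₚ n -ₚ 1ₚ) *ₚ (ιₚ n -ₚ ιₚ 2) *ₚ ιₚ p ^ₚ 3 *ₚ bₚ (n ∸ 3)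
    b-faulhaberₚ n = mk ⟨ ι 24 * rest n , Int-* (Int-ι 24) (Int-rest n) ⟩ (begin
      val (ιₚ 24) * val (Sumsₚ.∑ p (λ a → ιₚ a ^ₚ n))
        ≡⟨ cong₂ _*_ (val-ι 24) (trans (val-∑ p _) (∑-cong′ p λ a → trans (val-^ (ιₚ a) n) (cong (_^ n) (val-ι a)))) ⟩
      ι 24 * powerSum p n
        ≡⟨ faulhaber-24 n ⟩
      shape (pB n) (pB (n ∸ 1)) (pB (n ∸ 2)) (pB (n ∸ 3)) (ι n) P (ι 24) (ι 12) (ι 4) (ι 2) + P ^ 4 * (ι 24 * rest n)
        ≡⟨ cong₂ _+_ (shape-cong (pB n) (pB (n ∸ 1)) (pB (n ∸ 2)) (pB (n ∸ 3)) (sym (val-ι n)) (sym (val-ι p)) (sym (val-ι 24)) (sym (val-ι 12)) (sym (val-ι 4)) (sym (val-ι 2)))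
             (cong (λ z → z ^ 4 * (ι 24 * rest n)) (sym (val-ι p))) ⟩
      shape (pB n) (pB (n ∸ 1)) (pB (n ∸ 2)) (pB (n ∸ 3)) (val (ιₚ n)) (val (ιₚ p)) (val (ιₚ 24)) (val (ιₚ 12)) (val (ιₚ 4)) (val (ιₚ 2)) + val (ιₚ p) ^ 4 * (ι 24 * rest n) ∎)
      where open ≡-Reasoning

    b-0ₚ : val (bₚ 0) ≡ val (ιₚ p)
    b-0ₚ = trans (ℚₚ.*-identityʳ P) (sym (val-ι p))

    b-1ₚ : val (ιₚ 2) * val (bₚ 1) ≡ - val (ιₚ p)
    b-1ₚ = begin
      ι 2 * (P * B 1)         ≡⟨ solve {2} (λ p b → # 2 :* (p :* b) := p :* (# 2 :* b)) (P ∷ B 1 ∷ []) ⟩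
      P * (ι 2 * B 1)         ≡⟨ solve {1} (λ p → p :* con (ℤ.- + 1) := :- p) (P ∷ []) ⟩
      - P                     ≡⟨ cong (-_) (val-ι p) ⟨
      - val (ιₚ p)            ∎
      where open ≡-Reasoning

    b-oddₚ : ∀ k → val (bₚ (3 ℕ.+ 2 ℕ.* k)) ≡ 0ℚ
    b-oddₚ k = trans (cong (P *_) (B-odd k)) (ℚₚ.*-zeroʳ P)

    p∤720 : ¬ (p ∣ 720)
    p∤720 = p∤* {8} {90} (p∤small 8 (s≤s z≤n) (ℕₚ.≤-trans (ℕₚ.m≤m+n 9 2) 11≤p))
      (p∤* {9} {10} (p∤small 9 (s≤s z≤n) (ℕₚ.≤-trans (ℕₚ.m≤m+n 10 1) 11≤p)) (p∤small 10 (s≤s z≤n) 11≤p))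

    regular : Regular ringₚ r bₚ
    regular = record
      { cancel      = λ {a} {b} → cancelₚ {a} {b}
      ; 9≤r         = 9≤r
      ; unit-∤      = unit-∤ₚ
      ; p∤720       = p∤720
      ; m-even      = m-evenₚ
      ; b-faulhaber = b-faulhaberₚ
      ; b-0         = b-0ₚ
      ; b-1         = b-1ₚ
      ; b-odd       = b-oddₚ
      }

  module A = Assembly ringₚ r Instance.bₚ Instance.regular

  -- Residues and Hensel digits of p-integral numbers

  module Digits where
    open import Defs
    import Data.Nat.DivMod as DM
    import Data.Nat.Coprimality as Coprimality
    import Data.Integer.DivMod as ℤDM
    import Data.Integer.Properties as ℤₚ
    open import Data.Rational as ℚ using (ℚ; _+_; _*_; _-_; -_; 0ℚ; ↥_; ↧ₙ_)
    import Data.Rational.Unnormalised as ℚᵘ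
    open ≡ using (refl; sym; trans; cong; cong₂; subst; module ≡-Reasoning)
    open Numeralsℚ using (ι-*; ι-^)
    open Rationals
    open Instance
    open A using (fermat; m)
    open Baseₚ using (ιℤ; ιℤ-+; ιℤ-*; ιℤ-neg; ι-+; ι-∸) renaming (ι-* to ιₚ-*; ι-^ to ιₚ-^; solve to solveₚ; _:=_ to _:=ₚ_; _:+_ to _:+ₚ_; _:*_ to _:*ₚ_; _:-_ to _:-ₚ_; :-_ to :-ₚ_; # to #ₚ)
    open Congₚ
    open import Algebra.Properties.Semiring.Exp Rₚ.semiring using () renaming (_^_ to _^ₚ_)
    open Rₚ using () renaming (_-_ to _-ₚ_)

    val-ιℤ : ∀ z → val (ιℤ z) ≡ ℤ→ℚ z
    val-ιℤ (+ n)    = trans (val-ι n) (ι≡ℕ→ℚ n)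
    val-ιℤ -[1+ n ] = trans (cong (-_) (trans (val-ι (suc n)) (ι≡ℕ→ℚ (suc n)))) (sym (ℤ→ℚ-neg (+ suc n)))

    ℤ→ℚ-injective : ∀ x y → ℤ→ℚ x ≡ ℤ→ℚ y → x ≡ y
    ℤ→ℚ-injective x y h with ℚₚ.fromℚᵘ-injective {ℚᵘ.mkℚᵘ x 0} {ℚᵘ.mkℚᵘ y 0} h
    ... | ℚᵘ.*≡* e = trans (sym (ℤₚ.*-identityʳ x)) (trans e (ℤₚ.*-identityʳ y))

    p^ : ℕ → ℕ
    p^ k = p ℕ.^ k

    0<p^ : ∀ k → 0 ℕ.< p^ k
    0<p^ k = ℕₚ.m^n>0 p k

    p^∣-cancel : ∀ k t b → ¬ (p ∣ b) → p^ k ∣ t ℕ.* b → p^ k ∣ t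
    p^∣-cancel zero    t b p∤b h = divides t (sym (ℕₚ.*-identityʳ t))
    p^∣-cancel (suc k) t b p∤b h with euclidsLemma t b prime (∣-trans (m∣m*n (p^ k)) h)
    ... | inj₂ p∣b = contradiction p∣b p∤b
    ... | inj₁ (divides t′ refl) = subst (p ℕ.* p^ k ∣_) (ℕₚ.*-comm p t′) (*-monoʳ-∣ p (p^∣-cancel k t′ b p∤b
        (*-cancelˡ-∣ p (subst (p ℕ.* p^ k ∣_) (trans (cong (ℕ._* b) (ℕₚ.*-comm t′ p)) (ℕₚ.*-assoc p t′ b)) h))))

    val-p^ : ∀ k → val (ιₚ p ^ₚ k) ≡ ℤ→ℚ (+ (p^ k))
    val-p^ k = trans (sym (ιₚ-^ p k)) (trans (val-ι (p^ k)) (ι≡ℕ→ℚ (p^ k)))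

    -- The quotient of a congruence is only p-integral, but its denominator is prime to p and
    -- cancels from a divisibility by a power of p.
    ∣-from-cong : ∀ k z → ιℤ z ≈[ k ] 0ₚ → p^ k ∣ ℤ.∣ z ∣
    ∣-from-cong k z (mk y e) = go (isInt (int y))
      where
      go : IsPInt p (val y) → p^ k ∣ ℤ.∣ z ∣
      go (a , b , p∤b , h) = p^∣-cancel k ℤ.∣ z ∣ b p∤b (divides ℤ.∣ a ∣ (begin
        ℤ.∣ z ∣ ℕ.* b              ≡⟨ ℤₚ.abs-* z (+ b) ⟨
        ℤ.∣ z ℤ.* + b ∣            ≡⟨ cong ℤ.∣_∣ (ℤ→ℚ-injective (z ℤ.* + b) (a ℤ.* + (p^ k)) zb) ⟩
        ℤ.∣ a ℤ.* + (p^ k) ∣       ≡⟨ ℤₚ.abs-* a (+ (p^ k)) ⟩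
        ℤ.∣ a ∣ ℕ.* p^ k           ∎))
        where
        open ≡-Reasoning
        zb : ℤ→ℚ (z ℤ.* + b) ≡ ℤ→ℚ (a ℤ.* + (p^ k))
        zb = begin
          ℤ→ℚ (z ℤ.* + b)                              ≡⟨ ℤ→ℚ-* z (+ b) ⟩
          ℤ→ℚ z * ℕ→ℚ b                                ≡⟨ cong (_* ℕ→ℚ b) (trans (sym (val-ιℤ z)) e) ⟩
          (0ℚ + val (ιₚ p ^ₚ k) * val y) * ℕ→ℚ b       ≡⟨ cong (_* ℕ→ℚ b) (ℚₚ.+-identityˡ (val (ιₚ p ^ₚ k) * val y)) ⟩
          val (ιₚ p ^ₚ k) * val y * ℕ→ℚ b              ≡⟨ ℚₚ.*-assoc (val (ιₚ p ^ₚ k)) (val y) (ℕ→ℚ b) ⟩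
          val (ιₚ p ^ₚ k) * (val y * ℕ→ℚ b)            ≡⟨ cong₂ _*_ (val-p^ k) h ⟩
          ℤ→ℚ (+ (p^ k)) * ℤ→ℚ a                       ≡⟨ ℚₚ.*-comm (ℤ→ℚ (+ (p^ k))) (ℤ→ℚ a) ⟩
          ℤ→ℚ a * ℤ→ℚ (+ (p^ k))                       ≡⟨ ℤ→ℚ-* a (+ (p^ k)) ⟨
          ℤ→ℚ (a ℤ.* + (p^ k))                         ∎

    small≡0 : ∀ k t → t ℕ.< p^ k → ιₚ t ≈[ k ] 0ₚ → t ≡ 0
    small≡0 k zero    _  _ = refl
    small≡0 k (suc t) t< h = contradiction (∣⇒≤ (∣-from-cong k (+ suc t) h)) (ℕₚ.<⇒≱ t<)

    private
      residue-≤ : ∀ k {t t′} → t ℕ.≤ t′ → t′ ℕ.< p^ k → ιₚ t ≈[ k ] ιₚ t′ → t ≡ t′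
      residue-≤ k {t} {t′} t≤t′ t′< h = ℕₚ.≤-antisym t≤t′ (ℕₚ.m∸n≡0⇒m≤n (small≡0 k (t′ ∸ t) (ℕₚ.≤-<-trans (ℕₚ.m∸n≤m t′ t) t′<)
        (transᵐ {y = ιₚ t′ -ₚ ιₚ t} (exact (ι-∸ t≤t′)) (x≈y⇒x-y≈0ᵐ (symᵐ h)))))

    residue-unique : ∀ k {t t′} → t ℕ.< p^ k → t′ ℕ.< p^ k → ιₚ t ≈[ k ] ιₚ t′ → t ≡ t′
    residue-unique k {t} {t′} t< t′< h with ℕₚ.≤-total t t′
    ... | inj₁ t≤t′ = residue-≤ k t≤t′ t′< h
    ... | inj₂ t′≤t = sym (residue-≤ k t′≤t t< (symᵐ h))

    ℤ-residue : ∀ z → ∃ λ c → c ℕ.< p × ιℤ z ≈[ 1 ] ιₚ c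
    ℤ-residue z = z ℤ.%ℕ p , ℤDM.n%ℕd<d z p , transᵐ (exact (trans (cong (λ y → val (ιℤ y)) (ℤDM.a≡a%ℕn+[a/ℕn]*n z p))
      (trans (ιℤ-+ (+ (z ℤ.%ℕ p)) (z ℤ./ℕ p ℤ.* + p)) (cong (λ y → val (ιₚ (z ℤ.%ℕ p)) + y) (ιℤ-* (z ℤ./ℕ p) (+ p))))))
      (solveMod 1 {2} (λ π a b → a :+ₚ b :*ₚ π :=ₚ a) (ιₚ (z ℤ.%ℕ p) ∷ ιℤ (z ℤ./ℕ p) ∷ []))

    Unit-ι : ∀ n → ¬ (p ∣ n) → Unit (ιₚ n)
    Unit-ι n h = unit-∤ₚ n h

    fermat-unit : ∀ b → ¬ (p ∣ b) → ιₚ b ^ₚ m ≈[ 1 ] 1ₚ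
    fermat-unit b p∤b = unit-cancel (Unit-ι b p∤b) (transᵐ (fermat b) (exact (sym (ℚₚ.*-identityʳ (val (ιₚ b))))))

    numerator : ∀ (y : ℤₚ) → ∃ λ b → ¬ (p ∣ b) × ∃ λ a → val (ιₚ b *ₚ y) ≡ val (ιℤ a)
    numerator y = go (isInt (int y))
      where
      go : IsPInt p (val y) → ∃ λ b → ¬ (p ∣ b) × ∃ λ a → val (ιₚ b *ₚ y) ≡ val (ιℤ a)
      go (a , b , p∤b , h) = b , p∤b , a , trans (ℚₚ.*-comm (val (ιₚ b)) (val y)) (trans (cong (val y *_) (trans (val-ι b) (ι≡ℕ→ℚ b))) (trans h (sym (val-ιℤ a))))

    -- For y = a / b the residue is that of a b ^ (p - 2), by Fermat's theorem.
    hensel₁ : ∀ y → ∃ λ c → c ℕ.< p × y ≈[ 1 ] ιₚ c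
    hensel₁ y = c , proj₁ (proj₂ res) , unit-cancel (Unit-ι b p∤b) (begin
      ιₚ b *ₚ y                              ≈⟨ exact by≡a ⟩
      ιℤ a                                   ≈⟨ exact (sym (ℚₚ.*-identityˡ (val (ιℤ a)))) ⟩
      1ₚ *ₚ ιℤ a                             ≈⟨ *-congʳᵐ (fermat-unit b p∤b) ⟨
      ιₚ b *ₚ ιₚ b ^ₚ r *ₚ ιℤ a              ≈⟨ exact (ℚₚ.*-assoc (val (ιₚ b)) (val (ιₚ b ^ₚ r)) (val (ιℤ a))) ⟩
      ιₚ b *ₚ (ιₚ b ^ₚ r *ₚ ιℤ a)            ≈⟨ *-congˡᵐ (exact (trans (cong (_* val (ιℤ a)) (sym (ιₚ-^ b r))) (sym (ιℤ-* (+ (b ℕ.^ r)) a)))) ⟩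
      ιₚ b *ₚ ιℤ (+ (b ℕ.^ r) ℤ.* a)         ≈⟨ *-congˡᵐ (proj₂ (proj₂ res)) ⟩
      ιₚ b *ₚ ιₚ c                           ∎)
      where
      open Reasoning
      b = proj₁ (numerator y)
      p∤b = proj₁ (proj₂ (numerator y))
      a = proj₁ (proj₂ (proj₂ (numerator y)))
      by≡a = proj₂ (proj₂ (proj₂ (numerator y)))
      res = ℤ-residue (+ (b ℕ.^ r) ℤ.* a)
      c = proj₁ res

    hensel : ∀ k y → ∃ λ t → t ℕ.< p^ k × y ≈[ k ] ιₚ t
    hensel zero    y = 0 , s≤s z≤n , mk y (solveₚ {1} (λ y → y :=ₚ #ₚ 0 :+ₚ #ₚ 1 :*ₚ y) (y ∷ []))
    hensel (suc k) y = step (hensel k y)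
      where
      step : (∃ λ t → t ℕ.< p^ k × y ≈[ k ] ιₚ t) → ∃ λ t → t ℕ.< p^ (suc k) × y ≈[ suc k ] ιₚ t
      step (t , t< , mk z e) = t ℕ.+ c ℕ.* p^ k ,
        ℕₚ.<-≤-trans (ℕₚ.+-monoˡ-< (c ℕ.* p^ k) t<) (ℕₚ.*-monoˡ-≤ (p^ k) (proj₁ (proj₂ (hensel₁ z)))) , (begin
        y                                        ≈⟨ exact e ⟩
        ιₚ t +ₚ ιₚ p ^ₚ k *ₚ z                   ≈⟨ +-congˡᵐ (subst (λ l → ιₚ p ^ₚ k *ₚ z ≈[ l ] ιₚ p ^ₚ k *ₚ ιₚ c) (ℕₚ.+-comm k 1) (π^*-cong k (proj₂ (proj₂ (hensel₁ z))))) ⟩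
        ιₚ t +ₚ ιₚ p ^ₚ k *ₚ ιₚ c                ≈⟨ exact (cong (λ w → val (ιₚ t) + w) (trans (ℚₚ.*-comm (val (ιₚ p ^ₚ k)) (val (ιₚ c))) (trans (cong (val (ιₚ c) *_) (sym (ιₚ-^ p k))) (sym (ιₚ-* c (p^ k)))))) ⟩
        ιₚ t +ₚ ιₚ (c ℕ.* p^ k)                  ≈⟨ exact (sym (ι-+ t (c ℕ.* p^ k))) ⟩
        ιₚ (t ℕ.+ c ℕ.* p^ k)                    ∎)
        where
        open Reasoning
        c = proj₁ (hensel₁ z)

    search-spec : ∀ c s (Pr : ℕ → Bool) → (∃ λ t → s ℕ.≤ t × t ℕ.< s ℕ.+ c × Pr t ≡ true) → search c s Pr ℕ.< s ℕ.+ c × Pr (search c s Pr) ≡ true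
    search-spec zero    s Pr (t , s≤t , t< , _) = contradiction (subst (t ℕ.<_) (ℕₚ.+-identityʳ s) t<) (ℕₚ.≤⇒≯ s≤t)
    search-spec (suc c) s Pr (t , s≤t , t< , e) with Pr s in eq
    ... | true  = ℕₚ.m<m+n s (s≤s z≤n) , eq
    ... | false with ℕₚ.m≤n⇒m<n∨m≡n s≤t
    ...   | inj₂ refl = contradiction (trans (sym eq) e) λ ()
    ...   | inj₁ s<t with search-spec c (suc s) Pr (t , s<t , subst (t ℕ.<_) (ℕₚ.+-suc s c) t< , e)
    ...     | l , f = subst (search c (suc s) Pr ℕ.<_) (sym (ℕₚ.+-suc s c)) l , f

    modℤ-∣ : ∀ M z → 0 ℕ.< M → M ∣ ℤ.∣ z ∣ → modℤ z M ≡ 0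
    modℤ-∣ (suc M) (+ n)    _ h = n∣m⇒m%n≡0 n (suc M) h
    modℤ-∣ (suc M) -[1+ n ] _ h with suc n ℕ.% suc M | n∣m⇒m%n≡0 (suc n) (suc M) h
    ... | zero | _ = refl

    ∣-modℤ : ∀ M z → 0 ℕ.< M → modℤ z M ≡ 0 → ∃ λ c → z ≡ c ℤ.* + M
    ∣-modℤ (suc M) z _ h = z ℤ./ℕ suc M , trans (ℤDM.a≡a%ℕn+[a/ℕn]*n z (suc M)) (trans (cong (λ w → + w ℤ.+ (z ℤ./ℕ suc M) ℤ.* + suc M) h) (ℤₚ.+-identityˡ ((z ℤ./ℕ suc M) ℤ.* + suc M)))

    isZero-true : ∀ {n} → n ≡ 0 → isZero n ≡ true
    isZero-true refl = refl

    isZero-zero : ∀ n → isZero n ≡ true → n ≡ 0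
    isZero-zero zero _ = refl

    divℕ≡/ : ∀ a b .{{_ : ℕ.NonZero b}} → divℕ a b ≡ a ℕ./ b
    divℕ≡/ a (suc b) = refl

    -- Denominators are in lowest terms: if x is n / d and also a / b with p prime to b, then n b =
    -- a d, so a factor p of d would divide n as well.
    p∤denominator : ∀ (x : ℤₚ) → ¬ (p ∣ ↧ₙ (val x))
    p∤denominator x = go (val x) (isInt (int x))
      where
      go : ∀ v → IsPInt p v → ¬ (p ∣ ↧ₙ v)
      go v@(ℚ.mkℚ n d-1 coprime) (a , b , p∤b , h) p∣d = [ (λ p∣n → p≢1 (Coprimality.recompute coprime (p∣n , p∣d))) , p∤b ]′
        (euclidsLemma ℤ.∣ n ∣ b prime (subst (p ∣_) nb (∣-trans p∣d (n∣m*n ℤ.∣ a ∣))))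
        where
        open ≡-Reasoning
        nb≡ad : ℤ→ℚ (n ℤ.* + b) ≡ ℤ→ℚ (a ℤ.* + suc d-1)
        nb≡ad = begin
          ℤ→ℚ (n ℤ.* + b)                 ≡⟨ ℤ→ℚ-* n (+ b) ⟩
          ℤ→ℚ n * ℕ→ℚ b                   ≡⟨ cong (_* ℕ→ℚ b) (↥-↧ v) ⟨
          v * ℕ→ℚ (suc d-1) * ℕ→ℚ b       ≡⟨ ℚₚ.*-assoc v (ℕ→ℚ (suc d-1)) (ℕ→ℚ b) ⟩
          v * (ℕ→ℚ (suc d-1) * ℕ→ℚ b)     ≡⟨ cong (v *_) (ℚₚ.*-comm (ℕ→ℚ (suc d-1)) (ℕ→ℚ b)) ⟩
          v * (ℕ→ℚ b * ℕ→ℚ (suc d-1))     ≡⟨ ℚₚ.*-assoc v (ℕ→ℚ b) (ℕ→ℚ (suc d-1)) ⟨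
          v * ℕ→ℚ b * ℕ→ℚ (suc d-1)       ≡⟨ cong (_* ℕ→ℚ (suc d-1)) h ⟩
          ℤ→ℚ a * ℕ→ℚ (suc d-1)           ≡⟨ ℤ→ℚ-* a (+ suc d-1) ⟨
          ℤ→ℚ (a ℤ.* + suc d-1)           ∎
        nb : ℤ.∣ a ∣ ℕ.* suc d-1 ≡ ℤ.∣ n ∣ ℕ.* b
        nb = trans (sym (ℤₚ.abs-* a (+ suc d-1))) (trans (cong ℤ.∣_∣ (sym (ℤ→ℚ-injective (n ℤ.* + b) (a ℤ.* + suc d-1) nb≡ad))) (ℤₚ.abs-* n (+ b)))
        p≢1 : ¬ (p ≡ 1)
        p≢1 ()

    vpℕ-zero : ∀ f d → ¬ (p ∣ d) → vpℕ p f d ≡ 0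
    vpℕ-zero zero    d p∤d = refl
    vpℕ-zero (suc f) zero    p∤d = contradiction (p ∣0) p∤d
    vpℕ-zero (suc f) (suc d) p∤d with modℕ (suc d) p in eq
    ... | zero  = contradiction (m%n≡0⇒n∣m (suc d) p eq) p∤d
    ... | suc _ = refl

    -- The denominator of a p-integral number has valuation 0, so its digits are not shifted.
    digit≡ : ∀ j (x : ℤₚ) → digit p j (val x) ≡ digitInt p j (↥ val x) (↧ₙ val x)
    digit≡ j x = trans (cong (λ e → digitInt p (j ℕ.+ e) (↥ val x) (divℕ (↧ₙ val x) (p ℕ.^ e))) (vpℕ-zero (↧ₙ val x) (↧ₙ val x) (p∤denominator x)))
      (cong₂ (λ j′ d′ → digitInt p j′ (↥ val x) d′) (ℕₚ.+-identityʳ j) (DM.n/1≡n (↧ₙ val x)))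

    -- The search finds the residue of x modulo p ^ (j + 1), since `hensel` provides one in its
    -- range; t gathers the digits below j. This congruence is all that later arguments use about
    -- digits.
    digit-spec : ∀ j (x : ℤₚ) → ∃ λ t → t ℕ.< p^ j × digit p j (val x) ℕ.< p × x ≈[ suc j ] ιₚ (t ℕ.+ digit p j (val x) ℕ.* p^ j)
    digit-spec j x = ρ ℕ.% p^ j , DM.m%n<n ρ (p^ j) , subst (ℕ._< p) (sym digit≡/) ρ/<p ,
      subst (λ z → x ≈[ suc j ] ιₚ z) (trans (DM.m≡m%n+[m/n]*n ρ (p^ j)) (cong (λ z → ρ ℕ.% p^ j ℕ.+ z ℕ.* p^ j) (sym digit≡/))) x≈ρ
      where
      instance
        nz : ℕ.NonZero (p^ j)
        nz = ℕ.>-nonZero (0<p^ j)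
      n = ↥ val x
      d = ↧ₙ val x
      M = p^ (suc j)
      difference : ℕ → ℤ
      difference t = (+ (d ℕ.* t)) ℤ.- n
      Pr : ℕ → Bool
      Pr t = isZero (modℤ (difference t) M)
      ρ = search M 0 Pr
      dx≡n : val (ιₚ d *ₚ x) ≡ val (ιℤ n)
      dx≡n = trans (ℚₚ.*-comm (val (ιₚ d)) (val x)) (trans (cong (val x *_) (trans (val-ι d) (ι≡ℕ→ℚ d))) (trans (↥-↧ (val x)) (sym (val-ιℤ n))))
      difference≡ : ∀ t → val (ιℤ (difference t)) ≡ val (ιₚ d *ₚ (ιₚ t -ₚ x))
      difference≡ t = begin
        val (ιℤ (+ (d ℕ.* t) ℤ.+ ℤ.- n))              ≡⟨ ιℤ-+ (+ (d ℕ.* t)) (ℤ.- n) ⟩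
        val (ιₚ (d ℕ.* t)) + val (ιℤ (ℤ.- n))         ≡⟨ cong₂ _+_ (ιₚ-* d t) (trans (ιℤ-neg n) (cong (-_) (sym dx≡n))) ⟩
        val (ιₚ d *ₚ ιₚ t -ₚ ιₚ d *ₚ x)               ≡⟨ solveₚ {3} (λ d t x → d :*ₚ t :-ₚ d :*ₚ x :=ₚ d :*ₚ (t :-ₚ x)) (ιₚ d ∷ ιₚ t ∷ x ∷ []) ⟩
        val (ιₚ d *ₚ (ιₚ t -ₚ x))                     ∎
        where open ≡-Reasoning
      exists : ∃ λ t → 0 ℕ.≤ t × t ℕ.< M × Pr t ≡ true
      exists = t , z≤n , proj₁ (proj₂ (hensel (suc j) x)) , isZero-true (modℤ-∣ M (difference t) (0<p^ (suc j)) (∣-from-cong (suc j) (difference t)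
        (transᵐ {y = ιₚ d *ₚ (ιₚ t -ₚ x)} (exact (difference≡ t)) (transᵐ {y = ιₚ d *ₚ 0ₚ} (*-congˡᵐ (x≈y⇒x-y≈0ᵐ (symᵐ (proj₂ (proj₂ (hensel (suc j) x)))))) (exact (ℚₚ.*-zeroʳ (val (ιₚ d))))))))
        where t = proj₁ (hensel (suc j) x)
      found = search-spec M 0 Pr exists
      ρ<M : ρ ℕ.< M
      ρ<M = proj₁ found
      x≈ρ : x ≈[ suc j ] ιₚ ρ
      x≈ρ = symᵐ (x-y≈0⇒x≈yᵐ (unit-cancel {u = ιₚ d} {x = ιₚ ρ -ₚ x} {y = 0ₚ} (Unit-ι d (p∤denominator x)) (transᵐ {y = ιℤ (difference ρ)} (exact (sym (difference≡ ρ))) (transᵐ {y = 0ₚ} (multiple (∣-modℤ M (difference ρ) (0<p^ (suc j)) (isZero-zero _ (proj₂ found)))) (exact (sym (ℚₚ.*-zeroʳ (val (ιₚ d)))))))))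
        where
        multiple : (∃ λ c → difference ρ ≡ c ℤ.* + M) → ιℤ (difference ρ) ≈[ suc j ] 0ₚ
        multiple (c , e) = mk (ιℤ c) (begin
          val (ιℤ (difference ρ))                       ≡⟨ cong (λ z → val (ιℤ z)) e ⟩
          val (ιℤ (c ℤ.* + M))                          ≡⟨ ιℤ-* c (+ M) ⟩
          val (ιℤ c) * val (ιₚ M)                       ≡⟨ cong (val (ιℤ c) *_) (ιₚ-^ p (suc j)) ⟩
          val (ιℤ c) * val (ιₚ p ^ₚ suc j)              ≡⟨ trans (ℚₚ.*-comm (val (ιℤ c)) (val (ιₚ p ^ₚ suc j))) (sym (ℚₚ.+-identityˡ (val (ιₚ p ^ₚ suc j) * val (ιℤ c)))) ⟩
          0ℚ + val (ιₚ p ^ₚ suc j) * val (ιℤ c)         ∎)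
          where open ≡-Reasoning
      ρ/<p : ρ ℕ./ p^ j ℕ.< p
      ρ/<p = DM.m<n*o⇒m/o<n ρ<M
      digit≡/ : digit p j (val x) ≡ ρ ℕ./ p^ j
      digit≡/ = trans (digit≡ j x) (trans (cong (ℕ._% p) (divℕ≡/ ρ (p^ j))) (DM.m<n⇒m%n≡m ρ/<p))

    -- As x is divisible by p ^ j, the number t formed by the lower digits is zero, and p ^ j can be
    -- cancelled.
    digit-leading : ∀ j {x y : ℤₚ} → x ≈[ suc j ] ιₚ p ^ₚ j *ₚ y → ιₚ (digit p j (val x)) ≈[ 1 ] y
    digit-leading j {x} {y} x≈ = leading (digit-spec j x)
      where
      D = digit p j (val x)
      π^-cancel : ∀ k {a b} → ιₚ p ^ₚ k *ₚ a ≈[ suc k ] ιₚ p ^ₚ k *ₚ b → a ≈[ 1 ] b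
      π^-cancel zero    {a} {b} h = transᵐ (exact (sym (ℚₚ.*-identityˡ (val a)))) (transᵐ h (exact (ℚₚ.*-identityˡ (val b))))
      π^-cancel (suc k) {a} {b} h = π^-cancel k (π*-cancel (λ {a} {b} → cancelₚ {a} {b}) (transᵐ (exact (sym (ℚₚ.*-assoc (val (ιₚ p)) (val (ιₚ p ^ₚ k)) (val a)))) (transᵐ h (exact (ℚₚ.*-assoc (val (ιₚ p)) (val (ιₚ p ^ₚ k)) (val b))))))
      split : ∀ t → val (ιₚ (t ℕ.+ D ℕ.* p^ j)) ≡ val (ιₚ t +ₚ ιₚ p ^ₚ j *ₚ ιₚ D)
      split t = trans (ι-+ t (D ℕ.* p^ j)) (cong (λ z → val (ιₚ t) + z) (trans (ιₚ-* D (p^ j)) (trans (ℚₚ.*-comm (val (ιₚ D)) (val (ιₚ (p^ j)))) (cong (_* val (ιₚ D)) (ιₚ-^ p j)))))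
      leading : (∃ λ t → t ℕ.< p^ j × D ℕ.< p × x ≈[ suc j ] ιₚ (t ℕ.+ D ℕ.* p^ j)) → ιₚ D ≈[ 1 ] y
      leading (t , t< , D<p , h) = π^-cancel j (begin
        ιₚ p ^ₚ j *ₚ ιₚ D                 ≈⟨ exact (solveₚ {1} (λ a → a :=ₚ #ₚ 0 :+ₚ a) (ιₚ p ^ₚ j *ₚ ιₚ D ∷ [])) ⟩
        ιₚ 0 +ₚ ιₚ p ^ₚ j *ₚ ιₚ D         ≈⟨ exact (cong (λ z → val (ιₚ z +ₚ ιₚ p ^ₚ j *ₚ ιₚ D)) (sym t≡0)) ⟩
        ιₚ t +ₚ ιₚ p ^ₚ j *ₚ ιₚ D         ≈⟨ exact (sym (split t)) ⟩
        ιₚ (t ℕ.+ D ℕ.* p^ j)             ≈⟨ symᵐ h ⟩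
        x                                 ≈⟨ x≈ ⟩
        ιₚ p ^ₚ j *ₚ y                    ∎)
        where
        open Reasoning
        t≡0 : t ≡ 0
        t≡0 = small≡0 j t t< (begin
          ιₚ t                                              ≈⟨ mk (-ₚ ιₚ D) (solveₚ {3} (λ t a d → t :=ₚ (t :+ₚ a :*ₚ d) :+ₚ a :*ₚ :-ₚ d) (ιₚ t ∷ ιₚ p ^ₚ j ∷ ιₚ D ∷ [])) ⟩
          ιₚ t +ₚ ιₚ p ^ₚ j *ₚ ιₚ D                         ≈⟨ exact (sym (split t)) ⟩
          ιₚ (t ℕ.+ D ℕ.* p^ j)                             ≈⟨ reduce (ℕₚ.n≤1+n j) (symᵐ h) ⟩
          x                                                 ≈⟨ reduce (ℕₚ.n≤1+n j) x≈ ⟩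
          ιₚ p ^ₚ j *ₚ y                                    ≈⟨ mk y (solveₚ {2} (λ a y → a :*ₚ y :=ₚ #ₚ 0 :+ₚ a :*ₚ y) (ιₚ p ^ₚ j ∷ y ∷ [])) ⟩
          0ₚ                                                ∎)

    -- By uniqueness of residues D is the lowest digit of y, even if it was obtained as a digit of
    -- another number.
    digits-01 : ∀ (y : ℤₚ) D → D ℕ.< p → ιₚ D ≈[ 1 ] y → ιₚ D +ₚ ιₚ p *ₚ ιₚ (digit p 1 (val y)) ≈[ 2 ] y
    digits-01 y D D<p D≈y = lemma (digit-spec 1 y)
      where
      d = digit p 1 (val y)
      p^1 : p ≡ p^ 1
      p^1 = sym (ℕₚ.*-identityʳ p)
      lemma : (∃ λ t → t ℕ.< p^ 1 × d ℕ.< p × y ≈[ 2 ] ιₚ (t ℕ.+ d ℕ.* p^ 1)) → ιₚ D +ₚ ιₚ p *ₚ ιₚ d ≈[ 2 ] y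
      lemma (t , t< , _ , h) = begin
        ιₚ D +ₚ ιₚ p *ₚ ιₚ d            ≈⟨ exact (cong (λ z → val (ιₚ z +ₚ ιₚ p *ₚ ιₚ d)) D≡t) ⟩
        ιₚ t +ₚ ιₚ p *ₚ ιₚ d            ≈⟨ exact (sym split) ⟩
        ιₚ (t ℕ.+ d ℕ.* p^ 1)           ≈⟨ symᵐ h ⟩
        y                               ∎
        where
        open Reasoning
        split : val (ιₚ (t ℕ.+ d ℕ.* p^ 1)) ≡ val (ιₚ t +ₚ ιₚ p *ₚ ιₚ d)
        split = trans (ι-+ t (d ℕ.* p^ 1)) (cong (λ z → val (ιₚ t) + z) (trans (ιₚ-* d (p^ 1)) (trans (ℚₚ.*-comm (val (ιₚ d)) (val (ιₚ (p^ 1)))) (cong (λ z → val (ιₚ z) * val (ιₚ d)) (sym p^1)))))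
        D≡t : D ≡ t
        D≡t = residue-unique 1 (subst (D ℕ.<_) p^1 D<p) t< (begin
          ιₚ D                          ≈⟨ D≈y ⟩
          y                             ≈⟨ reduce (s≤s z≤n) h ⟩
          ιₚ (t ℕ.+ d ℕ.* p^ 1)         ≈⟨ exact split ⟩
          ιₚ t +ₚ ιₚ p *ₚ ιₚ d          ≈⟨ solveMod 1 {2} (λ π t d → t :+ₚ π :*ₚ d :=ₚ t) (ιₚ t ∷ ιₚ d ∷ []) ⟩
          ιₚ t                          ∎)

  -- Identification with the quantities of the theorem

  module Values where
    open import Defs
    open import Data.Rational as ℚ using (ℚ; _+_; _*_; _-_; -_; 0ℚ; 1ℚ)
    open ≡ using (refl; sym; trans; cong; cong₂; subst; module ≡-Reasoning)
    open Numeralsℚ using (ι; ι-^; solve; _:=_; _:+_; _:*_; _:-_; :-_; #)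
    open Sumsℚ using (∑; ∑-cong; ∑-cong′; ∑-cons)
    open Rationals
    open Bernoulli using (sumFrom≡∑; 1/; ι-cancel)
    open Instance
    open import Algebra.Properties.Semiring.Exp (CommutativeRing.semiring ℚₚ.+-*-commutativeRing) using (_^_)
    open import Algebra.Properties.CommutativeSemiring.Exp (CommutativeRing.commutativeSemiring ℚₚ.+-*-commutativeRing) using (^-distrib-*)
    open import Algebra.Properties.Semiring.Exp Rₚ.semiring using () renaming (_^_ to _^ₚ_)
    open Rₚ using () renaming (_-_ to _-ₚ_)
    open Congₚ
    open Sumsₚ using () renaming (∑ to ∑ₚ)
    open Digits
    open A using (DividedBernoulli; 𝔠; conv; 𝕋; m; M)

    ℕ→ℚ≢0 : ∀ n → ℕ→ℚ (suc n) ≢ 0ℚ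
    ℕ→ℚ≢0 n e = ℚₚ.1≢0 (trans (sym (invℕ n)) (trans (cong (_* frac (+ 1) (suc n)) e) (ℚₚ.*-zeroˡ (frac (+ 1) (suc n)))))

    val-ι′ : ∀ n → val (ιₚ n) ≡ ℕ→ℚ n
    val-ι′ n = trans (val-ι n) (ι≡ℕ→ℚ n)

    ÷q-unique : ∀ x y n → y * ℕ→ℚ (suc n) ≡ x → x ÷q ℕ→ℚ (suc n) ≡ y
    ÷q-unique x y n h = *-cancelʳ-ℕ n (trans (÷q-* x (ℕ→ℚ (suc n)) (ℕ→ℚ≢0 n)) (sym h))

    divided-B : ∀ n {y} → DividedBernoulli n y → B n ≡ val (ιₚ n) * val y
    divided-B n {y} d = ι-cancel (suc r) (trans d (cong (_* (val (ιₚ n) * val y)) (val-ι p)))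

    divided-𝓑 : ∀ n {y} → 0 ℕ.< n → DividedBernoulli n y → val y ≡ 𝓑 n
    divided-𝓑 (suc n) {y} _ d = sym (÷q-unique (B (suc n)) (val y) n (trans (ℚₚ.*-comm (val y) (ℕ→ℚ (suc n))) (trans (cong (_* val y) (sym (val-ι′ (suc n)))) (sym (divided-B (suc n) {y} d)))))

    𝔠-𝓑 : ∀ n → 2 ℕ.≤ n → n ℕ.< r → val (𝔠 n) ≡ 𝓑 n
    𝔠-𝓑 n 2≤n n<r = divided-𝓑 n {𝔠 n} (ℕₚ.≤-trans (s≤s z≤n) 2≤n) (A.𝔠-divided n 2≤n n<r)

    -- Convolutions of a sequence c supported on 2 ≤ i, written with the summation bounds of 𝓒 and 𝓣.
    module Convolution (c β : ℕ → ℚ) (c-0 : c 0 ≡ 0ℚ) (c-1 : c 1 ≡ 0ℚ) (c≡β : ∀ i → 2 ℕ.≤ i → i ℕ.< r → c i ≡ β i) where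
      open ≡-Reasoning

      convℚ : ℕ → ℚ
      convℚ k = ∑ (suc k) (λ n → c n * c (k ∸ n))

      left : ∀ {a} b → a ≡ 0ℚ → a * b ≡ 0ℚ
      left b e = trans (cong (_* b) e) (ℚₚ.*-zeroˡ b)

      right : ∀ a {b} → b ≡ 0ℚ → a * b ≡ 0ℚ
      right a e = trans (cong (a *_) e) (ℚₚ.*-zeroʳ a)

      -- Both indices of a nonzero term are at least 2, so the convolution starts at 4. This
      -- accounts for the upper bound m - 4 in `𝓣`.
      convℚ-small : ∀ k → k ℕ.≤ 3 → convℚ k ≡ 0ℚ
      convℚ-small 0 _ = cong (λ z → 0ℚ + z) (left (c 0) c-0)
      convℚ-small 1 _ = cong₂ (λ a b → 0ℚ + a + b) (left (c 1) c-0) (left (c 0) c-1)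
      convℚ-small 2 _ = cong₂ _+_ (cong₂ (λ a b → 0ℚ + a + b) (left (c 2) c-0) (left (c 1) c-1)) (right (c 2) c-0)
      convℚ-small 3 _ = cong₂ _+_ (cong₂ _+_ (cong₂ (λ a b → 0ℚ + a + b) (left (c 3) c-0) (left (c 2) c-1)) (right (c 2) c-1)) (right (c 3) c-0)
      convℚ-small (suc (suc (suc (suc _)))) (s≤s (s≤s (s≤s ())))

      ∑-cons₂ : ∀ k (g : ℕ → ℚ) → g 0 ≡ 0ℚ → g 1 ≡ 0ℚ → ∑ (2 ℕ.+ k) g ≡ ∑ k (λ i → g (2 ℕ.+ i))
      ∑-cons₂ k g g-0 g-1 = begin
        ∑ (2 ℕ.+ k) g                                  ≡⟨ trans (∑-cons (suc k) g) (cong (λ z → g 0 + z) (∑-cons k (λ i → g (suc i)))) ⟩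
        g 0 + (g 1 + ∑ k (λ i → g (2 ℕ.+ i)))          ≡⟨ cong₂ (λ a b → a + (b + ∑ k (λ i → g (2 ℕ.+ i)))) g-0 g-1 ⟩
        0ℚ + (0ℚ + ∑ k (λ i → g (2 ℕ.+ i)))            ≡⟨ solve {1} (λ s → # 0 :+ (# 0 :+ s) := s) (∑ k (λ i → g (2 ℕ.+ i)) ∷ []) ⟩
        ∑ k (λ i → g (2 ℕ.+ i))                        ∎

      convℚ≡ : ∀ k → k ℕ.≤ m → convℚ k ≡ Σ[ 2 ≤i≤ k ∸ 2 ] (λ i → β i * β (k ∸ i))
      convℚ≡ 0 _ = convℚ-small 0 z≤n
      convℚ≡ 1 _ = convℚ-small 1 (s≤s z≤n)
      convℚ≡ 2 _ = convℚ-small 2 (s≤s (s≤s z≤n))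
      convℚ≡ N@(suc (suc (suc k))) k≤m = begin
        ∑ (2 ℕ.+ k) g + g (2 ℕ.+ k) + g (3 ℕ.+ k)
          ≡⟨ cong₂ _+_ (cong₂ _+_ (∑-cons₂ k g (left (c N) c-0) (left (c (2 ℕ.+ k)) c-1)) (right (c (2 ℕ.+ k)) (trans (cong c last-2) c-1))) (right (c N) (trans (cong c (ℕₚ.n∸n≡0 k)) c-0)) ⟩
        ∑ k (λ i → g (2 ℕ.+ i)) + 0ℚ + 0ℚ
          ≡⟨ trans (ℚₚ.+-identityʳ _) (ℚₚ.+-identityʳ (∑ k (λ i → g (2 ℕ.+ i)))) ⟩
        ∑ k (λ i → g (2 ℕ.+ i))
          ≡⟨ ∑-cong k (λ i i<k → cong₂ _*_ (c≡β (2 ℕ.+ i) (s≤s (s≤s z≤n)) (upper i i<k)) (c≡β (N ∸ (2 ℕ.+ i)) (lower i i<k) (ℕₚ.≤-<-trans (ℕₚ.m∸n≤m (suc k) i) (ℕₚ.≤-pred k≤m)))) ⟩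
        ∑ k (λ i → β (2 ℕ.+ i) * β (N ∸ (2 ℕ.+ i)))
          ≡⟨ sumFrom≡∑ 2 k (λ i → β i * β (N ∸ i)) ⟨
        Σ[ 2 ≤i≤ N ∸ 2 ] (λ i → β i * β (N ∸ i)) ∎
        where
        g : ℕ → ℚ
        g n = c n * c (N ∸ n)
        last-2 : N ∸ (2 ℕ.+ k) ≡ 1
        last-2 = trans (ℕₚ.+-∸-assoc 1 (ℕₚ.≤-refl {k})) (cong suc (ℕₚ.n∸n≡0 k))
        upper : ∀ i → i ℕ.< k → 2 ℕ.+ i ℕ.< r
        upper i i<k = ℕₚ.<-≤-trans (ℕₚ.+-monoʳ-< 2 i<k) (ℕₚ.≤-pred k≤m)
        lower : ∀ i → i ℕ.< k → 2 ℕ.≤ suc k ∸ i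
        lower i i<k = subst (2 ℕ.≤_) (sym (ℕₚ.+-∸-assoc 1 (ℕₚ.<⇒≤ i<k))) (s≤s (ℕₚ.m<n⇒0<n∸m i<k))

      -- Writing N as 5 + t exposes the last four terms, at which the inner convolution has argument
      -- at most 3.
      triple≡ : ∀ N t → N ≡ 5 ℕ.+ t → N ≡ m → ∑ (suc N) (λ n → c n * convℚ (N ∸ n)) ≡ Σ[ 2 ≤i≤ N ∸ 4 ] (λ i → β i * Σ[ 2 ≤i≤ (N ∸ i) ∸ 2 ] (λ j → β j * β ((N ∸ i) ∸ j)))
      triple≡ .(5 ℕ.+ t) t refl N≡m = begin
        ∑ (2 ℕ.+ t) g + g (2 ℕ.+ t) + g (3 ℕ.+ t) + g (4 ℕ.+ t) + g (5 ℕ.+ t)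
          ≡⟨ cong₂ _+_ (cong₂ _+_ (cong₂ _+_ (cong₂ _+_ (∑-cons₂ t g (left (convℚ N) c-0) (left (convℚ (4 ℕ.+ t)) c-1)) (vanish 2 3 ℕₚ.≤-refl refl)) (vanish 3 2 (ℕₚ.n≤1+n 2) refl)) (vanish 4 1 (s≤s z≤n) refl)) (vanish 5 0 z≤n refl) ⟩
        s + 0ℚ + 0ℚ + 0ℚ + 0ℚ
          ≡⟨ solve {1} (λ s → s :+ # 0 :+ # 0 :+ # 0 :+ # 0 := s) (s ∷ []) ⟩
        s
          ≡⟨ ∑-cong t (λ i i<t → cong₂ _*_ (c≡β (2 ℕ.+ i) (s≤s (s≤s z≤n)) (upper i i<t)) (convℚ≡ (N ∸ (2 ℕ.+ i)) (ℕₚ.≤-trans (ℕₚ.m∸n≤m N (2 ℕ.+ i)) (ℕₚ.≤-reflexive N≡m)))) ⟩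
        ∑ t (λ i → f (2 ℕ.+ i))
          ≡⟨ sumFrom≡∑ 2 t f ⟨
        sumFrom 2 t f ∎
        where
        N = 5 ℕ.+ t
        f g : ℕ → ℚ
        f i = β i * Σ[ 2 ≤i≤ (N ∸ i) ∸ 2 ] (λ j → β j * β ((N ∸ i) ∸ j))
        g n = c n * convℚ (N ∸ n)
        s = ∑ t (λ i → g (2 ℕ.+ i))
        vanish : ∀ j k → k ℕ.≤ 3 → j ℕ.+ k ≡ 5 → g (j ℕ.+ t) ≡ 0ℚ
        vanish j k k≤3 e = right (c (j ℕ.+ t)) (trans (cong convℚ difference) (convℚ-small k k≤3))
          where
          difference : N ∸ (j ℕ.+ t) ≡ k
          difference = trans (cong (λ z → z ℕ.+ t ∸ (j ℕ.+ t)) (trans (sym e) (ℕₚ.+-comm j k))) (trans (cong (_∸ (j ℕ.+ t)) (ℕₚ.+-assoc k j t)) (ℕₚ.m+n∸n≡m k (j ℕ.+ t)))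
        upper : ∀ i → i ℕ.< t → 2 ℕ.+ i ℕ.< r
        upper i i<t = ℕₚ.≤-trans (ℕₚ.+-monoʳ-≤ 3 (ℕₚ.<⇒≤ i<t)) (ℕₚ.≤-trans (ℕₚ.n≤1+n (3 ℕ.+ t)) (ℕₚ.≤-reflexive (ℕₚ.suc-injective N≡m)))

    open Convolution (λ n → val (𝔠 n)) 𝓑 refl refl 𝔠-𝓑

    conv-convℚ : ∀ k → val (conv k) ≡ convℚ k
    conv-convℚ k = val-∑ (suc k) (λ n → 𝔠 n *ₚ 𝔠 (k ∸ n))

    conv-𝓒 : val (conv m) ≡ 𝓒 m
    conv-𝓒 = trans (conv-convℚ m) (convℚ≡ m ℕₚ.≤-refl)

    𝕋-𝓣 : val 𝕋 ≡ 𝓣 m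
    𝕋-𝓣 = trans (val-∑ (suc m) (λ n → 𝔠 n *ₚ conv (m ∸ n))) (trans (∑-cong′ (suc m) (λ n → cong (val (𝔠 n) *_) (conv-convℚ (m ∸ n))))
      (triple≡ m (r ∸ 4) (cong suc (sym (ℕₚ.m+[n∸m]≡n (ℕₚ.≤-trans (ℕₚ.m≤m+n 4 5) 9≤r)))) refl))

    ^q≡^ : ∀ x n → x ^q n ≡ x ^ n
    ^q≡^ x zero    = refl
    ^q≡^ x (suc n) = cong (x *_) (^q≡^ x n)

    q-value : ∀ i → i ℕ.< m → val (A.q i) ≡ q p (suc i)
    q-value i i<m = *-cancelʳ-ℕ (suc r) (sym (begin
      q p (suc i) * ℕ→ℚ p                                  ≡⟨ frac-* (+ (suc i ℕ.^ m) ℤ.- + 1) (suc r) ⟩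
      ℤ→ℚ (+ (suc i ℕ.^ m) ℤ.- + 1)                        ≡⟨ ℤ→ℚ-+ (+ (suc i ℕ.^ m)) (ℤ.- + 1) ⟩
      ℕ→ℚ (suc i ℕ.^ m) - 1ℚ                               ≡⟨ cong (_- 1ℚ) (trans (sym (ι≡ℕ→ℚ (suc i ℕ.^ m))) (ι-^ (suc i) m)) ⟩
      ι (suc i) ^ m - 1ℚ                                   ≡⟨ cong (_- 1ℚ) (trans (cong (_^ m) (sym (val-ι (suc i)))) (trans (sym (val-^ (ιₚ (suc i)) m)) (A.u-spec i i<m))) ⟩
      1ℚ + val (ιₚ p) * val (A.q i) - 1ℚ                   ≡⟨ solve {2} (λ a b → # 1 :+ a :* b :- # 1 := b :* a) (val (ιₚ p) ∷ val (A.q i) ∷ []) ⟩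
      val (A.q i) * val (ιₚ p)                             ≡⟨ cong (val (A.q i) *_) (val-ι′ p) ⟩
      val (A.q i) * ℕ→ℚ p                                  ∎))
      where open ≡-Reasoning

    inverse : ℕ → ℤₚ
    inverse i with i ℕ.<? m
    ... | yes i<m = proj₁ (unitₚ (suc i) (s≤s z≤n) (s≤s i<m))
    ... | no  _   = 0ₚ

    inverse-spec : ∀ i → i ℕ.< m → val (ιₚ (suc i)) * val (inverse i) ≡ 1ℚ
    inverse-spec i i<m with i ℕ.<? m
    ... | yes i<m′ = proj₂ (unitₚ (suc i) (s≤s z≤n) (s≤s i<m′))
    ... | no  i≮m = contradiction i<m i≮m

    inverse≈x : ∀ i → i ℕ.< m → inverse i ≈[ 1 ] A.x i
    inverse≈x i i<m = unit-cancel {u = ιₚ (suc i)} (unitₚ (suc i) (s≤s z≤n) (s≤s i<m)) (begin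
      ιₚ (suc i) *ₚ inverse i      ≈⟨ exact (inverse-spec i i<m) ⟩
      1ₚ                           ≈⟨ reduce (s≤s z≤n) (A.ω^m i i<m) ⟨
      A.ω i *ₚ A.x i               ≈⟨ *-congʳᵐ (A.ω≈ i) ⟩
      ιₚ (suc i) *ₚ A.x i          ∎)
      where open Reasoning

    -- The double sum with exact inverses 1 / a, as in the theorem. In `A.big` they are replaced by
    -- powers of x, which is correct modulo p and sufficient under the factor p ^ 3.
    bigₚ : ℤₚ
    bigₚ = ∑ₚ m (λ i → ∑ₚ (r ∸ 8) (λ k → A.n𝔠 (6 ℕ.+ k) *ₚ inverse i ^ₚ (6 ℕ.+ k) *ₚ A.q i ^ₚ 2))

    6+k<r : ∀ k → k ℕ.< r ∸ 8 → 6 ℕ.+ k ℕ.< r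
    6+k<r k k< = ℕₚ.<-≤-trans (ℕₚ.+-monoʳ-< 6 k<) (ℕₚ.≤-trans (ℕₚ.+-monoˡ-≤ (r ∸ 8) (ℕₚ.m≤m+n 6 2)) (ℕₚ.≤-reflexive (ℕₚ.m+[n∸m]≡n (ℕₚ.≤-trans (ℕₚ.n≤1+n 8) 9≤r))))

    bigₚ≈ : bigₚ ≈[ 1 ] A.big
    bigₚ≈ = begin
      bigₚ
        ≈⟨ ∑-congᵐ m (λ i i<m → ∑-congᵐ (r ∸ 8) (λ k k< → *-congʳᵐ (*-congˡᵐ (transᵐ (^-congᵐ (6 ℕ.+ k) (inverse≈x i i<m)) (reduce (s≤s z≤n) (A.x^≈ω^ i (6 ℕ.+ k) i<m (ℕₚ.<⇒≤ (ℕₚ.m<n⇒m<1+n (6+k<r k k<))))))))) ⟩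
      ∑ₚ m (λ i → ∑ₚ (r ∸ 8) (λ k → A.n𝔠 (6 ℕ.+ k) *ₚ A.ω i ^ₚ (m ∸ (6 ℕ.+ k)) *ₚ A.q i ^ₚ 2))
        ≈⟨ exact (trans (Sumsₚ.∑-swap m (r ∸ 8) (λ i k → A.n𝔠 (6 ℕ.+ k) *ₚ A.ω i ^ₚ (m ∸ (6 ℕ.+ k)) *ₚ A.q i ^ₚ 2))
             (Sumsₚ.∑-cong′ (r ∸ 8) λ k → trans (Sumsₚ.∑-cong′ m λ i → ℚₚ.*-assoc (val (A.n𝔠 (6 ℕ.+ k))) (val (A.ω i ^ₚ (m ∸ (6 ℕ.+ k)))) (val (A.q i ^ₚ 2)))
               (Sumsₚ.∑-*ˡ m (A.n𝔠 (6 ℕ.+ k)) (λ i → A.ω i ^ₚ (m ∸ (6 ℕ.+ k)) *ₚ A.q i ^ₚ 2)))) ⟩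
      A.big ∎
      where open Reasoning

    big-value : val bigₚ ≡ bigSum p
    big-value = begin
      val bigₚ
        ≡⟨ val-∑ m _ ⟩
      ∑ m (λ i → val (∑ₚ (r ∸ 8) (λ k → A.n𝔠 (6 ℕ.+ k) *ₚ inverse i ^ₚ (6 ℕ.+ k) *ₚ A.q i ^ₚ 2)))
        ≡⟨ ∑-cong m (λ i i<m → trans (val-∑ (r ∸ 8) _) (trans (∑-cong (r ∸ 8) λ k k< → summand i i<m (6 ℕ.+ k) (s≤s (s≤s z≤n)) (6+k<r k k<)) (trans (cong (λ c → ∑ c (λ k → f (suc i) (6 ℕ.+ k))) count) (sym (sumFrom≡∑ 6 (suc (p ∸ 5) ∸ 6) (f (suc i))))))) ⟩
      ∑ m (λ i → Σ[ 6 ≤i≤ p ∸ 5 ] (f (suc i)))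
        ≡⟨ sumFrom≡∑ 1 m (λ a → Σ[ 6 ≤i≤ p ∸ 5 ] (f a)) ⟨
      bigSum p ∎
      where
      open ≡-Reasoning
      f : ℕ → ℕ → ℚ
      f a i = (B i ÷q (ℕ→ℚ a ^q i)) * q p a ^q 2
      count : r ∸ 8 ≡ suc (p ∸ 5) ∸ 6
      count = sym (ℕₚ.∸-+-assoc r 3 5)
      power≢0 : ∀ i n → ℕ→ℚ (suc i) ^q n ≢ 0ℚ
      power≢0 i n e = ℕ→ℚ≢0 (suc i ℕ.^ n ∸ 1) (trans (trans (cong ℕ→ℚ (ℕₚ.m+[n∸m]≡n {1} (ℕₚ.m^n>0 (suc i) n))) (trans (sym (ι≡ℕ→ℚ (suc i ℕ.^ n))) (trans (ι-^ (suc i) n) (trans (cong (_^ n) (ι≡ℕ→ℚ (suc i))) (sym (^q≡^ (ℕ→ℚ (suc i)) n)))))) e)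
      summand : ∀ i → i ℕ.< m → ∀ n → 2 ℕ.≤ n → n ℕ.< r → val (A.n𝔠 n *ₚ inverse i ^ₚ n *ₚ A.q i ^ₚ 2) ≡ f (suc i) n
      summand i i<m n 2≤n n<r = cong₂ _*_ quotient (trans (val-^ (A.q i) 2) (trans (cong (_^ 2) (q-value i i<m)) (sym (^q≡^ (q p (suc i)) 2))))
        where
        a = ℕ→ℚ (suc i)
        v = val (inverse i)
        av≡1 : a * v ≡ 1ℚ
        av≡1 = trans (cong (_* v) (sym (val-ι′ (suc i)))) (inverse-spec i i<m)
        1^ : ∀ n → 1ℚ ^ n ≡ 1ℚ
        1^ zero    = refl
        1^ (suc n) = trans (ℚₚ.*-identityˡ (1ℚ ^ n)) (1^ n)
        a^v^ : (a ^q n) * v ^ n ≡ 1ℚ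
        a^v^ = trans (cong (_* v ^ n) (^q≡^ a n)) (trans (sym (^-distrib-* a v n)) (trans (cong (_^ n) av≡1) (1^ n)))
        D = B n ÷q (a ^q n)
        quotient : val (A.n𝔠 n *ₚ inverse i ^ₚ n) ≡ D
        quotient = begin
          val (A.n𝔠 n) * val (inverse i ^ₚ n)      ≡⟨ cong₂ _*_ (sym (divided-B n {𝔠 n} (A.𝔠-divided n 2≤n n<r))) (val-^ (inverse i) n) ⟩
          B n * v ^ n                              ≡⟨ cong (_* v ^ n) (÷q-* (B n) (a ^q n) (power≢0 i n)) ⟨
          D * (a ^q n) * v ^ n                     ≡⟨ ℚₚ.*-assoc D (a ^q n) (v ^ n) ⟩
          D * ((a ^q n) * v ^ n)                   ≡⟨ cong (D *_) a^v^ ⟩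
          D * 1ℚ                                   ≡⟨ ℚₚ.*-identityʳ D ⟩
          D                                        ∎

    -- A variable cN stands for N / 720, and nN for N.
    formulaℚ : Vec ℚ 38 → ℚ
    formulaℚ (P ∷ T ∷ w ∷ β ∷ d₁ ∷ γ ∷ dC ∷ dX ∷ big ∷ b₁ ∷ b₂ ∷ b₃ ∷ β₂ ∷ B₁ ∷ γ₂ ∷ B₄ ∷ b″ ∷ AG ∷ c240 ∷ c180 ∷ c10 ∷ c420 ∷ c360 ∷ c120 ∷ c144 ∷ c960 ∷ c60 ∷ c330 ∷ c7 ∷ n2 ∷ n3 ∷ n4 ∷ n6 ∷ n7 ∷ n11 ∷ n12 ∷ n13 ∷ n19 ∷ []) =
        - (P ^ 3 * c240 * T)
        + P ^ 3 * c180 * (w * β + d₁)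
        - P ^ 3 * c10 * γ
        + c420 * P ^ 3 * β
        + c360 * P ^ 3 * dC
        + ((1ℚ - P) * c360) * (1ℚ + P * w) * P ^ 2 * dX
        - P ^ 2 * c120 * (1ℚ + P * w) * (c360 * β + c144 * γ)
        - P ^ 3 * c360 * big
        + (n13 * P ^ 3 + n12 * P - n12) * c240
        + (n19 * P ^ 3 - n12) * c360 * b₁
        + (n4 - n7 * P ^ 3) * b₂
        + (n11 * P ^ 3 - n6) * c120 * b₃
        + P * (n2 * β - β₂) * ((c360 - n3 * B₁) * P - c960 * P ^ 2)
        + n2 * P * (β₂ - n2 * β) * (P * c60 - c330 * P ^ 2 + P ^ 2 * c60 * AG)
        + n4 * P * (γ₂ - n2 * γ) * (P * (n2 * B₄ - b″) + c360 * (c7 * P ^ 2 + n2 * P * b″ + n2 * P * B₄ * b₁))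

    infixr 5 _∷-≡_
    _∷-≡_ : ∀ {n} {x y : ℚ} {xs ys : Vec ℚ n} → x ≡ y → xs ≡ ys → _≡_ {A = Vec ℚ (suc n)} (x ∷ xs) (y ∷ ys)
    refl ∷-≡ refl = refl

    private
      π : ℤₚ
      π = ιₚ p

      9≤r′ : ∀ {n} k → n ℕ.+ k ≡ 9 → n ℕ.≤ r
      9≤r′ {n} k e = ℕₚ.≤-trans (subst (n ℕ.≤_) e (ℕₚ.m≤m+n n k)) 9≤r

    wₚ : ℤₚ
    wₚ = quot A.wilson

    w-spec : val (ιₚ (m !)) ≡ val (π *ₚ wₚ -ₚ 1ₚ)
    w-spec = trans (eq A.wilson) (solve {2} (λ p w → :- # 1 :+ (p :* # 1) :* w := p :* w :- # 1) (val π ∷ val wₚ ∷ []))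

    w-value : val wₚ ≡ w p
    w-value = *-cancelʳ-ℕ (suc r) (sym (begin
      w p * ℕ→ℚ p                     ≡⟨ frac-* (+ (m ! ℕ.+ 1)) (suc r) ⟩
      ℕ→ℚ (m ! ℕ.+ 1)                 ≡⟨ ℕ→ℚ-+ (m !) 1 ⟩
      ℕ→ℚ (m !) + 1ℚ                  ≡⟨ cong (_+ 1ℚ) (trans (sym (val-ι′ (m !))) w-spec) ⟩
      val π * val wₚ - 1ℚ + 1ℚ        ≡⟨ solve {2} (λ p w → p :* w :- # 1 :+ # 1 := w :* p) (val π ∷ val wₚ ∷ []) ⟩
      val wₚ * val π                  ≡⟨ cong (val wₚ *_) (val-ι′ p) ⟩
      val wₚ * ℕ→ℚ p                  ∎))
      where open ≡-Reasoning

    -- 𝓑 (m + j) = 𝓑 j + p δ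
    module Shifted (j : ℕ) (2<j : 2 ℕ.< j) (j<r : j ℕ.< r) (even : Even j) where
      private
        2≤j : 2 ℕ.≤ j
        2≤j = ℕₚ.<⇒≤ 2<j

        existence : Σ ℤₚ (DividedBernoulli (m ℕ.+ j))
        existence = A.shifted-exists j 2≤j (ℕₚ.m<n⇒m<1+n j<r)

        y : ℤₚ
        y = proj₁ existence

        y≈ : y ≈[ 1 ] 𝔠 j
        y≈ = A.kummer₁ j {y} 2≤j j<r even (proj₂ existence)

      δ : ℤₚ
      δ = quot y≈

      private
        y≡ : val y ≡ val (𝔠 j +ₚ π *ₚ δ)
        y≡ = trans (eq y≈) (cong (λ z → val (𝔠 j) + z * val δ) (ℚₚ.*-identityʳ (val π)))

      value : val (𝔠 j +ₚ π *ₚ δ) ≡ 𝓑 (m ℕ.+ j)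
      value = trans (sym y≡) (divided-𝓑 (m ℕ.+ j) {y} (s≤s z≤n) (proj₂ existence))

      δ≈ : ιₚ 2 *ₚ δ ≈[ 1 ] -ₚ M j
      δ≈ = A.kummer-quotient j {y} {δ} 2<j j<r even (proj₂ existence) y≡

    -- The indices p - 3 and p - 5; adding p - 1 gives 2 p - 4 and 2 p - 6.
    j₂ j₄ : ℕ
    j₂ = r ∸ 1
    j₄ = r ∸ 3

    j₂-even : Even j₂
    j₂-even = even∸even (s≤s (9≤r′ {1} 8 refl)) m-evenₚ (1 , refl)

    j₄-even : Even j₄
    j₄-even = even∸even (s≤s (9≤r′ {3} 6 refl)) m-evenₚ (2 , refl)

    j₂<r : j₂ ℕ.< r
    j₂<r = ℕₚ.∸-monoʳ-< {r} {1} {0} (s≤s z≤n) (9≤r′ 8 refl)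

    j₄<r : j₄ ℕ.< r
    j₄<r = ℕₚ.∸-monoʳ-< {r} {3} {0} (s≤s z≤n) (9≤r′ 6 refl)

    2<j₂ : 2 ℕ.< j₂
    2<j₂ = ℕₚ.≤-trans (ℕₚ.m≤m+n 3 5) (ℕₚ.∸-monoˡ-≤ 1 9≤r)

    2<j₄ : 2 ℕ.< j₄
    2<j₄ = ℕₚ.≤-trans (ℕₚ.m≤m+n 3 3) (ℕₚ.∸-monoˡ-≤ 3 9≤r)

    module S₀ = Shifted 4 (s≤s (s≤s (s≤s z≤n))) (9≤r′ {5} 4 refl) (2 , refl)
    module S₂ = Shifted j₂ 2<j₂ j₂<r j₂-even
    module S₄ = Shifted j₄ 2<j₄ j₄<r j₄-even

    β-value : val A.β ≡ 𝓑 (p ∸ 3)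
    β-value = 𝔠-𝓑 j₂ (ℕₚ.<⇒≤ 2<j₂) j₂<r

    γₚ : ℤₚ
    γₚ = 𝔠 j₄

    γ-value : val γₚ ≡ 𝓑 (p ∸ 5)
    γ-value = 𝔠-𝓑 j₄ (ℕₚ.<⇒≤ 2<j₄) j₄<r

    2p≡ : 2 ℕ.* p ≡ 4 ℕ.+ (r ℕ.+ r)
    2p≡ = trans (cong (λ z → suc (suc (r ℕ.+ z))) (ℕₚ.+-identityʳ p)) (cong (λ z → suc (suc z)) (trans (ℕₚ.+-suc r (suc r)) (cong suc (ℕₚ.+-suc r r))))

    2p∸4 : m ℕ.+ j₂ ≡ 2 ℕ.* p ∸ 4
    2p∸4 = trans (trans (sym (ℕₚ.+-suc r j₂)) (cong (r ℕ.+_) (ℕₚ.m+[n∸m]≡n {1} {r} (9≤r′ 8 refl)))) (sym (cong (_∸ 4) 2p≡))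

    2p∸6 : m ℕ.+ j₄ ≡ 2 ℕ.* p ∸ 6
    2p∸6 = trans (cong suc (sym (ℕₚ.+-∸-assoc r {r} {3} (9≤r′ 6 refl)))) (trans (sym (ℕₚ.+-∸-assoc 1 {r ℕ.+ r} {3} (ℕₚ.≤-trans (9≤r′ {3} 6 refl) (ℕₚ.m≤m+n r r)))) (sym (cong (_∸ 6) 2p≡)))

    β₂ₚ γ₂ₚ B₄ₚ b″ₚ : ℤₚ
    β₂ₚ = A.β +ₚ π *ₚ S₂.δ
    γ₂ₚ = γₚ +ₚ π *ₚ S₄.δ
    B₄ₚ = -ₚ (A._/720 6)
    b″ₚ = -ₚ (A._/720 6) +ₚ π *ₚ S₀.δ

    β₂-value : val β₂ₚ ≡ 𝓑 (2 ℕ.* p ∸ 4)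
    β₂-value = trans S₂.value ((cong 𝓑 2p∸4))

    γ₂-value : val γ₂ₚ ≡ 𝓑 (2 ℕ.* p ∸ 6)
    γ₂-value = trans S₄.value ((cong 𝓑 2p∸6))

    fraction-value : ∀ n → val (A._/720 n) ≡ frac (+ n) 720
    fraction-value n = *-cancelʳ-ℕ 719 (begin
      val (ιₚ n) * (val A.ν * 1ℚ) * ℕ→ℚ 720      ≡⟨ solve {3} (λ n v N → n :* (v :* # 1) :* N := n :* (N :* v)) (val (ιₚ n) ∷ val A.ν ∷ ℕ→ℚ 720 ∷ []) ⟩
      val (ιₚ n) * (ℕ→ℚ 720 * val A.ν)           ≡⟨ cong (val (ιₚ n) *_) (trans (cong (_* val A.ν) (sym (val-ι′ 720))) (proj₂ (unit-∤ₚ 720 p∤720))) ⟩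
      val (ιₚ n) * 1ℚ                           ≡⟨ ℚₚ.*-identityʳ (val (ιₚ n)) ⟩
      val (ιₚ n)                                ≡⟨ val-ι′ n ⟩
      ℕ→ℚ n                                     ≡⟨ frac-* (+ n) 719 ⟨
      frac (+ n) 720 * ℕ→ℚ 720                  ∎)
      where open ≡-Reasoning

    B₄-value : val B₄ₚ ≡ 𝓑 4
    B₄-value = trans (cong (-_) (fraction-value 6)) refl

    𝔠4-value : val (𝔠 4) ≡ 𝓑 4
    𝔠4-value = 𝔠-𝓑 4 (s≤s (s≤s z≤n)) (9≤r′ {5} 4 refl)

    𝔠2-value : val (𝔠 2) ≡ 𝓑 2
    𝔠2-value = 𝔠-𝓑 2 (s≤s (s≤s z≤n)) (9≤r′ {3} 6 refl)

    12𝔠2 : val (ιₚ 12) * val (𝔠 2) ≡ 1ℚ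
    12𝔠2 = trans (cong₂ _*_ (val-ι′ 12) 𝔠2-value) refl

    120𝔠4 : val (ιₚ 120) * val (𝔠 4) ≡ - 1ℚ
    120𝔠4 = trans (cong₂ _*_ (val-ι′ 120) 𝔠4-value) refl

    b″-value : val b″ₚ ≡ 𝓑 (p ℕ.+ 3)
    b″-value = trans (cong (_+ val π * val (S₀.δ)) (trans B₄-value (sym 𝔠4-value))) (trans S₀.value ((cong 𝓑 (ℕₚ.+-suc m 3))))

    private
      existence₂ = A.shifted-exists 2 ℕₚ.≤-refl (s≤s (9≤r′ {2} 7 refl))
      y₂ : ℤₚ
      y₂ = proj₁ existence₂

      y₂≈ : ιₚ 12 *ₚ ((1ₚ +ₚ π) *ₚ y₂) ≈[ 1 ] 1ₚ
      y₂≈ = begin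
        ιₚ 12 *ₚ ((1ₚ +ₚ π) *ₚ y₂)      ≈⟨ *-congˡᵐ (*-congˡᵐ (A.kummer₁ 2 {y₂} ℕₚ.≤-refl (9≤r′ {3} 6 refl) (1 , refl) (proj₂ existence₂))) ⟩
        ιₚ 12 *ₚ ((1ₚ +ₚ π) *ₚ 𝔠 2)     ≈⟨ mk (ιₚ 12 *ₚ 𝔠 2) (solve {3} (λ p n c → n :* ((# 1 :+ p) :* c) := n :* c :+ (p :* # 1) :* (n :* c)) (val π ∷ val (ιₚ 12) ∷ val (𝔠 2) ∷ [])) ⟩
        ιₚ 12 *ₚ 𝔠 2                    ≈⟨ exact 12𝔠2 ⟩
        1ₚ                              ∎
        where open Reasoning

    -- As p + 1 = m + 2, the number B (p + 1) is (1 + p) y₂, and y₂ agrees with 𝓑 2 = 1/12 modulo p;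
    -- so 12 B (p + 1) has the form 1 + p θ.
    θₚ B₁ₚ : ℤₚ
    θₚ = quot y₂≈
    B₁ₚ = A._/720 60 *ₚ (1ₚ +ₚ π *ₚ θₚ)

    private
      y₂≡ : val (ιₚ 12 *ₚ ((1ₚ +ₚ π) *ₚ y₂)) ≡ val (1ₚ +ₚ π *ₚ θₚ)
      y₂≡ = trans (eq y₂≈) (cong (λ z → 1ℚ + z * val θₚ) (ℚₚ.*-identityʳ (val π)))

    B₁-value : val B₁ₚ ≡ B (p ℕ.+ 1)
    B₁-value = begin
      val (A._/720 60) * val (1ₚ +ₚ π *ₚ θₚ)                   ≡⟨ cong₂ _*_ (fraction-value 60) (sym y₂≡) ⟩
      frac (+ 60) 720 * (val (ιₚ 12) * ((1ℚ + val π) * val y₂)) ≡⟨ ℚₚ.*-assoc (frac (+ 60) 720) (val (ιₚ 12)) ((1ℚ + val π) * val y₂) ⟨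
      frac (+ 60) 720 * val (ιₚ 12) * ((1ℚ + val π) * val y₂)  ≡⟨ cong (_* ((1ℚ + val π) * val y₂)) (trans (cong (frac (+ 60) 720 *_) (val-ι′ 12)) refl) ⟩
      1ℚ * ((1ℚ + val π) * val y₂)                             ≡⟨ ℚₚ.*-identityˡ ((1ℚ + val π) * val y₂) ⟩
      (1ℚ + val π) * val y₂                                    ≡⟨ cong (λ z → val (ιₚ z) * val y₂) (ℕₚ.+-comm 2 m) ⟩
      val (ιₚ (m ℕ.+ 2)) * val y₂                              ≡⟨ divided-B (m ℕ.+ 2) {y₂} (proj₂ existence₂) ⟨
      B (m ℕ.+ 2)                                              ≡⟨ cong B (ℕₚ.+-suc m 1) ⟩
      B (p ℕ.+ 1)                                              ∎
      where open ≡-Reasoning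

    AGₚ b₁ₚ b₂ₚ b₃ₚ : ℤₚ
    AGₚ = quot (A.b-multiple≈-1 0)
    b₁ₚ = π *ₚ AGₚ -ₚ 1ₚ
    b₂ₚ = bₚ (2 ℕ.* m)
    b₃ₚ = bₚ (3 ℕ.* m)

    b₁≡ : val (bₚ (1 ℕ.* m)) ≡ val b₁ₚ
    b₁≡ = trans (eq (A.b-multiple≈-1 0)) (solve {2} (λ p w → :- # 1 :+ (p :* # 1) :* w := p :* w :- # 1) (val π ∷ val AGₚ ∷ []))

    b-value : ∀ k → val (bₚ (k ℕ.* m)) ≡ ℕ→ℚ p * B (k ℕ.* m)
    b-value k = cong (_* B (k ℕ.* m)) (ι≡ℕ→ℚ p)

    b₁-value : val b₁ₚ ≡ ℕ→ℚ p * B (p ∸ 1)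
    b₁-value = trans (sym b₁≡) (trans (b-value 1) (cong (λ z → ℕ→ℚ p * B z) (ℕₚ.+-identityʳ m)))

    AG-value : val AGₚ ≡ (ℕ→ℚ p * B (p ∸ 1) + 1ℚ) ÷q ℕ→ℚ p
    AG-value = sym (÷q-unique (ℕ→ℚ p * B (p ∸ 1) + 1ℚ) (val AGₚ) (suc r) (begin
      val AGₚ * ℕ→ℚ p                     ≡⟨ cong (val AGₚ *_) (val-ι′ p) ⟨
      val AGₚ * val π                     ≡⟨ solve {2} (λ p w → w :* p := p :* w :- # 1 :+ # 1) (val π ∷ val AGₚ ∷ []) ⟩
      val π * val AGₚ - 1ℚ + 1ℚ           ≡⟨ cong (_+ 1ℚ) b₁-value ⟩
      ℕ→ℚ p * B (p ∸ 1) + 1ℚ              ∎))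
      where open ≡-Reasoning

    digit-value : ∀ i (x : ℤₚ) {y} → val x ≡ y → val (ιₚ (digit p i (val x))) ≡ ℕ→ℚ (digit p i y)
    digit-value i x refl = val-ι′ (digit p i (val x))

    d₁ₚ : ℤₚ
    d₁ₚ = ιₚ (digit p 1 (val (β₂ₚ -ₚ A.β)))

    d₁≈δ : d₁ₚ ≈[ 1 ] S₂.δ
    d₁≈δ = digit-leading 1 {β₂ₚ -ₚ A.β} {S₂.δ} (exact (solve {3} (λ b p d → (b :+ p :* d) :- b := p :* # 1 :* d) (val A.β ∷ val π ∷ val (S₂.δ) ∷ [])))

    d₁-value : val d₁ₚ ≡ ℕ→ℚ (digit p 1 (𝓑 (2 ℕ.* p ∸ 4) - 𝓑 (p ∸ 3)))
    d₁-value = digit-value 1 (β₂ₚ -ₚ A.β) {𝓑 (2 ℕ.* p ∸ 4) - 𝓑 (p ∸ 3)} (cong₂ _-_ β₂-value β-value)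

    private
      im : ℤₚ
      im = proj₁ (unitₚ m (s≤s z≤n) ℕₚ.≤-refl)
      m*im : val (ιₚ m) * val im ≡ 1ℚ
      m*im = proj₂ (unitₚ m (s≤s z≤n) ℕₚ.≤-refl)

    -- With `im` = 1 / m, 2 p 𝓑 (2 m) is p B (2 m) / m and p 𝓑 m is p B m / m, which makes the
    -- p-integrality of X visible.
    Xₚ dXₚ dCₚ : ℤₚ
    Xₚ = im *ₚ bₚ (2 ℕ.* m) -ₚ (im *ₚ bₚ (1 ℕ.* m)) *ₚ (im *ₚ bₚ (1 ℕ.* m))
    dXₚ = ιₚ (digit p 2 (val Xₚ))
    dCₚ = ιₚ (digit p 1 (val (conv m)))

    m²X : val (ιₚ m *ₚ (ιₚ m *ₚ Xₚ)) ≡ val (ιₚ m *ₚ bₚ (2 ℕ.* m) -ₚ bₚ (1 ℕ.* m) *ₚ bₚ (1 ℕ.* m))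
    m²X = begin
      n * (n * (i * b₂ - i * b₁ * (i * b₁)))        ≡⟨ solve {4} (λ n i b₂ b₁ → n :* (n :* (i :* b₂ :- i :* b₁ :* (i :* b₁))) := (n :* i) :* (n :* b₂) :- (n :* i) :* (n :* i) :* (b₁ :* b₁)) (n ∷ i ∷ b₂ ∷ b₁ ∷ []) ⟩
      n * i * (n * b₂) - n * i * (n * i) * (b₁ * b₁) ≡⟨ cong (λ z → z * (n * b₂) - z * z * (b₁ * b₁)) m*im ⟩
      1ℚ * (n * b₂) - 1ℚ * 1ℚ * (b₁ * b₁)           ≡⟨ solve {2} (λ a b → # 1 :* a :- # 1 :* # 1 :* b := a :- b) (n * b₂ ∷ b₁ * b₁ ∷ []) ⟩
      n * b₂ - b₁ * b₁                              ∎
      where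
      open ≡-Reasoning
      n = val (ιₚ m)
      i = val im
      b₂ = val (bₚ (2 ℕ.* m))
      b₁ = val (bₚ (1 ℕ.* m))

    X-value : val Xₚ ≡ Xp p
    X-value = cong₂ _-_ (sym first) (sym (begin
      P^2 * 𝓑 m ^q 2                          ≡⟨ solve {2} (λ p b → (p :* (p :* # 1)) :* (b :* (b :* # 1)) := (p :* b) :* (p :* b)) (ℕ→ℚ p ∷ 𝓑 m ∷ []) ⟩
      (ℕ→ℚ p * 𝓑 m) * (ℕ→ℚ p * 𝓑 m)           ≡⟨ cong (λ z → z * z) second ⟩
      val (im *ₚ bₚ (1 ℕ.* m)) * val (im *ₚ bₚ (1 ℕ.* m)) ∎))
      where
      open ≡-Reasoning
      P^2 = ℕ→ℚ p ^q 2
      scaled : ∀ y x → y * ℕ→ℚ m ≡ x → y ≡ val im * x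
      scaled y x h = begin
        y                                ≡⟨ ℚₚ.*-identityʳ y ⟨
        y * 1ℚ                           ≡⟨ cong (y *_) m*im ⟨
        y * (val (ιₚ m) * val im)        ≡⟨ solve {3} (λ y n i → y :* (n :* i) := i :* (y :* n)) (y ∷ val (ιₚ m) ∷ val im ∷ []) ⟩
        val im * (y * val (ιₚ m))        ≡⟨ cong (λ z → val im * (y * z)) (val-ι′ m) ⟩
        val im * (y * ℕ→ℚ m)             ≡⟨ cong (val im *_) h ⟩
        val im * x                       ∎
      first : ℕ→ℚ 2 * ℕ→ℚ p * 𝓑 (2 ℕ.* m) ≡ val im * val (bₚ (2 ℕ.* m))
      first = scaled _ _ (begin
        ℕ→ℚ 2 * ℕ→ℚ p * 𝓑 (2 ℕ.* m) * ℕ→ℚ m     ≡⟨ solve {4} (λ t p b n → t :* p :* b :* n := p :* (b :* (t :* n))) (ℕ→ℚ 2 ∷ ℕ→ℚ p ∷ 𝓑 (2 ℕ.* m) ∷ ℕ→ℚ m ∷ []) ⟩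
        ℕ→ℚ p * (𝓑 (2 ℕ.* m) * (ℕ→ℚ 2 * ℕ→ℚ m)) ≡⟨ cong (λ z → ℕ→ℚ p * (𝓑 (2 ℕ.* m) * z)) (ℕ→ℚ-* 2 m) ⟨
        ℕ→ℚ p * (𝓑 (2 ℕ.* m) * ℕ→ℚ (2 ℕ.* m))   ≡⟨ cong (ℕ→ℚ p *_) (÷q-* (B (2 ℕ.* m)) (ℕ→ℚ (2 ℕ.* m)) (ℕ→ℚ≢0 (r ℕ.+ (m ℕ.+ 0)))) ⟩
        ℕ→ℚ p * B (2 ℕ.* m)                     ≡⟨ b-value 2 ⟨
        val (bₚ (2 ℕ.* m))                      ∎)
      second : ℕ→ℚ p * 𝓑 m ≡ val im * val (bₚ (1 ℕ.* m))
      second = scaled _ _ (begin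
        ℕ→ℚ p * 𝓑 m * ℕ→ℚ m                     ≡⟨ ℚₚ.*-assoc (ℕ→ℚ p) (𝓑 m) (ℕ→ℚ m) ⟩
        ℕ→ℚ p * (𝓑 m * ℕ→ℚ m)                   ≡⟨ cong (ℕ→ℚ p *_) (÷q-* (B m) (ℕ→ℚ m) (ℕ→ℚ≢0 r)) ⟩
        ℕ→ℚ p * B m                             ≡⟨ cong (λ z → ℕ→ℚ p * B z) (ℕₚ.+-identityʳ m) ⟨
        ℕ→ℚ p * B (1 ℕ.* m)                     ≡⟨ b-value 1 ⟨
        val (bₚ (1 ℕ.* m))                      ∎)

    dX-value : val dXₚ ≡ ℕ→ℚ (digit p 2 (Xp p))
    dX-value = digit-value 2 Xₚ {Xp p} X-value

    dC-value : val dCₚ ≡ ℕ→ℚ (digit p 1 (𝓒 (p ∸ 1)))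
    dC-value = digit-value 1 (conv m) {𝓒 (p ∸ 1)} conv-𝓒

    -- The digit of index 2 of X serves as the digit of index 0 of 𝓒 (p - 1), which the theorem does
    -- not mention itself.
    conv-digits : dXₚ +ₚ π *ₚ dCₚ ≈[ 2 ] conv m
    conv-digits = digits-01 (conv m) (digit p 2 (val Xₚ)) (proj₁ (proj₂ (proj₂ (digit-spec 2 Xₚ)))) (digit-leading 2 {Xₚ} {conv m} (A.X≈conv {Xₚ} m²X))

    formulaₚ : ℤₚ
    formulaₚ = A.formula 𝕋 wₚ A.β d₁ₚ γₚ dCₚ dXₚ bigₚ b₁ₚ b₂ₚ b₃ₚ β₂ₚ B₁ₚ γ₂ₚ B₄ₚ b″ₚ AGₚ

    formula′ₚ : ℤₚ
    formula′ₚ = A.formula′ {wₚ} {d₁ₚ} {γₚ} {dCₚ} {dXₚ} {b₂ₚ} {b₃ₚ} {S₂.δ} {θₚ} {S₄.δ} {S₀.δ} {AGₚ}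

    -- The two sides differ only in the double sum, where the factor p ^ 3 lifts a congruence modulo
    -- p to one modulo p ^ 4.
    formula≈formula′ : formulaₚ ≈[ 4 ] formula′ₚ
    formula≈formula′ = +-congʳᵐ (+-congʳᵐ (+-congʳᵐ (+-congʳᵐ (+-congʳᵐ (+-congʳᵐ (+-congʳᵐ (+-congˡᵐ (-‿congᵐ big-cong))))))))
      where
      big-cong : π ^ₚ 3 *ₚ A._/720 360 *ₚ bigₚ ≈[ 4 ] π ^ₚ 3 *ₚ A._/720 360 *ₚ A.big
      big-cong = transᵐ {y = π ^ₚ 3 *ₚ (A._/720 360 *ₚ bigₚ)} (exact (ℚₚ.*-assoc (val (π ^ₚ 3)) (val (A._/720 360)) (val bigₚ)))
        (transᵐ {y = π ^ₚ 3 *ₚ (A._/720 360 *ₚ A.big)} (π^*-cong 3 (*-congˡᵐ bigₚ≈)) (exact (sym (ℚₚ.*-assoc (val (π ^ₚ 3)) (val (A._/720 360)) (val A.big)))))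

    formula*[p-1]! : formulaₚ *ₚ ιₚ (m !) ≈[ 4 ] -ₚ ιₚ m
    formula*[p-1]! = transᵐ (*-congʳᵐ formula≈formula′)
      (A.formula′*[p-1]! {wₚ} {d₁ₚ} {γₚ} {dCₚ} {dXₚ} {b₂ₚ} {b₃ₚ} {S₂.δ} {θₚ} {S₄.δ} {S₀.δ} {AGₚ} b₁≡ refl refl w-spec conv-digits d₁≈δ 12𝔠2 120𝔠4 (S₂.δ≈) (S₄.δ≈)
        (A.B[p+1] {y₂} {θₚ} 12𝔠2 (proj₂ existence₂) y₂≡))

    private
      constant : ∀ n {x} → frac (+ n) 720 ≡ x → x ≡ val (A._/720 n)
      constant n e = trans (sym e) (sym (fraction-value n))

    -- Both sides are values of `formulaℚ` by computation, so the comparison reduces to argument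
    -- vectors, entry by entry.
    body-formula : body p ≡ val formulaₚ
    body-formula = begin
      body p
        ≡⟨⟩
      formulaℚ ((ℕ→ℚ p) ∷ (𝓣 (p ∸ 1)) ∷ (w p) ∷ (𝓑 (p ∸ 3)) ∷ (ℕ→ℚ (digit p 1 (𝓑 (2 ℕ.* p ∸ 4) - 𝓑 (p ∸ 3)))) ∷ (𝓑 (p ∸ 5)) ∷ (ℕ→ℚ (digit p 1 (𝓒 (p ∸ 1)))) ∷ (ℕ→ℚ (digit p 2 (Xp p))) ∷ (bigSum p) ∷ (ℕ→ℚ p * B (p ∸ 1)) ∷ (ℕ→ℚ p * B (2 ℕ.* (p ∸ 1))) ∷ (ℕ→ℚ p * B (3 ℕ.* (p ∸ 1))) ∷ (𝓑 (2 ℕ.* p ∸ 4)) ∷ (B (p ℕ.+ 1)) ∷ (𝓑 (2 ℕ.* p ∸ 6)) ∷ (𝓑 4) ∷ (𝓑 (p ℕ.+ 3)) ∷ ((ℕ→ℚ p * B (p ∸ 1) + 1ℚ) ÷q ℕ→ℚ p) ∷ (frac (+ 1) 3) ∷ (frac (+ 1) 4) ∷ (frac (+ 1) 72) ∷ (frac (+ 7) 12) ∷ (frac (+ 1) 2) ∷ (frac (+ 1) 6) ∷ (frac (+ 1) 5) ∷ (frac (+ 4) 3) ∷ (frac (+ 1) 12) ∷ (frac (+ 11) 24) ∷ (frac (+ 7) 720) ∷ (ℕ→ℚ 2) ∷ (ℕ→ℚ 3) ∷ (ℕ→ℚ 4) ∷ (ℕ→ℚ 6) ∷ (ℕ→ℚ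 7) ∷ (ℕ→ℚ 11) ∷ (ℕ→ℚ 12) ∷ (ℕ→ℚ 13) ∷ (ℕ→ℚ 19) ∷ [])
        ≡⟨ cong formulaℚ (sym (val-ι′ p) ∷-≡ sym 𝕋-𝓣 ∷-≡ sym w-value ∷-≡ sym β-value ∷-≡ sym d₁-value ∷-≡ sym γ-value ∷-≡ sym dC-value ∷-≡ sym dX-value ∷-≡ sym big-value ∷-≡ sym b₁-value ∷-≡ sym (b-value 2) ∷-≡ sym (b-value 3) ∷-≡ sym β₂-value ∷-≡ sym B₁-value ∷-≡ sym γ₂-value ∷-≡ sym B₄-value ∷-≡ sym b″-value ∷-≡ sym AG-value ∷-≡ constant 240 refl ∷-≡ constant 180 refl ∷-≡ constant 10 refl ∷-≡ constant 420 refl ∷-≡ constant 360 refl ∷-≡ constant 120 refl ∷-≡ constant 144 refl ∷-≡ constant 960 refl ∷-≡ constant 60 refl ∷-≡ constant 330 refl ∷-≡ constant 7 refl ∷-≡ sym (val-ι′ 2) ∷-≡ sym (val-ι′ 3) ∷-≡ sym (val-ι′ 4) ∷-≡ sym (val-ι′ 6) ∷-≡ sym (val-ι′ 7) ∷-≡ sym (val-ι′ 11) ∷-≡ sym (val-ι′ 12) ∷-≡ sym (val-ι′ 13) ∷-≡ sym (val-ι′ 19) ∷-≡ refl) ⟩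
      formulaℚ ((val (ιₚ p)) ∷ (val 𝕋) ∷ (val wₚ) ∷ (val A.β) ∷ (val d₁ₚ) ∷ (val γₚ) ∷ (val dCₚ) ∷ (val dXₚ) ∷ (val bigₚ) ∷ (val b₁ₚ) ∷ (val b₂ₚ) ∷ (val b₃ₚ) ∷ (val β₂ₚ) ∷ (val B₁ₚ) ∷ (val γ₂ₚ) ∷ (val B₄ₚ) ∷ (val b″ₚ) ∷ (val AGₚ) ∷ (val (A._/720 240)) ∷ (val (A._/720 180)) ∷ (val (A._/720 10)) ∷ (val (A._/720 420)) ∷ (val (A._/720 360)) ∷ (val (A._/720 120)) ∷ (val (A._/720 144)) ∷ (val (A._/720 960)) ∷ (val (A._/720 60)) ∷ (val (A._/720 330)) ∷ (val (A._/720 7)) ∷ (val (ιₚ 2)) ∷ (val (ιₚ 3)) ∷ (val (ιₚ 4)) ∷ (val (ιₚ 6)) ∷ (val (ιₚ 7)) ∷ (val (ιₚ 11)) ∷ (val (ιₚ 12)) ∷ (val (ιₚ 13)) ∷ (val (ιₚ 19)) ∷ [])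
        ≡⟨⟩
      val formulaₚ ∎
      where open ≡-Reasoning

    elemSym-above : ∀ n k → n ℕ.< k → elemSym n k ≡ 0ℚ
    elemSym-above zero    (suc k) _         = refl
    elemSym-above (suc n) (suc k) (s≤s n<k) = trans (cong₂ (λ a b → a + b * frac (+ 1) (suc n)) (elemSym-above n (suc k) (ℕₚ.m<n⇒m<1+n n<k)) (elemSym-above n k n<k))
      (trans (ℚₚ.+-identityˡ _) (ℚₚ.*-zeroˡ (frac (+ 1) (suc n))))

    elemSym-top : ∀ n → elemSym n n * ℕ→ℚ (n !) ≡ 1ℚ
    elemSym-top zero    = refl
    elemSym-top (suc n) = begin
      (elemSym n (suc n) + elemSym n n * 1/ n) * ℕ→ℚ (suc n ℕ.* n !)    ≡⟨ cong₂ (λ a b → (a + elemSym n n * 1/ n) * b) (elemSym-above n (suc n) ℕₚ.≤-refl) (ℕ→ℚ-* (suc n) (n !)) ⟩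
      (0ℚ + elemSym n n * 1/ n) * (ℕ→ℚ (suc n) * ℕ→ℚ (n !))             ≡⟨ solve {4} (λ e i s f → (# 0 :+ e :* i) :* (s :* f) := (s :* i) :* (e :* f)) (elemSym n n ∷ 1/ n ∷ ℕ→ℚ (suc n) ∷ ℕ→ℚ (n !) ∷ []) ⟩
      ℕ→ℚ (suc n) * 1/ n * (elemSym n n * ℕ→ℚ (n !))                    ≡⟨ cong₂ _*_ (invℕ n) (elemSym-top n) ⟩
      1ℚ * 1ℚ                                                           ≡⟨⟩
      1ℚ                                                                ∎
      where open ≡-Reasoning

    p∤! : ∀ n → n ℕ.< p → ¬ (p ∣ n !)
    p∤! zero    _   = p∤1
    p∤! (suc n) n<p = p∤* {suc n} {n !} (p∤small (suc n) (s≤s z≤n) n<p) (p∤! n (ℕₚ.<-trans ℕₚ.≤-refl n<p))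

    Astarₚ : ℤₚ
    Astarₚ = ⟨ Astar p m , isPInt (+ 1 , m ! , p∤! m ℕₚ.≤-refl , elemSym-top m) ⟩

    rhsₚ : ℤₚ
    rhsₚ = -ₚ (im *ₚ formulaₚ)

    rhs-value : val rhsₚ ≡ rhs5 p
    rhs-value = cong₂ (λ a b → - (a * b)) im-value (sym body-formula)
      where
      open ≡-Reasoning
      im-value : val im ≡ frac (+ 1) m
      im-value = *-cancelʳ-ℕ r {val im} {frac (+ 1) m} (begin
        val im * ℕ→ℚ m            ≡⟨ ℚₚ.*-comm (val im) (ℕ→ℚ m) ⟩
        ℕ→ℚ m * val im            ≡⟨ cong (_* val im) (val-ι′ m) ⟨
        val (ιₚ m) * val im       ≡⟨ m*im ⟩
        1ℚ                        ≡⟨ frac-* (+ 1) r ⟨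
        frac (+ 1) m * ℕ→ℚ m      ∎)

    Astar≈rhs : Astarₚ ≈[ 4 ] rhsₚ
    Astar≈rhs = symᵐ (begin
      -ₚ (im *ₚ formulaₚ)
        -- The factor (p - 1)! A* = 1 is inserted, so that the product of the formula with (p - 1)!,
        -- which is - (p - 1), can be used.
        ≈⟨ exact (sym one) ⟩
      -ₚ (im *ₚ (formulaₚ *ₚ ιₚ (m !) *ₚ Astarₚ))
        ≈⟨ -‿congᵐ (*-congˡᵐ (*-congʳᵐ formula*[p-1]!)) ⟩
      -ₚ (im *ₚ ((-ₚ ιₚ m) *ₚ Astarₚ))
        ≈⟨ exact two ⟩
      Astarₚ ∎)
      where
      open Reasoning
      one : val (-ₚ (im *ₚ (formulaₚ *ₚ ιₚ (m !) *ₚ Astarₚ))) ≡ val (-ₚ (im *ₚ formulaₚ))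
      one = cong (λ z → - (val im * z)) (trans (ℚₚ.*-assoc (val formulaₚ) (val (ιₚ (m !))) (Astar p m)) (trans (cong (val formulaₚ *_) (trans (ℚₚ.*-comm (val (ιₚ (m !))) (Astar p m)) (trans (cong (Astar p m *_) (val-ι′ (m !))) (elemSym-top m)))) (ℚₚ.*-identityʳ (val formulaₚ))))
      two : val (-ₚ (im *ₚ ((-ₚ ιₚ m) *ₚ Astarₚ))) ≡ val Astarₚ
      two = trans (solve {3} (λ i n a → :- (i :* ((:- n) :* a)) := (n :* i) :* a) (val im ∷ val (ιₚ m) ∷ Astar p m ∷ [])) (trans (cong (_* Astar p m) m*im) (ℚₚ.*-identityˡ (Astar p m)))

    theorem : CongP p 4 (Astar p m) (rhs5 p)
    theorem = subst (IsPInt p) (sym quotient) (isInt (int (quot Astar≈rhs)))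
      where
      z = val (quot Astar≈rhs)
      nonzero : ℕ→ℚ (p ℕ.^ 4) ≢ 0ℚ
      nonzero e = ℕ→ℚ≢0 (p ℕ.^ 4 ∸ 1) (trans (cong ℕ→ℚ (ℕₚ.m+[n∸m]≡n {1} (ℕₚ.m^n>0 p 4))) e)
      quotient : (Astar p m - rhs5 p) ÷q ℕ→ℚ (p ℕ.^ 4) ≡ z
      quotient = cancel (p ℕ.^ 4) (ℕₚ.m^n>0 p 4) (trans (÷q-* (Astar p m - rhs5 p) (ℕ→ℚ (p ℕ.^ 4)) nonzero) (begin
        Astar p m - rhs5 p                            ≡⟨ cong₂ _-_ (eq Astar≈rhs) (sym rhs-value) ⟩
        val rhsₚ + val (π ^ₚ 4) * z - val rhsₚ        ≡⟨ solve {3} (λ a b z → a :+ b :* z :- a := z :* b) (val rhsₚ ∷ val (π ^ₚ 4) ∷ z ∷ []) ⟩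
        z * val (π ^ₚ 4)                              ≡⟨ cong (z *_) (val-p^ 4) ⟩
        z * ℕ→ℚ (p ℕ.^ 4)                             ∎))
        where
        open ≡-Reasoning
        cancel : ∀ N → 0 ℕ.< N → ∀ {x y} → x * ℕ→ℚ N ≡ y * ℕ→ℚ N → x ≡ y
        cancel (suc N) _ = *-cancelʳ-ℕ N

open import Defs
open import Data.Nat using (_≤_)

theorem5 : (p : ℕ) → Prime p → 11 ≤ p →
    CongP p 4 (Astar p (p ∸ 1)) (rhs5 p)
theorem5 (suc (suc r)) p-prime 11≤p = AtPrime.Values.theorem r p-prime 11≤p
theorem5 (suc zero)    _     (s≤s ())
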